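{- Let $G$ be a finite abelian group, let $u$ be a positive integer, let $X \in \mathbb{Z}[\zeta_u][G]$ and put $v=\mathrm{lcm}(u,\exp(G))$. Suppose that $XX^{(-1)} = n$ where $n$ is a positive integer with $\gcd(n,|G|)=1$. Suppose $t$ is an integer coprime to $u|G|$ such that the automorphism $\sigma_t$ of $\mathbb{Q}(\zeta_v)$ (given by $\zeta_v\mapsto\zeta_v^t$) fixes every prime ideal of $\mathbb{Z}[\zeta_v]$ dividing $n$. Then $t$ is a multiplier of $X$, i.e. $X^{(t)} = \pm \zeta_u^e g X$ for some $g \in G$ and some integer $e$.
   Context: $\zeta_m$ denotes a primitive $m$-th root of unity. $\mathbb{Z}[\zeta_u][G]$ is the group ring of $G$ with coefficients in $\mathbb{Z}[\zeta_u]$, with elements $X=\sum_{g\in G}X_g g$, $X_g\in\mathbb{Z}[\zeta_u]$. For an integer $t$ coprime to $u|G|$, $\sigma_t\in\mathrm{Gal}(\mathbb{Q}(\zeta_u)/\mathbb{Q})$ is defined by $\zeta_u\mapsto\zeta_u^t$ and $X^{(t)}=\sum_{g\in G}\sigma_t(X_g)\,g^t$; in particular $X^{(-1)}=\sum_{g}\overline{X_g}\,g^{ -1}$ (complex conjugation). An integer $t$ with $\gcd(t,u|G|)=1$ is called a multiplier of $X$ if $X^{(t)}=\pm\zeta_u^e gX$ for some $g\in G$, $e\in\mathbb{Z}$. -}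

module Defs where

open import Level using (Level; _⊔_) renaming (suc to lsuc)
open import Data.Nat as ℕ using (ℕ; zero; suc; _<_; _≤_)
open import Data.Nat.Divisibility using (_∣?_)
open import Data.Integer as ℤ using (ℤ; +_; -[1+_]; 0ℤ; 1ℤ; -1ℤ)
open import Data.Fin as Fin using (Fin)
open import Data.List using (List; []; _∷_; map; foldr; filter; concatMap; applyUpTo; replicate; _++_; [_])
open import Data.List.Relation.Unary.All using (All)
open import Data.Product using (Σ; ∃; _×_; _,_; proj₁; proj₂)
open import Data.Sum using (_⊎_)
open import Data.Bool using (if_then_else_)
open import Relation.Nullary using (¬_; does)
open import Relation.Binary.PropositionalEquality as ≡ using (_≡_)
open import Algebra.Bundles using (AbelianGroup)
open import Function.Bundles using (Inverse)

-- Integer polynomials (coefficient lists, lowest degree first)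

Poly : Set
Poly = List ℤ

addP : Poly → Poly → Poly
addP []       q        = q
addP (a ∷ p)  []       = a ∷ p
addP (a ∷ p)  (b ∷ q)  = (a ℤ.+ b) ∷ addP p q

scaleP : ℤ → Poly → Poly
scaleP c = map (c ℤ.*_)

negP : Poly → Poly
negP = scaleP -1ℤ

mulP : Poly → Poly → Poly
mulP []      q = []
mulP (a ∷ p) q = addP (scaleP a q) (0ℤ ∷ mulP p q)

constP : ℤ → Poly
constP c = [ c ]

monomial : ℕ → ℤ → Poly
monomial k c = replicate k 0ℤ ++ [ c ]

prodP : List Poly → Poly
prodP = foldr mulP (constP 1ℤ)

substP : ℕ → Poly → Poly
substP s []      = []
substP s (a ∷ p) = addP (constP a) (mulP (monomial s 1ℤ) (substP s p))

IsZeroP : Poly → Set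
IsZeroP p = All (_≡ 0ℤ) p

-- Möbius function, via μ(1) = 1 and Σ_{d ∣ n} μ(d) = 0 for n > 1

sumℤ : List ℤ → ℤ
sumℤ = foldr ℤ._+_ 0ℤ

private
  μ' : ℕ → ℕ → ℤ
  μ' zero     n = 0ℤ
  μ' (suc f) n with n ℕ.≟ 1
  ... | Relation.Nullary.yes _ = 1ℤ
  ... | Relation.Nullary.no  _ =
        ℤ.- sumℤ (map (μ' f) (filter (λ d → d ∣? n) (applyUpTo suc (n ℕ.∸ 1))))

möbius : ℕ → ℤ
möbius n = μ' (suc n) n

-- The m-th cyclotomic polynomial Φ_m = ∏_{d e = m} (x^d - 1)^{μ(e)},
-- encoded as the pair (A_m , B_m) with  Φ_m · A_m = B_m, where
-- A_m = ∏_{d e = m, μ(e) = -1} (x^d - 1),  B_m = ∏_{d e = m, μ(e) = 1} (x^d - 1).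

private
  factorPairs : ℕ → List (ℕ × ℕ)
  factorPairs m =
    filter (λ p → (proj₁ p ℕ.* proj₂ p) ℕ.≟ m)
      (concatMap (λ d → map (λ e → (d , e)) (applyUpTo suc m)) (applyUpTo suc m))

  xPowMinusOne : ℕ → Poly
  xPowMinusOne d = addP (monomial d 1ℤ) (constP -1ℤ)

cycloDen : ℕ → Poly
cycloDen m = prodP (map (λ p → xPowMinusOne (proj₁ p))
                     (filter (λ p → möbius (proj₂ p) ℤ.≟ -1ℤ) (factorPairs m)))

cycloNum : ℕ → Poly
cycloNum m = prodP (map (λ p → xPowMinusOne (proj₁ p))
                     (filter (λ p → möbius (proj₂ p) ℤ.≟ 1ℤ) (factorPairs m)))

-- ℤ[ζ_m] ≅ ℤ[x]/(Φ_m): elements are polynomials p (representing p(ζ_m)),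
-- and p ≈[ m ] q  iff  Φ_m divides p - q in ℤ[x],
-- i.e. (p - q) · A_m = r · B_m for some r ∈ ℤ[x].

_≈[_]_ : Poly → ℕ → Poly → Set
p ≈[ m ] q = ∃ λ (r : Poly) →
  IsZeroP (addP (mulP (addP p (negP q)) (cycloDen m)) (negP (mulP r (cycloNum m))))

-- exponent representing ζ_m^t by a natural number (ζ^{-k} = ζ^{k(m-1)})
expo : ℕ → ℤ → ℕ
expo m (+ n)     = n
expo m -[1+ n ]  = suc n ℕ.* (m ℕ.∸ 1)

σ : ℕ → ℤ → Poly → Poly
σ m t = substP (expo m t)

ζpow : ℕ → ℤ → Poly
ζpow m e = monomial (expo m e) 1ℤ

-- Ideals of ℤ[ζ_m] (as predicates on representatives)

record IsIdeal (m : ℕ) (P : Poly → Set) : Set where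
  field
    resp  : ∀ a b → a ≈[ m ] b → P a → P b
    zero∈ : P []
    add∈  : ∀ a b → P a → P b → P (addP a b)
    mul∈  : ∀ r a → P a → P (mulP r a)

record IsPrimeIdeal (m : ℕ) (P : Poly → Set) : Set where
  field
    isIdeal : IsIdeal m P
    proper  : ¬ P (constP 1ℤ)
    prime   : ∀ a b → P (mulP a b) → P a ⊎ P b

FixedBy : ℕ → ℤ → (Poly → Set) → Set
FixedBy m t P = ∀ a → (P a → P (σ m t a)) × (P (σ m t a) → P a)

record FinAbGroup (c ℓ : Level) : Set (lsuc (c ⊔ ℓ)) where
  field
    grp   : AbelianGroup c ℓ
    order : ℕ
    enum  : Inverse (≡.setoid (Fin order)) (AbelianGroup.setoid grp)
  open AbelianGroup grp public

module _ {c ℓ} (G : FinAbGroup c ℓ) where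
  open FinAbGroup G

  elt : Fin order → Carrier
  elt = Inverse.to enum

  idx : Carrier → Fin order
  idx = Inverse.from enum

  gpowℕ : Carrier → ℕ → Carrier
  gpowℕ g zero    = ε
  gpowℕ g (suc n) = g ∙ gpowℕ g n

  gpow : Carrier → ℤ → Carrier
  gpow g (+ n)    = gpowℕ g n
  gpow g -[1+ n ] = gpowℕ g (suc n) ⁻¹

  record IsExponent (e : ℕ) : Set (c ⊔ ℓ) where
    field
      pos   : 0 < e
      kills : ∀ g → gpowℕ g e ≈ ε
      least : ∀ e' → 0 < e' → (∀ g → gpowℕ g e' ≈ ε) → e ≤ e'

  -- elements of ℤ[ζ_m][G]: the coefficient of g is X (idx g)
  GR : Set
  GR = Fin order → Poly

  private
    sumF : ∀ {k} → (Fin k → Poly) → Poly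
    sumF {zero}  f = []
    sumF {suc k} f = addP (f Fin.zero) (sumF (λ i → f (Fin.suc i)))

  mulGR : GR → GR → GR
  mulGR X Y j = sumF (λ i → mulP (X i) (Y (idx (elt i ⁻¹ ∙ elt j))))

  -- X^{(t)} = Σ_g σ_t(X_g) g^t   (computed in ℤ[ζ_m])
  twist : ℕ → ℤ → GR → GR
  twist m t X j =
    sumF (λ i → if does (idx (gpow (elt i) t) Fin.≟ j) then σ m t (X i) else [])

  scalarGR : ℤ → GR
  scalarGR n j = if does (idx ε Fin.≟ j) then constP n else []

  shiftGR : ℕ → ℤ → ℤ → Carrier → GR → GR
  shiftGR m s e h X j = scaleP s (mulP (ζpow m e) (X (idx (h ⁻¹ ∙ elt j))))

  _≈GR[_]_ : GR → ℕ → GR → Set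
  X ≈GR[ m ] Y = ∀ j → X j ≈[ m ] Y j

module Submission where

-- Let E = X^(t) X^(-1) / n.  For a prime p dividing n choose a prime ideal of ℤ[ζ_v] above p.  As σ_t
-- maps it into itself, Gauss periods show that t is a power of p modulo the prime-to-p part of v, so that
-- modulo a uniformiser at p the map X ↦ X^(t) is a power of the Frobenius.  Hence divisibility of X X^(-1)
-- by p^b passes to X^(t) X^(-1), and E is integral.  Moreover E E^(-1) = 1.  The positive definite form
-- Tr(f f̄) then makes multiplication by each coefficient of E a contraction; since f^ℓ ≡ σ_ℓ(f) modulo ℓ,
-- for large primes ℓ this congruence is an equality, and a power of each coefficient is an idempotent, that
-- is, 0 or 1.  So exactly one coefficient of E is nonzero, and it is ± ζ_u^e.  Finally
-- n X^(t) = X^(t) X^(-1) X = n E X.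

-- All work takes place in ℤ[x]/(Φ), so regularity and positivity are won algebraically: ζ^k - 1 is
-- regular because it divides a rational prime, and the trace form is positive because m Tr(f f̄) is
-- the sum of the squares of the integers Tr(f ζ^k). The delicate point of the divisibility step is
-- ramification. If p divides u, then ζ_u to the prime-to-p part of v is 1 only modulo ϖ = ξ - 1,
-- with ξ a root of unity of p-power order; since gcd(n, |G|) = 1, the group elements show no such
-- defect. Frobenius is thus visible modulo ϖ and not modulo p. Suitable powers of Y act as
-- idempotents modulo higher and higher powers of ϖ and carry divisibility of Y Z over to Y^(t) Z;
-- the relation between ϖ^E and p, with E the ramification index, leads back to powers of p. The
-- comparison of α^ℓ with σ_ℓ(α) asks for ℓ > 2m because their trace coordinates are bounded by m
-- each; hence exponents are kept prime to (2m)!. The sign in the result enters for odd m, where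
-- only β^(2m) = 1 follows at once.

-- Commutative rings: integers inside them, divisibility, congruences and finite sums.

module RingTools where

  open import Algebra.Bundles using (CommutativeRing)

  module Ring {c ℓ} (R : CommutativeRing c ℓ) where
    open CommutativeRing R public hiding (zero)
    open import Algebra.Properties.Semiring.Sum semiring public
      using (sum; sum-cong-≋; sum-cong-≗; ∑-distrib-+; ∑-comm; sum-permute; *-distribˡ-sum; *-distribʳ-sum; sum-replicate-zero)
    open import Algebra.Properties.CommutativeSemiring.Exp commutativeSemiring public
      using (_^_; ^-congˡ; ^-congʳ; ^-homo-*; ^-assocʳ; ^-distrib-*)
    open import Algebra.Properties.Ring ring public
      using (-‿distribˡ-*; -‿distribʳ-*; -‿involutive; x∙y⁻¹≈ε⇒x≈y)
    open import Algebra.Properties.AbelianGroup +-abelianGroup public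
      using () renaming (⁻¹-∙-comm to neg-+; ε⁻¹≈ε to neg-0)
    open import Relation.Binary.Reasoning.Setoid setoid
    open import Data.Nat as ℕ using (ℕ; zero; suc)
    import Data.Nat.Properties as ℕ
    open import Data.Integer as ℤ using (ℤ; +_; -[1+_])
    import Data.Integer.Properties as ℤ
    open import Data.Fin as Fin using (Fin; toℕ)
    import Data.Fin.Properties as Fin
    open import Level using (_⊔_)
    open import Data.Maybe using (just; nothing)
    open import Relation.Nullary using (yes; no)
    open import Relation.Binary.PropositionalEquality as ≡ using (_≡_; _≢_)
    open import Relation.Binary.Definitions using (WeaklyDecidable)
    open import Algebra.Solver.Ring.AlmostCommutativeRing
      using (_-Raw-AlmostCommutative⟶_; fromCommutativeRing; Induced-equivalence)

    -- The structure map ℤ → R; `nat 1 = 1#` holds definitionally so that the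
    -- solver's `con (+ 1)` matches `1#`.

    nat : ℕ → Carrier
    nat zero          = 0#
    nat (suc zero)    = 1#
    nat (suc (suc n)) = 1# + nat (suc n)

    ι : ℤ → Carrier
    ι (+ n)    = nat n
    ι -[1+ n ] = - nat (suc n)

    nat-suc : ∀ n → nat (suc n) ≈ 1# + nat n
    nat-suc zero    = sym (+-identityʳ 1#)
    nat-suc (suc n) = refl

    nat-+ : ∀ m n → nat (m ℕ.+ n) ≈ nat m + nat n
    nat-+ zero    n = sym (+-identityˡ _)
    nat-+ (suc m) n = begin
      nat (suc (m ℕ.+ n))    ≈⟨ nat-suc (m ℕ.+ n) ⟩
      1# + nat (m ℕ.+ n)     ≈⟨ +-congˡ (nat-+ m n) ⟩
      1# + (nat m + nat n)   ≈⟨ +-assoc _ _ _ ⟨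
      (1# + nat m) + nat n   ≈⟨ +-congʳ (nat-suc m) ⟨
      nat (suc m) + nat n    ∎

    private
      sub-suc : ∀ x y → x - y ≈ (1# + x) - (1# + y)
      sub-suc x y = sym (begin
        (1# + x) - (1# + y)       ≈⟨ +-congˡ (neg-+ 1# y) ⟨
        (1# + x) + (- 1# + - y)   ≈⟨ +-congʳ (+-comm 1# x) ⟩
        (x + 1#) + (- 1# + - y)   ≈⟨ +-assoc x 1# _ ⟩
        x + (1# + (- 1# + - y))   ≈⟨ +-congˡ (+-assoc 1# (- 1#) (- y)) ⟨
        x + ((1# + - 1#) + - y)   ≈⟨ +-congˡ (+-congʳ (-‿inverseʳ 1#)) ⟩
        x + (0# + - y)            ≈⟨ +-congˡ (+-identityˡ _) ⟩
        x - y                     ∎)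

    ι-⊖ : ∀ m n → ι (m ℤ.⊖ n) ≈ nat m - nat n
    ι-⊖ m zero = begin
      ι (m ℤ.⊖ 0)    ≡⟨ ≡.cong ι (ℤ.⊖-≥ {m} ℕ.z≤n) ⟩
      nat m         ≈⟨ +-identityʳ _ ⟨
      nat m + 0#    ≈⟨ +-congˡ neg-0 ⟨
      nat m - 0#    ∎
    ι-⊖ zero (suc n) = sym (+-identityˡ _)
    ι-⊖ (suc m) (suc n) = begin
      ι (suc m ℤ.⊖ suc n)        ≡⟨ ≡.cong ι (ℤ.[1+m]⊖[1+n]≡m⊖n m n) ⟩
      ι (m ℤ.⊖ n)                ≈⟨ ι-⊖ m n ⟩
      nat m - nat n              ≈⟨ sub-suc _ _ ⟩
      (1# + nat m) - (1# + nat n)  ≈⟨ +-cong (nat-suc m) (-‿cong (nat-suc n)) ⟨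
      nat (suc m) - nat (suc n)  ∎

    ι-+ : ∀ a b → ι (a ℤ.+ b) ≈ ι a + ι b
    ι-+ (+ m)    (+ n)    = nat-+ m n
    ι-+ (+ m)    -[1+ n ] = ι-⊖ m (suc n)
    ι-+ -[1+ m ] (+ n)    = trans (ι-⊖ n (suc m)) (+-comm _ _)
    ι-+ -[1+ m ] -[1+ n ] = begin
      - nat (suc (suc (m ℕ.+ n)))        ≡⟨ ≡.cong (λ k → - nat (suc k)) (ℕ.+-suc m n) ⟨
      - nat (suc m ℕ.+ suc n)          ≈⟨ -‿cong (nat-+ (suc m) (suc n)) ⟩
      - (nat (suc m) + nat (suc n))         ≈⟨ neg-+ _ _ ⟨
      - (nat (suc m)) - (nat (suc n))       ∎

    ι-neg : ∀ a → ι (ℤ.- a) ≈ - ι a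
    ι-neg (+ zero)  = sym neg-0
    ι-neg (+ suc n) = refl
    ι-neg -[1+ n ]  = sym (-‿involutive _)

    ι-* : ∀ a b → ι (a ℤ.* b) ≈ ι a * ι b
    ι-* (+ m) b = go m
      where
      go : ∀ m → ι (+ m ℤ.* b) ≈ ι (+ m) * ι b
      go zero    = sym (zeroˡ _)
      go (suc m) = begin
        ι (+ suc m ℤ.* b)          ≡⟨ ≡.cong ι (ℤ.suc-* (+ m) b) ⟩
        ι (b ℤ.+ + m ℤ.* b)        ≈⟨ ι-+ b (+ m ℤ.* b) ⟩
        ι b + ι (+ m ℤ.* b)        ≈⟨ +-cong (sym (*-identityˡ _)) (go m) ⟩
        1# * ι b + ι (+ m) * ι b   ≈⟨ distribʳ _ _ _ ⟨
        (1# + ι (+ m)) * ι b       ≈⟨ *-congʳ (nat-suc m) ⟨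
        ι (+ suc m) * ι b          ∎
    ι-* -[1+ m ] b = begin
      ι (-[1+ m ] ℤ.* b)         ≡⟨ ≡.cong ι (ℤ.neg-distribˡ-* (+ suc m) b) ⟨
      ι (ℤ.- (+ suc m ℤ.* b))    ≈⟨ ι-neg (+ suc m ℤ.* b) ⟩
      - ι (+ suc m ℤ.* b)        ≈⟨ -‿cong (ι-* (+ suc m) b) ⟩
      - (ι (+ suc m) * ι b)      ≈⟨ -‿distribˡ-* _ _ ⟩
      - ι (+ suc m) * ι b        ∎

    ι-- : ∀ a b → ι (a ℤ.- b) ≈ ι a - ι b
    ι-- a b = trans (ι-+ a (ℤ.- b)) (+-congˡ (ι-neg b))

    ι-^ : ∀ a n → ι (a ℤ.^ n) ≈ ι a ^ n
    ι-^ a zero    = refl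
    ι-^ a (suc n) = trans (ι-* a (a ℤ.^ n)) (*-congˡ (ι-^ a n))

    morphism : ℤ.+-*-rawRing -Raw-AlmostCommutative⟶ fromCommutativeRing R
    morphism = record
      { ⟦_⟧ = ι ; +-homo = ι-+ ; *-homo = ι-* ; -‿homo = ι-neg ; 0-homo = refl ; 1-homo = refl }

    private
      coeff≟ : WeaklyDecidable (Induced-equivalence morphism)
      coeff≟ a b with a ℤ.≟ b
      ... | yes a≡b = just (reflexive (≡.cong ι a≡b))
      ... | no  _   = nothing

    module Solver where
      open import Algebra.Solver.Ring ℤ.+-*-rawRing (fromCommutativeRing R) morphism coeff≟ public
        using (solve; con; _:=_; _:+_; _:*_; _:-_; :-_; _:^_)

    open Solver

    infix 4 _∣_
    infixr 4 _,_
    -- A record and not a Σ-type, so that unification recovers `d` and `a` from a proof of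
    -- divisibility; `_≡[_]_` is wrapped for the same reason.
    record _∣_ (d a : Carrier) : Set (c ⊔ ℓ) where
      constructor _,_
      field
        quotient : Carrier
        equality : a ≈ d * quotient

    ∣-resp : ∀ {d a b} → a ≈ b → d ∣ a → d ∣ b
    ∣-resp a≈b (q , e) = q , trans (sym a≈b) e

    ∣-respˡ : ∀ {d e a} → d ≈ e → d ∣ a → e ∣ a
    ∣-respˡ d≈e (q , h) = q , trans h (*-congʳ d≈e)

    ∣-trans : ∀ {a b c} → a ∣ b → b ∣ c → a ∣ c
    ∣-trans (q , e) (r , f) = q * r , trans f (trans (*-congʳ e) (*-assoc _ _ _))

    ∣-refl : ∀ {a} → a ∣ a
    ∣-refl = 1# , sym (*-identityʳ _)

    ∣-+ : ∀ {d a b} → d ∣ a → d ∣ b → d ∣ a + b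
    ∣-+ (q , e) (r , f) = q + r , trans (+-cong e f) (sym (distribˡ _ _ _))

    ∣-*ˡ : ∀ {d a} b → d ∣ a → d ∣ b * a
    ∣-*ˡ {d} b (q , e) = b * q , trans (*-congˡ e) (solve 3 (λ b d q → b :* (d :* q) := d :* (b :* q)) refl b d q)

    ∣-*ʳ : ∀ {d a} b → d ∣ a → d ∣ a * b
    ∣-*ʳ b d∣a = ∣-resp (*-comm _ _) (∣-*ˡ b d∣a)

    ∣-neg : ∀ {d a} → d ∣ a → d ∣ - a
    ∣-neg (q , e) = - q , trans (-‿cong e) (-‿distribʳ-* _ _)

    ∣-sub : ∀ {d a b} → d ∣ a → d ∣ b → d ∣ a - b
    ∣-sub h k = ∣-+ h (∣-neg k)

    ∣0 : ∀ {d} → d ∣ 0#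
    ∣0 = 0# , sym (zeroʳ _)

    1∣ : ∀ {a} → 1# ∣ a
    1∣ = _ , sym (*-identityˡ _)

    *-∣ : ∀ {a b c d} → a ∣ b → c ∣ d → a * c ∣ b * d
    *-∣ {a} {b} {c} {d} (q , e) (r , f) = q * r , trans (*-cong e f)
      (solve 4 (λ a c q r → (a :* q) :* (c :* r) := (a :* c) :* (q :* r)) refl a c q r)

    ι-∣ : ∀ {a b} q → b ≡ a ℤ.* q → ι a ∣ ι b
    ι-∣ {a} q ≡.refl = ι q , ι-* a q

    infix 4 _≡[_]_
    record _≡[_]_ (a d b : Carrier) : Set (c ⊔ ℓ) where
      constructor cg
      field difference : d ∣ a - b
    open _≡[_]_ public

    sub-self : ∀ {a b} → a ≈ b → a - b ≈ 0#
    sub-self {a} {b} e = trans (+-congʳ e) (-‿inverseʳ b)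

    ≡-refl : ∀ {d a b} → a ≈ b → a ≡[ d ] b
    ≡-refl e = cg (∣-resp (sym (sub-self e)) ∣0)

    ≡-sym : ∀ {d a b} → a ≡[ d ] b → b ≡[ d ] a
    ≡-sym {d} {a} {b} (cg h) = cg (∣-resp (solve 2 (λ a b → :- (a :- b) := b :- a) refl a b) (∣-neg h))

    ≡-trans : ∀ {d a b c} → a ≡[ d ] b → b ≡[ d ] c → a ≡[ d ] c
    ≡-trans {d} {a} {b} {c} (cg h) (cg k) =
      cg (∣-resp (solve 3 (λ a b c → (a :- b) :+ (b :- c) := a :- c) refl a b c) (∣-+ h k))

    ≡-+ : ∀ {d a b a' b'} → a ≡[ d ] b → a' ≡[ d ] b' → a + a' ≡[ d ] b + b'
    ≡-+ {d} {a} {b} {a'} {b'} (cg h) (cg k) =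
      cg (∣-resp (solve 4 (λ a b a' b' → (a :- b) :+ (a' :- b') := (a :+ a') :- (b :+ b')) refl a b a' b') (∣-+ h k))

    ≡-* : ∀ {d a b a' b'} → a ≡[ d ] b → a' ≡[ d ] b' → a * a' ≡[ d ] b * b'
    ≡-* {d} {a} {b} {a'} {b'} (cg h) (cg k) =
      cg (∣-resp (solve 4 (λ a b a' b' → (a' :* (a :- b)) :+ (b :* (a' :- b')) := (a :* a') :- (b :* b')) refl a b a' b')
        (∣-+ (∣-*ˡ a' h) (∣-*ˡ b k)))

    ≡-neg : ∀ {d a b} → a ≡[ d ] b → - a ≡[ d ] - b
    ≡-neg {d} {a} {b} (cg h) = cg (∣-resp (solve 2 (λ a b → :- (a :- b) := (:- a) :- (:- b)) refl a b) (∣-neg h))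

    ≡-^ : ∀ {d a b} n → a ≡[ d ] b → a ^ n ≡[ d ] b ^ n
    ≡-^ zero    h = ≡-refl refl
    ≡-^ (suc n) h = ≡-* h (≡-^ n h)

    ≡-∣ : ∀ {d a b} → a ≡[ d ] b → d ∣ b → d ∣ a
    ≡-∣ {d} {a} {b} (cg h) k = ∣-resp (solve 2 (λ a b → (a :- b) :+ b := a) refl a b) (∣-+ h k)

    ∣⇒≡ : ∀ {d a} → d ∣ a → a ≡[ d ] 0#
    ∣⇒≡ {d} {a} h = cg (∣-resp (solve 1 (λ a → a := a :- con (+ 0)) refl a) h)

    ≡-resp : ∀ {d a b a' b'} → a ≈ a' → b ≈ b' → a ≡[ d ] b → a' ≡[ d ] b'
    ≡-resp e f (cg h) = cg (∣-resp (+-cong e (-‿cong f)) h)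

    ≡-weaken : ∀ {d e a b} → e ∣ d → a ≡[ d ] b → a ≡[ e ] b
    ≡-weaken e∣d (cg h) = cg (∣-trans e∣d h)

    1^n≈1 : ∀ n → 1# ^ n ≈ 1#
    1^n≈1 zero    = refl
    1^n≈1 (suc n) = trans (*-identityˡ _) (1^n≈1 n)

    -- Modulo `x - 1` the element `x` is `1`, and congruences may be raised to powers.
    x-1∣x^n-1 : ∀ x n → x - 1# ∣ x ^ n - 1#
    x-1∣x^n-1 x n = ∣-resp (+-congˡ (-‿cong (1^n≈1 n))) (difference (≡-^ {b = 1#} n (cg ∣-refl)))

    Σ< : ℕ → (ℕ → Carrier) → Carrier
    Σ< n F = sum {n} (λ i → F (toℕ i))

    Σ<-cong : ∀ n {F G : ℕ → Carrier} → (∀ i → i ℕ.< n → F i ≈ G i) → Σ< n F ≈ Σ< n G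
    Σ<-cong n h = sum-cong-≋ (λ i → h (toℕ i) (Fin.toℕ<n i))

    Σ<-0 : ∀ n {F : ℕ → Carrier} → (∀ i → i ℕ.< n → F i ≈ 0#) → Σ< n F ≈ 0#
    Σ<-0 n h = trans (Σ<-cong n h) (sum-replicate-zero n)

    Σ<-+ : ∀ n F G → Σ< n (λ i → F i + G i) ≈ Σ< n F + Σ< n G
    Σ<-+ n F G = ∑-distrib-+ {n} _ _

    Σ<-neg : ∀ n F → Σ< n (λ i → - F i) ≈ - Σ< n F
    Σ<-neg zero F = sym neg-0
    Σ<-neg (suc n) F = trans (+-congˡ (Σ<-neg n (λ i → F (suc i)))) (neg-+ _ _)

    Σ<-sub : ∀ n F G → Σ< n (λ i → F i - G i) ≈ Σ< n F - Σ< n G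
    Σ<-sub n F G = trans (Σ<-+ n F (λ i → - G i)) (+-congˡ (Σ<-neg n G))

    Σ<-*ˡ : ∀ n x F → x * Σ< n F ≈ Σ< n (λ i → x * F i)
    Σ<-*ˡ n x F = *-distribˡ-sum {n} x _

    Σ<-*ʳ : ∀ n x F → Σ< n F * x ≈ Σ< n (λ i → F i * x)
    Σ<-*ʳ n x F = *-distribʳ-sum {n} x _

    Σ<-comm : ∀ m n (F : ℕ → ℕ → Carrier) → Σ< m (λ i → Σ< n (F i)) ≈ Σ< n (λ j → Σ< m (λ i → F i j))
    Σ<-comm m n F = ∑-comm {m} {n} _

    Σ<-split : ∀ a b F → Σ< (a ℕ.+ b) F ≈ Σ< a F + Σ< b (λ i → F (a ℕ.+ i))
    Σ<-split zero    b F = sym (+-identityˡ _)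
    Σ<-split (suc a) b F = trans (+-congˡ (Σ<-split a b (λ i → F (suc i)))) (sym (+-assoc _ _ _))

    Σ<-last : ∀ n F → Σ< (suc n) F ≈ Σ< n F + F n
    Σ<-last zero    F = +-comm _ _
    Σ<-last (suc n) F = trans (+-congˡ (Σ<-last n (λ i → F (suc i)))) (sym (+-assoc _ _ _))

    Σ<-const : ∀ n x → Σ< n (λ _ → x) ≈ ι (+ n) * x
    Σ<-const zero    x = sym (zeroˡ x)
    Σ<-const (suc n) x = trans (+-cong (sym (*-identityˡ x)) (Σ<-const n x)) (trans (sym (distribʳ x 1# _)) (*-congʳ (sym (nat-suc n))))

    Σ<-∣ : ∀ n {d F} → (∀ i → d ∣ F i) → d ∣ Σ< n F
    Σ<-∣ zero    h = ∣0
    Σ<-∣ (suc n) {F = F} h = ∣-+ (h 0) (Σ<-∣ n {F = λ i → F (suc i)} (λ i → h (suc i)))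

    ≡-Σ< : ∀ n {d} {F G : ℕ → Carrier} → (∀ i → F i ≡[ d ] G i) → Σ< n F ≡[ d ] Σ< n G
    ≡-Σ< zero    h = ≡-refl refl
    ≡-Σ< (suc n) {F = F} {G} h = ≡-+ (h 0) (≡-Σ< n {F = λ i → F (suc i)} {λ i → G (suc i)} (λ i → h (suc i)))

    Σ<-single : ∀ n k F → k ℕ.< n → (∀ i → i ℕ.< n → i ≢ k → F i ≈ 0#) → Σ< n F ≈ F k
    Σ<-single (suc n) zero F _ h =
      trans (+-congˡ (Σ<-0 n {λ i → F (suc i)} (λ i i<n → h (suc i) (ℕ.s≤s i<n) (λ ())))) (+-identityʳ _)
    Σ<-single (suc n) (suc k) F (ℕ.s≤s k<n) h =
      trans (+-cong (h 0 ℕ.z<s (λ ())) (Σ<-single n k (λ i → F (suc i)) k<n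
        (λ i i<n i≢k → h (suc i) (ℕ.s≤s i<n) (λ e → i≢k (ℕ.suc-injective e))))) (+-identityˡ _)

    geometric : ∀ x n → (x - 1#) * Σ< n (x ^_) ≈ x ^ n - 1#
    geometric x zero = trans (zeroʳ _) (sym (-‿inverseʳ 1#))
    geometric x (suc n) = begin
      (x - 1#) * Σ< (suc n) (x ^_)                    ≈⟨ *-congˡ (Σ<-last n (x ^_)) ⟩
      (x - 1#) * (Σ< n (x ^_) + x ^ n)                ≈⟨ distribˡ _ _ _ ⟩
      (x - 1#) * Σ< n (x ^_) + (x - 1#) * x ^ n       ≈⟨ +-congʳ (geometric x n) ⟩
      (x ^ n - 1#) + (x - 1#) * x ^ n
        ≈⟨ solve 2 (λ x y → (y :- con (+ 1)) :+ (x :- con (+ 1)) :* y := x :* y :- con (+ 1)) refl x (x ^ n) ⟩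
      x * x ^ n - 1#                                  ∎

-- The ring ℤ[x] on coefficient lists, evaluation and substitution.

module IntegerPolynomials where

  open import Defs
  open RingTools
  open import Algebra.Bundles using (CommutativeRing)
  open import Data.Nat using (ℕ; zero; suc)
  open import Data.Integer as ℤ using (ℤ; +_; -[1+_]; 0ℤ; 1ℤ; -1ℤ)
  import Data.Integer.Properties as ℤ
  open import Data.Integer.Solver using (module +-*-Solver)
  open import Data.List using ([]; _∷_)
  open import Data.List.Relation.Unary.All using ([]; _∷_)
  open import Data.Product using (_,_)
  open import Level as Level using (0ℓ)
  open import Relation.Binary.PropositionalEquality as ≡ using (_≡_; refl; sym; trans; cong; cong₂)

  coeff : Poly → ℕ → ℤ
  coeff []      i       = 0ℤ
  coeff (a ∷ p) zero    = a
  coeff (a ∷ p) (suc i) = coeff p i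

  infix 4 _≐_
  -- Coefficient lists may carry trailing zeros, so polynomials are compared coefficient by
  -- coefficient, with zeros beyond the end.
  record _≐_ (f g : Poly) : Set where
    constructor mk
    field at : ∀ i → coeff f i ≡ coeff g i
  open _≐_ public

  ≐-refl : ∀ {f} → f ≐ f
  ≐-refl = mk λ _ → refl

  ≐-sym : ∀ {f g} → f ≐ g → g ≐ f
  ≐-sym h = mk λ i → sym (at h i)

  ≐-trans : ∀ {f g h} → f ≐ g → g ≐ h → f ≐ h
  ≐-trans p q = mk λ i → trans (at p i) (at q i)

  coeff-add : ∀ f g i → coeff (addP f g) i ≡ coeff f i ℤ.+ coeff g i
  coeff-add []      g       i       = sym (ℤ.+-identityˡ _)
  coeff-add (a ∷ f) []      i       = sym (ℤ.+-identityʳ _)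
  coeff-add (a ∷ f) (b ∷ g) zero    = refl
  coeff-add (a ∷ f) (b ∷ g) (suc i) = coeff-add f g i

  coeff-scale : ∀ c f i → coeff (scaleP c f) i ≡ c ℤ.* coeff f i
  coeff-scale c []      i       = sym (ℤ.*-zeroʳ c)
  coeff-scale c (a ∷ f) zero    = refl
  coeff-scale c (a ∷ f) (suc i) = coeff-scale c f i

  coeff-neg : ∀ f i → coeff (negP f) i ≡ ℤ.- coeff f i
  coeff-neg f i = trans (coeff-scale -1ℤ f i) (ℤ.-1*i≡-i _)

  ≐⇒IsZero : ∀ {f} → f ≐ [] → IsZeroP f
  ≐⇒IsZero {[]}    h = []
  ≐⇒IsZero {a ∷ f} h = at h 0 ∷ ≐⇒IsZero (mk λ i → at h (suc i))

  IsZero⇒≐ : ∀ {f} → IsZeroP f → f ≐ []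
  IsZero⇒≐ []      = ≐-refl
  IsZero⇒≐ (e ∷ z) = mk λ { zero → e ; (suc i) → at (IsZero⇒≐ z) i }

  ∷-cong : ∀ {a b f g} → a ≡ b → f ≐ g → (a ∷ f) ≐ (b ∷ g)
  ∷-cong e h = mk λ { zero → e ; (suc i) → at h i }

  tail-≐ : ∀ {a b f g} → (a ∷ f) ≐ (b ∷ g) → f ≐ g
  tail-≐ h = mk λ i → at h (suc i)

  add-cong : ∀ {f f' g g'} → f ≐ f' → g ≐ g' → addP f g ≐ addP f' g'
  add-cong {f} {f'} {g} {g'} h k = mk λ i → trans (coeff-add f g i)
    (trans (cong₂ ℤ._+_ (at h i) (at k i)) (sym (coeff-add f' g' i)))

  scale-cong : ∀ {f f'} c → f ≐ f' → scaleP c f ≐ scaleP c f'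
  scale-cong {f} {f'} c h = mk λ i → trans (coeff-scale c f i)
    (trans (cong (c ℤ.*_) (at h i)) (sym (coeff-scale c f' i)))

  add-comm : ∀ f g → addP f g ≐ addP g f
  add-comm f g = mk λ i → trans (coeff-add f g i) (trans (ℤ.+-comm (coeff f i) _) (sym (coeff-add g f i)))

  add-assoc : ∀ f g h → addP (addP f g) h ≐ addP f (addP g h)
  add-assoc f g h = mk λ i → begin
    coeff (addP (addP f g) h) i                   ≡⟨ coeff-add (addP f g) h i ⟩
    coeff (addP f g) i ℤ.+ coeff h i              ≡⟨ cong (ℤ._+ coeff h i) (coeff-add f g i) ⟩
    (coeff f i ℤ.+ coeff g i) ℤ.+ coeff h i       ≡⟨ ℤ.+-assoc (coeff f i) _ _ ⟩
    coeff f i ℤ.+ (coeff g i ℤ.+ coeff h i)       ≡⟨ cong (ℤ._+_ (coeff f i)) (coeff-add g h i) ⟨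
    coeff f i ℤ.+ coeff (addP g h) i              ≡⟨ coeff-add f (addP g h) i ⟨
    coeff (addP f (addP g h)) i                   ∎
    where open ≡.≡-Reasoning

  add-idʳ : ∀ f → addP f [] ≐ f
  add-idʳ []      = ≐-refl
  add-idʳ (a ∷ f) = ≐-refl

  add-invʳ : ∀ f → addP f (negP f) ≐ []
  add-invʳ f = mk λ i → trans (coeff-add f (negP f) i)
    (trans (cong (ℤ._+_ (coeff f i)) (coeff-neg f i)) (ℤ.+-inverseʳ (coeff f i)))

  add-interchange : ∀ f g h k → addP (addP f g) (addP h k) ≐ addP (addP f h) (addP g k)
  add-interchange f g h k = ≐-trans (add-assoc f g (addP h k))
    (≐-trans (add-cong (≐-refl {f}) (≐-trans (≐-sym (add-assoc g h k))
       (≐-trans (add-cong (add-comm g h) (≐-refl {k})) (add-assoc h g k))))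
    (≐-sym (add-assoc f h (addP g k))))

  0∷[]≐[] : ∀ {f} → f ≐ [] → (0ℤ ∷ f) ≐ []
  0∷[]≐[] h = mk λ { zero → refl ; (suc i) → at h i }

  scale-add : ∀ c f g → scaleP c (addP f g) ≐ addP (scaleP c f) (scaleP c g)
  scale-add c f g = mk λ i → begin
    coeff (scaleP c (addP f g)) i                        ≡⟨ coeff-scale c (addP f g) i ⟩
    c ℤ.* coeff (addP f g) i                             ≡⟨ cong (c ℤ.*_) (coeff-add f g i) ⟩
    c ℤ.* (coeff f i ℤ.+ coeff g i)                      ≡⟨ ℤ.*-distribˡ-+ c (coeff f i) _ ⟩
    c ℤ.* coeff f i ℤ.+ c ℤ.* coeff g i                  ≡⟨ cong₂ ℤ._+_ (coeff-scale c f i) (coeff-scale c g i) ⟨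
    coeff (scaleP c f) i ℤ.+ coeff (scaleP c g) i        ≡⟨ coeff-add (scaleP c f) _ i ⟨
    coeff (addP (scaleP c f) (scaleP c g)) i             ∎
    where open ≡.≡-Reasoning

  scale-* : ∀ a b f → scaleP (a ℤ.* b) f ≐ scaleP a (scaleP b f)
  scale-* a b f = mk λ i → trans (coeff-scale (a ℤ.* b) f i) (trans (ℤ.*-assoc a b _)
    (sym (trans (coeff-scale a (scaleP b f) i) (cong (a ℤ.*_) (coeff-scale b f i)))))

  scale-0 : ∀ f → scaleP 0ℤ f ≐ []
  scale-0 f = mk λ i → coeff-scale 0ℤ f i

  scale-1 : ∀ f → scaleP 1ℤ f ≐ f
  scale-1 f = mk λ i → trans (coeff-scale 1ℤ f i) (ℤ.*-identityˡ _)

  mul-congʳ : ∀ f {g g'} → g ≐ g' → mulP f g ≐ mulP f g'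
  mul-congʳ []      h = ≐-refl
  mul-congʳ (a ∷ f) h = add-cong (scale-cong a h) (∷-cong refl (mul-congʳ f h))

  mul-zeroʳ : ∀ f → mulP f [] ≐ []
  mul-zeroʳ []      = ≐-refl
  mul-zeroʳ (a ∷ f) = 0∷[]≐[] (mul-zeroʳ f)

  mul-∷ʳ : ∀ f b g → mulP f (b ∷ g) ≐ addP (scaleP b f) (0ℤ ∷ mulP f g)
  mul-∷ʳ []      b g = ≐-sym (0∷[]≐[] ≐-refl)
  mul-∷ʳ (a ∷ f) b g = ∷-cong (cong (ℤ._+ 0ℤ) (ℤ.*-comm a b))
    (≐-trans (add-cong (≐-refl {scaleP a g}) (mul-∷ʳ f b g))
    (≐-trans (≐-sym (add-assoc (scaleP a g) _ _))
    (≐-trans (add-cong (add-comm (scaleP a g) (scaleP b f)) ≐-refl) (add-assoc (scaleP b f) _ _))))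

  mul-comm : ∀ f g → mulP f g ≐ mulP g f
  mul-comm []      g = ≐-sym (mul-zeroʳ g)
  mul-comm (a ∷ f) g = ≐-trans (add-cong (≐-refl {scaleP a g}) (∷-cong refl (mul-comm f g))) (≐-sym (mul-∷ʳ g a f))

  mul-cong : ∀ {f f' g g'} → f ≐ f' → g ≐ g' → mulP f g ≐ mulP f' g'
  mul-cong {f} {f'} {g} {g'} h k = ≐-trans (mul-congʳ f k)
    (≐-trans (mul-comm f g') (≐-trans (mul-congʳ g' h) (mul-comm g' f')))

  mul-distribˡ : ∀ f g h → mulP f (addP g h) ≐ addP (mulP f g) (mulP f h)
  mul-distribˡ []      g h = ≐-refl
  mul-distribˡ (a ∷ f) g h = ≐-trans
    (add-cong (scale-add a g h) (∷-cong refl (mul-distribˡ f g h)))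
    (add-interchange (scaleP a g) (scaleP a h) (0ℤ ∷ mulP f g) (0ℤ ∷ mulP f h))

  mul-distribʳ : ∀ h f g → mulP (addP f g) h ≐ addP (mulP f h) (mulP g h)
  mul-distribʳ h f g = ≐-trans (mul-comm (addP f g) h)
    (≐-trans (mul-distribˡ h f g) (add-cong (mul-comm h f) (mul-comm h g)))

  mul-scaleˡ : ∀ a f g → mulP (scaleP a f) g ≐ scaleP a (mulP f g)
  mul-scaleˡ a []      g = ≐-refl
  mul-scaleˡ a (b ∷ f) g = ≐-trans
    (add-cong (scale-* a b g) (∷-cong (sym (ℤ.*-zeroʳ a)) (mul-scaleˡ a f g)))
    (≐-sym (scale-add a (scaleP b g) (0ℤ ∷ mulP f g)))

  mul-shiftˡ : ∀ f g → mulP (0ℤ ∷ f) g ≐ (0ℤ ∷ mulP f g)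
  mul-shiftˡ f g = add-cong (scale-0 g) ≐-refl

  mul-assoc : ∀ f g h → mulP (mulP f g) h ≐ mulP f (mulP g h)
  mul-assoc []      g h = ≐-refl
  mul-assoc (a ∷ f) g h = ≐-trans (mul-distribʳ h (scaleP a g) (0ℤ ∷ mulP f g))
    (add-cong (mul-scaleˡ a g h) (≐-trans (mul-shiftˡ (mulP f g) h) (∷-cong refl (mul-assoc f g h))))

  mul-const : ∀ c f → mulP (constP c) f ≐ scaleP c f
  mul-const c f = ≐-trans (add-cong (≐-refl {scaleP c f}) (0∷[]≐[] ≐-refl)) (add-idʳ (scaleP c f))

  mul-identityˡ : ∀ f → mulP (constP 1ℤ) f ≐ f
  mul-identityˡ f = ≐-trans (mul-const 1ℤ f) (scale-1 f)

  ℤ[x] : CommutativeRing 0ℓ 0ℓ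
  ℤ[x] .CommutativeRing.Carrier = Poly
  ℤ[x] .CommutativeRing._≈_ = _≐_
  ℤ[x] .CommutativeRing._+_ = addP
  ℤ[x] .CommutativeRing._*_ = mulP
  ℤ[x] .CommutativeRing.-_ = negP
  ℤ[x] .CommutativeRing.0# = []
  ℤ[x] .CommutativeRing.1# = constP 1ℤ
  ℤ[x] .CommutativeRing.isCommutativeRing = record
      { isRing = record
        { +-isAbelianGroup = record
          { isGroup = record
            { isMonoid = record
              { isSemigroup = record
                { isMagma = record
                  { isEquivalence = record { refl = ≐-refl ; sym = ≐-sym ; trans = ≐-trans }
                  ; ∙-cong = add-cong }
                ; assoc = add-assoc }
              ; identity = (λ f → ≐-refl) , add-idʳ }
            ; inverse = (λ f → ≐-trans (add-comm (negP f) f) (add-invʳ f)) , add-invʳ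
            ; ⁻¹-cong = scale-cong -1ℤ }
          ; comm = add-comm }
        ; *-cong = mul-cong
        ; *-assoc = mul-assoc
        ; *-identity = mul-identityˡ , (λ f → ≐-trans (mul-comm f _) (mul-identityˡ f))
        ; distrib = mul-distribˡ , mul-distribʳ
        }
      ; *-comm = mul-comm
      }

  module P = Ring ℤ[x]

  nat-const : ∀ n → P.nat n ≐ constP (+ n)
  nat-const zero          = ≐-sym (0∷[]≐[] ≐-refl)
  nat-const (suc zero)    = ≐-refl
  nat-const (suc (suc n)) = add-cong (≐-refl {constP 1ℤ}) (nat-const (suc n))

  ι-const : ∀ c → P.ι c ≐ constP c
  ι-const (+ n)    = nat-const n
  ι-const -[1+ n ] = ≐-trans (P.-‿cong (nat-const (suc n))) (∷-cong (ℤ.-1*i≡-i (+ suc n)) ≐-refl)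

  scale≐ι* : ∀ c f → scaleP c f ≐ P.ι c P.* f
  scale≐ι* c f = ≐-sym (≐-trans (mul-cong (ι-const c) ≐-refl) (mul-const c f))

  X : Poly
  X = monomial 1 1ℤ

  shift≐X* : ∀ f → (0ℤ ∷ f) ≐ X P.* f
  shift≐X* f = ≐-sym (≐-trans (mul-shiftˡ (constP 1ℤ) f) (∷-cong refl (mul-identityˡ f)))

  ∷≐ : ∀ a f → (a ∷ f) ≐ P.ι a P.+ X P.* f
  ∷≐ a f = ≐-trans (∷-cong (sym (ℤ.+-identityʳ a)) ≐-refl)
    (add-cong (≐-sym (ι-const a)) (shift≐X* f))

  monomial≐ : ∀ k → monomial k 1ℤ ≐ X P.^ k
  monomial≐ zero    = ≐-refl
  monomial≐ (suc k) = ≐-trans (∷-cong refl (monomial≐ k)) (shift≐X* (X P.^ k))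

  module Eval {c ℓ} (S : CommutativeRing c ℓ) where
    open Ring S renaming (_∣_ to _∣ˢ_) hiding (refl; sym; trans)
    open Ring S using () renaming (refl to ≈-refl; sym to ≈-sym; trans to ≈-trans)
    open Solver
    open import Relation.Binary.Reasoning.Setoid setoid

    ev : Carrier → Poly → Carrier
    ev x []      = 0#
    ev x (a ∷ f) = ι a + x * ev x f

    ev-zero : ∀ x {f} → f ≐ [] → ev x f ≈ 0#
    ev-zero x {[]}    h = ≈-refl
    ev-zero x {a ∷ f} h = begin
      ι a + x * ev x f   ≡⟨ cong (λ b → ι b + x * ev x f) (at h 0) ⟩
      0# + x * ev x f    ≈⟨ +-identityˡ _ ⟩
      x * ev x f         ≈⟨ *-congˡ (ev-zero x {f} (mk λ i → at h (suc i))) ⟩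
      x * 0#             ≈⟨ zeroʳ x ⟩
      0#                 ∎

    ev-cong : ∀ x {f g} → f ≐ g → ev x f ≈ ev x g
    ev-cong x {[]}    {g}     h = ≈-sym (ev-zero x (≐-sym h))
    ev-cong x {a ∷ f} {[]}    h = ev-zero x h
    ev-cong x {a ∷ f} {b ∷ g} h = +-cong (reflexive (cong ι (at h 0))) (*-congˡ (ev-cong x (tail-≐ h)))

    ev-congˡ : ∀ {x y} f → x ≈ y → ev x f ≈ ev y f
    ev-congˡ []      h = ≈-refl
    ev-congˡ (a ∷ f) h = +-congˡ (*-cong h (ev-congˡ f h))

    ev-+ : ∀ x f g → ev x (addP f g) ≈ ev x f + ev x g
    ev-+ x []      g       = ≈-sym (+-identityˡ _)
    ev-+ x (a ∷ f) []      = ≈-sym (+-identityʳ _)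
    ev-+ x (a ∷ f) (b ∷ g) = begin
      ι (a ℤ.+ b) + x * ev x (addP f g)          ≈⟨ +-cong (ι-+ a b) (*-congˡ (ev-+ x f g)) ⟩
      (ι a + ι b) + x * (ev x f + ev x g)
        ≈⟨ solve 5 (λ a b x f g → (a :+ b) :+ x :* (f :+ g) := (a :+ x :* f) :+ (b :+ x :* g)) ≈-refl
             (ι a) (ι b) x (ev x f) (ev x g) ⟩
      (ι a + x * ev x f) + (ι b + x * ev x g)    ∎

    ev-scale : ∀ x c f → ev x (scaleP c f) ≈ ι c * ev x f
    ev-scale x c []      = ≈-sym (zeroʳ _)
    ev-scale x c (a ∷ f) = begin
      ι (c ℤ.* a) + x * ev x (scaleP c f)   ≈⟨ +-cong (ι-* c a) (*-congˡ (ev-scale x c f)) ⟩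
      ι c * ι a + x * (ι c * ev x f)
        ≈⟨ solve 4 (λ c a x f → c :* a :+ x :* (c :* f) := c :* (a :+ x :* f)) ≈-refl (ι c) (ι a) x (ev x f) ⟩
      ι c * (ι a + x * ev x f)              ∎

    ev-* : ∀ x f g → ev x (mulP f g) ≈ ev x f * ev x g
    ev-* x []      g = ≈-sym (zeroˡ _)
    ev-* x (a ∷ f) g = begin
      ev x (addP (scaleP a g) (0ℤ ∷ mulP f g))         ≈⟨ ev-+ x (scaleP a g) (0ℤ ∷ mulP f g) ⟩
      ev x (scaleP a g) + (0# + x * ev x (mulP f g))   ≈⟨ +-cong (ev-scale x a g) (+-congˡ (*-congˡ (ev-* x f g))) ⟩
      ι a * ev x g + (0# + x * (ev x f * ev x g))
        ≈⟨ solve 4 (λ a x f g → a :* g :+ (con (+ 0) :+ x :* (f :* g)) := (a :+ x :* f) :* g) ≈-refl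
             (ι a) x (ev x f) (ev x g) ⟩
      (ι a + x * ev x f) * ev x g                      ∎

    ev-const : ∀ x c → ev x (constP c) ≈ ι c
    ev-const x c = ≈-trans (+-congˡ (zeroʳ x)) (+-identityʳ _)

    ev-X : ∀ x → ev x X ≈ x
    ev-X x = begin
      0# + x * (1# + x * 0#)  ≈⟨ solve 1 (λ x → con (+ 0) :+ x :* (con (+ 1) :+ x :* con (+ 0)) := x) ≈-refl x ⟩
      x                       ∎

    ev-^ : ∀ x f n → ev x (f P.^ n) ≈ ev x f ^ n
    ev-^ x f zero    = ev-const x 1ℤ
    ev-^ x f (suc n) = ≈-trans (ev-* x f (f P.^ n)) (*-congˡ (ev-^ x f n))

    ev-monomial : ∀ x k → ev x (monomial k 1ℤ) ≈ x ^ k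
    ev-monomial x k = ≈-trans (ev-cong x (monomial≐ k)) (≈-trans (ev-^ x X k) (^-congˡ k (ev-X x)))

    ev-≡ : ∀ {d x y} f → x ≡[ d ] y → ev x f ≡[ d ] ev y f
    ev-≡ []      h = ≡-refl ≈-refl
    ev-≡ (a ∷ f) h = ≡-+ (≡-refl ≈-refl) (≡-* h (ev-≡ f h))

  record IsHom {a b c d} (S : CommutativeRing a b) (T : CommutativeRing c d)
               (φ : CommutativeRing.Carrier S → CommutativeRing.Carrier T) : Set (a Level.⊔ b Level.⊔ c Level.⊔ d) where
    private
      module S = CommutativeRing S
      module T = CommutativeRing T
    field
      φ-cong : ∀ {x y} → x S.≈ y → φ x T.≈ φ y
      φ-+    : ∀ x y → φ (x S.+ y) T.≈ φ x T.+ φ y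
      φ-*    : ∀ x y → φ (x S.* y) T.≈ φ x T.* φ y
      φ-1    : φ S.1# T.≈ T.1#

  module HomProps {a b c d} {S : CommutativeRing a b} {T : CommutativeRing c d} {φ} (hom : IsHom S T φ) where
    open IsHom hom public
    private
      module S = Ring S
      module T = Ring T
    open import Relation.Binary.Reasoning.Setoid T.setoid
    open import Algebra.Properties.AbelianGroup T.+-abelianGroup using (identityˡ-unique; inverseʳ-unique)

    φ-0 : φ S.0# T.≈ T.0#
    φ-0 = identityˡ-unique (φ S.0#) (φ S.0#)
      (T.trans (T.sym (φ-+ S.0# S.0#)) (φ-cong (S.+-identityˡ S.0#)))

    φ-neg : ∀ x → φ (S.- x) T.≈ T.- φ x
    φ-neg x = inverseʳ-unique (φ x) (φ (S.- x))
      (T.trans (T.sym (φ-+ x (S.- x))) (T.trans (φ-cong (S.-‿inverseʳ x)) φ-0))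

    φ-nat : ∀ n → φ (S.nat n) T.≈ T.nat n
    φ-nat zero          = φ-0
    φ-nat (suc zero)    = φ-1
    φ-nat (suc (suc n)) = T.trans (φ-+ _ _) (T.+-cong φ-1 (φ-nat (suc n)))

    φ-ι : ∀ n → φ (S.ι n) T.≈ T.ι n
    φ-ι (+ n)    = φ-nat n
    φ-ι -[1+ n ] = T.trans (φ-neg _) (T.-‿cong (φ-nat (suc n)))

    φ-sub : ∀ x y → φ (x S.- y) T.≈ φ x T.- φ y
    φ-sub x y = T.trans (φ-+ x (S.- y)) (T.+-congˡ (φ-neg y))

    φ-^ : ∀ x n → φ (x S.^ n) T.≈ φ x T.^ n
    φ-^ x zero    = φ-1
    φ-^ x (suc n) = T.trans (φ-* x (x S.^ n)) (T.*-congˡ (φ-^ x n))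

    φ-∣ : ∀ {x y} → x S.∣ y → φ x T.∣ φ y
    φ-∣ {x} (q S., e) = φ q T., T.trans (φ-cong e) (φ-* x q)

    φ-Σ : ∀ n F → φ (S.Σ< n F) T.≈ T.Σ< n (λ i → φ (F i))
    φ-Σ zero    F = φ-0
    φ-Σ (suc n) F = T.trans (φ-+ _ _) (T.+-congˡ (φ-Σ n (λ i → F (suc i))))

    φ-ev : ∀ x f → φ (Eval.ev S x f) T.≈ Eval.ev T (φ x) f
    φ-ev x []      = φ-0
    φ-ev x (a ∷ f) = T.trans (φ-+ _ _) (T.+-cong (φ-ι a) (T.trans (φ-* _ _) (T.*-congˡ (φ-ev x f))))

  ev-isHom : ∀ {a b} (S : CommutativeRing a b) x → IsHom ℤ[x] S (Eval.ev S x)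
  ev-isHom S x = record { φ-cong = ev-cong x ; φ-+ = ev-+ x ; φ-* = ev-* x ; φ-1 = ev-const x 1ℤ }
    where open Eval S

  -- Evaluation at a polynomial is composition: `PE.ev (X P.^ s) f` is f(x^s), so `substP` inherits
  -- the homomorphism laws of `ev`.
  module PE = Eval ℤ[x]

  substP≐ev : ∀ s f → substP s f ≐ PE.ev (X P.^ s) f
  substP≐ev s []      = ≐-refl
  substP≐ev s (a ∷ f) = add-cong (≐-sym (ι-const a)) (mul-cong (monomial≐ s) (substP≐ev s f))

  ev-self : ∀ f → PE.ev X f ≐ f
  ev-self []      = ≐-refl
  ev-self (a ∷ f) = ≐-trans (add-cong (≐-refl {P.ι a}) (mul-congʳ X (ev-self f))) (≐-sym (∷≐ a f))

-- Elementary number theory: congruences, prime parts, multiplicative order, radical.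

module NumberTheory where

  open RingTools
  open import Data.Nat as ℕ using (ℕ; zero; suc; _+_; _*_; _∸_; _^_; _<_; _≤_; s≤s; z≤n; z<s; NonZero)
  import Data.Nat.Properties as ℕ
  open import Data.Nat.Divisibility
  open import Data.Nat.DivMod using (_%_; m%n<n; m≡m%n+[m/n]*n; _/_)
  open import Data.Nat.Primality
  open import Data.Nat.Primality.Factorisation using (factorise)
  open import Data.Nat.Coprimality as Cop using (Coprime; coprime-divisor; coprime?)
  open import Data.Nat.GCD using (gcd; gcd[m,n]∣m; gcd[m,n]∣n; module Bézout)
  open import Data.Nat.Induction using (<-rec)
  open import Data.Nat.Combinatorics using (_C_; k![n∸k]!∣n!; nCk≡n!/k![n-k]!)
  open import Data.Nat using (_!)
  open import Data.Nat.Base using (nonTrivial⇒n>1)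
  open import Data.Integer as ℤ using (ℤ; +_; -[1+_]) renaming (∣_∣ to abs)
  import Data.Integer.Properties as ℤ
  open import Data.Fin as Fin using (Fin; toℕ; fromℕ<)
  import Data.Fin.Properties as Fin
  open import Data.List using ([]; _∷_)
  open import Data.Nat.ListAction using (product)
  open import Data.List.Relation.Unary.All as All using (All; []; _∷_)
  open import Data.List.Relation.Unary.AllPairs using ([]; _∷_)
  open import Data.List.Relation.Unary.Unique.Propositional using (Unique)
  open import Data.List.Relation.Unary.Any using (here; there)
  open import Data.List.Membership.Propositional using (_∈_)
  open import Data.Product using (∃; ∃₂; _×_; _,_)
  open import Data.Sum using (_⊎_; inj₁; inj₂)
  open import Data.Empty using (⊥; ⊥-elim)
  open import Relation.Nullary
  open import Relation.Unary using (Decidable)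
  open import Relation.Binary.PropositionalEquality

  module Z = Ring ℤ.+-*-commutativeRing
  open Z using (cg; difference; _,_)

  ∣⇒Z∣ : ∀ {m n} → m ∣ n → (+ m) Z.∣ (+ n)
  ∣⇒Z∣ {m} (divides q refl) = + q , trans (ℤ.pos-* q m) (ℤ.*-comm (+ q) (+ m))

  Z∣⇒∣ : ∀ {m i} → (+ m) Z.∣ i → m ∣ abs i
  Z∣⇒∣ {m} (q , refl) = divides (abs q) (trans (ℤ.abs-* (+ m) q) (ℕ.*-comm m (abs q)))

  ∣⇒Z∣abs : ∀ {m} i → m ∣ abs i → (+ m) Z.∣ i
  ∣⇒Z∣abs (+ n)    h = ∣⇒Z∣ h
  ∣⇒Z∣abs -[1+ n ] h = Z.∣-neg (∣⇒Z∣ h)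

  infix 4 _≡_mod_
  -- The congruence lives in ℤ, where differences exist, although the exponents that it compares are
  -- natural numbers.
  _≡_mod_ : ℕ → ℕ → ℕ → Set
  a ≡ b mod m = (+ a) Z.≡[ + m ] (+ b)

  mod-refl : ∀ {a b m} → a ≡ b → a ≡ b mod m
  mod-refl e = Z.≡-refl (cong +_ e)

  mod-+ : ∀ {a b c d m} → a ≡ b mod m → c ≡ d mod m → a + c ≡ b + d mod m
  mod-+ h k = Z.≡-+ h k

  mod-* : ∀ {a b c d m} → a ≡ b mod m → c ≡ d mod m → a * c ≡ b * d mod m
  mod-* {a} {b} {c} {d} h k = Z.≡-resp (sym (ℤ.pos-* a c)) (sym (ℤ.pos-* b d)) (Z.≡-* h k)

  mod-scale : ∀ q {a b m} → a ≡ b mod m → q * a ≡ q * b mod (q * m)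
  mod-scale q {a} {b} {m} (cg (x , e)) = cg (x , (begin
    + (q * a) ℤ.- + (q * b)            ≡⟨ cong₂ ℤ._-_ (ℤ.pos-* q a) (ℤ.pos-* q b) ⟩
    + q ℤ.* + a ℤ.- + q ℤ.* + b        ≡⟨ lem (+ q) (+ a) (+ b) ⟩
    + q ℤ.* (+ a ℤ.- + b)              ≡⟨ cong (ℤ._*_ (+ q)) e ⟩
    + q ℤ.* (+ m ℤ.* x)                ≡⟨ ℤ.*-assoc (+ q) (+ m) x ⟨
    + q ℤ.* + m ℤ.* x                  ≡⟨ cong (ℤ._* x) (ℤ.pos-* q m) ⟨
    + (q * m) ℤ.* x                    ∎))
    where
    open ≡-Reasoning
    open Z.Solver
    lem : ∀ q a b → q ℤ.* a ℤ.- q ℤ.* b ≡ q ℤ.* (a ℤ.- b)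
    lem = solve 3 (λ q a b → q :* a :- q :* b := q :* (a :- b)) refl

  mod-^ : ∀ {a b m} n → a ≡ b mod m → a ^ n ≡ b ^ n mod m
  mod-^ zero    h = mod-refl refl
  mod-^ {a} {b} (suc n) h = mod-* {a} {b} h (mod-^ n h)

  -- A signed difference becomes a natural multiple added on one side, the form in which powers of
  -- an element with x^m = 1 can be compared directly.
  mod-cases : ∀ {a b m} → a ≡ b mod m → ∃ (λ k → a ≡ b + m * k) ⊎ ∃ (λ k → b ≡ a + m * k)
  mod-cases {a} {b} {m} (cg (+ k , e)) = inj₁ (k , ℤ.+-injective (begin
    + a                       ≡⟨ lem (+ a) (+ b) ⟩
    + b ℤ.+ (+ a ℤ.- + b)     ≡⟨ cong (ℤ._+_ (+ b)) (trans e (sym (ℤ.pos-* m k))) ⟩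
    + (b + m * k)             ∎))
    where
    open ≡-Reasoning
    open Z.Solver
    lem : ∀ x y → x ≡ y ℤ.+ (x ℤ.- y)
    lem = solve 2 (λ x y → x := y :+ (x :- y)) refl
  mod-cases {a} {b} {m} (cg (-[1+ k ] , e)) = inj₂ (suc k , ℤ.+-injective (begin
    + b                             ≡⟨ lem (+ a) (+ b) ⟩
    + a ℤ.- (+ a ℤ.- + b)           ≡⟨ cong (λ z → + a ℤ.- z) e ⟩
    + a ℤ.- (+ m ℤ.* -[1+ k ])      ≡⟨ cong (ℤ._+_ (+ a)) (ℤ.neg-distribʳ-* (+ m) -[1+ k ]) ⟩
    + a ℤ.+ (+ m ℤ.* + suc k)       ≡⟨ cong (ℤ._+_ (+ a)) (ℤ.pos-* m (suc k)) ⟨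
    + (a + m * suc k)               ∎))
    where
    open ≡-Reasoning
    open Z.Solver
    lem : ∀ x y → y ≡ x ℤ.- (x ℤ.- y)
    lem = solve 2 (λ x y → y := x :- (x :- y)) refl

  ∣⇒mod0 : ∀ {a m} → m ∣ a → a ≡ 0 mod m
  ∣⇒mod0 {a} h = Z.∣⇒≡ (∣⇒Z∣ h)

  mod-% : ∀ a m .{{_ : NonZero m}} → a % m ≡ a mod m
  mod-% a m = Z.≡-sym (cg (+ (a / m) , (begin
    + a ℤ.- + (a % m)                               ≡⟨ cong (λ z → + z ℤ.- + (a % m)) (m≡m%n+[m/n]*n a m) ⟩
    + (a % m + a / m * m) ℤ.- + (a % m)             ≡⟨ lem (+ (a % m)) (+ (a / m * m)) ⟩
    + (a / m * m)                                   ≡⟨ trans (ℤ.pos-* (a / m) m) (ℤ.*-comm (+ (a / m)) (+ m)) ⟩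
    + m ℤ.* + (a / m)                               ∎)))
    where
    open ≡-Reasoning
    open Z.Solver
    lem : ∀ x y → (x ℤ.+ y) ℤ.- x ≡ y
    lem = solve 2 (λ x y → (x :+ y) :- x := y) refl

  mod-<⇒≡ : ∀ {a b m} → a < m → b < m → a ≡ b mod m → a ≡ b
  mod-<⇒≡ {a} {b} {m} a<m b<m h with mod-cases {a} {b} h
  ... | inj₁ (zero , e)  = trans e (trans (cong (_+_ b) (ℕ.*-zeroʳ m)) (ℕ.+-identityʳ b))
  ... | inj₁ (suc k , e) = ⊥-elim (ℕ.<⇒≱ a<m (subst (m ≤_) (sym e) (ℕ.≤-trans (ℕ.m≤m*n m (suc k)) (ℕ.m≤n+m _ b))))
  ... | inj₂ (zero , e)  = sym (trans e (trans (cong (_+_ a) (ℕ.*-zeroʳ m)) (ℕ.+-identityʳ a)))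
  ... | inj₂ (suc k , e) = ⊥-elim (ℕ.<⇒≱ b<m (subst (m ≤_) (sym e) (ℕ.≤-trans (ℕ.m≤m*n m (suc k)) (ℕ.m≤n+m _ a))))

  mod-dec : ∀ a b m → Dec (a ≡ b mod m)
  mod-dec a b m with m ∣? abs (+ a ℤ.- + b)
  ... | yes h = yes (cg (∣⇒Z∣abs (+ a ℤ.- + b) h))
  ... | no ¬h = no (λ k → ¬h (Z∣⇒∣ (difference k)))

  prime>1 : ∀ {p} → Prime p → 1 < p
  prime>1 p = nonTrivial⇒n>1 _ {{prime⇒nonTrivial p}}

  prime>0 : ∀ {p} → Prime p → 0 < p
  prime>0 p = ℕ.<-trans z<s (prime>1 p)

  prime∤1 : ∀ {p} → Prime p → ¬ p ∣ 1
  prime∤1 p h = ℕ.<⇒≢ (prime>1 p) (sym (∣1⇒≡1 h))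

  prime-∣-prime : ∀ {p q} → Prime p → Prime q → p ∣ q → p ≡ q
  prime-∣-prime pp pq h with prime⇒irreducible pq h
  ... | inj₁ refl = ⊥-elim (prime∤1 pp ∣-refl)
  ... | inj₂ e    = e

  primeDivisor : ∀ n → 1 < n → ∃ λ p → Prime p × p ∣ n
  primeDivisor n 1<n with factorise n {{ℕ.>-nonZero (ℕ.<-trans z<s 1<n)}}
  ... | record { factors = [] ; isFactorisation = e } = ⊥-elim (ℕ.<⇒≢ 1<n (sym e))
  ... | record { factors = p ∷ ps ; isFactorisation = e ; factorsPrime = pr ∷ _ } =
    p , pr , subst (p ∣_) (sym e) (m∣m*n (product ps))

  coprimeByPrimes : ∀ {a b} → 0 < b → (∀ p → Prime p → p ∣ a → p ∣ b → ⊥) → Coprime a b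
  coprimeByPrimes {b = b} 0<b h {zero}        (_ , 0∣b) = ⊥-elim (ℕ.<⇒≢ 0<b (sym (0∣⇒≡0 0∣b)))
  coprimeByPrimes         0<b h {suc zero}    _ = refl
  coprimeByPrimes {a} {b} 0<b h {suc (suc d)} (d∣a , d∣b) with primeDivisor (suc (suc d)) (s≤s (s≤s z≤n))
  ... | p , pr , p∣d = ⊥-elim (h p pr (∣-trans p∣d d∣a) (∣-trans p∣d d∣b))

  coprime-*ʳ : ∀ {a b c} → Coprime a b → Coprime a c → Coprime a (b * c)
  coprime-*ʳ {a} {b} {c} h k {d} (d∣a , d∣bc) =
    k (d∣a , coprime-divisor {d} {b} {c} (λ { (e∣d , e∣b) → h (∣-trans e∣d d∣a , e∣b) }) d∣bc)

  coprime-^ʳ : ∀ {a b} n → Coprime a b → Coprime a (b ^ n)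
  coprime-^ʳ zero    h (_ , d∣1) = ∣1⇒≡1 d∣1
  coprime-^ʳ (suc n) h = coprime-*ʳ h (coprime-^ʳ n h)

  coprime-∣ʳ : ∀ {a b c} → c ∣ b → Coprime a b → Coprime a c
  coprime-∣ʳ c∣b h (d∣a , d∣c) = h (d∣a , ∣-trans d∣c c∣b)

  coprime-∣ˡ : ∀ {a b c} → c ∣ a → Coprime a b → Coprime c b
  coprime-∣ˡ c∣a h (d∣c , d∣b) = h (∣-trans d∣c c∣a , d∣b)

  ∤⇒coprime : ∀ {p m} → Prime p → ¬ p ∣ m → Coprime p m
  ∤⇒coprime pp p∤m {d} (d∣p , d∣m) with prime⇒irreducible pp d∣p
  ... | inj₁ e    = e
  ... | inj₂ refl = ⊥-elim (p∤m d∣m)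

  coprime⇒∤ : ∀ {p m} → Prime p → Coprime p m → ¬ p ∣ m
  coprime⇒∤ pp h p∣m = prime∤1 pp (subst (_∣ 1) (sym (h (∣-refl , p∣m))) ∣-refl)

  coprime-mod : ∀ {a b m} → a ≡ b mod m → Coprime a m → Coprime b m
  coprime-mod {a} {b} {m} h c {d} (d∣b , d∣m) = c (Z∣⇒∣ (Z.∣-resp (lem (+ a) (+ b))
     (Z.∣-+ (difference (Z.≡-weaken (∣⇒Z∣ d∣m) h)) (∣⇒Z∣ d∣b))) , d∣m)
    where
    open Z.Solver
    lem : ∀ x y → (x ℤ.- y) ℤ.+ y ≡ x
    lem = solve 2 (λ x y → (x :- y) :+ y := x) refl

  bézout : ∀ {a b} → Coprime a b → ∃₂ λ x y → x ℤ.* + a ℤ.+ y ℤ.* + b ≡ + 1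
  bézout {a} {b} h with Cop.coprime-Bézout h
  ... | Bézout.+- x y eq = + x , ℤ.- + y , lem (+ x ℤ.* + a) (+ y) (+ b) (trans (cong (ℤ._+_ (+ 1)) (sym (ℤ.pos-* y b))) (trans (cong +_ eq) (ℤ.pos-* x a)))
    where
    open Z.Solver
    lem : ∀ X Y B → + 1 ℤ.+ Y ℤ.* B ≡ X → X ℤ.+ (ℤ.- Y) ℤ.* B ≡ + 1
    lem X Y B refl = solve 2 (λ y b → con (+ 1) :+ y :* b :+ (:- y) :* b := con (+ 1)) refl Y B
  ... | Bézout.-+ x y eq = ℤ.- + x , + y , lem (+ x) (+ a) (+ y ℤ.* + b) (trans (cong (ℤ._+_ (+ 1)) (sym (ℤ.pos-* x a))) (trans (cong +_ eq) (ℤ.pos-* y b)))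
    where
    open Z.Solver
    lem : ∀ X A Y → + 1 ℤ.+ X ℤ.* A ≡ Y → (ℤ.- X) ℤ.* A ℤ.+ Y ≡ + 1
    lem X A Y refl = solve 2 (λ x a → (:- x) :* a :+ (con (+ 1) :+ x :* a) := con (+ 1)) refl X A

  mod-inverse : ∀ {a m} → 0 < m → Coprime a m → ∃ λ b → b * a ≡ 1 mod m
  mod-inverse {a} {m} 0<m h with Cop.coprime-Bézout h
  ... | Bézout.+- x y eq = x , cg (+ y , (begin
      + (x * a) ℤ.- + 1             ≡⟨ cong (λ z → + z ℤ.- + 1) eq ⟨
      + (1 + y * m) ℤ.- + 1         ≡⟨ lem (+ (y * m)) ⟩
      + (y * m)                     ≡⟨ trans (ℤ.pos-* y m) (ℤ.*-comm (+ y) (+ m)) ⟩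
      + m ℤ.* + y                   ∎))
    where
    open ≡-Reasoning
    open Z.Solver
    lem : ∀ z → (+ 1 ℤ.+ z) ℤ.- + 1 ≡ z
    lem = solve 1 (λ z → (con (+ 1) :+ z) :- con (+ 1) := z) refl
  -- Here `x * a` is -1 modulo `m`, and `m ∸ 1` contributes the second factor -1.
  ... | Bézout.-+ x y eq = (m ∸ 1) * x , Z.≡-trans {+ m} {+ ((m ∸ 1) * x * a)} {+ ((m ∸ 1) * (m ∸ 1))}
          (subst (λ z → z ≡ (m ∸ 1) * (m ∸ 1) mod m) (sym (ℕ.*-assoc (m ∸ 1) x a)) (mod-* {m ∸ 1} (mod-refl refl) xa≡-1))
          sq
    where
    open Z.Solver
    m-1 : + (m ∸ 1) ≡ + m ℤ.- + 1
    m-1 = trans (sym (ℤ.⊖-≥ 0<m)) (sym (ℤ.m-n≡m⊖n m 1))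
    xa≡-1 : x * a ≡ m ∸ 1 mod m
    xa≡-1 = cg ((+ y ℤ.- + 1) , trans (cong₂ ℤ._-_ (lem1 {+ (x * a)} (trans (cong +_ eq) (ℤ.pos-* y m))) m-1) (lem2 (+ y) (+ m)))
      where
      lem1 : ∀ {X Y} → + 1 ℤ.+ X ≡ Y → X ≡ Y ℤ.- + 1
      lem1 {X} refl = solve 1 (λ x → x := (con (+ 1) :+ x) :- con (+ 1)) refl X
      lem2 : ∀ y m → (y ℤ.* m ℤ.- + 1) ℤ.- (m ℤ.- + 1) ≡ m ℤ.* (y ℤ.- + 1)
      lem2 = solve 2 (λ y m → (y :* m :- con (+ 1)) :- (m :- con (+ 1)) := m :* (y :- con (+ 1))) refl
    sq : (m ∸ 1) * (m ∸ 1) ≡ 1 mod m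
    sq = cg ((+ m ℤ.- + 2) , trans (cong (ℤ._- + 1) (trans (ℤ.pos-* (m ∸ 1) (m ∸ 1)) (cong₂ ℤ._*_ m-1 m-1))) (lem (+ m)))
      where
      lem : ∀ m → (m ℤ.- + 1) ℤ.* (m ℤ.- + 1) ℤ.- + 1 ≡ m ℤ.* (m ℤ.- + 2)
      lem = solve 1 (λ m → (m :- con (+ 1)) :* (m :- con (+ 1)) :- con (+ 1) := m :* (m :- con (+ 2))) refl

  mod-cancelˡ : ∀ {a b c m} → Coprime m c → c * a ≡ c * b mod m → a ≡ b mod m
  mod-cancelˡ {a} {b} {c} {m} h (cg k) = cg (∣⇒Z∣abs (+ a ℤ.- + b) (coprime-divisor {m} {c} h (subst (m ∣_)
    (ℤ.abs-* (+ c) (+ a ℤ.- + b)) (Z∣⇒∣ (Z.∣-resp (trans (cong₂ ℤ._-_ (ℤ.pos-* c a) (ℤ.pos-* c b))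
       (sym (lem (+ c) (+ a) (+ b)))) k)))))
    where
    open Z.Solver
    lem : ∀ c a b → c ℤ.* (a ℤ.- b) ≡ c ℤ.* a ℤ.- c ℤ.* b
    lem = solve 3 (λ c a b → c :* (a :- b) := c :* a :- c :* b) refl

  primePart : ∀ p → 1 < p → ∀ n → 0 < n → ∃₂ λ a n' → n ≡ p ^ a * n' × ¬ p ∣ n'
  primePart p 1<p = <-rec _ go
    where
    go : ∀ n → (∀ {m} → m < n → 0 < m → ∃₂ λ a n' → m ≡ p ^ a * n' × ¬ p ∣ n') →
         0 < n → ∃₂ λ a n' → n ≡ p ^ a * n' × ¬ p ∣ n'
    go n rec 0<n with p ∣? n
    ... | no p∤n = 0 , n , sym (ℕ.+-identityʳ n) , p∤n
    ... | yes (divides q e) with rec {q} q<n (ℕ.n≢0⇒n>0 q≢0)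
      where
      q≢0 : q ≢ 0
      q≢0 refl = ℕ.<⇒≢ 0<n (sym e)
      q<n : q < n
      q<n = subst (q <_) (sym e) (ℕ.m<m*n q p {{ℕ.≢-nonZero q≢0}} 1<p)
    ...   | a , n' , e' , p∤n' = suc a , n' , trans e (trans (ℕ.*-comm q p) (trans (cong (p *_) e') (sym (ℕ.*-assoc p (p ^ a) n')))) , p∤n'

  -- Divide `n` by its gcd with `m` until nothing common is left; every prime lost on the way
  -- divides `m`.
  coprimePart : ∀ m → 0 < m → ∀ n → 0 < n →
    ∃ λ x → 0 < x × Coprime x m × (∀ q → Prime q → q ∣ n → q ∣ m ⊎ q ∣ x)
  coprimePart m 0<m = <-rec _ go
    where
    go : ∀ n → (∀ {k} → k < n → 0 < k → ∃ λ x → 0 < x × Coprime x m × (∀ q → Prime q → q ∣ k → q ∣ m ⊎ q ∣ x)) →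
         0 < n → ∃ λ x → 0 < x × Coprime x m × (∀ q → Prime q → q ∣ n → q ∣ m ⊎ q ∣ x)
    go n rec 0<n with coprime? n m
    ... | yes c = n , 0<n , c , λ q _ q∣n → inj₂ q∣n
    ... | no ¬c with gcd[m,n]∣m n m | gcd[m,n]∣n n m
    ...   | divides k e | g∣m with rec {k} k<n (ℕ.n≢0⇒n>0 k≢0)
      where
      k≢0 : k ≢ 0
      k≢0 refl = ℕ.<⇒≢ 0<n (sym e)
      g≢0 : gcd n m ≢ 0
      g≢0 g≡0 = ℕ.<⇒≢ 0<n (sym (trans e (trans (cong (k *_) g≡0) (ℕ.*-zeroʳ k))))
      1<g : 1 < gcd n m
      1<g = ℕ.≤∧≢⇒< (ℕ.n≢0⇒n>0 g≢0) (λ 1≡g → ¬c (Cop.gcd≡1⇒coprime (sym 1≡g)))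
      k<n : k < n
      k<n = subst (k <_) (sym e) (ℕ.m<m*n k (gcd n m) {{ℕ.≢-nonZero k≢0}} 1<g)
    ...     | x , 0<x , cx , h = x , 0<x , cx , λ q pq q∣n →
      case (euclidsLemma k (gcd n m) pq (subst (q ∣_) e q∣n)) of λ
        { (inj₁ q∣k) → h q pq q∣k ; (inj₂ q∣g) → inj₁ (∣-trans q∣g g∣m) }
      where open import Function using (case_of_)

  least : ∀ {P : ℕ → Set} → Decidable P → ∀ n → P n → ∃ λ m → P m × (∀ i → i < m → ¬ P i)
  least {P} P? = <-rec _ go
    where
    go : ∀ n → (∀ {m} → m < n → P m → ∃ λ m → P m × (∀ i → i < m → ¬ P i)) → P n → ∃ λ m → P m × (∀ i → i < m → ¬ P i)
    go n rec Pn with ℕ.anyUpTo? P? n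
    ... | yes (i , i<n , Pi) = rec i<n Pi
    ... | no ¬∃ = n , Pn , λ i i<n Pi → ¬∃ (i , i<n , Pi)

  -- Two of the m + 1 powers p^0, ..., p^m agree modulo `m`, and the smaller one cancels. The order
  -- is recorded as `suc M`, which keeps it positive.
  order : ∀ {p m} → 0 < m → Coprime m p →
    ∃ λ M → p ^ suc M ≡ 1 mod m × (∀ i → i < M → ¬ p ^ suc i ≡ 1 mod m)
  order {p} {m} 0<m c with Fin.pigeonhole (ℕ.n<1+n m) (λ i → fromℕ< (m%n<n (p ^ toℕ {suc m} i) m {{ℕ.>-nonZero 0<m}}))
  ... | i , j , i<j , e = least (λ i → mod-dec (p ^ suc i) 1 m) d (mod-cancelˡ {p ^ suc d} {1} {p ^ a} (coprime-^ʳ a c)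
          (subst₂ (λ x y → x ≡ y mod m) e1 (sym (ℕ.*-identityʳ (p ^ a))) (Z.≡-sym {+ m} {+ (p ^ a)} cong-ij)))
    where
    instance _ = ℕ.>-nonZero 0<m
    a = toℕ i
    b = toℕ j
    d = b ∸ suc a
    a+sd : a + suc d ≡ b
    a+sd = trans (ℕ.+-suc a d) (ℕ.m+[n∸m]≡n i<j)
    e1 : p ^ b ≡ p ^ a * p ^ suc d
    e1 = trans (cong (p ^_) (sym a+sd)) (ℕ.^-distribˡ-+-* p a (suc d))
    ij : p ^ a % m ≡ p ^ b % m
    ij = trans (sym (Fin.toℕ-fromℕ< _)) (trans (cong toℕ e) (Fin.toℕ-fromℕ< _))
    cong-ij : p ^ a ≡ p ^ b mod m
    cong-ij = Z.≡-trans {+ m} {+ (p ^ a)} {+ (p ^ a % m)} (Z.≡-sym {+ m} {+ (p ^ a % m)} (mod-% (p ^ a) m))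
                (subst (λ z → z ≡ p ^ b mod m) (sym ij) (mod-% (p ^ b) m))

  product-∣ : ∀ {q ps} → q ∈ ps → q ∣ product ps
  product-∣ {ps = p ∷ ps} (here refl) = m∣m*n (product ps)
  product-∣ {ps = p ∷ ps} (there h)   = ∣-trans (product-∣ h) (n∣m*n p)

  coprime-product : ∀ {q} ps → Prime q → All Prime ps → All (q ≢_) ps → Coprime q (product ps)
  coprime-product []       pq _ _ (_ , d∣1) = ∣1⇒≡1 d∣1
  coprime-product (p ∷ ps) pq (pp ∷ pps) (q≢p ∷ q≢ps) =
    coprime-*ʳ (∤⇒coprime pq (λ q∣p → q≢p (prime-∣-prime pq pp q∣p))) (coprime-product ps pq pps q≢ps)

  -- The cofactor `k` collects the repeated prime factors; later Φ_m(x) is obtained as Φ(x^k) with Φ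
  -- belonging to the square-free number `product ps`.
  radical : ∀ m → 0 < m → ∃₂ λ ps k → All Prime ps × Unique ps × m ≡ k * product ps × (∀ q → Prime q → q ∣ m → q ∈ ps)
  radical = <-rec _ go
    where
    Rad : ℕ → Set
    Rad m = ∃₂ λ ps k → All Prime ps × Unique ps × m ≡ k * product ps × (∀ q → Prime q → q ∣ m → q ∈ ps)
    go : ∀ m → (∀ {n} → n < m → 0 < n → Rad n) → 0 < m → Rad m
    go m rec 0<m with 1 ℕ.<? m
    ... | no ¬1<m = [] , 1 , [] , [] , ℕ.≤-antisym (ℕ.≮⇒≥ ¬1<m) 0<m ,
          λ q pq q∣m → ⊥-elim (ℕ.<⇒≱ (prime>1 pq) (ℕ.≤-trans (∣⇒≤ {{ℕ.>-nonZero 0<m}} q∣m) (ℕ.≮⇒≥ ¬1<m)))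
    ... | yes 1<m with primeDivisor m 1<m
    ...   | p , pp , p∣m with primePart p (prime>1 pp) m 0<m
    ...     | zero , n' , e , p∤n' = ⊥-elim (p∤n' (subst (p ∣_) (trans e (ℕ.+-identityʳ n')) p∣m))
    ...     | suc a , n' , e , p∤n' with rec {n'} n'<m 0<n'
      where
      0<n' : 0 < n'
      0<n' = ℕ.n≢0⇒n>0 (λ { refl → p∤n' (p ∣0) })
      1<pa : 1 < p ^ suc a
      1<pa = ℕ.<-≤-trans (prime>1 pp) (ℕ.m≤m*n p (p ^ a) {{ℕ.m^n≢0 p a {{prime⇒nonZero pp}}}})
      n'<m : n' < m
      n'<m = subst (n' <_) (trans (ℕ.*-comm n' (p ^ suc a)) (sym e)) (ℕ.m<m*n n' (p ^ suc a) {{ℕ.>-nonZero 0<n'}} 1<pa)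
    ...       | ps , k , allp , uniq , e' , has = p ∷ ps , p ^ a * k , pp ∷ allp ,
                All.tabulate (λ {q} q∈ps p≡q → p∤n' (subst₂ _∣_ (sym p≡q) (sym e') (∣-trans (product-∣ q∈ps) (n∣m*n k)))) ∷ uniq ,
                trans e (trans (cong (p ^ suc a *_) e') (lem p (p ^ a) k (product ps))) ,
                λ q pq q∣m → hasq q pq (euclidsLemma (p ^ suc a) n' pq (subst (q ∣_) e q∣m))
      where
      open import Data.Nat.Solver using (module +-*-Solver)
      open +-*-Solver
      lem : ∀ p q k r → p * q * (k * r) ≡ q * k * (p * r)
      lem = solve 4 (λ p q k r → p :* q :* (k :* r) := q :* k :* (p :* r)) refl
      prime-^ : ∀ q → Prime q → ∀ n → q ∣ p ^ n → q ≡ p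
      prime-^ q pq zero    h = ⊥-elim (prime∤1 pq h)
      prime-^ q pq (suc n) h with euclidsLemma p (p ^ n) pq h
      ... | inj₁ q∣p = prime-∣-prime pq pp q∣p
      ... | inj₂ q∣r = prime-^ q pq n q∣r
      hasq : ∀ q → Prime q → q ∣ p ^ suc a ⊎ q ∣ n' → q ∈ p ∷ ps
      hasq q pq (inj₁ h) = here (prime-^ q pq (suc a) h)
      hasq q pq (inj₂ h) = there (has q pq h)

  -- `p` divides p! but neither factorial in the denominator, all of whose factors are smaller than
  -- `p`.
  p∣pCk : ∀ {p k} → Prime p → 0 < k → k < p → p ∣ p C k
  p∣pCk {p} {k} pp 0<k k<p with k![n∸k]!∣n! (ℕ.<⇒≤ k<p)
  ... | divides q e with euclidsLemma q (k ! * (p ∸ k) !) pp (subst (p ∣_) e (p∣p! pp))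
    where
    p∣p! : ∀ {p} → Prime p → p ∣ p !
    p∣p! {zero}  pp = ⊥-elim (¬prime[0] pp)
    p∣p! {suc p} pp = m∣m*n (p !)
  ...   | inj₁ p∣q = subst (p ∣_) (sym C≡q) p∣q
    where
    open import Data.Nat.DivMod using (m*n/n≡m; /-congˡ)
    instance _ = ℕ.m*n≢0 (k !) ((p ∸ k) !) {{k ℕ.!≢0}} {{(p ∸ k) ℕ.!≢0}}
    C≡q : p C k ≡ q
    C≡q = trans (nCk≡n!/k![n-k]! (ℕ.<⇒≤ k<p)) (trans (/-congˡ e) (m*n/n≡m q (k ! * (p ∸ k) !)))
  ...   | inj₂ p∣kk = ⊥-elim (case euclidsLemma (k !) ((p ∸ k) !) pp p∣kk of λ
            { (inj₁ h) → p∤! k k<p h ; (inj₂ h) → p∤! (p ∸ k) (ℕ.∸-monoʳ-< {p} 0<k (ℕ.<⇒≤ k<p)) h })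
    where
    open import Function using (case_of_)
    p∤! : ∀ k → k < p → ¬ p ∣ k !
    p∤! zero    _   h = prime∤1 pp h
    p∤! (suc k) k<p h with euclidsLemma (suc k) (k !) pp h
    ... | inj₁ h' = ℕ.<⇒≱ k<p (∣⇒≤ h')
    ... | inj₂ h' = p∤! k (ℕ.<-trans (ℕ.n<1+n k) k<p) h'

-- Frobenius congruences modulo a prime and their lifting.

module FrobeniusPowers where

  open RingTools
  open IntegerPolynomials
  open NumberTheory using (p∣pCk)
  open import Algebra.Bundles using (CommutativeRing)
  open import Data.Nat as ℕ using (ℕ; zero; suc; _∸_; s≤s)
  import Data.Nat.Properties as ℕ
  import Data.Nat.Divisibility as ℕ
  open import Data.Nat.Combinatorics using (_C_; nCn≡1; nC1≡n)
  open import Data.Nat.Primality using (Prime; ¬prime[0]; ¬prime[1])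
  open import Data.Integer as ℤ using (ℤ; +_; -[1+_])
  import Data.Integer.Properties as ℤ
  open import Data.List using ([]; _∷_)
  open import Data.Product using (∃) renaming (_,_ to _,,_)
  open import Data.Empty using (⊥-elim)
  open import Relation.Binary.PropositionalEquality as ≡ using (_≡_)

  module Frobenius {c ℓ} (R : CommutativeRing c ℓ) where
    open Ring R
    open Solver
    open Eval R
    open import Relation.Binary.Reasoning.Setoid setoid
    open import Algebra.Properties.Semiring.Mult semiring using (_×_)
    import Algebra.Properties.CommutativeSemiring.Binomial commutativeSemiring as Binomial

    ×≈ι* : ∀ n x → n × x ≈ ι (+ n) * x
    ×≈ι* zero    x = sym (zeroˡ x)
    ×≈ι* (suc n) x = begin
      x + n × x            ≈⟨ +-cong (sym (*-identityˡ x)) (×≈ι* n x) ⟩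
      1# * x + nat n * x   ≈⟨ distribʳ _ _ _ ⟨
      (1# + nat n) * x     ≈⟨ *-congʳ (nat-suc n) ⟨
      nat (suc n) * x      ∎

    -- the terms x y^(p-1) are kept apart because their coefficient is exactly p
    binomial-prime : ∀ {p} → Prime p → ∀ x y →
      ∃ λ r → (x + y) ^ p ≈ (x ^ p + y ^ p) + ι (+ p) * (x * y ^ (p ∸ 1) + x * x * r)
    binomial-prime {zero}        pp = ⊥-elim (¬prime[0] pp)
    binomial-prime {suc zero}    pp = ⊥-elim (¬prime[1] pp)
    binomial-prime {suc (suc q)} pp x y = r ,, (begin
      (x + y) ^ p                                                ≈⟨ Binomial.theorem p x y ⟩
      Σ< (suc p) F                                               ≡⟨⟩
      F 0 + (F 1 + Σ< (suc q) G)                                 ≈⟨ +-congˡ (+-congˡ (Σ<-last q G)) ⟩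
      F 0 + (F 1 + (Σ< q G + F p))                               ≈⟨ +-cong F0 (+-cong F1 (+-cong (mid .equality) Fp)) ⟩
      y ^ p + (P * (x * y ^ suc q) + (P * (x * x) * r + x ^ p))
        ≈⟨ solve 6 (λ yp P x y' xp r → yp :+ (P :* (x :* y') :+ (P :* (x :* x) :* r :+ xp)) :=
                     (xp :+ yp) :+ P :* (x :* y' :+ x :* x :* r)) refl (y ^ p) P x (y ^ suc q) (x ^ p) r ⟩
      (x ^ p + y ^ p) + P * (x * y ^ suc q + x * x * r)          ∎)
      where
      open _∣_
      p = suc (suc q)
      P = ι (+ p)
      F G : ℕ → Carrier
      F k = (p C k) × (x ^ k * y ^ (p ∸ k))
      G i = F (suc (suc i))
      F0 : F 0 ≈ y ^ p
      F0 = trans (+-identityʳ _) (*-identityˡ _)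
      F1 : F 1 ≈ P * (x * y ^ suc q)
      F1 = trans (reflexive (≡.cong (_× (x ^ 1 * y ^ suc q)) (nC1≡n p)))
            (trans (×≈ι* p _) (*-congˡ (*-congʳ (*-identityʳ x))))
      Fp : F p ≈ x ^ p
      Fp = begin
        (p C p) × (x ^ p * y ^ (p ∸ p))   ≡⟨ ≡.cong₂ (λ a b → a × (x ^ p * y ^ b)) (nCn≡1 p) (ℕ.n∸n≡0 p) ⟩
        x ^ p * 1# + 0#                   ≈⟨ trans (+-identityʳ _) (*-identityʳ _) ⟩
        x ^ p                             ∎
      term : ∀ i → i ℕ.< q → P * (x * x) ∣ G i
      term i i<q with p∣pCk pp (ℕ.z<s {suc i}) (s≤s (s≤s i<q))
      ... | ℕ.divides k e = ι (+ k) * (x ^ i * y ^ (q ∸ i)) , (begin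
        (p C suc (suc i)) × (x ^ suc (suc i) * y ^ (q ∸ i))    ≈⟨ ×≈ι* (p C suc (suc i)) _ ⟩
        ι (+ (p C suc (suc i))) * (x ^ suc (suc i) * y ^ (q ∸ i))
          ≡⟨ ≡.cong (λ z → ι z * (x ^ suc (suc i) * y ^ (q ∸ i))) (≡.trans (≡.cong +_ e) (ℤ.pos-* k p)) ⟩
        ι (+ k ℤ.* + p) * (x ^ suc (suc i) * y ^ (q ∸ i))      ≈⟨ *-congʳ (ι-* (+ k) (+ p)) ⟩
        (ι (+ k) * P) * ((x * (x * x ^ i)) * y ^ (q ∸ i))
          ≈⟨ solve 5 (λ k P x xi y → (k :* P) :* ((x :* (x :* xi)) :* y) := (P :* (x :* x)) :* (k :* (xi :* y))) refl
               (ι (+ k)) P x (x ^ i) (y ^ (q ∸ i)) ⟩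
        (P * (x * x)) * (ι (+ k) * (x ^ i * y ^ (q ∸ i)))      ∎)
      Σ-∣ : ∀ n (H : ℕ → Carrier) → (∀ i → i ℕ.< n → P * (x * x) ∣ H i) → P * (x * x) ∣ Σ< n H
      Σ-∣ zero    H h = ∣0
      Σ-∣ (suc n) H h = ∣-+ (h 0 ℕ.z<s) (Σ-∣ n (λ i → H (suc i)) (λ i i<n → h (suc i) (s≤s i<n)))
      mid : P * (x * x) ∣ Σ< q G
      mid = Σ-∣ q G term
      r = mid .quotient

    ≥2 : ∀ {p} → Prime p → ∃ λ k → p ≡ suc (suc k)
    ≥2 {zero}        pp = ⊥-elim (¬prime[0] pp)
    ≥2 {suc zero}    pp = ⊥-elim (¬prime[1] pp)
    ≥2 {suc (suc k)} pp = k ,, ≡.refl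

    module _ {p} (pp : Prime p) where
      private P = ι (+ p)

      p≢0 : ∃ λ k → p ≡ suc (suc k)
      p≢0 = ≥2 pp

      0^p≈0 : 0# ^ p ≈ 0#
      0^p≈0 with p≢0
      ... | k ,, ≡.refl = zeroˡ _

      frobenius-+ : ∀ x y → (x + y) ^ p ≡[ P ] x ^ p + y ^ p
      frobenius-+ x y with binomial-prime pp x y
      ... | r ,, e = ≡-trans (≡-refl e) (cg (_ , solve 2 (λ a b → (a :+ b) :- a := b) refl (x ^ p + y ^ p) _))

      fermat-nat : ∀ n → nat n ^ p ≡[ P ] nat n
      fermat-nat zero    = ≡-refl 0^p≈0
      fermat-nat (suc n) = ≡-trans (≡-refl (^-congˡ p (nat-suc n))) (≡-trans (frobenius-+ 1# (nat n))
        (≡-trans (≡-+ (≡-refl (1^n≈1 p)) (fermat-nat n)) (≡-refl (sym (nat-suc n)))))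

      frobenius-neg : ∀ x → (- x) ^ p ≡[ P ] - (x ^ p)
      frobenius-neg x = ≡-resp (solve 2 (λ a b → (a :+ b) :- b := a) refl ((- x) ^ p) (x ^ p)) (+-identityˡ _)
        (≡-+ (≡-trans (≡-sym (frobenius-+ (- x) x)) (≡-refl (trans (^-congˡ p (-‿inverseˡ x)) 0^p≈0)))
             (≡-refl {b = - (x ^ p)} refl))

      fermat : ∀ a → ι a ^ p ≡[ P ] ι a
      fermat (+ n)    = fermat-nat n
      fermat -[1+ n ] = ≡-trans (frobenius-neg (nat (suc n))) (≡-neg (fermat-nat (suc n)))

      -- Integer coefficients are fixed by p-th powers modulo `p` (Fermat), so only the argument of
      -- the polynomial is raised.
      frobenius-ev : ∀ x f → ev x f ^ p ≡[ P ] ev (x ^ p) f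
      frobenius-ev x []      = ≡-refl 0^p≈0
      frobenius-ev x (a ∷ f) = ≡-trans (frobenius-+ (ι a) (x * ev x f))
        (≡-+ (fermat a) (≡-trans (≡-refl (^-distrib-* x (ev x f) p)) (≡-* (≡-refl refl) (frobenius-ev x f))))

      frobenius-ev-^ : ∀ j x f → ev x f ^ (p ℕ.^ j) ≡[ P ] ev (x ^ (p ℕ.^ j)) f
      frobenius-ev-^ zero    x f = ≡-refl (trans (*-identityʳ _) (ev-congˡ f (sym (*-identityʳ x))))
      frobenius-ev-^ (suc j) x f = ≡-trans (≡-refl (sym (^-assocʳ (ev x f) p (p ℕ.^ j))))
        (≡-trans (≡-^ (p ℕ.^ j) (frobenius-ev x f))
        (≡-trans (frobenius-ev-^ j (x ^ p) f) (≡-refl (ev-congˡ f (^-assocʳ x p (p ℕ.^ j))))))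

      -- Each p-th power gains a factor π: if u = z + w and π^(k+1) divides z, the mixed binomial
      -- terms carry p z and the remaining term z^p carries z², and both are divisible by π^(k+2).
      ≡-lift : ∀ {π} → π ∣ P → ∀ k {a b} → a ≡[ π ] b → a ^ (p ℕ.^ k) ≡[ π ^ suc k ] b ^ (p ℕ.^ k)
      ≡-lift {π} π∣P zero    {a} {b} h =
        ≡-weaken (1# , trans (sym (*-identityʳ π)) (sym (*-identityʳ _))) (≡-resp (sym (*-identityʳ a)) (sym (*-identityʳ b)) h)
      ≡-lift {π} π∣P (suc k) {a} {b} h = ≡-resp (e a) (e b) (step (≡-lift π∣P k h))
        where
        e : ∀ a → (a ^ (p ℕ.^ k)) ^ p ≈ a ^ (p ℕ.^ suc k)
        e a = trans (^-assocʳ a (p ℕ.^ k) p) (^-congʳ a (ℕ.*-comm (p ℕ.^ k) p))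
        step : ∀ {u w} → u ≡[ π ^ suc k ] w → u ^ p ≡[ π ^ suc (suc k) ] w ^ p
        step {u} {w} (cg (t , e')) with binomial-prime pp (π ^ suc k * t) w | p≢0
        ... | r ,, e″ | q ,, ≡.refl = ≡-trans (≡-refl (trans (^-congˡ p u≈) e″)) (cg
            (∣-resp (solve 3 (λ a b c → a :+ c := (a :+ b) :+ c :- b) refl (z ^ p) (w ^ p) (P * (z * w ^ suc q + z * z * r)))
              (∣-+ z^p∣ (∣-resp (solve 4 (λ P z y r → P :* z :* (y :+ z :* r) := P :* (z :* y :+ z :* z :* r)) refl P z (w ^ suc q) r)
                 (∣-*ʳ (w ^ suc q + z * r) (*-∣ π∣P (t , refl)))))))
          where
          z = π ^ suc k * t
          u≈ : u ≈ z + w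
          u≈ = trans (solve 2 (λ u w → u := (u :- w) :+ w) refl u w) (+-congʳ e')
          z^p∣ : π ^ suc (suc k) ∣ z ^ p
          z^p∣ = ∣-resp (*-assoc z z _) (∣-*ʳ (z ^ q) (*-∣ {π} {z} (π ^ k * t , *-assoc π (π ^ k) t) (t , refl)))

-- Cyclotomic polynomials of square-free order, built prime by prime.

module CyclotomicTower where

  open import Defs
  open RingTools
  open IntegerPolynomials
  open NumberTheory
  open import Data.Nat as ℕ using (ℕ; zero; suc; z≤n; s≤s; _<_; _≤_)
  import Data.Nat.Properties as ℕ
  import Data.Nat.Divisibility as ℕ
  open import Data.Nat.GCD using (module Bézout)
  open import Data.Nat.Coprimality as Cop using (Coprime)
  open import Data.Nat.Primality using (Prime)
  open import Data.Nat.ListAction using (product)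
  open import Data.Integer as ℤ using (ℤ; +_; 0ℤ; 1ℤ)
  import Data.Integer.Properties as ℤ
  open import Data.List using (List; []; _∷_)
  open import Data.List.Relation.Unary.All using (All; []; _∷_)
  open import Data.List.Relation.Unary.AllPairs using ([]; _∷_)
  open import Data.List.Relation.Unary.Unique.Propositional using (Unique)
  open import Data.List.Relation.Unary.Any using (here; there)
  open import Data.List.Membership.Propositional using (_∈_)
  open import Data.Product using (∃; ∃₂; proj₁; proj₂) renaming (_,_ to _,,_)
  open import Relation.Binary.PropositionalEquality as ≡ using (_≡_; refl; sym; trans; cong; cong₂; subst)
  open P.Solver

  record Monic (d : ℕ) (f : Poly) : Set where
    constructor monic
    field
      leading : coeff f d ≡ 1ℤ
      above   : ∀ i → d < i → coeff f i ≡ 0ℤ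
  open Monic

  monic-cong : ∀ {d f g} → f ≐ g → Monic d f → Monic d g
  monic-cong h (monic l a) = monic (trans (sym (at h _)) l) (λ i d<i → trans (sym (at h i)) (a i d<i))

  coeff-mul-suc : ∀ a g f i → coeff (mulP (a ∷ g) f) (suc i) ≡ a ℤ.* coeff f (suc i) ℤ.+ coeff (mulP g f) i
  coeff-mul-suc a g f i = trans (coeff-add (scaleP a f) (0ℤ ∷ mulP g f) (suc i)) (cong (ℤ._+ _) (coeff-scale a f (suc i)))

  coeff-mul-zero : ∀ a g f → coeff (mulP (a ∷ g) f) 0 ≡ a ℤ.* coeff f 0
  coeff-mul-zero a g f = trans (coeff-add (scaleP a f) (0ℤ ∷ mulP g f) 0) (trans (ℤ.+-identityʳ _) (coeff-scale a f 0))

  coeff-tail : ∀ {d f} → Monic d f → ∀ a g i → d ≤ i → coeff (mulP (a ∷ g) f) (suc i) ≡ coeff (mulP g f) i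
  coeff-tail {d} {f} m a g i d≤i = trans (coeff-mul-suc a g f i) (trans
    (cong (λ z → a ℤ.* z ℤ.+ coeff (mulP g f) i) (above m (suc i) (s≤s d≤i)))
    (trans (cong (ℤ._+ coeff (mulP g f) i) (ℤ.*-zeroʳ a)) (ℤ.+-identityˡ _)))

  ∣coeff-mul : ∀ {K} g f → (∀ i → K Z.∣ coeff g i) → ∀ i → K Z.∣ coeff (mulP g f) i
  ∣coeff-mul []      f h i       = Z.∣0
  ∣coeff-mul (a ∷ g) f h zero    = Z.∣-resp (sym (coeff-mul-zero a g f)) (Z.∣-*ʳ (coeff f 0) (h 0))
  ∣coeff-mul (a ∷ g) f h (suc i) = Z.∣-resp (sym (coeff-mul-suc a g f i))
    (Z.∣-+ (Z.∣-*ʳ (coeff f (suc i)) (h 0)) (∣coeff-mul g f (λ i → h (suc i)) i))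

  -- Because `f` is monic, the coefficients of `g` can be read off the product from the top down,
  -- and those of degree at least `d` suffice. K = 0 yields cancellation; a nonzero K yields
  -- divisibility of remainders.
  gauss : ∀ {K d f} → Monic d f → ∀ g → (∀ i → d ≤ i → K Z.∣ coeff (mulP g f) i) → ∀ i → K Z.∣ coeff g i
  gauss m [] h i = Z.∣0
  gauss {K} {d} {f} m (a ∷ g) h = λ { zero → head d m h ; (suc i) → tl i }
    where
    tl : ∀ i → K Z.∣ coeff g i
    tl = gauss m g (λ i d≤i → Z.∣-resp (coeff-tail m a g i d≤i) (h (suc i) (ℕ.m≤n⇒m≤1+n d≤i)))
    head : ∀ d → Monic d f → (∀ i → d ≤ i → K Z.∣ coeff (mulP (a ∷ g) f) i) → K Z.∣ a
    head zero    m h = Z.∣-resp (trans (coeff-mul-zero a g f) (trans (cong (a ℤ.*_) (leading m)) (ℤ.*-identityʳ a))) (h 0 z≤n)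
    head (suc d) m h = Z.∣-resp (lem (trans (coeff-mul-suc a g f d) (cong (λ z → a ℤ.* z ℤ.+ coeff (mulP g f) d) (leading m))))
        (Z.∣-sub (h (suc d) ℕ.≤-refl) (∣coeff-mul g f tl d))
      where
      lem : ∀ {x y} → x ≡ a ℤ.* 1ℤ ℤ.+ y → x ℤ.- y ≡ a
      lem {y = y} refl = Z.Solver.solve 2 (λ a y → (a Z.Solver.:* Z.Solver.con 1ℤ Z.Solver.:+ y) Z.Solver.:- y Z.Solver.:= a) refl a y

  0∣⇒≡0 : ∀ {a} → 0ℤ Z.∣ a → a ≡ 0ℤ
  0∣⇒≡0 (q Z., e) = trans e (ℤ.*-zeroˡ q)

  ≡0⇒∣ : ∀ {K a} → a ≡ 0ℤ → K Z.∣ a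
  ≡0⇒∣ e = Z.∣-resp (sym e) Z.∣0

  monic-≐0 : ∀ {d f} → Monic d f → ∀ g → (∀ i → d ≤ i → coeff (mulP g f) i ≡ 0ℤ) → g ≐ []
  monic-≐0 m g h = mk λ i → 0∣⇒≡0 (gauss m g (λ i d≤i → ≡0⇒∣ (h i d≤i)) i)

  monic-cancel : ∀ {d f} → Monic d f → ∀ {g h} → g P.* f ≐ h P.* f → g ≐ h
  monic-cancel {d} {f} m {g} {h} e = P.x∙y⁻¹≈ε⇒x≈y g h (monic-≐0 m (g P.- h)
    (λ i _ → at (≐-trans (solve 3 (λ g h f → (g :- h) :* f := g :* f :- h :* f) ≐-refl g h f) (P.sub-self e)) i))

  -- Finds the degree and leading coefficient of a cofactor that is known only through its product
  -- with `f`.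
  monic-quotient : ∀ {d f} → Monic d f → ∀ e g → Monic (d ℕ.+ e) (g P.* f) → Monic e g
  monic-quotient {d} {f} m e [] (monic l _) with () ← l
  monic-quotient {d} {f} m zero (a ∷ g) (monic l ab) = monic a≡1 λ { (suc i) _ → at g≐0 i }
    where
    d+0 = ℕ.+-identityʳ d
    g≐0 : g ≐ []
    g≐0 = monic-≐0 m g (λ i d≤i → trans (sym (coeff-tail m a g i d≤i)) (ab (suc i) (ℕ.≤-trans (ℕ.≤-reflexive (cong suc d+0)) (s≤s d≤i))))
    a≡1 : a ≡ 1ℤ
    a≡1 = trans (sym (head d m)) (subst (λ k → coeff (mulP (a ∷ g) f) k ≡ 1ℤ) d+0 l)
      where
      head : ∀ d → Monic d f → coeff (mulP (a ∷ g) f) d ≡ a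
      head zero    m = trans (coeff-mul-zero a g f) (trans (cong (a ℤ.*_) (leading m)) (ℤ.*-identityʳ a))
      head (suc d) m = trans (coeff-mul-suc a g f d) (trans (cong₂ (λ x y → a ℤ.* x ℤ.+ y) (leading m)
        (at (mul-cong {g = f} g≐0 ≐-refl) d)) (trans (ℤ.+-identityʳ _) (ℤ.*-identityʳ a)))
  monic-quotient {d} {f} m (suc e) (a ∷ g) (monic l ab) = monic (leading rec) λ { (suc i) (s≤s e<i) → above rec i e<i }
    where
    d+e = ℕ.+-suc d e
    rec : Monic e g
    rec = monic-quotient m e g (monic
      (trans (sym (coeff-tail m a g (d ℕ.+ e) (ℕ.m≤m+n d e))) (subst (λ k → coeff (mulP (a ∷ g) f) k ≡ 1ℤ) d+e l))
      (λ i d+e<i → trans (sym (coeff-tail m a g i (ℕ.≤-trans (ℕ.m≤m+n d e) (ℕ.<⇒≤ d+e<i))))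
         (ab (suc i) (subst (_< suc i) (sym d+e) (s≤s d+e<i)))))

  infix 9 _⟨_⟩
  _⟨_⟩ : Poly → ℕ → Poly
  f ⟨ s ⟩ = PE.ev (X P.^ s) f

  module Sub s = HomProps (ev-isHom ℤ[x] (X P.^ s))

  ⟨⟩-cong : ∀ s {f g} → f ≐ g → f ⟨ s ⟩ ≐ g ⟨ s ⟩
  ⟨⟩-cong s = Sub.φ-cong s

  X^⟨⟩ : ∀ k s → (X P.^ k) ⟨ s ⟩ ≐ X P.^ (s ℕ.* k)
  X^⟨⟩ k s = ≐-trans (PE.ev-^ (X P.^ s) X k) (≐-trans (P.^-congˡ k (PE.ev-X (X P.^ s))) (P.^-assocʳ X s k))

  ⟨⟩-⟨⟩ : ∀ f s t → f ⟨ s ⟩ ⟨ t ⟩ ≐ f ⟨ t ℕ.* s ⟩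
  ⟨⟩-⟨⟩ f s t = ≐-trans (Sub.φ-ev t (X P.^ s) f) (PE.ev-congˡ f (X^⟨⟩ s t))

  ⟨⟩-comm : ∀ f s t → f ⟨ s ⟩ ⟨ t ⟩ ≐ f ⟨ t ⟩ ⟨ s ⟩
  ⟨⟩-comm f s t = ≐-trans (⟨⟩-⟨⟩ f s t) (≐-trans (≐-reflexive (cong (f ⟨_⟩) (ℕ.*-comm t s))) (≐-sym (⟨⟩-⟨⟩ f t s)))
    where
    ≐-reflexive : ∀ {f g} → f ≡ g → f ≐ g
    ≐-reflexive refl = ≐-refl

  coeff-shift : ∀ s h i → coeff (X P.^ s P.* h) (s ℕ.+ i) ≡ coeff h i
  coeff-shift zero    h i = at (mul-identityˡ h) i
  coeff-shift (suc s) h i = trans (at (≐-trans (mul-assoc X (X P.^ s) h) (≐-sym (shift≐X* (X P.^ s P.* h)))) (suc s ℕ.+ i)) (coeff-shift s h i)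

  coeff-∷⟨⟩ : ∀ a f s i → 0 < s → coeff ((a ∷ f) ⟨ s ⟩) (s ℕ.+ i) ≡ coeff (f ⟨ s ⟩) i
  coeff-∷⟨⟩ a f (suc s) i _ = trans (coeff-add (P.ι a) _ (suc s ℕ.+ i))
    (trans (cong₂ ℤ._+_ (at (ι-const a) (suc s ℕ.+ i)) (coeff-shift (suc s) (f ⟨ suc s ⟩) i)) (ℤ.+-identityˡ _))

  coeff-const⟨⟩ : ∀ a f s i → f ≐ [] → coeff ((a ∷ f) ⟨ s ⟩) i ≡ coeff (constP a) i
  coeff-const⟨⟩ a f s i z = at (≐-trans (⟨⟩-cong s {a ∷ f} {constP a} (∷-cong refl z)) (≐-trans (PE.ev-const (X P.^ s) a) (ι-const a))) i

  monic-⟨⟩ : ∀ {d f} s → 0 < s → Monic d f → Monic (s ℕ.* d) (f ⟨ s ⟩)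
  monic-⟨⟩ {zero} {[]} s 0<s (monic () _)
  monic-⟨⟩ {zero} {a ∷ f} s 0<s (monic l ab) = subst (λ k → Monic k ((a ∷ f) ⟨ s ⟩)) (sym (ℕ.*-zeroʳ s))
    (monic (trans (coeff-const⟨⟩ a f s 0 f≐0) l) λ { (suc i) _ → coeff-const⟨⟩ a f s (suc i) f≐0 })
    where
    f≐0 : f ≐ []
    f≐0 = mk λ i → ab (suc i) (s≤s z≤n)
  monic-⟨⟩ {suc d} {[]} s 0<s (monic () _)
  monic-⟨⟩ {suc d} {a ∷ f} s 0<s (monic l ab) = subst (λ k → Monic k ((a ∷ f) ⟨ s ⟩)) (sym (ℕ.*-suc s d))
    (monic (trans (coeff-∷⟨⟩ a f s (s ℕ.* d) 0<s) (leading rec)) up)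
    where
    rec : Monic (s ℕ.* d) (f ⟨ s ⟩)
    rec = monic-⟨⟩ {f = f} s 0<s (monic l (λ i d<i → ab (suc i) (s≤s d<i)))
    up : ∀ i → s ℕ.+ s ℕ.* d < i → coeff ((a ∷ f) ⟨ s ⟩) i ≡ 0ℤ
    up i h = trans (cong (coeff ((a ∷ f) ⟨ s ⟩)) (sym e)) (trans (coeff-∷⟨⟩ a f s (i ℕ.∸ s) 0<s)
      (above rec (i ℕ.∸ s) (ℕ.+-cancelˡ-< s _ _ (subst (s ℕ.+ s ℕ.* d <_) (sym e) h))))
      where
      e : s ℕ.+ (i ℕ.∸ s) ≡ i
      e = ℕ.m+[n∸m]≡n (ℕ.≤-trans (ℕ.m≤m+n s (s ℕ.* d)) (ℕ.<⇒≤ h))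

  geo : ℕ → Poly → Poly
  geo s y = P.Σ< s (y P.^_)

  geo-⟨⟩ : ∀ s k t → geo s (X P.^ k) ⟨ t ⟩ ≐ geo s (X P.^ (t ℕ.* k))
  geo-⟨⟩ s k t = ≐-trans (Sub.φ-Σ t s ((X P.^ k) P.^_)) (P.Σ<-cong s (λ i _ → ≐-trans (PE.ev-^ (X P.^ t) (X P.^ k) i) (P.^-congˡ i (X^⟨⟩ k t))))

  geo-cong : ∀ s {y z} → y ≐ z → geo s y ≐ geo s z
  geo-cong s h = P.Σ<-cong s (λ i _ → P.^-congˡ i h)

  X-1 : Poly
  X-1 = X P.- P.1#

  monic-X-1 : Monic 1 X-1
  monic-X-1 = monic refl λ { (suc (suc i)) _ → refl ; (suc zero) (s≤s ()) }

  X-1*geo : ∀ s → X-1 P.* geo s X ≐ X P.^ s P.- P.1#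
  X-1*geo = P.geometric X

  -- Multiplied by the monic `X-1`, both sides telescope to X^(s x) - 1.
  geo-* : ∀ s x → geo (s ℕ.* x) X ≐ geo s X P.* geo x (X P.^ s)
  geo-* s x = monic-cancel monic-X-1 (begin
    geo (s ℕ.* x) X P.* X-1                           ≈⟨ mul-comm (geo (s ℕ.* x) X) X-1 ⟩
    X-1 P.* geo (s ℕ.* x) X                           ≈⟨ X-1*geo (s ℕ.* x) ⟩
    X P.^ (s ℕ.* x) P.- P.1#                          ≈⟨ P.+-congʳ (P.^-assocʳ X s x) ⟨
    (X P.^ s) P.^ x P.- P.1#                          ≈⟨ P.geometric (X P.^ s) x ⟨
    (X P.^ s P.- P.1#) P.* geo x (X P.^ s)            ≈⟨ P.*-congʳ (X-1*geo s) ⟨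
    (X-1 P.* geo s X) P.* geo x (X P.^ s)             ≈⟨ solve 3 (λ a b c → (a :* b) :* c := (b :* c) :* a) ≐-refl X-1 (geo s X) (geo x (X P.^ s)) ⟩
    (geo s X P.* geo x (X P.^ s)) P.* X-1             ∎)
    where open import Relation.Binary.Reasoning.Setoid P.setoid

  geo-suc : ∀ k → geo (suc k) X ≐ P.1# P.+ X P.* geo k X
  geo-suc k = P.+-congˡ (≐-sym (P.Σ<-*ˡ k X (X P.^_)))

  -- Bézout identities with coefficients in ℤ[x] survive substitution and passage to divisors, and
  -- they produce exact quotients free of denominators.
  Comaximal : Poly → Poly → Set
  Comaximal f g = ∃₂ λ a b → a P.* f P.+ b P.* g ≐ P.1#

  comaximal-sym : ∀ {f g} → Comaximal f g → Comaximal g f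
  comaximal-sym {f} {g} (a ,, b ,, e) = b ,, a ,, ≐-trans (P.+-comm (b P.* g) (a P.* f)) e

  comaximal-∣ : ∀ {f g f' g'} → f' P.∣ f → g' P.∣ g → Comaximal f g → Comaximal f' g'
  comaximal-∣ {f} {g} {f'} {g'} (q P., e) (r P., e') (a ,, b ,, h) = a P.* q ,, b P.* r ,, ≐-trans
    (≐-trans (solve 6 (λ a q f b r g → (a :* q) :* f :+ (b :* r) :* g := a :* (f :* q) :+ b :* (g :* r)) ≐-refl a q f' b r g')
      (≐-sym (P.+-cong (P.*-congˡ {a} e) (P.*-congˡ {b} e')))) h

  comaximal-⟨⟩ : ∀ {f g} s → Comaximal f g → Comaximal (f ⟨ s ⟩) (g ⟨ s ⟩)
  comaximal-⟨⟩ {f} {g} s (a ,, b ,, h) = a ⟨ s ⟩ ,, b ⟨ s ⟩ ,,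
    ≐-trans (P.+-cong (≐-sym (Sub.φ-* s a f)) (≐-sym (Sub.φ-* s b g)))
    (≐-trans (≐-sym (Sub.φ-+ s (a P.* f) (b P.* g))) (≐-trans (⟨⟩-cong s h) (Sub.φ-1 s)))

  -- The relation 1 + z t = x s gives geo (x s) = 1 + X geo (z t), and these two geometric sums are
  -- multiples of geo s and geo t.
  geo-bézout : ∀ s t x z → 1 ℕ.+ z ℕ.* t ≡ x ℕ.* s → Comaximal (geo s X) (geo t X)
  geo-bézout s t x z eq = geo x (X P.^ s) ,, P.- (X P.* geo z (X P.^ t)) ,, (begin
    geo x (X P.^ s) P.* geo s X P.+ P.- (X P.* geo z (X P.^ t)) P.* geo t X
      ≈⟨ solve 5 (λ a b x c d → a :* b :+ :- (x :* c) :* d := b :* a :- x :* (d :* c)) ≐-refl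
           (geo x (X P.^ s)) (geo s X) X (geo z (X P.^ t)) (geo t X) ⟩
    geo s X P.* geo x (X P.^ s) P.- X P.* (geo t X P.* geo z (X P.^ t))
      ≈⟨ P.+-cong (geo-* s x) (P.-‿cong (P.*-congˡ {X} (geo-* t z))) ⟨
    geo (s ℕ.* x) X P.- X P.* geo (t ℕ.* z) X
      ≡⟨ ≡.cong₂ (λ i j → geo i X P.- X P.* geo j X) (trans (ℕ.*-comm s x) (sym eq)) (ℕ.*-comm t z) ⟩
    geo (suc (z ℕ.* t)) X P.- X P.* geo (z ℕ.* t) X
      ≈⟨ P.+-congʳ (geo-suc (z ℕ.* t)) ⟩
    (P.1# P.+ X P.* geo (z ℕ.* t) X) P.- X P.* geo (z ℕ.* t) X
      ≈⟨ solve 1 (λ a → (con (+ 1) :+ a) :- a := con (+ 1)) ≐-refl (X P.* geo (z ℕ.* t) X) ⟩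
    P.1#  ∎)
    where open import Relation.Binary.Reasoning.Setoid P.setoid

  geo-comaximal : ∀ {s t} → Coprime s t → Comaximal (geo s X) (geo t X)
  geo-comaximal {s} {t} h with Cop.coprime-Bézout h
  ... | Bézout.+- x z eq = geo-bézout s t x z eq
  ... | Bézout.-+ x z eq = comaximal-sym (geo-bézout t s z x eq)

  -- Numerator and denominator of Φ for a square-free order, kept apart along Φ_qn(x) = Φ_n(x^q) /
  -- Φ_n(x): the division makes the old denominator a factor of the new numerator, and conversely.
  num den : List ℕ → Poly
  num []       = X-1
  num (q ∷ ps) = num ps ⟨ q ⟩ P.* den ps
  den []       = P.1#
  den (q ∷ ps) = den ps ⟨ q ⟩ P.* num ps

  -- F is the product of the y - ω over the primitive roots of unity ω of order Π ps, built
  -- one prime at a time through F_{q ps}(y) = F_ps(y^q) / F_ps(y).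

  record Tower (ps : List ℕ) : Set where
    field
      F          : Poly
      degree     : ℕ
      degree>0   : 0 < degree
      F-monic    : Monic degree F
      c          : ∀ s → 0 < s → Coprime s (product ps) → Poly
      F⟨⟩        : ∀ s (0<s : 0 < s) (h : Coprime s (product ps)) → F ⟨ s ⟩ ≐ F P.* c s 0<s h
      c∣geo      : ∀ s (0<s : 0 < s) (h : Coprime s (product ps)) → c s 0<s h P.∣ geo s (X P.^ product ps)
      comaximal  : ∀ s (0<s : 0 < s) (h : Coprime s (product ps)) t (0<t : 0 < t) (k : Coprime t (product ps)) → Coprime s t → Comaximal (c s 0<s h) (c t 0<t k)
      F∣geo      : ∀ p → 0 < p → p ∈ ps → ∀ k → k ℕ.* p ≡ product ps → F P.∣ geo p (X P.^ k)
      F∣X^-1     : F P.∣ X P.^ product ps P.- P.1#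
      num≐F*den  : num ps ≐ F P.* den ps

  tower[] : Tower []
  tower[] = record
    { F = X-1 ; degree = 1 ; degree>0 = s≤s z≤n ; F-monic = monic-X-1
    ; c = λ s _ _ → geo s X
    ; F⟨⟩ = λ s _ _ → ≐-trans (Sub.φ-sub s X P.1#) (≐-trans (P.+-cong (PE.ev-X (X P.^ s)) (P.-‿cong (Sub.φ-1 s))) (≐-sym (X-1*geo s)))
    ; c∣geo = λ s _ _ → P.1# P., ≐-trans (geo-cong s (P.*-identityʳ X)) (≐-sym (P.*-identityʳ (geo s X)))
    ; comaximal = λ s _ _ t _ _ h → geo-comaximal h
    ; F∣geo = λ p _ ()
    ; F∣X^-1 = P.∣-resp (P.+-congʳ {x = P.- P.1#} (≐-sym (P.*-identityʳ X))) P.∣-refl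
    ; num≐F*den = ≐-sym (P.*-identityʳ X-1)
    }

  -- The new F is the cofactor `c q` of the smaller tower. Its own cofactor for `s` has to be
  -- cs(y^q) / cs(y); that this quotient lies in ℤ[x] follows from the comaximality of `c s` and
  -- `c q`, which is why the tower carries comaximality as an invariant.
  module Step {ps} (T : Tower ps) {q} (0<q : 0 < q) (1<q : 1 < q) (hq : Coprime q (product ps)) where
    open Tower T
    open import Relation.Binary.Reasoning.Setoid P.setoid

    F' : Poly
    F' = c q 0<q hq

    module C s (0<s : 0 < s) (h : Coprime s (q ℕ.* product ps)) where
      hs : Coprime s (product ps)
      hs = coprime-∣ʳ (ℕ.n∣m*n q) h
      hsq : Coprime s q
      hsq = coprime-∣ʳ (ℕ.m∣m*n (product ps)) h
      cs : Poly
      cs = c s 0<s hs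
      bz : Comaximal cs F'
      bz = comaximal s 0<s hs q 0<q hq hsq
      a b c' : Poly
      a = proj₁ bz
      b = proj₁ (proj₂ bz)
      -- With a cs + b F' = 1 and cs F'(y^s) = F' cs(y^q), this combination equals both quotients
      -- cs(y^q) / cs(y) and F'(y^s) / F'(y).
      c' = a P.* cs ⟨ q ⟩ P.+ b P.* F' ⟨ s ⟩

      -- Both sides are F(y^(q s)), reached by the two orders of substitution.
      eq1 : F P.* (cs P.* F' ⟨ s ⟩) ≐ F P.* (F' P.* cs ⟨ q ⟩)
      eq1 = begin
        F P.* (cs P.* F' ⟨ s ⟩)      ≈⟨ P.*-assoc F cs (F' ⟨ s ⟩) ⟨
        (F P.* cs) P.* F' ⟨ s ⟩      ≈⟨ P.*-congʳ (F⟨⟩ s 0<s hs) ⟨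
        F ⟨ s ⟩ P.* F' ⟨ s ⟩         ≈⟨ Sub.φ-* s F F' ⟨
        (F P.* F') ⟨ s ⟩             ≈⟨ ⟨⟩-cong s (F⟨⟩ q 0<q hq) ⟨
        F ⟨ q ⟩ ⟨ s ⟩                ≈⟨ ⟨⟩-comm F q s ⟩
        F ⟨ s ⟩ ⟨ q ⟩                ≈⟨ ⟨⟩-cong q (F⟨⟩ s 0<s hs) ⟩
        (F P.* cs) ⟨ q ⟩             ≈⟨ Sub.φ-* q F cs ⟩
        F ⟨ q ⟩ P.* cs ⟨ q ⟩         ≈⟨ P.*-congʳ (F⟨⟩ q 0<q hq) ⟩
        (F P.* F') P.* cs ⟨ q ⟩      ≈⟨ P.*-assoc F F' (cs ⟨ q ⟩) ⟩
        F P.* (F' P.* cs ⟨ q ⟩)      ∎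

      eq2 : cs P.* F' ⟨ s ⟩ ≐ F' P.* cs ⟨ q ⟩
      eq2 = monic-cancel F-monic (≐-trans (P.*-comm _ F) (≐-trans eq1 (P.*-comm F _)))

      cs*c' : cs P.* c' ≐ cs ⟨ q ⟩
      cs*c' = begin
        cs P.* (a P.* cs ⟨ q ⟩ P.+ b P.* F' ⟨ s ⟩)
          ≈⟨ solve 5 (λ c a x b y → c :* (a :* x :+ b :* y) := (a :* c) :* x :+ b :* (c :* y)) ≐-refl cs a (cs ⟨ q ⟩) b (F' ⟨ s ⟩) ⟩
        (a P.* cs) P.* cs ⟨ q ⟩ P.+ b P.* (cs P.* F' ⟨ s ⟩)     ≈⟨ P.+-congˡ (P.*-congˡ {b} eq2) ⟩
        (a P.* cs) P.* cs ⟨ q ⟩ P.+ b P.* (F' P.* cs ⟨ q ⟩)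
          ≈⟨ solve 4 (λ d x b f → d :* x :+ b :* (f :* x) := (d :+ b :* f) :* x) ≐-refl (a P.* cs) (cs ⟨ q ⟩) b F' ⟩
        (a P.* cs P.+ b P.* F') P.* cs ⟨ q ⟩                     ≈⟨ P.*-congʳ (proj₂ (proj₂ bz)) ⟩
        P.1# P.* cs ⟨ q ⟩                                        ≈⟨ P.*-identityˡ _ ⟩
        cs ⟨ q ⟩                                                 ∎

      c'∣ : c' P.∣ cs ⟨ q ⟩
      c'∣ = cs P., ≐-trans (≐-sym cs*c') (P.*-comm cs c')

      F'⟨s⟩ : F' ⟨ s ⟩ ≐ F' P.* c'
      F'⟨s⟩ = monic-cancel {f = F ⟨ s ⟩} (monic-⟨⟩ s 0<s F-monic) (begin
        F' ⟨ s ⟩ P.* F ⟨ s ⟩                  ≈⟨ P.*-congˡ {F' ⟨ s ⟩} (F⟨⟩ s 0<s hs) ⟩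
        F' ⟨ s ⟩ P.* (F P.* cs)               ≈⟨ solve 3 (λ x f c → x :* (f :* c) := (c :* x) :* f) ≐-refl (F' ⟨ s ⟩) F cs ⟩
        (cs P.* F' ⟨ s ⟩) P.* F               ≈⟨ P.*-congʳ eq2 ⟩
        (F' P.* cs ⟨ q ⟩) P.* F               ≈⟨ P.*-congʳ (P.*-congˡ {F'} cs*c') ⟨
        (F' P.* (cs P.* c')) P.* F            ≈⟨ solve 4 (λ x c d f → (x :* (c :* d)) :* f := (x :* d) :* (f :* c)) ≐-refl F' cs c' F ⟩
        (F' P.* c') P.* (F P.* cs)            ≈⟨ P.*-congˡ {F' P.* c'} (F⟨⟩ s 0<s hs) ⟨
        (F' P.* c') P.* F ⟨ s ⟩               ∎)

      c'∣geo : c' P.∣ geo s (X P.^ (q ℕ.* product ps))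
      c'∣geo = P.∣-trans c'∣ (P.∣-resp (geo-⟨⟩ s (product ps) q) (Sub.φ-∣ q (c∣geo s 0<s hs)))

    q-1 : ∃ λ r → q ≡ suc (suc r)
    q-1 = pred₂ 1<q
      where
      pred₂ : ∀ {q} → 1 < q → ∃ λ r → q ≡ suc (suc r)
      pred₂ (s≤s (s≤s {n = r} _)) = r ,, refl

    -- The old degree times q - 1, with q - 1 written as a successor so that positivity is visible.
    deg' : ℕ
    deg' = suc (proj₁ q-1) ℕ.* degree

    F'-monic : Monic deg' F'
    F'-monic = monic-quotient F-monic deg' F' (monic-cong (≐-trans (F⟨⟩ q 0<q hq) (P.*-comm F F'))
      (subst (λ k → Monic k (F ⟨ q ⟩)) (cong (ℕ._* degree) (proj₂ q-1)) (monic-⟨⟩ q 0<q F-monic)))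

    step : Tower (q ∷ ps)
    step = record
      { F = F' ; degree = deg'
      ; degree>0 = ℕ.≤-trans degree>0 (ℕ.m≤m+n degree _)
      ; F-monic = F'-monic
      ; c = C.c' ; F⟨⟩ = C.F'⟨s⟩ ; c∣geo = C.c'∣geo
      ; comaximal = λ s 0<s h t 0<t k st → comaximal-∣ (C.c'∣ s 0<s h) (C.c'∣ t 0<t k)
          (comaximal-⟨⟩ q (comaximal s 0<s (C.hs s 0<s h) t 0<t (C.hs t 0<t k) st))
      ; F∣geo = fg
      ; F∣X^-1 = P.∣-trans (F P., ≐-trans (F⟨⟩ q 0<q hq) (P.*-comm F F'))
          (P.∣-resp (≐-trans (Sub.φ-sub q (X P.^ product ps) P.1#)
              (P.+-cong (X^⟨⟩ (product ps) q) (P.-‿cong {P.1# ⟨ q ⟩} (Sub.φ-1 q)))) (Sub.φ-∣ q F∣X^-1))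
      ; num≐F*den = begin
          num ps ⟨ q ⟩ P.* den ps                               ≈⟨ P.*-congʳ (⟨⟩-cong q num≐F*den) ⟩
          (F P.* den ps) ⟨ q ⟩ P.* den ps                       ≈⟨ P.*-congʳ (Sub.φ-* q F (den ps)) ⟩
          (F ⟨ q ⟩ P.* den ps ⟨ q ⟩) P.* den ps                 ≈⟨ P.*-congʳ (P.*-congʳ (F⟨⟩ q 0<q hq)) ⟩
          ((F P.* F') P.* den ps ⟨ q ⟩) P.* den ps
            ≈⟨ solve 4 (λ f g x d → ((f :* g) :* x) :* d := g :* (x :* (f :* d))) ≐-refl F F' (den ps ⟨ q ⟩) (den ps) ⟩
          F' P.* (den ps ⟨ q ⟩ P.* (F P.* den ps))              ≈⟨ P.*-congˡ {F'} (P.*-congˡ {den ps ⟨ q ⟩} num≐F*den) ⟨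
          F' P.* (den ps ⟨ q ⟩ P.* num ps)                      ∎
      }
      where
      instance _ = ℕ.>-nonZero 0<q
      fg : ∀ p → 0 < p → p ∈ q ∷ ps → ∀ k → k ℕ.* p ≡ q ℕ.* product ps → F' P.∣ geo p (X P.^ k)
      fg p _ (here refl) k e = subst (λ z → F' P.∣ geo q (X P.^ z))
        (sym (ℕ.*-cancelʳ-≡ k (product ps) q (trans e (ℕ.*-comm q (product ps))))) (c∣geo q 0<q hq)
      fg p 0<p (there p∈ps) k e with product-∣ p∈ps
      ... | ℕ.divides j e' = P.∣-trans (F P., ≐-trans (F⟨⟩ q 0<q hq) (P.*-comm F F'))
              (P.∣-resp (≐-trans (geo-⟨⟩ p j q) (geo-cong p (P.^-congʳ X kj))) (Sub.φ-∣ q (F∣geo p 0<p p∈ps j (sym e'))))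
        where
        kj : q ℕ.* j ≡ k
        kj = ℕ.*-cancelʳ-≡ (q ℕ.* j) k p {{ℕ.>-nonZero 0<p}} (trans (ℕ.*-assoc q j p) (trans (cong (q ℕ.*_) (sym e')) (sym e)))

  tower : ∀ ps → All Prime ps → Unique ps → Tower ps
  tower []       _ _ = tower[]
  tower (q ∷ ps) (pq ∷ pps) (q∉ ∷ u) = Step.step (tower ps pps u) (prime>0 pq) (prime>1 pq) (coprime-product ps pq pps q∉)

-- Sums with side conditions on the index, and their rearrangements.

module IndexedSums where

  open RingTools
  open NumberTheory
  open import Algebra.Bundles using (CommutativeRing)
  open import Data.Bool using (if_then_else_)
  open import Data.Nat as ℕ using (ℕ; zero; suc; s≤s; _<_; _≤_; _∸_)
  import Data.Nat.Properties as ℕ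
  import Data.Nat.Divisibility as ℕ
  open import Data.Nat.DivMod using (_%_; m%n<n)
  open import Data.Nat.Coprimality using (Coprime)
  open import Data.Integer using (+_)
  open import Data.Fin as Fin using (Fin; toℕ; fromℕ<)
  import Data.Fin.Properties as Fin
  open import Data.Fin.Permutation using (permutation)
  open import Data.Product using (proj₁; proj₂)
  open import Data.Empty using (⊥-elim)
  open import Function using (_∘_)
  open import Relation.Nullary
  open import Relation.Binary.PropositionalEquality as ≡ using (_≡_)

  module RingSums {c ℓ} (R : CommutativeRing c ℓ) where
    open Ring R
    open import Relation.Binary.Reasoning.Setoid setoid

    -- An Iverson bracket: a sum over some of the residues remains a sum over the full range, where
    -- it can be split, permuted and interchanged.
    when : ∀ {a} {A : Set a} → Dec A → Carrier → Carrier
    when d x = if does d then x else 0#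

    when-yes : ∀ {a} {A : Set a} (d : Dec A) {x} → A → when d x ≈ x
    when-yes (yes _) _ = refl
    when-yes (no ¬a) a = ⊥-elim (¬a a)

    when-no : ∀ {a} {A : Set a} (d : Dec A) {x} → ¬ A → when d x ≈ 0#
    when-no (yes a) ¬a = ⊥-elim (¬a a)
    when-no (no _)  _  = refl

    when-cong : ∀ {a} {A : Set a} (d : Dec A) {x y} → (A → x ≈ y) → when d x ≈ when d y
    when-cong (yes a) h = h a
    when-cong (no _)  h = refl

    when-⇔ : ∀ {a b} {A : Set a} {B : Set b} (d : Dec A) (e : Dec B) {x} → (A → B) → (B → A) → when d x ≈ when e x
    when-⇔ (yes a) e f g = sym (when-yes e (f a))
    when-⇔ (no ¬a) e f g = sym (when-no e (¬a ∘ g))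

    when-* : ∀ {a} {A : Set a} (d : Dec A) {x y} → x * when d y ≈ when d (x * y)
    when-* (yes _) = refl
    when-* (no _)  = zeroʳ _

    when-0 : ∀ {a} {A : Set a} (d : Dec A) {x} → x ≈ 0# → when d x ≈ 0#
    when-0 (yes _) h = h
    when-0 (no _)  h = refl

    when-*ʳ : ∀ {a} {A : Set a} (d : Dec A) {x y} → when d y * x ≈ when d (y * x)
    when-*ʳ (yes _) = refl
    when-*ʳ (no _)  = zeroˡ _

    when-+ : ∀ {a} {A : Set a} (d : Dec A) {x y z} → (A → x ≈ y + z) → when d x ≈ when d y + when d z
    when-+ (yes a) h = h a
    when-+ (no _)  h = sym (+-identityˡ 0#)

    when-*-when : ∀ {a} {A : Set a} (d : Dec A) {x y z} → (A → x * y ≈ z) → when d x * when d y ≈ when d z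
    when-*-when (yes a) h = h a
    when-*-when (no _)  h = zeroˡ 0#

    -- In each block of `p` consecutive indices exactly the first is a multiple of `p`. This is
    -- inclusion-exclusion for a single prime, used for the Möbius function and for sums over
    -- reduced residues.
    Σ<-multiples : ∀ p → 0 < p → ∀ M F →
      Σ< (M ℕ.* p) F ≈ Σ< (M ℕ.* p) (λ d → when (¬? (p ℕ.∣? d)) (F d)) + Σ< M (λ d → F (d ℕ.* p))
    Σ<-multiples p       0<p zero    F = sym (+-identityʳ 0#)
    Σ<-multiples (suc p) 0<p (suc M) F = begin
      Σ< (q ℕ.+ M ℕ.* q) F                                                  ≈⟨ Σ<-split q (M ℕ.* q) F ⟩
      Σ< q F + Σ< (M ℕ.* q) (λ i → F (q ℕ.+ i))                             ≈⟨ +-cong block (Σ<-multiples q 0<p M (λ i → F (q ℕ.+ i))) ⟩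
      (Σ< q G + F 0) + (Σ< (M ℕ.* q) (λ i → when (¬? (q ℕ.∣? i)) (F (q ℕ.+ i))) + Σ< M (λ d → F (q ℕ.+ d ℕ.* q)))
        ≈⟨ +-congˡ (+-congʳ (Σ<-cong (M ℕ.* q) (λ i _ → when-⇔ (¬? (q ℕ.∣? i)) (¬? (q ℕ.∣? (q ℕ.+ i))) {F (q ℕ.+ i)}
              (λ n h → n (ℕ.∣m+n∣m⇒∣n h ℕ.∣-refl)) (λ n h → n (ℕ.∣m∣n⇒∣m+n ℕ.∣-refl h))))) ⟩
      (Σ< q G + F 0) + (Σ< (M ℕ.* q) (λ i → G (q ℕ.+ i)) + Σ< M (λ d → F (q ℕ.+ d ℕ.* q)))
        ≈⟨ solve 4 (λ a b c d → (a :+ b) :+ (c :+ d) := (a :+ c) :+ (b :+ d)) refl _ _ _ _ ⟩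
      (Σ< q G + Σ< (M ℕ.* q) (λ i → G (q ℕ.+ i))) + (F 0 + Σ< M (λ d → F (q ℕ.+ d ℕ.* q)))
        ≈⟨ +-congʳ (Σ<-split q (M ℕ.* q) G) ⟨
      Σ< (q ℕ.+ M ℕ.* q) G + Σ< (suc M) (λ d → F (d ℕ.* q))                  ∎
      where
      open Solver
      q = suc p
      G : ℕ → Carrier
      G d = when (¬? (q ℕ.∣? d)) (F d)
      block : Σ< q F ≈ Σ< q G + F 0
      block = begin
        F 0 + Σ< p (λ i → F (suc i))            ≈⟨ +-comm _ _ ⟩
        Σ< p (λ i → F (suc i)) + F 0
          ≈⟨ +-congʳ (Σ<-cong p {λ i → F (suc i)} (λ i i<p → sym (when-yes (¬? (q ℕ.∣? suc i)) (λ h → ℕ.<⇒≱ (s≤s i<p) (ℕ.∣⇒≤ h))))) ⟩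
        Σ< p (λ i → G (suc i)) + F 0            ≈⟨ +-congʳ (+-identityˡ _) ⟨
        (0# + Σ< p (λ i → G (suc i))) + F 0
          ≈⟨ +-congʳ (+-congʳ (when-no (¬? (q ℕ.∣? 0)) {F 0} (λ n → n (q ℕ.∣0)))) ⟨
        Σ< q G + F 0                            ∎

    Σ<-truncate : ∀ n k F → n ≤ k → (∀ i → n ≤ i → F i ≈ 0#) → Σ< k F ≈ Σ< n F
    Σ<-truncate n k F n≤k h = begin
      Σ< k F                                     ≡⟨ ≡.cong (λ j → Σ< j F) (≡.sym (ℕ.m+[n∸m]≡n n≤k)) ⟩
      Σ< (n ℕ.+ (k ∸ n)) F                       ≈⟨ Σ<-split n (k ∸ n) F ⟩
      Σ< n F + Σ< (k ∸ n) (λ i → F (n ℕ.+ i))    ≈⟨ +-congˡ (Σ<-0 (k ∸ n) (λ i _ → h (n ℕ.+ i) (ℕ.m≤m+n n i))) ⟩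
      Σ< n F + 0#                                ≈⟨ +-identityʳ _ ⟩
      Σ< n F                                     ∎

    -- Multiplication by `s` permutes the residues modulo `m`; a modular inverse undoes it.
    Σ<-reindex : ∀ m s F → 0 < m → Coprime s m → (∀ {i j} → i ≡ j mod m → F i ≈ F j) →
                 Σ< m (λ i → F (s ℕ.* i)) ≈ Σ< m F
    Σ<-reindex m s F 0<m cop per = begin
      Σ< m (λ i → F (s ℕ.* i))      ≈⟨ Σ<-cong m (λ i _ → sym (per (mod-% (s ℕ.* i) m))) ⟩
      Σ< m (λ i → F (s ℕ.* i % m))
        ≈⟨ sum-cong-≋ {m} (λ i → reflexive (≡.cong F (Fin.toℕ-fromℕ< (m%n<n (s ℕ.* toℕ i) m)))) ⟨
      sum {m} (λ i → F (toℕ (mul s i)))   ≈⟨ sum-permute {m} {m} (λ i → F (toℕ i)) (permutation (mul s) (mul s') inv₁ inv₂) ⟨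
      Σ< m F                        ∎
      where
      instance _ = ℕ.>-nonZero 0<m
      s' : ℕ
      s' = proj₁ (mod-inverse 0<m cop)
      mul : ℕ → Fin m → Fin m
      mul s i = fromℕ< (m%n<n (s ℕ.* toℕ i) m)
      toℕ-mul : ∀ s i → toℕ (mul s i) ≡ s ℕ.* toℕ i mod m
      toℕ-mul s i = ≡.subst (λ k → k ≡ s ℕ.* toℕ i mod m) (≡.sym (Fin.toℕ-fromℕ< _)) (mod-% (s ℕ.* toℕ i) m)
      mul-mul : ∀ s t → t ℕ.* s ≡ 1 mod m → ∀ i → mul t (mul s i) ≡ i
      mul-mul s t h i = Fin.toℕ-injective (mod-<⇒≡ (Fin.toℕ<n _) (Fin.toℕ<n i)
        (Z.≡-trans (toℕ-mul t (mul s i)) (Z.≡-trans (mod-* {t} (mod-refl ≡.refl) (toℕ-mul s i))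
        (Z.≡-trans (mod-refl (≡.sym (ℕ.*-assoc t s (toℕ i))))
        (Z.≡-trans (mod-* {c = toℕ i} h (mod-refl ≡.refl)) (mod-refl (ℕ.*-identityˡ (toℕ i))))))))
      ts : s' ℕ.* s ≡ 1 mod m
      ts = proj₂ (mod-inverse 0<m cop)
      inv₁ : ∀ i → mul s (mul s' i) ≡ i
      inv₁ = mul-mul s' s (≡.subst (λ k → k ≡ 1 mod m) (ℕ.*-comm s' s) ts)
      inv₂ : ∀ i → mul s' (mul s i) ≡ i
      inv₂ = mul-mul s s' ts

-- The Möbius function and the factorised form of `cycloNum` and `cycloDen`.

module MöbiusPairs where

  open import Defs
  open RingTools
  open IntegerPolynomials
  open NumberTheory
  open IndexedSums
  open CyclotomicTower
  open import Data.Bool using (Bool; true; false; not)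
  open import Data.Nat as ℕ using (ℕ; zero; suc; z≤n; s≤s; _<_; _≤_; _*_)
  import Data.Nat.Properties as ℕ
  open import Data.Nat.Divisibility as ℕ using (_∣_; _∣?_)
  open import Data.Nat.Primality using (Prime)
  open import Data.Nat.Coprimality using (Coprime; coprime-divisor) renaming (sym to coprime-sym)
  open import Data.Nat.Induction using (<-rec)
  open import Data.Nat.ListAction using (product)
  open import Data.Integer as ℤ using (ℤ; +_; 0ℤ; 1ℤ; -1ℤ)
  import Data.Integer.Properties as ℤ
  open import Data.List using (List; []; _∷_; map; filter; applyUpTo; concatMap; _++_)
  open import Data.List.Relation.Unary.All as All using (All; []; _∷_)
  open import Data.List.Relation.Unary.Any using (here; there)
  open import Data.List.Relation.Unary.AllPairs as AllPairs using (AllPairs; []; _∷_)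
  import Data.List.Relation.Unary.AllPairs.Properties as AllPairs
  import Data.List.Relation.Unary.All.Properties as All
  open import Data.List.Relation.Unary.Unique.Propositional using (Unique)
  import Data.List.Relation.Unary.Unique.Propositional.Properties as Unique
  open import Data.List.Membership.Propositional using (_∈_)
  open import Data.List.Membership.Propositional.Properties
  open import Data.List.Membership.Propositional.Properties.WithK using (unique∧set⇒bag)
  open import Data.List.Relation.Binary.BagAndSetEquality using (∼bag⇒↭)
  open import Data.List.Relation.Binary.Permutation.Propositional as Perm using (_↭_)
  open import Data.Product using (∃; _×_; _,_; proj₁; proj₂)
  open import Data.Product.Properties using (,-injective)
  open import Data.Sum using (_⊎_; inj₁; inj₂)
  open import Data.Empty using (⊥; ⊥-elim)
  open import Function.Bundles using (mk⇔)
  open import Relation.Nullary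
  open import Relation.Binary.PropositionalEquality

  module ZS = RingSums ℤ.+-*-commutativeRing
  open ZS using (when; when-yes; when-no)

  -- The fuelled auxiliary function behind `möbius` is private; the meta variable
  -- is solved by the recursion equation `möbius-rec`.

  mutual
    private
      μ-fuel : ℕ → ℕ → ℤ
      μ-fuel = _

    möbius-rec : ∀ k → möbius (suc (suc k)) ≡
      ℤ.- sumℤ (map (μ-fuel k) (filter (λ d → d ∣? suc (suc k)) (applyUpTo suc (suc k))))
    möbius-rec k = refl

  sum-map-filter : ∀ n (f g : ℕ → ℤ) xs → (∀ {x} → x ∈ xs → f x ≡ g x) →
    sumℤ (map f (filter (λ d → d ∣? n) xs)) ≡ sumℤ (map g (filter (λ d → d ∣? n) xs))
  sum-map-filter n f g []       h = refl
  sum-map-filter n f g (x ∷ xs) h with x ∣? n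
  ... | yes _ = cong₂ ℤ._+_ (h (here refl)) (sum-map-filter n f g xs (λ i → h (there i)))
  ... | no  _ = sum-map-filter n f g xs (λ i → h (there i))

  private
    -- Once the fuel exceeds the argument its amount no longer matters, because the recursion
    -- descends to proper divisors.
    μ-fuel≡möbius : ∀ d k → 0 < d → d ≤ suc k → μ-fuel k d ≡ möbius d
    μ-fuel≡möbius = <-rec _ go
      where
      go : ∀ d → (∀ {e} → e < d → ∀ k → 0 < e → e ≤ suc k → μ-fuel k e ≡ möbius e) →
           ∀ k → 0 < d → d ≤ suc k → μ-fuel k d ≡ möbius d
      go (suc zero)    rec k       _ _ = refl
      go (suc (suc j)) rec zero    _ (s≤s ())
      go (suc (suc j)) rec (suc k) _ (s≤s j<k) = cong ℤ.-_
        (sum-map-filter (suc (suc j)) (μ-fuel k) (μ-fuel j) (applyUpTo suc (suc j)) eq)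
        where
        eq : ∀ {x} → x ∈ applyUpTo suc (suc j) → μ-fuel k x ≡ μ-fuel j x
        eq x∈ with ∈-applyUpTo⁻ suc x∈
        ... | i , i<sj , refl = trans (rec (s≤s i<sj) k (s≤s z≤n) (ℕ.≤-trans i<sj j<k))
                                      (sym (rec (s≤s i<sj) j (s≤s z≤n) i<sj))

  sum-divisors : ∀ n (f : ℕ → ℤ) k (s : ℕ → ℕ) →
    sumℤ (map f (filter (λ d → d ∣? n) (applyUpTo s k))) ≡ Z.Σ< k (λ i → when (s i ∣? n) (f (s i)))
  sum-divisors n f zero    s = refl
  sum-divisors n f (suc k) s with s 0 ∣? n
  ... | yes _ = cong (ℤ._+_ (f (s 0))) (sum-divisors n f k (λ i → s (suc i)))
  ... | no  _ = trans (sum-divisors n f k (λ i → s (suc i))) (sym (ℤ.+-identityˡ _))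

  möbius-sum : ∀ n → 1 < n → möbius n ≡ ℤ.- Z.Σ< n (λ d → when (d ∣? n) (möbius d))
  möbius-sum (suc zero) (s≤s ())
  möbius-sum (suc (suc k)) _ = trans (möbius-rec k) (cong ℤ.-_ (begin
    sumℤ (map (μ-fuel k) ds)                                      ≡⟨ sum-map-filter n (μ-fuel k) möbius (applyUpTo suc (suc k)) eq ⟩
    sumℤ (map möbius ds)                                          ≡⟨ sum-divisors n möbius (suc k) suc ⟩
    Z.Σ< (suc k) (λ i → when (suc i ∣? n) (möbius (suc i)))       ≡⟨ ℤ.+-identityˡ _ ⟨
    0ℤ ℤ.+ Z.Σ< (suc k) (λ i → when (suc i ∣? n) (möbius (suc i)))
      ≡⟨ cong (ℤ._+ Z.Σ< (suc k) (λ i → when (suc i ∣? n) (möbius (suc i)))) (sym (when-no (0 ∣? n) {möbius 0} (λ h → case (ℕ.0∣⇒≡0 h) of λ ()))) ⟩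
    Z.Σ< n (λ d → when (d ∣? n) (möbius d))                       ∎))
    where
    open ≡-Reasoning
    open import Function using (case_of_)
    n = suc (suc k)
    ds = filter (λ d → d ∣? n) (applyUpTo suc (suc k))
    eq : ∀ {x} → x ∈ applyUpTo suc (suc k) → μ-fuel k x ≡ möbius x
    eq x∈ with ∈-applyUpTo⁻ suc x∈
    ... | i , i<sk , refl = μ-fuel≡möbius (suc i) k (s≤s z≤n) i<sk

  -- In the sum over proper divisors of n p, those prime to p are divisors of n; the others are d p
  -- with d a proper divisor of n, where induction gives the negative of the term at d. Everything
  -- cancels except the term at n.
  möbius-prime-* : ∀ p → Prime p → ∀ n → 0 < n → möbius (n * p) ≡ ℤ.- when (¬? (p ∣? n)) (möbius n)
  möbius-prime-* p pp = <-rec _ go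
    where
    Goal : ℕ → Set
    Goal n = 0 < n → möbius (n * p) ≡ ℤ.- when (¬? (p ∣? n)) (möbius n)
    go : ∀ n → (∀ {k} → k < n → Goal k) → Goal n
    go n rec 0<n = trans (möbius-sum N 1<N) (cong ℤ.-_ (begin
      Z.Σ< N H                                                       ≡⟨ ZS.Σ<-multiples p (prime>0 pp) n H ⟩
      Z.Σ< N (λ d → when (¬? (p ∣? d)) (H d)) ℤ.+ Z.Σ< n (λ d → H (d * p))
        ≡⟨ cong₂ ℤ._+_ part₁ part₂ ⟩
      (Z.Σ< n G ℤ.+ G n) ℤ.+ ℤ.- Z.Σ< n G                            ≡⟨ lem (Z.Σ< n G) (G n) ⟩
      G n
        ≡⟨ ZS.when-cong (¬? (p ∣? n)) (λ _ → when-yes (n ∣? n) ℕ.∣-refl) ⟩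
      when (¬? (p ∣? n)) (möbius n)                                  ∎))
      where
      open ≡-Reasoning
      N = n * p
      1<N : 1 < N
      1<N = ℕ.<-≤-trans (prime>1 pp) (ℕ.m≤n*m p n {{ℕ.>-nonZero 0<n}})
      H G : ℕ → ℤ
      H d = when (d ∣? N) (möbius d)
      G d = when (¬? (p ∣? d)) (when (d ∣? n) (möbius d))
      lem : ∀ x y → (x ℤ.+ y) ℤ.+ ℤ.- x ≡ y
      lem = solve 2 (λ x y → (x :+ y) :- x := y) refl
            where
              open Z.Solver
      part₁ : Z.Σ< N (λ d → when (¬? (p ∣? d)) (H d)) ≡ Z.Σ< n G ℤ.+ G n
      part₁ = begin
        Z.Σ< N (λ d → when (¬? (p ∣? d)) (H d))
          ≡⟨ Z.Σ<-cong N (λ d _ → ZS.when-cong (¬? (p ∣? d)) (λ p∤d → ZS.when-⇔ (d ∣? N) (d ∣? n) {möbius d}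
               (λ d∣N → coprime-divisor {d} {p} {n} (coprime-sym {p} (∤⇒coprime pp p∤d)) (subst (d ∣_) (ℕ.*-comm n p) d∣N))
               (λ d∣n → ℕ.∣m⇒∣m*n p d∣n))) ⟩
        Z.Σ< N G       ≡⟨ ZS.Σ<-truncate (suc n) N G (ℕ.m<m*n n p {{ℕ.>-nonZero 0<n}} (prime>1 pp))
                            (λ i n<i → ZS.when-0 (¬? (p ∣? i)) (when-no (i ∣? n) (λ i∣n → ℕ.<⇒≱ n<i (ℕ.∣⇒≤ {{ℕ.>-nonZero 0<n}} i∣n)))) ⟩
        Z.Σ< (suc n) G ≡⟨ Z.Σ<-last n G ⟩
        Z.Σ< n G ℤ.+ G n ∎
      part₂ : Z.Σ< n (λ d → H (d * p)) ≡ ℤ.- Z.Σ< n G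
      part₂ = trans (Z.Σ<-cong n (λ d d<n → eq d d<n)) (Z.Σ<-neg n G)
        where
        eq : ∀ d → d < n → H (d * p) ≡ ℤ.- G d
        eq zero    d<n = trans (when-no (0 ∣? N) (λ h → ℕ.<⇒≢ (ℕ.<-trans (s≤s z≤n) 1<N) (sym (ℕ.0∣⇒≡0 h))))
           (cong ℤ.-_ (sym (ZS.when-0 (¬? (p ∣? 0)) (when-no (0 ∣? n) {möbius 0} (λ h → ℕ.<⇒≢ 0<n (sym (ℕ.0∣⇒≡0 h)))))))
        eq d@(suc _) d<n = begin
          when (d * p ∣? N) (möbius (d * p))                  ≡⟨ ZS.when-⇔ (d * p ∣? N) (d ∣? n)
                                                                   (ℕ.*-cancelʳ-∣ p {{ℕ.>-nonZero (prime>0 pp)}}) (ℕ.*-monoˡ-∣ p) ⟩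
          when (d ∣? n) (möbius (d * p))                      ≡⟨ ZS.when-cong (d ∣? n) (λ _ → rec d<n (s≤s z≤n)) ⟩
          when (d ∣? n) (ℤ.- when (¬? (p ∣? d)) (möbius d))   ≡⟨ comm (d ∣? n) (¬? (p ∣? d)) (möbius d) ⟩
          ℤ.- G d                                             ∎
          where
          comm : ∀ {A B : Set} (a : Dec A) (b : Dec B) x → when a (ℤ.- when b x) ≡ ℤ.- when b (when a x)
          comm (yes _) b       x = refl
          comm (no _)  (yes _) x = refl
          comm (no _)  (no _)  x = refl

  sgn : Bool → ℤ
  sgn true  = 1ℤ
  sgn false = -1ℤ

  scaleD scaleE : ℕ → ℕ × ℕ → ℕ × ℕ
  scaleD q (d , e) = q * d , e
  scaleE q (d , e) = d , q * e

  -- Each prime goes into the first component or, with a change of sign, into the second; `b` is the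
  -- sign of μ at the second component.
  pairs : Bool → List ℕ → List (ℕ × ℕ)
  pairs true  []       = (1 , 1) ∷ []
  pairs false []       = []
  pairs b     (q ∷ ps) = map (scaleD q) (pairs b ps) ++ map (scaleE q) (pairs (not b) ps)

  pairs-∷⁻ : ∀ b q ps {v} → v ∈ pairs b (q ∷ ps) →
    (∃ λ w → w ∈ pairs b ps × v ≡ scaleD q w) ⊎ (∃ λ w → w ∈ pairs (not b) ps × v ≡ scaleE q w)
  pairs-∷⁻ true  q ps h with ∈-++⁻ (map (scaleD q) (pairs true ps)) h
  ... | inj₁ k = inj₁ (∈-map⁻ (scaleD q) k)
  ... | inj₂ k = inj₂ (∈-map⁻ (scaleE q) k)
  pairs-∷⁻ false q ps h with ∈-++⁻ (map (scaleD q) (pairs false ps)) h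
  ... | inj₁ k = inj₁ (∈-map⁻ (scaleD q) k)
  ... | inj₂ k = inj₂ (∈-map⁻ (scaleE q) k)

  pairs-∷⁺ˡ : ∀ b q ps {w} → w ∈ pairs b ps → scaleD q w ∈ pairs b (q ∷ ps)
  pairs-∷⁺ˡ true  q ps h = ∈-++⁺ˡ (∈-map⁺ (scaleD q) h)
  pairs-∷⁺ˡ false q ps h = ∈-++⁺ˡ (∈-map⁺ (scaleD q) h)

  pairs-∷⁺ʳ : ∀ b q ps {w} → w ∈ pairs (not b) ps → scaleE q w ∈ pairs b (q ∷ ps)
  pairs-∷⁺ʳ true  q ps h = ∈-++⁺ʳ (map (scaleD q) (pairs true ps)) (∈-map⁺ (scaleE q) h)
  pairs-∷⁺ʳ false q ps h = ∈-++⁺ʳ (map (scaleD q) (pairs false ps)) (∈-map⁺ (scaleE q) h)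

  pairs-product : ∀ b ps {d e} → (d , e) ∈ pairs b ps → d * e ≡ product ps
  pairs-product true  [] (here refl) = refl
  pairs-product false [] ()
  pairs-product b (q ∷ ps) h with pairs-∷⁻ b q ps h
  ... | inj₁ ((d , e) , k , refl) = trans (ℕ.*-assoc q d e) (cong (q *_) (pairs-product b ps k))
  ... | inj₂ ((d , e) , k , refl) = trans (lem d q e) (cong (q *_) (pairs-product (not b) ps k))
    where
    open import Data.Nat.Solver using (module +-*-Solver)
    open +-*-Solver
    lem : ∀ d q e → d * (q * e) ≡ q * (d * e)
    lem = solve 3 (λ d q e → d :* (q :* e) := q :* (d :* e)) refl

  sgn-not : ∀ b → ℤ.- sgn (not b) ≡ sgn b
  sgn-not true  = refl
  sgn-not false = refl

  module _ where
    PrimeList : List ℕ → Set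
    PrimeList ps = All Prime ps × Unique ps

    prime-tail : ∀ {q ps} → PrimeList (q ∷ ps) → PrimeList ps
    prime-tail (_ ∷ a , _ ∷ u) = a , u

    head-coprime : ∀ {q ps} → PrimeList (q ∷ ps) → Coprime q (product ps)
    head-coprime {q} {ps} (pq ∷ a , q∉ ∷ u) = coprime-product ps pq a q∉

    product>0 : ∀ ps → PrimeList ps → 0 < product ps
    product>0 []       _ = s≤s z≤n
    product>0 (q ∷ ps) (pq ∷ a , _ ∷ u) = ℕ.*-mono-< (prime>0 pq) (product>0 ps (a , u))

    pair-∤ : ∀ b {q ps d e} → PrimeList (q ∷ ps) → (d , e) ∈ pairs b ps → ¬ q ∣ d × ¬ q ∣ e
    pair-∤ b {q} {ps} {d} {e} pl@(pq ∷ _ , _) h = (λ k → bad (ℕ.∣m⇒∣m*n e k)) , (λ k → bad (ℕ.∣n⇒∣m*n d k))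
      where
      bad : ¬ q ∣ d * e
      bad k = coprime⇒∤ pq (head-coprime pl) (subst (q ∣_) (pairs-product b ps h) k)

    pairs-pos : ∀ b ps {d e} → PrimeList ps → (d , e) ∈ pairs b ps → 0 < d × 0 < e
    pairs-pos b ps {d} {e} pl h with pairs-product b ps h | product>0 ps pl
    ... | eq | pos = pos′ d e (subst (0 <_) (sym eq) pos)
      where
      pos′ : ∀ d e → 0 < d * e → 0 < d × 0 < e
      pos′ (suc d) (suc e) _ = s≤s z≤n , s≤s z≤n
      pos′ (suc d) zero    h = ⊥-elim (ℕ.<⇒≢ h (sym (ℕ.*-zeroʳ d)))

    möbius-*-prime : ∀ q n → Prime q → 0 < n → ¬ q ∣ n → möbius (q * n) ≡ ℤ.- möbius n
    möbius-*-prime q n pq 0<n q∤n = trans (cong möbius (ℕ.*-comm q n))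
      (trans (möbius-prime-* q pq n 0<n) (cong ℤ.-_ (when-yes (¬? (q ∣? n)) q∤n)))

    möbius-*-square : ∀ q n → Prime q → 0 < n → q ∣ n → möbius (q * n) ≡ 0ℤ
    möbius-*-square q n pq 0<n q∣n = trans (cong möbius (ℕ.*-comm q n))
      (trans (möbius-prime-* q pq n 0<n) (cong ℤ.-_ (when-no (¬? (q ∣? n)) {möbius n} (λ h → h q∣n))))

    pairs-möbius : ∀ b ps {d e} → PrimeList ps → (d , e) ∈ pairs b ps → möbius e ≡ sgn b
    pairs-möbius true  [] pl (here refl) = refl
    pairs-möbius false [] pl ()
    pairs-möbius b (q ∷ ps) pl h with pairs-∷⁻ b q ps h
    ... | inj₁ ((d , e) , k , refl) = pairs-möbius b ps (prime-tail pl) k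
    ... | inj₂ ((d , e) , k , refl) = trans (möbius-*-prime q e (All.head (proj₁ pl)) (proj₂ (pairs-pos (not b) ps (prime-tail pl) k)) (proj₂ (pair-∤ (not b) pl k)))
          (trans (cong ℤ.-_ (pairs-möbius (not b) ps (prime-tail pl) k)) (sgn-not b))

    pairs-unique : ∀ b ps → PrimeList ps → Unique (pairs b ps)
    pairs-unique true  [] _ = [] ∷ []
    pairs-unique false [] _ = []
    pairs-unique b (q ∷ ps) pl@(pq ∷ _ , _) = cast b
      (Unique.++⁺ (Unique.map⁺ injD (pairs-unique b ps (prime-tail pl))) (Unique.map⁺ injE (pairs-unique (not b) ps (prime-tail pl))) disj)
      where
      instance _ = ℕ.>-nonZero (prime>0 pq)
      cast : ∀ b → Unique (map (scaleD q) (pairs b ps) ++ map (scaleE q) (pairs (not b) ps)) → Unique (pairs b (q ∷ ps))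
      cast true  u = u
      cast false u = u
      injD : ∀ {x y} → scaleD q x ≡ scaleD q y → x ≡ y
      injD {d , e} {d' , e'} h with ,-injective h
      ... | h₁ , refl = cong (_, e) (ℕ.*-cancelˡ-≡ d d' q h₁)
      injE : ∀ {x y} → scaleE q x ≡ scaleE q y → x ≡ y
      injE {d , e} {d' , e'} h with ,-injective h
      ... | refl , h₂ = cong (d ,_) (ℕ.*-cancelˡ-≡ e e' q h₂)
      disj : ∀ {v} → v ∈ map (scaleD q) (pairs b ps) × v ∈ map (scaleE q) (pairs (not b) ps) → ⊥
      disj (h , k) with ∈-map⁻ (scaleD q) h | ∈-map⁻ (scaleE q) k
      ... | (d , e) , h' , refl | (d' , e') , k' , eq with ,-injective eq
      ...   | eq₁ , _ = proj₁ (pair-∤ (not b) pl k') (subst (q ∣_) eq₁ (ℕ.m∣m*n d))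

    -- A nonzero Möbius value makes `e` square-free, so every listed prime divides `e` at most once
    -- and its place in the pair is determined.
    möbius⇒pair : ∀ ps b → PrimeList ps → ∀ e → 0 < e → (∀ r → Prime r → r ∣ e → r ∈ ps) → möbius e ≡ sgn b → ∃ λ d → (d , e) ∈ pairs b ps
    möbius⇒pair [] b pl e 0<e has μe with 1 ℕ.<? e
    ... | yes 1<e with primeDivisor e 1<e
    ...   | r , pr , r∣e with () ← has r pr r∣e
    möbius⇒pair [] true  pl e 0<e has μe | no ¬1<e with ℕ.≤-antisym (ℕ.≮⇒≥ ¬1<e) 0<e
    ... | refl = 1 , here refl
    möbius⇒pair [] false pl e 0<e has μe | no ¬1<e with ℕ.≤-antisym (ℕ.≮⇒≥ ¬1<e) 0<e
    ... | refl with () ← μe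
    möbius⇒pair (q ∷ ps) b pl@(pq ∷ _ , _) e 0<e has μe with q ∣? e
    ... | no q∤e = _ , pairs-∷⁺ˡ b q ps (proj₂ (möbius⇒pair ps b (prime-tail pl) e 0<e has' μe))
      where
      has' : ∀ r → Prime r → r ∣ e → r ∈ ps
      has' r pr r∣e with has r pr r∣e
      ... | here refl = ⊥-elim (q∤e r∣e)
      ... | there h   = h
    ... | yes (ℕ.divides n refl) = byCases (q ∣? n)
      where
      0<n : 0 < n
      0<n = ℕ.n≢0⇒n>0 (λ { refl → ℕ.<⇒≢ 0<e refl })
      μqn : möbius (q * n) ≡ sgn b
      μqn = trans (cong möbius (ℕ.*-comm q n)) μe
      sgn≢0 : ∀ b → sgn b ≢ 0ℤ
      sgn≢0 true ()
      sgn≢0 false ()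
      byCases : Dec (q ∣ n) → ∃ λ d → (d , n * q) ∈ pairs b (q ∷ ps)
      byCases (yes q∣n) = ⊥-elim (sgn≢0 b (trans (sym μqn) (möbius-*-square q n pq 0<n q∣n)))
      byCases (no q∤n)  = proj₁ ih , subst (λ z → (proj₁ ih , z) ∈ pairs b (q ∷ ps)) (ℕ.*-comm q n) (pairs-∷⁺ʳ b q ps (proj₂ ih))
        where
        has' : ∀ r → Prime r → r ∣ n → r ∈ ps
        has' r pr r∣n with has r pr (ℕ.∣m⇒∣m*n q r∣n)
        ... | here refl = ⊥-elim (q∤n r∣n)
        ... | there h   = h
        μn : möbius n ≡ sgn (not b)
        μn = neg-inj (trans (sym (trans (sym μqn) (möbius-*-prime q n pq 0<n q∤n))) (sym (sgn-not b)))
          where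
          neg-inj : ∀ {x y} → ℤ.- x ≡ ℤ.- y → x ≡ y
          neg-inj {x} {y} h = trans (sym (ℤ.neg-involutive x)) (trans (cong ℤ.-_ h) (ℤ.neg-involutive y))
        ih : ∃ λ d → (d , n) ∈ pairs (not b) ps
        ih = möbius⇒pair ps (not b) (prime-tail pl) n 0<n has' μn

  -- Definitionally the list from which `cycloNum` and `cycloDen` select, which is private there;
  -- `x^-1` stands in the same way for their factors.
  factorPairs′ : ℕ → List (ℕ × ℕ)
  factorPairs′ m = filter (λ p → (proj₁ p * proj₂ p) ℕ.≟ m)
    (concatMap (λ d → map (λ e → (d , e)) (applyUpTo suc m)) (applyUpTo suc m))

  factorPairs-unique : ∀ m → Unique (factorPairs′ m)
  factorPairs-unique m = Unique.filter⁺ (λ p → (proj₁ p * proj₂ p) ℕ.≟ m)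
    (Unique.concat⁺ (All.map⁺ (All.tabulate (λ {d} _ → Unique.map⁺ (λ { refl → refl }) u)))
                    (AllPairs.map⁺ (AllPairs.map (λ {d} {d'} d≢d' {v} h → disj d d' d≢d' h) u)))
    where
    u : Unique (applyUpTo suc m)
    u = Unique.applyUpTo⁺₁ suc m (λ i<j _ e → ℕ.<⇒≢ i<j (ℕ.suc-injective e))
    disj : ∀ d d' → d ≢ d' → ∀ {v} → v ∈ map (λ e → (d , e)) (applyUpTo suc m) × v ∈ map (λ e → (d' , e)) (applyUpTo suc m) → ⊥
    disj d d' d≢d' (h , k) with ∈-map⁻ (d ,_) h | ∈-map⁻ (d' ,_) k
    ... | e , _ , refl | e' , _ , eq = d≢d' (proj₁ (,-injective eq))

  ∈-factorPairs⁻ : ∀ m {d e} → (d , e) ∈ factorPairs′ m → d * e ≡ m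
  ∈-factorPairs⁻ m h = proj₂ (∈-filter⁻ (λ p → (proj₁ p * proj₂ p) ℕ.≟ m)
    {xs = concatMap (λ d → map (λ e → (d , e)) (applyUpTo suc m)) (applyUpTo suc m)} h)

  ∈-upTo-suc : ∀ m d → 0 < d → d ∣ m → 0 < m → d ∈ applyUpTo suc m
  ∈-upTo-suc m (suc d) _ d∣m 0<m = ∈-applyUpTo⁺ suc (ℕ.∣⇒≤ {{ℕ.>-nonZero 0<m}} d∣m)

  ∈-factorPairs⁺ : ∀ m {d e} → 0 < m → d * e ≡ m → (d , e) ∈ factorPairs′ m
  ∈-factorPairs⁺ m {d} {e} 0<m refl = ∈-filter⁺ (λ p → (proj₁ p * proj₂ p) ℕ.≟ m)
    (∈-concat⁺′ {vs = map (d ,_) (applyUpTo suc m)} (∈-map⁺ (d ,_) (∈-upTo-suc m e 0<e (ℕ.∣n⇒∣m*n d ℕ.∣-refl) 0<m))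
      (∈-map⁺ (λ d → map (λ e → (d , e)) (applyUpTo suc m)) (∈-upTo-suc m d 0<d (ℕ.∣m⇒∣m*n e ℕ.∣-refl) 0<m))) refl
    where
    0<d : 0 < d
    0<d = ℕ.n≢0⇒n>0 (λ { refl → ℕ.<⇒≢ 0<m refl })
    0<e : 0 < e
    0<e = ℕ.n≢0⇒n>0 (λ { refl → ℕ.<⇒≢ 0<m (sym (ℕ.*-zeroʳ d)) })

  -- A nonzero Möbius value confines the second component to divisors of the radical, so the surplus
  -- factor `k` always lands in the first. Both lists are free of duplicates and have the same
  -- members, hence they are permutations of each other.
  factorPairs↭ : ∀ m k ps b → 0 < m → PrimeList ps → m ≡ k * product ps → (∀ q → Prime q → q ∣ m → q ∈ ps) →
    filter (λ p → möbius (proj₂ p) ℤ.≟ sgn b) (factorPairs′ m) ↭ map (scaleD k) (pairs b ps)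
  factorPairs↭ m k ps b 0<m pl m≡ has = ∼bag⇒↭ (unique∧set⇒bag
    (Unique.filter⁺ (λ p → möbius (proj₂ p) ℤ.≟ sgn b) (factorPairs-unique m))
    (Unique.map⁺ inj (pairs-unique b ps pl)) (mk⇔ to from))
    where
    k≢0 : k ≢ 0
    k≢0 refl = ℕ.<⇒≢ 0<m (sym m≡)
    instance _ = ℕ.≢-nonZero k≢0
    inj : ∀ {x y} → scaleD k x ≡ scaleD k y → x ≡ y
    inj {d , e} {d' , e'} h with ,-injective h
    ... | h₁ , refl = cong (_, e) (ℕ.*-cancelˡ-≡ d d' k h₁)
    to : ∀ {v} → v ∈ filter (λ p → möbius (proj₂ p) ℤ.≟ sgn b) (factorPairs′ m) → v ∈ map (scaleD k) (pairs b ps)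
    to {d , e} h with ∈-filter⁻ (λ p → möbius (proj₂ p) ℤ.≟ sgn b) {xs = factorPairs′ m} h
    ... | h₁ , μe with ∈-factorPairs⁻ m h₁
    ...   | de≡m = subst (λ z → (z , e) ∈ map (scaleD k) (pairs b ps)) kd₀≡d (∈-map⁺ (scaleD k) (proj₂ pair))
      where
      e≢0 : e ≢ 0
      e≢0 refl = ℕ.<⇒≢ 0<m (trans (sym (ℕ.*-zeroʳ d)) de≡m)
      pair : ∃ λ d₀ → (d₀ , e) ∈ pairs b ps
      pair = möbius⇒pair ps b pl e (ℕ.n≢0⇒n>0 e≢0) (λ r pr r∣e → has r pr (subst (r ∣_) de≡m (ℕ.∣n⇒∣m*n d r∣e))) μe
      kd₀≡d : k * proj₁ pair ≡ d
      kd₀≡d = ℕ.*-cancelʳ-≡ (k * proj₁ pair) d e {{ℕ.≢-nonZero e≢0}}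
        (trans (ℕ.*-assoc k (proj₁ pair) e) (trans (cong (k *_) (pairs-product b ps (proj₂ pair))) (trans (sym m≡) (sym de≡m))))
    from : ∀ {v} → v ∈ map (scaleD k) (pairs b ps) → v ∈ filter (λ p → möbius (proj₂ p) ℤ.≟ sgn b) (factorPairs′ m)
    from h with ∈-map⁻ (scaleD k) h
    ... | (d , e) , h₁ , refl = ∈-filter⁺ (λ p → möbius (proj₂ p) ℤ.≟ sgn b)
          (∈-factorPairs⁺ m 0<m (trans (ℕ.*-assoc k d e) (trans (cong (k *_) (pairs-product b ps h₁)) (sym m≡)))) (pairs-möbius b ps pl h₁)

  x^-1 : ℕ → Poly
  x^-1 d = addP (monomial d 1ℤ) (constP -1ℤ)

  prodX : List (ℕ × ℕ) → Poly
  prodX L = prodP (map (λ p → x^-1 (proj₁ p)) L)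

  x^-1-⟨⟩ : ∀ d s → x^-1 d ⟨ s ⟩ ≐ x^-1 (s * d)
  x^-1-⟨⟩ d s = ≐-trans (Sub.φ-+ s (monomial d 1ℤ) (constP -1ℤ)) (add-cong
    (≐-trans (PE.ev-monomial (X P.^ s) d) (≐-trans (P.^-assocʳ X s d) (≐-sym (monomial≐ (s * d)))))
    (≐-trans (PE.ev-const (X P.^ s) -1ℤ) (ι-const -1ℤ)))

  prodX-↭ : ∀ {L M} → L ↭ M → prodX L ≐ prodX M
  prodX-↭ Perm.refl = ≐-refl
  prodX-↭ (Perm.prep x h) = mul-congʳ (x^-1 (proj₁ x)) (prodX-↭ h)
  prodX-↭ (Perm.swap {L} {M} x y h) = ≐-trans (mul-congʳ (x^-1 (proj₁ x)) (mul-congʳ (x^-1 (proj₁ y)) (prodX-↭ h)))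
    (solve 3 (λ a b c → a :* (b :* c) := b :* (a :* c)) ≐-refl (x^-1 (proj₁ x)) (x^-1 (proj₁ y)) (prodX M))
    where open P.Solver
  prodX-↭ (Perm.trans h k) = ≐-trans (prodX-↭ h) (prodX-↭ k)

  prodX-++ : ∀ L M → prodX (L ++ M) ≐ prodX L P.* prodX M
  prodX-++ []      M = ≐-sym (mul-identityˡ (prodX M))
  prodX-++ (x ∷ L) M = ≐-trans (mul-congʳ (x^-1 (proj₁ x)) (prodX-++ L M)) (≐-sym (mul-assoc (x^-1 (proj₁ x)) (prodX L) (prodX M)))

  prodX-scaleD : ∀ s L → prodX (map (scaleD s) L) ≐ prodX L ⟨ s ⟩
  prodX-scaleD s []      = ≐-sym (Sub.φ-1 s)
  prodX-scaleD s (x ∷ L) = ≐-trans (mul-cong (≐-sym (x^-1-⟨⟩ (proj₁ x) s)) (prodX-scaleD s L))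
    (≐-sym (Sub.φ-* s (x^-1 (proj₁ x)) (prodX L)))

  prodX-scaleE : ∀ s L → prodX (map (scaleE s) L) ≡ prodX L
  prodX-scaleE s []      = refl
  prodX-scaleE s (x ∷ L) = cong (mulP (x^-1 (proj₁ x))) (prodX-scaleE s L)

  mutual
    num≐ : ∀ ps → num ps ≐ prodX (pairs true ps)
    num≐ []       = ≐-trans (mk λ { zero → refl ; (suc zero) → refl ; (suc (suc _)) → refl }) (≐-sym (P.*-identityʳ (x^-1 1)))
    num≐ (q ∷ ps) = ≐-trans (mul-cong (⟨⟩-cong q (num≐ ps)) (den≐ ps)) (≐-sym (split q ps true))

    den≐ : ∀ ps → den ps ≐ prodX (pairs false ps)
    den≐ []       = ≐-refl
    den≐ (q ∷ ps) = ≐-trans (mul-cong (⟨⟩-cong q (den≐ ps)) (num≐ ps)) (≐-sym (split q ps false))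

    split : ∀ q ps b → prodX (pairs b (q ∷ ps)) ≐ prodX (pairs b ps) ⟨ q ⟩ P.* prodX (pairs (not b) ps)
    split q ps b = ≐-trans (cast b) (≐-trans (prodX-++ (map (scaleD q) (pairs b ps)) (map (scaleE q) (pairs (not b) ps)))
      (mul-cong (prodX-scaleD q (pairs b ps)) (subst (prodX (map (scaleE q) (pairs (not b) ps)) ≐_) (prodX-scaleE q (pairs (not b) ps)) ≐-refl)))
      where
      cast : ∀ b → prodX (pairs b (q ∷ ps)) ≐ prodX (map (scaleD q) (pairs b ps) ++ map (scaleE q) (pairs (not b) ps))
      cast true  = ≐-refl
      cast false = ≐-refl

  module _ (m k : ℕ) (ps : List ℕ) (0<m : 0 < m) (pl : PrimeList ps) (m≡ : m ≡ k * product ps)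
           (has : ∀ q → Prime q → q ∣ m → q ∈ ps) where

    cycloNum≐ : cycloNum m ≐ num ps ⟨ k ⟩
    cycloNum≐ = ≐-trans (prodX-↭ (factorPairs↭ m k ps true 0<m pl m≡ has))
      (≐-trans (prodX-scaleD k (pairs true ps)) (⟨⟩-cong k (≐-sym (num≐ ps))))

    cycloDen≐ : cycloDen m ≐ den ps ⟨ k ⟩
    cycloDen≐ = ≐-trans (prodX-↭ (factorPairs↭ m k ps false 0<m pl m≡ has))
      (≐-trans (prodX-scaleD k (pairs false ps)) (⟨⟩-cong k (≐-sym (den≐ ps))))

-- The rings ℤ[ζ_m] as quotients of ℤ[x], and their abstract interface.

module CyclotomicRings where

  open import Defs hiding (σ)
  open RingTools
  open IntegerPolynomials
  open NumberTheory
  open CyclotomicTower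
  open MöbiusPairs using (PrimeList; product>0; cycloNum≐; cycloDen≐)
  open import Algebra.Bundles using (CommutativeRing)
  open import Data.Nat as ℕ using (ℕ; zero; suc; z≤n; s≤s; _<_; _≤_)
  import Data.Nat.Properties as ℕ
  import Data.Nat.Divisibility as ℕ
  open import Data.Nat.Coprimality using (Coprime; 0-coprimeTo-m⇒m≡1)
  open import Data.Nat.Primality using (Prime)
  open import Data.Nat.ListAction using (product)
  open import Data.Integer as ℤ using (ℤ; +_; 0ℤ; 1ℤ)
  import Data.Integer.Properties as ℤ
  open import Data.List using (List; []; _∷_)
  open import Data.List.Relation.Unary.All as All using (All; []; _∷_)
  open import Data.List.Membership.Propositional using (_∈_)
  open import Data.Product using (∃; ∃₂; _×_; proj₁; proj₂) renaming (_,_ to _,,_)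
  open import Data.Sum using (inj₁; inj₂)
  open import Level using (0ℓ)
  open import Relation.Nullary
  open import Relation.Nullary.Decidable using (map′)
  open import Relation.Binary.PropositionalEquality using (_≡_; _≢_; refl; sym; trans; cong; cong₂; subst)

  module _ (S : CommutativeRing 0ℓ 0ℓ) (d : CommutativeRing.Carrier S) where
    private module S = Ring S
    open S using (_≡[_]_; ≡-refl; ≡-sym; ≡-trans; ≡-+; ≡-*; ≡-neg)
    open CommutativeRing using (Carrier; _≈_; _+_; _*_; -_; 0#; 1#; isCommutativeRing)

    -- The quotient keeps the carrier and only coarsens the equality, so representatives pass
    -- unchanged from one ring to the other.
    _/⟨_⟩ : CommutativeRing 0ℓ 0ℓ
    _/⟨_⟩ .Carrier = S.Carrier
    _/⟨_⟩ ._≈_ x y = x ≡[ d ] y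
    _/⟨_⟩ ._+_ = S._+_
    _/⟨_⟩ ._*_ = S._*_
    _/⟨_⟩ .-_ = S.-_
    _/⟨_⟩ .0# = S.0#
    _/⟨_⟩ .1# = S.1#
    _/⟨_⟩ .isCommutativeRing = record
        { isRing = record
          { +-isAbelianGroup = record
            { isGroup = record
              { isMonoid = record
                { isSemigroup = record
                  { isMagma = record
                    { isEquivalence = record { refl = ≡-refl (Ring.refl S) ; sym = ≡-sym ; trans = ≡-trans }
                    ; ∙-cong = ≡-+ }
                  ; assoc = λ x y z → ≡-refl (S.+-assoc x y z) }
                ; identity = (λ x → ≡-refl (S.+-identityˡ x)) ,, (λ x → ≡-refl (S.+-identityʳ x)) }
              ; inverse = (λ x → ≡-refl (S.-‿inverseˡ x)) ,, (λ x → ≡-refl (S.-‿inverseʳ x))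
              ; ⁻¹-cong = ≡-neg }
            ; comm = λ x y → ≡-refl (S.+-comm x y) }
          ; *-cong = ≡-*
          ; *-assoc = λ x y z → ≡-refl (S.*-assoc x y z)
          ; *-identity = (λ x → ≡-refl (S.*-identityˡ x)) ,, (λ x → ≡-refl (S.*-identityʳ x))
          ; distrib = (λ x y z → ≡-refl (S.distribˡ x y z)) ,, (λ x y z → ≡-refl (S.distribʳ x y z))
          }
        ; *-comm = λ x y → ≡-refl (S.*-comm x y)
        }

    quotient-isHom : IsHom S _/⟨_⟩ (λ x → x)
    quotient-isHom = record
      { φ-cong = ≡-refl ; φ-+ = λ _ _ → ≡-refl (Ring.refl S) ; φ-* = λ _ _ → ≡-refl (Ring.refl S) ; φ-1 = ≡-refl (Ring.refl S) }

  -- The properties of ℤ[ζ_m] on which the arithmetic rests. `Σζ≈0` and `torsion-free` together make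
  -- the elements ζ^k - 1 regular; `ι∣?` makes searches modulo a prime effective and, at k = 0,
  -- decides equality.
  record IsCyclotomic (m : ℕ) (R : CommutativeRing 0ℓ 0ℓ) (ζ : CommutativeRing.Carrier R)
                      (σ : ℕ → CommutativeRing.Carrier R → CommutativeRing.Carrier R) : Set where
    open Ring R
    open Eval R
    field
      0<m          : 0 < m
      rep-ev       : ∀ f → ∃ λ p → f ≈ ev ζ p
      ζ^m          : ζ ^ m ≈ 1#
      σ-hom        : ∀ s → Coprime s m → IsHom R R (σ s)
      σ-ζ          : ∀ s → Coprime s m → σ s ζ ≈ ζ ^ s
      torsion-free : ∀ k f → k ≢ 0ℤ → ι k * f ≈ 0# → f ≈ 0#
      proper       : ∀ p → 1 < p → ¬ ι (+ p) ∣ 1#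
      Σζ≈0         : ∀ p → Prime p → ∀ d → d ℕ.* p ≡ m → Σ< p ((ζ ^ d) ^_) ≈ 0#
      ι∣?          : ∀ k f → Dec (ι (+ k) ∣ f)

  module Division {d Φ} (Φ-monic : Monic (suc d) Φ) where
    open P.Solver

    Reduced : Poly → Set
    Reduced r = ∀ i → suc d ≤ i → coeff r i ≡ 0ℤ

    -- Horner's scheme: multiplying the remainder by x can spoil it only in degree d + 1, the degree
    -- of `Φ`, and `c` removes the coefficient that appears there.
    divide : ∀ f → ∃₂ λ q r → f ≐ q P.* Φ P.+ r × Reduced r
    divide [] = [] ,, [] ,, ≐-refl ,, λ _ _ → refl
    divide (a ∷ f) with divide f
    ... | q ,, r ,, e ,, red = (c ∷ q) ,, r' ,, eq ,, red'
      where
      c = coeff r d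
      r' = addP (a ∷ r) (negP (scaleP c Φ))
      eq : (a ∷ f) ≐ (c ∷ q) P.* Φ P.+ r'
      eq = begin
        (a ∷ f)                                                   ≈⟨ ∷≐ a f ⟩
        P.ι a P.+ X P.* f                                         ≈⟨ P.+-congˡ {P.ι a} (P.*-congˡ {X} e) ⟩
        P.ι a P.+ X P.* (q P.* Φ P.+ r)
          ≈⟨ solve 6 (λ a x q f r c → a :+ x :* (q :* f :+ r) := (c :+ x :* q) :* f :+ (a :+ x :* r :- c :* f)) ≐-refl (P.ι a) X q Φ r (P.ι c) ⟩
        (P.ι c P.+ X P.* q) P.* Φ P.+ (P.ι a P.+ X P.* r P.- P.ι c P.* Φ)
          ≈⟨ P.+-cong (P.*-congʳ {Φ} (∷≐ c q)) (P.+-cong (∷≐ a r) (P.-‿cong (scale≐ι* c Φ))) ⟨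
        (c ∷ q) P.* Φ P.+ r'                                      ∎
        where open import Relation.Binary.Reasoning.Setoid P.setoid
      coeff-r' : ∀ i → coeff r' (suc i) ≡ coeff r i ℤ.- c ℤ.* coeff Φ (suc i)
      coeff-r' i = trans (coeff-add (a ∷ r) (negP (scaleP c Φ)) (suc i)) (cong (ℤ._+_ (coeff r i))
        (trans (coeff-neg (scaleP c Φ) (suc i)) (cong ℤ.-_ (coeff-scale c Φ (suc i)))))
      red' : Reduced r'
      red' (suc i) (s≤s d≤i) with ℕ.m≤n⇒m<n∨m≡n d≤i
      ... | inj₁ d<i = trans (coeff-r' i) (trans (cong₂ (λ x y → x ℤ.- c ℤ.* y) (red i d<i) (Monic.above Φ-monic (suc i) (s≤s d<i)))
                (trans (ℤ.+-identityˡ _) (cong ℤ.-_ (ℤ.*-zeroʳ c))))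
      ... | inj₂ refl = trans (coeff-r' d) (trans (cong (λ y → c ℤ.- c ℤ.* y) (Monic.leading Φ-monic))
                (trans (cong (λ y → c ℤ.- y) (ℤ.*-identityʳ c)) (ℤ.+-inverseʳ c)))

    -- From degree d + 1 on, `r` vanishes, so there K divides the coefficients of h Φ and hence, by
    -- `gauss`, every coefficient of h.
    reduced-∣ : ∀ {K} r g h → Reduced r → r ≐ P.ι K P.* g P.+ h P.* Φ → ∀ i → K Z.∣ coeff r i
    reduced-∣ {K} r g h red e i = Z.∣-resp (sym (co i)) (Z.∣-+ (coeff g i Z., refl) (∣coeff-mul h Φ K∣h i))
      where
      co : ∀ i → coeff r i ≡ K ℤ.* coeff g i ℤ.+ coeff (mulP h Φ) i
      co i = trans (at e i) (trans (coeff-add (P.ι K P.* g) (h P.* Φ) i)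
        (cong (ℤ._+ coeff (mulP h Φ) i) (trans (at (≐-sym (scale≐ι* K g)) i) (coeff-scale K g i))))
      K∣h : ∀ i → K Z.∣ coeff h i
      K∣h = gauss Φ-monic h (λ i d≤i → Z.∣-resp (lem (co i) (red i d≤i)) (Z.∣-neg (coeff g i Z., refl)))
        where
        lem : ∀ {r x y} → r ≡ x ℤ.+ y → r ≡ 0ℤ → ℤ.- x ≡ y
        lem {x = x} {y} e₁ e₂ = trans (ring x y) (trans (cong (λ z → ℤ.- z ℤ.+ y) (trans (sym e₁) e₂)) (ℤ.+-identityˡ y))
          where
          ring : ∀ x y → ℤ.- x ≡ ℤ.- (x ℤ.+ y) ℤ.+ y
          ring = Z.Solver.solve 2 (λ x y → Z.Solver.:- x Z.Solver.:= Z.Solver.:- (x Z.Solver.:+ y) Z.Solver.:+ y) refl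

    all-coeff : ∀ {K : ℤ} f → All (λ a → K Z.∣ a) f → ∀ i → K Z.∣ coeff f i
    all-coeff []      _        i       = Z.∣0
    all-coeff (a ∷ f) (h ∷ _)  zero    = h
    all-coeff (a ∷ f) (_ ∷ hs) (suc i) = all-coeff f hs i

    coeff-all : ∀ {K : ℤ} f → (∀ i → K Z.∣ coeff f i) → All (λ a → K Z.∣ a) f
    coeff-all []      h = []
    coeff-all (a ∷ f) h = h 0 ∷ coeff-all f (λ i → h (suc i))

    all-scale : ∀ {K : ℤ} f → All (λ a → K Z.∣ a) f → ∃ λ g → f ≐ P.ι K P.* g
    all-scale {K} [] _ = [] ,, ≐-sym (mul-zeroʳ (P.ι K))
    all-scale {K} (a ∷ f) ((q Z., e) ∷ hs) with all-scale f hs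
    ... | g ,, e' = (q ∷ g) ,, ≐-trans (∷-cong e (≐-trans e' (≐-sym (scale≐ι* K g)))) (scale≐ι* K (q ∷ g))

  module _ where
    -- The quantifier over `s` lets the property pass through the substitutions in `num` and `den`.
    Cancellable : Poly → Set
    Cancellable f = ∀ s → 0 < s → ∀ g → g P.* f ⟨ s ⟩ ≐ [] → g ≐ []

    cancellable-* : ∀ {f g} → Cancellable f → Cancellable g → Cancellable (f P.* g)
    cancellable-* {f} {g} cf cg s 0<s h e = cf s 0<s h (cg s 0<s (h P.* f ⟨ s ⟩)
      (≐-trans (mul-assoc h (f ⟨ s ⟩) (g ⟨ s ⟩)) (≐-trans (mul-congʳ h (≐-sym (Sub.φ-* s f g))) e)))

    cancellable-⟨⟩ : ∀ {f} q → 0 < q → Cancellable f → Cancellable (f ⟨ q ⟩)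
    cancellable-⟨⟩ {f} q 0<q cf s 0<s h e = cf (s ℕ.* q) (ℕ.*-mono-< 0<s 0<q) h
      (≐-trans (mul-congʳ h (≐-sym (⟨⟩-⟨⟩ f q s))) e)

    mutual
      num-cancellable : ∀ ps → All Prime ps → Cancellable (num ps)
      num-cancellable [] _ s 0<s g e = monic-≐0 (monic-⟨⟩ s 0<s monic-X-1) g (λ i _ → at e i)
      num-cancellable (q ∷ ps) (pq ∷ a) = cancellable-* {num ps ⟨ q ⟩} {den ps}
        (cancellable-⟨⟩ {num ps} q (prime>0 pq) (num-cancellable ps a)) (den-cancellable ps a)

      den-cancellable : ∀ ps → All Prime ps → Cancellable (den ps)
      den-cancellable [] _ s 0<s g e = ≐-trans (≐-sym (P.*-identityʳ g)) (≐-trans (mul-congʳ g (≐-sym (Sub.φ-1 s))) e)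
      den-cancellable (q ∷ ps) (pq ∷ a) = cancellable-* {den ps ⟨ q ⟩} {num ps}
        (cancellable-⟨⟩ {den ps} q (prime>0 pq) (den-cancellable ps a)) (num-cancellable ps a)

  -- `num≐Φ*den` and `den-cancel` tie Φ to the equality `_≈[_]_` of the statement; the
  -- divisibilities by Φ supply ζ^m = 1, the Galois action and the vanishing sums.
  record CyclotomicPoly (m : ℕ) : Set where
    field
      0<m       : 0 < m
      Φ         : Poly
      d         : ℕ
      Φ-monic   : Monic (suc d) Φ
      Φ∣X^m-1   : Φ P.∣ X P.^ m P.- P.1#
      Φ∣Φ⟨⟩     : ∀ s → 0 < s → Coprime s m → Φ P.∣ Φ ⟨ s ⟩
      Φ∣geo     : ∀ p → Prime p → ∀ e → e ℕ.* p ≡ m → Φ P.∣ geo p (X P.^ e)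
      num≐Φ*den : cycloNum m ≐ Φ P.* cycloDen m
      den-cancel : ∀ g → g P.* cycloDen m ≐ [] → g ≐ []

  module Construct (m : ℕ) (0<m : 0 < m) (k : ℕ) (ps : List ℕ) (pl : PrimeList ps) (m≡ : m ≡ k ℕ.* product ps)
                   (has : ∀ q → Prime q → q ℕ.∣ m → q ∈ ps) (T : Tower ps) where
    open CyclotomicTower.Tower T

    0<k : 0 < k
    0<k = ℕ.n≢0⇒n>0 (λ k≡0 → ℕ.<⇒≢ 0<m (sym (trans m≡ (cong (ℕ._* product ps) k≡0))))

    0<deg : 0 < k ℕ.* degree
    0<deg = ℕ.*-mono-< 0<k degree>0

    coprime-ps : ∀ {s} → Coprime s m → Coprime s (product ps)
    coprime-ps = coprime-∣ʳ (ℕ.divides k m≡)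

    cyclotomicPoly : CyclotomicPoly m
    cyclotomicPoly = record
      { 0<m = 0<m ; Φ = F ⟨ k ⟩ ; d = ℕ.pred (k ℕ.* degree)
      ; Φ-monic = subst (λ n → Monic n (F ⟨ k ⟩)) (sym (ℕ.suc-pred (k ℕ.* degree) {{ℕ.>-nonZero 0<deg}})) (monic-⟨⟩ k 0<k F-monic)
      ; Φ∣X^m-1 = P.∣-resp (≐-trans (Sub.φ-sub k (X P.^ product ps) P.1#) (P.+-cong
          (≐-trans (X^⟨⟩ (product ps) k) (P.^-congʳ X (sym m≡))) (P.-‿cong {P.1# ⟨ k ⟩} (Sub.φ-1 k)))) (Sub.φ-∣ k F∣X^-1)
      ; Φ∣Φ⟨⟩ = λ s 0<s h → c s 0<s (coprime-ps h) ⟨ k ⟩ P., ≐-trans (⟨⟩-comm F k s)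
          (≐-trans (⟨⟩-cong k (F⟨⟩ s 0<s (coprime-ps h))) (Sub.φ-* k F (c s 0<s (coprime-ps h))))
      ; Φ∣geo = Σζ
      ; num≐Φ*den = ≐-trans (cycloNum≐ m k ps 0<m pl m≡ has) (≐-trans (⟨⟩-cong k num≐F*den)
          (≐-trans (Sub.φ-* k F (den ps)) (mul-congʳ (F ⟨ k ⟩) (≐-sym (cycloDen≐ m k ps 0<m pl m≡ has)))))
      ; den-cancel = λ g e → den-cancellable ps (proj₁ pl) k 0<k g (≐-trans (mul-congʳ g (≐-sym (cycloDen≐ m k ps 0<m pl m≡ has))) e)
      }
      where
      Σζ : ∀ p → Prime p → ∀ e → e ℕ.* p ≡ m → F ⟨ k ⟩ P.∣ geo p (X P.^ e)
      Σζ p pp e e*p≡m with product-∣ (has p pp (ℕ.divides e (sym e*p≡m)))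
      ... | ℕ.divides j P≡ = P.∣-resp (≐-trans (geo-⟨⟩ p j k) (geo-cong p (P.^-congʳ X kj≡e)))
              (Sub.φ-∣ k (F∣geo p (prime>0 pp) (has p pp (ℕ.divides e (sym e*p≡m))) j (sym P≡)))
        where
        kj≡e : k ℕ.* j ≡ e
        kj≡e = ℕ.*-cancelʳ-≡ (k ℕ.* j) e p {{ℕ.>-nonZero (prime>0 pp)}}
          (trans (ℕ.*-assoc k j p) (trans (cong (k ℕ.*_) (sym P≡)) (trans (sym m≡) (sym e*p≡m))))

  cyclotomicPoly : ∀ m → 0 < m → CyclotomicPoly m
  cyclotomicPoly m 0<m with radical m 0<m
  ... | ps ,, k ,, allp ,, uniq ,, m≡ ,, has =
    Construct.cyclotomicPoly m 0<m k ps (allp ,, uniq) m≡ has (tower ps allp uniq)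

  module Cyclotomic {m : ℕ} (C : CyclotomicPoly m) where
    open CyclotomicPoly C
    open P.Solver
    open Division Φ-monic

    module R = Ring (ℤ[x] /⟨ Φ ⟩)

    -- The relation `_≈[_]_` says (p - q) A = r B for a pair with B = Φ A; the regular factor A
    -- cancels.
    ≈⇒≡ : ∀ {p q} → p ≈[ m ] q → p P.≡[ Φ ] q
    ≈⇒≡ {p} {q} (r ,, z) = P.cg (r P., P.x∙y⁻¹≈ε⇒x≈y (p P.- q) (Φ P.* r)
      (den-cancel (p P.- q P.- Φ P.* r) (begin
        (p P.- q P.- Φ P.* r) P.* cycloDen m
          ≈⟨ solve 4 (λ x f r a → (x :- f :* r) :* a := x :* a :- r :* (f :* a)) ≐-refl (p P.- q) Φ r (cycloDen m) ⟩
        (p P.- q) P.* cycloDen m P.- r P.* (Φ P.* cycloDen m)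
          ≈⟨ P.+-congˡ {(p P.- q) P.* cycloDen m} (P.-‿cong (mul-congʳ r num≐Φ*den)) ⟨
        (p P.- q) P.* cycloDen m P.- r P.* cycloNum m              ≈⟨ IsZero⇒≐ z ⟩
        []                                                         ∎)))
      where open import Relation.Binary.Reasoning.Setoid P.setoid

    ≡⇒≈ : ∀ {p q} → p P.≡[ Φ ] q → p ≈[ m ] q
    ≡⇒≈ {p} {q} (P.cg (r P., e)) = r ,, ≐⇒IsZero (begin
      (p P.- q) P.* cycloDen m P.- r P.* cycloNum m
        ≈⟨ P.+-cong (mul-cong e (≐-refl {cycloDen m})) (P.-‿cong (mul-congʳ r num≐Φ*den)) ⟩
      (Φ P.* r) P.* cycloDen m P.- r P.* (Φ P.* cycloDen m)
        ≈⟨ solve 3 (λ f r a → (f :* r) :* a :- r :* (f :* a) := con 0ℤ) ≐-refl Φ r (cycloDen m) ⟩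
      []                                                           ∎)
      where open import Relation.Binary.Reasoning.Setoid P.setoid

    quot : IsHom ℤ[x] (ℤ[x] /⟨ Φ ⟩) (λ f → f)
    quot = quotient-isHom ℤ[x] Φ

    module Quot = HomProps quot

    X^m≡1 : X P.^ m P.≡[ Φ ] P.1#
    X^m≡1 = P.cg Φ∣X^m-1

    ⟨⟩-≡ : ∀ s → Coprime s m → ∀ {f g} → f P.≡[ Φ ] g → f ⟨ s ⟩ P.≡[ Φ ] g ⟨ s ⟩
    ⟨⟩-≡ (suc s) h {f} {g} (P.cg e) = P.cg (P.∣-trans (Φ∣Φ⟨⟩ (suc s) (s≤s z≤n) h) (P.∣-resp (Sub.φ-sub (suc s) f g) (Sub.φ-∣ (suc s) e)))
    -- The exponent 0 is prime to m only if m = 1. Then X^0 and X^m agree modulo Φ, and the positive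
    -- exponent m can be used instead.
    ⟨⟩-≡ zero    h {f} {g} e = P.≡-trans (P.≡-sym (m→0 f)) (P.≡-trans (go m≡1 m→0 e) (m→0 g))
      where
      m≡1 : m ≡ 1
      m≡1 = 0-coprimeTo-m⇒m≡1 h
      m→0 : ∀ f → f ⟨ m ⟩ P.≡[ Φ ] f ⟨ 0 ⟩
      m→0 f = PE.ev-≡ f X^m≡1
      go : m ≡ 1 → _ → f P.≡[ Φ ] g → f ⟨ m ⟩ P.≡[ Φ ] g ⟨ m ⟩
      go e1 _ (P.cg e) = P.cg (P.∣-trans (Φ∣Φ⟨⟩ m 0<m (λ { (i∣m ,, _) → ℕ.∣1⇒≡1 (subst (_ ℕ.∣_) e1 i∣m) }))
        (P.∣-resp (Sub.φ-sub m f g) (Sub.φ-∣ m e)))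

    substP-isHom : ∀ s → Coprime s m → IsHom (ℤ[x] /⟨ Φ ⟩) (ℤ[x] /⟨ Φ ⟩) (substP s)
    substP-isHom s h = record
      { φ-cong = λ {f} {g} e → P.≡-resp (≐-sym (substP≐ev s f)) (≐-sym (substP≐ev s g)) (⟨⟩-≡ s h e)
      ; φ-+ = λ f g → P.≡-refl (≐-trans (substP≐ev s (f P.+ g)) (≐-trans (Sub.φ-+ s f g) (≐-sym (add-cong (substP≐ev s f) (substP≐ev s g)))))
      ; φ-* = λ f g → P.≡-refl (≐-trans (substP≐ev s (f P.* g)) (≐-trans (Sub.φ-* s f g) (≐-sym (mul-cong (substP≐ev s f) (substP≐ev s g)))))
      ; φ-1 = P.≡-refl (≐-trans (substP≐ev s P.1#) (Sub.φ-1 s)) }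

    ι*-≡0 : ∀ c f → R.ι c R.* f R.≈ R.0# → P.ι c P.* f P.≡[ Φ ] P.0#
    ι*-≡0 c f e = P.≡-trans (P.≡-* {a = P.ι c} {b = R.ι c} {a' = f} {b' = f} (Quot.φ-ι c) (P.≡-refl ≐-refl)) e

    -- With `r` the remainder of `f`, the polynomial c r is a multiple of the monic Φ but has
    -- smaller degree, so it vanishes.
    torsion-free-Φ : ∀ c f → c ≢ 0ℤ → P.ι c P.* f P.≡[ Φ ] P.0# → f P.≡[ Φ ] P.0#
    torsion-free-Φ c f c≢0 (P.cg (h P., e')) with divide f
    ... | q ,, r ,, f≐ ,, red = P.∣⇒≡ (P.∣-resp (≐-sym (≐-trans f≐ (≐-trans (P.+-congˡ {q P.* Φ} r≐0) (P.+-identityʳ (q P.* Φ))))) (q P., P.*-comm q Φ))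
      where
      g = h P.- P.ι c P.* q
      gΦ≐ : g P.* Φ ≐ P.ι c P.* r
      gΦ≐ = ≐-trans (solve 4 (λ h c q f → (h :- c :* q) :* f := f :* h :- c :* (q :* f)) ≐-refl h (P.ι c) q Φ)
        (≐-trans (P.+-congʳ {x = P.- (P.ι c P.* (q P.* Φ))} (≐-sym e'))
        (≐-trans (P.+-congʳ {x = P.- (P.ι c P.* (q P.* Φ))} (P.+-congʳ {x = P.- P.0#} (P.*-congˡ {P.ι c} f≐)))
        (solve 4 (λ c q f r → (c :* (q :* f :+ r) :- con 0ℤ) :- c :* (q :* f) := c :* r) ≐-refl (P.ι c) q Φ r)))
      coeff-cr : ∀ i → coeff (g P.* Φ) i ≡ c ℤ.* coeff r i
      coeff-cr i = trans (at gΦ≐ i) (trans (sym (at (scale≐ι* c r) i)) (coeff-scale c r i))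
      g≐0 : g ≐ []
      g≐0 = monic-≐0 Φ-monic g (λ i d≤i → trans (coeff-cr i) (trans (cong (c ℤ.*_) (red i d≤i)) (ℤ.*-zeroʳ c)))
      r≐0 : r ≐ []
      r≐0 = mk λ i → ℤ.*-cancelˡ-≡ c (coeff r i) 0ℤ {{ℤ.≢-nonZero c≢0}} (trans (sym (coeff-cr i))
        (trans (at (mul-cong g≐0 (≐-refl {Φ})) i) (sym (ℤ.*-zeroʳ c))))

    R-torsion-free : ∀ c f → c ≢ 0ℤ → R.ι c R.* f R.≈ R.0# → f R.≈ R.0#
    R-torsion-free c f c≢0 e = torsion-free-Φ c f c≢0 (ι*-≡0 c f e)

    ι* : ∀ K g → R.ι K R.* g P.≡[ Φ ] P.ι K P.* g
    ι* K g = P.≡-* {a = R.ι K} {b = P.ι K} {a' = g} {b' = g} (P.≡-sym (Quot.φ-ι K)) (P.≡-refl ≐-refl)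

    ι∣-split : ∀ K f g → f P.≡[ Φ ] P.ι K P.* g → ∃₂ λ g h → f ≐ P.ι K P.* g P.+ h P.* Φ
    ι∣-split K f g (P.cg (h P., e')) = g ,, h ,, ≐-trans (solve 2 (λ f x → f := x :+ (f :- x)) ≐-refl f (P.ι K P.* g))
          (P.+-congˡ {P.ι K P.* g} (≐-trans e' (mul-comm Φ h)))

    ι∣⇒ : ∀ K f → R.ι K R.∣ f → ∃₂ λ g h → f ≐ P.ι K P.* g P.+ h P.* Φ
    ι∣⇒ K f d = ι∣-split K f (R._∣_.quotient d) (P.≡-trans (R._∣_.equality d) (ι* K (R._∣_.quotient d)))

    1-proper : ∀ p → 1 < p → ¬ (∃₂ λ g h → P.1# ≐ P.ι (+ p) P.* g P.+ h P.* Φ)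
    1-proper p 1<p (g ,, h ,, e) = ℕ.<⇒≢ 1<p (sym (ℕ.∣1⇒≡1 (Z∣⇒∣ {p} {1ℤ} (reduced-∣ P.1# g h (λ { (suc i) _ → refl }) e 0))))

    R-proper : ∀ p → 1 < p → ¬ R.ι (+ p) R.∣ R.1#
    R-proper p 1<p h = 1-proper p 1<p (ι∣⇒ (+ p) R.1# h)

    Z∣? : ∀ n a → Dec ((+ n) Z.∣ a)
    Z∣? n a = map′ (∣⇒Z∣abs a) Z∣⇒∣ (n ℕ.∣? ℤ.∣ a ∣)

    split-≡ : ∀ K f g h → f ≐ P.ι K P.* g P.+ h P.* Φ → f P.≡[ Φ ] P.ι K P.* g
    split-≡ K f g h e = (P.cg (h P., ≐-trans (P.+-congʳ {x = P.- (P.ι K P.* g)} e) (solve 3 (λ x h f → (x :+ h :* f) :- x := f :* h) ≐-refl (P.ι K P.* g) h Φ)))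

    ι∣-from-split : ∀ K f g h → f ≐ P.ι K P.* g P.+ h P.* Φ → R.ι K R.∣ f
    ι∣-from-split K f g h e = g R., P.≡-trans (split-≡ K f g h e) (P.≡-sym (ι* K g))

    remainder-∣ : ∀ n f q r → f ≐ q P.* Φ P.+ r → Reduced r → (∃₂ λ g h → f ≐ P.ι (+ n) P.* g P.+ h P.* Φ) → All (λ a → (+ n) Z.∣ a) r
    remainder-∣ n f q r f≐ red (g ,, h ,, e) = coeff-all r (reduced-∣ r g (h P.- q) red (begin
        r                                             ≈⟨ solve 2 (λ r y → r := (y :+ r) :- y) ≐-refl r (q P.* Φ) ⟩
        (q P.* Φ P.+ r) P.- q P.* Φ                   ≈⟨ P.+-congʳ {x = P.- (q P.* Φ)} (≐-trans (≐-sym f≐) e) ⟩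
        (P.ι (+ n) P.* g P.+ h P.* Φ) P.- q P.* Φ     ≈⟨ solve 4 (λ a h f q → (a :+ h :* f) :- q :* f := a :+ (h :- q) :* f) ≐-refl (P.ι (+ n) P.* g) h Φ q ⟩
        P.ι (+ n) P.* g P.+ (h P.- q) P.* Φ           ∎))
      where open import Relation.Binary.Reasoning.Setoid P.setoid

    ∣-remainder : ∀ n f q r → f ≐ q P.* Φ P.+ r → All (λ a → (+ n) Z.∣ a) r → ∃₂ λ g h → f ≐ P.ι (+ n) P.* g P.+ h P.* Φ
    ∣-remainder n f q r f≐ h = proj₁ g ,, q ,, ≐-trans f≐ (≐-trans (P.+-comm (q P.* Φ) r) (P.+-congʳ {x = q P.* Φ} (proj₂ g)))
      where
      g : ∃ λ g → r ≐ P.ι (+ n) P.* g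
      g = all-scale r h

    -- Divisibility by `n` can be tested on the coefficients of the remainder modulo Φ, by
    -- `reduced-∣`.
    R-ι∣? : ∀ n f → Dec (R.ι (+ n) R.∣ f)
    R-ι∣? n f = decide (divide f)
      where
      decide : (∃₂ λ q r → f ≐ q P.* Φ P.+ r × Reduced r) → Dec (R.ι (+ n) R.∣ f)
      decide (q ,, r ,, f≐ ,, red) = map′
        (λ h → ι∣-from-split (+ n) f (proj₁ (∣-remainder n f q r f≐ h)) (proj₁ (proj₂ (∣-remainder n f q r f≐ h))) (proj₂ (proj₂ (∣-remainder n f q r f≐ h))))
        (λ h → remainder-∣ n f q r f≐ red (ι∣⇒ (+ n) f h))
        (All.all? (Z∣? n) r)

    R-rep-ev : ∀ f → f R.≈ Eval.ev (ℤ[x] /⟨ Φ ⟩) X f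
    R-rep-ev f = P.≡-trans (P.≡-refl (≐-sym (ev-self f))) (Quot.φ-ev X f)

    R-ζ^m : X R.^ m R.≈ R.1#
    R-ζ^m = P.≡-trans (P.≡-sym (Quot.φ-^ X m)) X^m≡1

    R-σ-ζ : ∀ s → Coprime s m → substP s X R.≈ X R.^ s
    R-σ-ζ s _ = P.≡-trans (P.≡-refl (≐-trans (substP≐ev s X) (PE.ev-X (X P.^ s)))) (Quot.φ-^ X s)

    pow-R : ∀ e i → (X P.^ e) P.^ i R.≈ (X R.^ e) R.^ i
    pow-R e i = P.≡-trans (Quot.φ-^ (X P.^ e) i) (R.^-congˡ i {X P.^ e} {X R.^ e} (Quot.φ-^ X e))

    geo-R : ∀ p e → geo p (X P.^ e) R.≈ R.Σ< p ((X R.^ e) R.^_)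
    geo-R p e = P.≡-trans (Quot.φ-Σ p ((X P.^ e) P.^_)) (R.Σ<-cong p {(X P.^ e) P.^_} {(X R.^ e) R.^_} (λ i _ → pow-R e i))

    R-Σζ≈0 : ∀ p → Prime p → ∀ e → e ℕ.* p ≡ m → R.Σ< p ((X R.^ e) R.^_) R.≈ R.0#
    R-Σζ≈0 p pp e h = P.≡-trans (P.≡-sym (geo-R p e)) (P.∣⇒≡ (Φ∣geo p pp e h))

    isCyclotomic : IsCyclotomic m (ℤ[x] /⟨ Φ ⟩) X substP
    isCyclotomic = record
      { 0<m = 0<m ; rep-ev = λ f → f ,, R-rep-ev f ; ζ^m = R-ζ^m ; σ-hom = substP-isHom ; σ-ζ = R-σ-ζ
      ; torsion-free = R-torsion-free ; proper = R-proper ; Σζ≈0 = R-Σζ≈0 ; ι∣? = R-ι∣? }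

-- Orthogonality of roots of unity, integrality of traces, and the trace form.

module TraceForm where

  open import Defs using (Poly)
  open RingTools
  open IntegerPolynomials
  open NumberTheory
  open IndexedSums
  open CyclotomicRings
  open import Algebra.Bundles using (CommutativeRing)
  open import Data.Nat as ℕ using (ℕ; zero; suc; z≤n; s≤s; _<_; _∸_)
  import Data.Nat.Properties as ℕ
  import Data.Nat.Divisibility as ℕ
  open import Data.Nat.DivMod using (_%_; m%n<n)
  open import Data.Nat.GCD using (gcd; gcd[m,n]∣m; gcd[m,n]∣n; gcd-greatest)
  open import Data.Nat.Coprimality as Cop using (Coprime; coprime?)
  open import Data.Nat.Primality using (Prime; euclidsLemma)
  open import Data.Nat.ListAction using (product)
  open import Data.Integer as ℤ using (ℤ; +_; 0ℤ; -1ℤ)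
  import Data.Integer.Properties as ℤ
  open import Data.List using ([]; _∷_)
  open import Data.List.Relation.Unary.All as All using (All; []; _∷_)
  open import Data.List.Relation.Unary.AllPairs using ([]; _∷_)
  open import Data.List.Relation.Unary.Unique.Propositional using (Unique)
  open import Data.List.Membership.Propositional using (_∈_)
  open import Data.Product using (∃; ∃₂; _×_; proj₁; proj₂) renaming (_,_ to _,,_)
  open import Data.Sum using (inj₁; inj₂; [_,_]′)
  open import Data.Empty using (⊥-elim)
  open import Level using (0ℓ)
  open import Relation.Nullary
  open import Relation.Nullary.Decidable using (map′)
  open import Relation.Binary.PropositionalEquality as ≡ using (_≡_; _≢_)

  -- The subgroup of ℤ/m generated by `k` is nontrivial, so it contains an element m/p of prime
  -- order. Questions on ζ^k - 1 thereby reduce to ζ^(m/p) - 1.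
  subgroup-prime : ∀ m k → 0 < m → ¬ m ℕ.∣ k → ∃ λ p → Prime p × ∃₂ λ e w → (e ℕ.* p ≡ m) × (k ℕ.* w ≡ e mod m)
  subgroup-prime m k 0<m m∤k = main (gcd k m) (gcd[m,n]∣m k m) (gcd[m,n]∣n k m) gcd-greatest
    where
    main : ∀ g → g ℕ.∣ k → g ℕ.∣ m → (∀ {d} → d ℕ.∣ k → d ℕ.∣ m → d ℕ.∣ g) → ∃ λ p → Prime p × ∃₂ λ e w → (e ℕ.* p ≡ m) × (k ℕ.* w ≡ e mod m)
    main g (ℕ.divides k' k≡) (ℕ.divides m' m≡) greatest = found (primeDivisor m' 1<m')
      where
      g≢0 : g ≢ 0
      g≢0 g≡0 = ℕ.<⇒≢ 0<m (≡.sym (≡.trans m≡ (≡.trans (≡.cong (m' ℕ.*_) g≡0) (ℕ.*-zeroʳ m'))))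
      0<m' : 0 < m'
      0<m' = ℕ.n≢0⇒n>0 (λ m'≡0 → ℕ.<⇒≢ 0<m (≡.sym (≡.trans m≡ (≡.cong (ℕ._* g) m'≡0))))
      1<m' : 1 < m'
      1<m' = ℕ.≤∧≢⇒< 0<m' (λ 1≡m' → m∤k (ℕ.divides k' (≡.trans k≡ (≡.cong (k' ℕ.*_)
        (≡.sym (≡.trans m≡ (≡.trans (≡.cong (ℕ._* g) (≡.sym 1≡m')) (ℕ.*-identityˡ g))))))))
      cop : Coprime k' m'
      cop {d} (ℕ.divides a e ,, ℕ.divides b f) = ℕ.∣1⇒≡1 (ℕ.*-cancelʳ-∣ {d} {1} g {{ℕ.≢-nonZero g≢0}}
        (≡.subst (d ℕ.* g ℕ.∣_) (≡.sym (ℕ.*-identityˡ g)) (greatest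
          (ℕ.divides a (≡.trans k≡ (≡.trans (≡.cong (ℕ._* g) e) (ℕ.*-assoc a d g))))
          (ℕ.divides b (≡.trans m≡ (≡.trans (≡.cong (ℕ._* g) f) (ℕ.*-assoc b d g)))))))
      found : (∃ λ p → Prime p × p ℕ.∣ m') → ∃ λ p → Prime p × ∃₂ λ e w → (e ℕ.* p ≡ m) × (k ℕ.* w ≡ e mod m)
      found (p ,, pp ,, ℕ.divides m″ m'≡) = p ,, pp ,, m″ ℕ.* g ,, w ℕ.* m″ ,, eq₁ ,, eq₂ (proj₂ (mod-inverse 0<m' cop))
        where
        w : ℕ
        w = proj₁ (mod-inverse 0<m' cop)
        eq₁ : m″ ℕ.* g ℕ.* p ≡ m
        eq₁ = ≡.trans (lem m″ g p) (≡.trans (≡.cong (ℕ._* g) (≡.sym m'≡)) (≡.sym m≡))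
          where
          open import Data.Nat.Solver using (module +-*-Solver)
          open +-*-Solver
          lem : ∀ a b c → a ℕ.* b ℕ.* c ≡ a ℕ.* c ℕ.* b
          lem = solve 3 (λ a b c → a :* b :* c := a :* c :* b) ≡.refl
        eq₂ : w ℕ.* k' ≡ 1 mod m' → k ℕ.* (w ℕ.* m″) ≡ m″ ℕ.* g mod m
        eq₂ (Z.cg (q Z., e)) = Z.cg ((q ℤ.* + m″) Z., (begin
          + (k ℕ.* (w ℕ.* m″)) ℤ.- + (m″ ℕ.* g)
            ≡⟨ ≡.cong (λ z → + z ℤ.- + (m″ ℕ.* g)) (≡.trans (≡.cong (ℕ._* (w ℕ.* m″)) k≡) (lem₁ k' g w m″)) ⟩
          + (w ℕ.* k' ℕ.* (m″ ℕ.* g)) ℤ.- + (m″ ℕ.* g)      ≡⟨ ≡.cong (ℤ._- + (m″ ℕ.* g)) (ℤ.pos-* (w ℕ.* k') (m″ ℕ.* g)) ⟩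
          + (w ℕ.* k') ℤ.* + (m″ ℕ.* g) ℤ.- + (m″ ℕ.* g)    ≡⟨ lem₂ (+ (w ℕ.* k')) (+ (m″ ℕ.* g)) ⟩
          (+ (w ℕ.* k') ℤ.- + 1) ℤ.* + (m″ ℕ.* g)           ≡⟨ ≡.cong₂ ℤ._*_ e (ℤ.pos-* m″ g) ⟩
          (+ m' ℤ.* q) ℤ.* (+ m″ ℤ.* + g)                   ≡⟨ lem₃ (+ m') q (+ m″) (+ g) ⟩
          (+ m' ℤ.* + g) ℤ.* (q ℤ.* + m″)                   ≡⟨ ≡.cong (ℤ._* (q ℤ.* + m″)) (≡.trans (≡.sym (ℤ.pos-* m' g)) (≡.cong +_ (≡.sym m≡))) ⟩
          + m ℤ.* (q ℤ.* + m″)                              ∎))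
          where
          open ≡.≡-Reasoning
          lem₁ : ∀ a b c d → a ℕ.* b ℕ.* (c ℕ.* d) ≡ c ℕ.* a ℕ.* (d ℕ.* b)
          lem₁ = solve 4 (λ a b c d → a :* b :* (c :* d) := c :* a :* (d :* b)) ≡.refl
            where
            open import Data.Nat.Solver using (module +-*-Solver)
            open +-*-Solver
          lem₂ : ∀ a b → a ℤ.* b ℤ.- b ≡ (a ℤ.- + 1) ℤ.* b
          lem₂ = solve 2 (λ a b → a :* b :- b := (a :- con (+ 1)) :* b) ≡.refl
                where
                  open Z.Solver
          lem₃ : ∀ a b c d → (a ℤ.* b) ℤ.* (c ℤ.* d) ≡ (a ℤ.* d) ℤ.* (b ℤ.* c)
          lem₃ = solve 4 (λ a b c d → (a :* b) :* (c :* d) := (a :* d) :* (b :* c)) ≡.refl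
                where
                  open Z.Solver

  coprime-byPrimeList : ∀ {N ps} → 0 < N → All Prime ps → (∀ q → Prime q → q ℕ.∣ N → q ∈ ps) → (∀ q → q ∈ ps → q ℕ.∣ N) →
    ∀ s → (Coprime s N → All (λ p → ¬ p ℕ.∣ s) ps) × (All (λ p → ¬ p ℕ.∣ s) ps → Coprime s N)
  coprime-byPrimeList {N} {ps} 0<N prs has div s =
    (λ c → All.tabulate (λ {p} p∈ p∣s → prime∤1 (All.lookup prs p∈) (≡.subst (p ℕ.∣_) (c (p∣s ,, div p p∈)) ℕ.∣-refl))) ,,
    (λ a → coprimeByPrimes 0<N (λ p pp p∣s p∣N → All.lookup a (has p pp p∣N) p∣s))

  abstract
    -- Opaque, so that the brackets `when (cop? s N)` never unfold into gcd computations.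
    cop? : ∀ s n → Dec (Coprime s n)
    cop? = coprime?

  pred-coprime : ∀ m → 0 < m → Coprime (m ∸ 1) m
  pred-coprime (suc m) _ {d} (d∣m ,, d∣sm) = ℕ.∣1⇒≡1 (ℕ.∣m+n∣m⇒∣n (≡.subst (d ℕ.∣_) (ℕ.+-comm 1 m) d∣sm) d∣m)

  module Props {m : ℕ} {R : CommutativeRing 0ℓ 0ℓ} {ζ σ} (C : IsCyclotomic m R ζ σ) where
    open IsCyclotomic C public
    open Ring R
    open Eval R
    open RingSums R
    open Solver
    open import Relation.Binary.Reasoning.Setoid setoid

    module σ s (h : Coprime s m) = HomProps (σ-hom s h)

    1≉0 : ¬ 1# ≈ 0#
    1≉0 e = proper 2 (s≤s (s≤s z≤n)) (∣-resp (sym e) ∣0)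

    ι-injective₀ : ∀ a → ι a ≈ 0# → a ≡ 0ℤ
    ι-injective₀ a e with a ℤ.≟ 0ℤ
    ... | yes a≡0 = a≡0
    ... | no a≢0  = ⊥-elim (1≉0 (torsion-free a 1# a≢0 (trans (*-identityʳ _) e)))

    ι-injective : ∀ a b → ι a ≈ ι b → a ≡ b
    ι-injective a b e = Z.x∙y⁻¹≈ε⇒x≈y a b (ι-injective₀ (a ℤ.- b) (trans (ι-- a b) (sub-self e)))

    ≈0? : ∀ f → Dec (f ≈ 0#)
    ≈0? f = map′ (λ { (q , e) → trans e (zeroˡ q) }) (λ e → ∣-resp (sym e) ∣0) (ι∣? 0 f)

    pow-mod : ∀ {x L} → x ^ L ≈ 1# → ∀ {a b} → a ≡ b mod L → x ^ a ≈ x ^ b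
    pow-mod {x} {L} h {a} {b} c with mod-cases {a} {b} {L} c
    ... | inj₁ (k ,, ≡.refl) = trans (^-homo-* x b (L ℕ.* k)) (trans (*-congˡ (trans (sym (^-assocʳ x L k)) (trans (^-congˡ k h) (1^n≈1 k)))) (*-identityʳ _))
    ... | inj₂ (k ,, ≡.refl) = sym (trans (^-homo-* x a (L ℕ.* k)) (trans (*-congˡ (trans (sym (^-assocʳ x L k)) (trans (^-congˡ k h) (1^n≈1 k)))) (*-identityʳ _)))

    ζ-mod : ∀ {a b} → a ≡ b mod m → ζ ^ a ≈ ζ ^ b
    ζ-mod = pow-mod ζ^m

    σ-ev : ∀ s → Coprime s m → ∀ p → σ s (ev ζ p) ≈ ev (ζ ^ s) p
    σ-ev s h p = trans (σ.φ-ev s h ζ p) (ev-congˡ p (σ-ζ s h))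

    σ-rep : ∀ s → Coprime s m → ∀ f → σ s f ≈ ev (ζ ^ s) (proj₁ (rep-ev f))
    σ-rep s h f = trans (σ.φ-cong s h (proj₂ (rep-ev f))) (σ-ev s h (proj₁ (rep-ev f)))

    σ-mod : ∀ {s t} → s ≡ t mod m → Coprime s m → Coprime t m → ∀ f → σ s f ≈ σ t f
    σ-mod {s} {t} e h k f = trans (σ-rep s h f) (trans (ev-congˡ (proj₁ (rep-ev f)) (ζ-mod {s} {t} e)) (sym (σ-rep t k f)))

    σ-1 : ∀ f → (h : Coprime 1 m) → σ 1 f ≈ f
    σ-1 f h = trans (σ-rep 1 h f) (trans (ev-congˡ (proj₁ (rep-ev f)) (*-identityʳ ζ)) (sym (proj₂ (rep-ev f))))

    σ-σ : ∀ s t → Coprime s m → Coprime t m → ∀ f → σ s (σ t f) ≈ ev (ζ ^ (t ℕ.* s)) (proj₁ (rep-ev f))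
    σ-σ s t h k f = trans (σ.φ-cong s h (σ-rep t k f)) (trans (σ.φ-ev s h (ζ ^ t) p)
      (ev-congˡ p (trans (σ.φ-^ s h ζ t) (trans (^-congˡ t (σ-ζ s h)) (trans (^-assocʳ ζ s t) (^-congʳ ζ (ℕ.*-comm s t)))))))
      where p = proj₁ (rep-ev f)

    σ-* : ∀ s t → Coprime s m → Coprime t m → (h : Coprime (t ℕ.* s) m) → ∀ f → σ s (σ t f) ≈ σ (t ℕ.* s) f
    σ-* s t h k hk f = trans (σ-σ s t h k f) (sym (σ-rep (t ℕ.* s) hk f))

    σ-comm : ∀ s t → Coprime s m → Coprime t m → ∀ f → σ s (σ t f) ≈ σ t (σ s f)
    σ-comm s t h k f = trans (σ-σ s t h k f) (trans (ev-congˡ (proj₁ (rep-ev f)) (^-congʳ ζ (ℕ.*-comm t s))) (sym (σ-σ t s k h f)))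

    σ-ζ^ : ∀ s → Coprime s m → ∀ k → σ s (ζ ^ k) ≈ ζ ^ (s ℕ.* k)
    σ-ζ^ s h k = trans (σ.φ-^ s h ζ k) (trans (^-congˡ k (σ-ζ s h)) (^-assocʳ ζ s k))

    -- The p powers of ζ^e sum to zero, so p is the sum of the elements 1 - (ζ^e)^i, all of them
    -- multiples of ζ^e - 1.
    ζ^e-1∣p : ∀ p → Prime p → ∀ e → e ℕ.* p ≡ m → ζ ^ e - 1# ∣ ι (+ p)
    ζ^e-1∣p p pp e ep≡m = ∣-resp p≈ (∣-neg (Σ<-∣ p {F = λ i → (ζ ^ e) ^ i - 1#} (x-1∣x^n-1 (ζ ^ e))))
      where
      p≈ : - Σ< p (λ i → (ζ ^ e) ^ i - 1#) ≈ ι (+ p)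
      p≈ = begin
        - Σ< p (λ i → (ζ ^ e) ^ i - 1#)                    ≈⟨ -‿cong (Σ<-sub p ((ζ ^ e) ^_) (λ _ → 1#)) ⟩
        - (Σ< p ((ζ ^ e) ^_) - Σ< p (λ _ → 1#))            ≈⟨ -‿cong (+-cong (Σζ≈0 p pp e ep≡m) (-‿cong (Σ<-const p 1#))) ⟩
        - (0# - ι (+ p) * 1#)                              ≈⟨ solve 1 (λ x → :- (con (+ 0) :- x :* con (+ 1)) := x) refl (ι (+ p)) ⟩
        ι (+ p)                                            ∎

    ζ^k-1∣p : ∀ k → ¬ m ℕ.∣ k → ∃ λ p → Prime p × ζ ^ k - 1# ∣ ι (+ p)
    ζ^k-1∣p k m∤k = proj₁ s ,, proj₁ (proj₂ s) ,, ∣-trans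
        (∣-resp (+-congʳ (trans (^-assocʳ ζ k w) (ζ-mod {k ℕ.* w} {e} (proj₂ (proj₂ (proj₂ (proj₂ (proj₂ s)))))))) (x-1∣x^n-1 (ζ ^ k) w))
        (ζ^e-1∣p (proj₁ s) (proj₁ (proj₂ s)) e (proj₁ (proj₂ (proj₂ (proj₂ (proj₂ s))))))
      where
      s = subgroup-prime m k 0<m m∤k
      e = proj₁ (proj₂ (proj₂ s))
      w = proj₁ (proj₂ (proj₂ (proj₂ s)))

    -- A divisor of a rational prime is regular, since the ring has no ℤ-torsion.
    ζ^k-1-regular : ∀ k → ¬ m ℕ.∣ k → ∀ f → (ζ ^ k - 1#) * f ≈ 0# → f ≈ 0#
    ζ^k-1-regular k m∤k f e = ∣p-regular (ζ^k-1∣p k m∤k)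
      where
      ∣p-regular : (∃ λ p → Prime p × ζ ^ k - 1# ∣ ι (+ p)) → f ≈ 0#
      ∣p-regular (p ,, pp ,, (q , pq)) = torsion-free (+ p) f (λ p≡0 → ℕ.<⇒≢ (prime>0 pp) (≡.sym (ℤ.+-injective p≡0))) (begin
        ι (+ p) * f               ≈⟨ *-congʳ pq ⟩
        ((ζ ^ k - 1#) * q) * f    ≈⟨ solve 3 (λ x q f → (x :* q) :* f := q :* (x :* f)) refl (ζ ^ k - 1#) q f ⟩
        q * ((ζ ^ k - 1#) * f)    ≈⟨ *-congˡ e ⟩
        q * 0#                    ≈⟨ zeroʳ q ⟩
        0#                        ∎)

    -- Multiplying the geometric sum by the regular element ζ^k - 1 gives ζ^(k L) - 1 = 0.
    orthogonal : ∀ L k → m ℕ.∣ k ℕ.* L → ¬ m ℕ.∣ k → Σ< L (λ i → ζ ^ (k ℕ.* i)) ≈ 0#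
    orthogonal L k m∣kL m∤k = trans (Σ<-cong L (λ i _ → sym (^-assocʳ ζ k i))) (ζ^k-1-regular k m∤k _ (begin
      (ζ ^ k - 1#) * Σ< L ((ζ ^ k) ^_)   ≈⟨ geometric (ζ ^ k) L ⟩
      (ζ ^ k) ^ L - 1#                   ≈⟨ +-congʳ (trans (^-assocʳ ζ k L) (ζ-mod {k ℕ.* L} {0} (∣⇒mod0 m∣kL))) ⟩
      1# - 1#                            ≈⟨ -‿inverseʳ 1# ⟩
      0#                                 ∎))

    diagonal : ∀ L k → m ℕ.∣ k → Σ< L (λ i → ζ ^ (k ℕ.* i)) ≈ ι (+ L)
    diagonal L k m∣k = trans (Σ<-cong L (λ i _ → ζ-mod {k ℕ.* i} {0} (∣⇒mod0 (ℕ.∣m⇒∣m*n i m∣k)))) (trans (Σ<-const L 1#) (*-identityʳ _))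

    avoid? : ∀ ps s → Dec (All (λ p → ¬ p ℕ.∣ s) ps)
    avoid? ps s = All.all? (λ p → ¬? (p ℕ.∣? s)) ps

    -- Ramanujan sums are integers: removing the multiples of one prime `p` leaves two such sums
    -- over fewer primes, one with `k` and one with `k * p` in the exponent.
    ramanujan : ∀ ps → All Prime ps → Unique ps → ∀ M k → m ℕ.∣ k ℕ.* (M ℕ.* product ps) →
      ∃ λ z → Σ< (M ℕ.* product ps) (λ s → when (avoid? ps s) (ζ ^ (k ℕ.* s))) ≈ ι z
    ramanujan [] _ _ M k h = byCases (m ℕ.∣? k)
      where
      byCases : Dec (m ℕ.∣ k) → ∃ λ z → Σ< (M ℕ.* 1) (λ s → ζ ^ (k ℕ.* s)) ≈ ι z
      byCases (yes m∣k) = + (M ℕ.* 1) ,, diagonal (M ℕ.* 1) k m∣k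
      byCases (no m∤k)  = 0ℤ ,, orthogonal (M ℕ.* 1) k h m∤k
    ramanujan (p ∷ ps) (pp ∷ prs) (p∉ ∷ u) M k h = proj₁ ih₁ ℤ.- proj₁ ih₂ ,, (begin
      Σ< N (λ s → when (avoid? (p ∷ ps) s) (ζ ^ (k ℕ.* s)))                  ≈⟨ Σ<-cong N (λ s _ → when-∷ s) ⟩
      Σ< N (λ s → when (¬? (p ℕ.∣? s)) (F s))                               ≡⟨ ≡.cong (λ n → Σ< n (λ s → when (¬? (p ℕ.∣? s)) (F s))) N≡ ⟩
      Σ< (K ℕ.* p) (λ s → when (¬? (p ℕ.∣? s)) (F s))
        ≈⟨ solve 2 (λ a b → a := (a :+ b) :- b) refl _ (Σ< K (λ d → F (d ℕ.* p))) ⟩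
      (Σ< (K ℕ.* p) (λ s → when (¬? (p ℕ.∣? s)) (F s)) + Σ< K (λ d → F (d ℕ.* p))) - Σ< K (λ d → F (d ℕ.* p))
        ≈⟨ +-congʳ (Σ<-multiples p (prime>0 pp) K F) ⟨
      Σ< (K ℕ.* p) F - Σ< K (λ d → F (d ℕ.* p))                             ≈⟨ +-cong (trans (reflexive (≡.cong (λ n → Σ< n F) N≡′)) (proj₂ ih₁)) (-‿cong (trans (Σ<-cong K (λ d _ → F-p d)) (proj₂ ih₂))) ⟩
      ι (proj₁ ih₁) - ι (proj₁ ih₂)                                         ≈⟨ ι-- (proj₁ ih₁) (proj₁ ih₂) ⟨
      ι (proj₁ ih₁ ℤ.- proj₁ ih₂)                                           ∎)
      where
      open import Data.Nat.Solver using (module +-*-Solver)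
      N = M ℕ.* (p ℕ.* product ps)
      K = M ℕ.* product ps
      N≡ : N ≡ K ℕ.* p
      N≡ = +-*-Solver.solve 3 (λ M p P → M +-*-Solver.:* (p +-*-Solver.:* P) +-*-Solver.:= M +-*-Solver.:* P +-*-Solver.:* p) ≡.refl M p (product ps)
      N≡′ : K ℕ.* p ≡ M ℕ.* p ℕ.* product ps
      N≡′ = +-*-Solver.solve 3 (λ M p P → M +-*-Solver.:* P +-*-Solver.:* p +-*-Solver.:= M +-*-Solver.:* p +-*-Solver.:* P) ≡.refl M p (product ps)
      F : ℕ → Carrier
      F s = when (avoid? ps s) (ζ ^ (k ℕ.* s))
      ih₁ : ∃ λ z → Σ< (M ℕ.* p ℕ.* product ps) F ≈ ι z
      ih₁ = ramanujan ps prs u (M ℕ.* p) k (≡.subst (λ n → m ℕ.∣ k ℕ.* n) (≡.trans N≡ N≡′) h)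
      ih₂ : ∃ λ z → Σ< K (λ s → when (avoid? ps s) (ζ ^ (k ℕ.* p ℕ.* s))) ≈ ι z
      ih₂ = ramanujan ps prs u M (k ℕ.* p) (≡.subst (m ℕ.∣_) (≡.trans (≡.cong (k ℕ.*_) (≡.trans N≡ (ℕ.*-comm K p))) (≡.sym (ℕ.*-assoc k p K))) h)
      when-∷ : ∀ s → when (avoid? (p ∷ ps) s) (ζ ^ (k ℕ.* s)) ≈ when (¬? (p ℕ.∣? s)) (F s)
      when-∷ s with p ℕ.∣? s | avoid? ps s
      ... | yes _ | _     = refl
      ... | no _  | yes _ = refl
      ... | no _  | no _  = refl
      F-p : ∀ d → F (d ℕ.* p) ≈ when (avoid? ps d) (ζ ^ (k ℕ.* p ℕ.* d))
      F-p d = trans (when-⇔ (avoid? ps (d ℕ.* p)) (avoid? ps d) (All.map (λ n q∣d → n (ℕ.∣m⇒∣m*n p q∣d))) to)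
                    (when-cong (avoid? ps d) (λ _ → ^-congʳ ζ (≡.trans (≡.cong (k ℕ.*_) (ℕ.*-comm d p)) (≡.sym (ℕ.*-assoc k p d)))))
        where
        to : All (λ q → ¬ q ℕ.∣ d) ps → All (λ q → ¬ q ℕ.∣ d ℕ.* p) ps
        to a = All.zipWith (λ { ((pq ,, p≢q) ,, n) q∣dp → [ n , (λ q∣p → p≢q (≡.sym (prime-∣-prime pq pp q∣p))) ]′ (euclidsLemma d p pq q∣dp) })
                 (All.zip (prs ,, p∉) ,, a)

    coprime-of : ∀ {N s} → m ℕ.∣ N → Coprime s N → Coprime s m
    coprime-of = coprime-∣ʳ

    -- For N a multiple of m this is a multiple of the trace. N = m gives the trace form; N = (2m)!
    -- serves elements whose conjugates are known only at exponents prime to (2m)!.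
    Tr : ℕ → Carrier → Carrier
    Tr N f = Σ< N (λ s → when (cop? s N) (σ s f))

    -- By linearity only powers of ζ matter, and for them the value is a Ramanujan sum.
    Tr-rational : ∀ N → 0 < N → m ℕ.∣ N → ∀ f → ∃ λ z → Tr N f ≈ ι z
    Tr-rational N 0<N m∣N f = byRadical (radical N 0<N)
      where
      byRadical : (∃₂ λ ps M → All Prime ps × Unique ps × N ≡ M ℕ.* product ps × (∀ q → Prime q → q ℕ.∣ N → q ∈ ps)) → ∃ λ z → Tr N f ≈ ι z
      byRadical (ps ,, M ,, prs ,, u ,, N≡ ,, has) = proj₁ (go 0 p₀) ,, trans (Σ<-cong N (λ s _ →
            trans (when-cong (cop? s N) (λ h → trans (σ-rep s (coprime-of m∣N h) f) (sym (*-identityˡ _)))) (when-⇔ (cop? s N) (avoid? ps s) (proj₁ (char s)) (proj₂ (char s)))))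
            (trans (reflexive (≡.cong (λ n → Σ< n (λ s → when (avoid? ps s) (1# * ev (ζ ^ s) p₀))) N≡)) (proj₂ (go 0 p₀)))
       where
       p₀ = proj₁ (rep-ev f)
       char : ∀ s → (Coprime s N → All (λ p → ¬ p ℕ.∣ s) ps) × (All (λ p → ¬ p ℕ.∣ s) ps → Coprime s N)
       char = coprime-byPrimeList 0<N prs has (λ q q∈ → ≡.subst (q ℕ.∣_) (≡.sym N≡) (ℕ.∣n⇒∣m*n M (product-∣ q∈)))
       N' = M ℕ.* product ps
       -- The factor ζ^(k s) records the degree already consumed by the Horner evaluation.
       go : ∀ k (p : Poly) → ∃ λ z → Σ< N' (λ s → when (avoid? ps s) (ζ ^ (k ℕ.* s) * ev (ζ ^ s) p)) ≈ ι z
       go k []      = 0ℤ ,, Σ<-0 N' (λ s _ → when-0 (avoid? ps s) (zeroʳ (ζ ^ (k ℕ.* s))))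
       go k (a ∷ p) = a ℤ.* proj₁ r ℤ.+ proj₁ (go (suc k) p) ,, (begin
         Σ< N' (λ s → when (avoid? ps s) (ζ ^ (k ℕ.* s) * (ι a + ζ ^ s * ev (ζ ^ s) p)))
           ≈⟨ Σ<-cong N' (λ s _ → split s) ⟩
         Σ< N' (λ s → ι a * when (avoid? ps s) (ζ ^ (k ℕ.* s)) + when (avoid? ps s) (ζ ^ (suc k ℕ.* s) * ev (ζ ^ s) p))
           ≈⟨ Σ<-+ N' (λ s → ι a * when (avoid? ps s) (ζ ^ (k ℕ.* s))) (λ s → when (avoid? ps s) (ζ ^ (suc k ℕ.* s) * ev (ζ ^ s) p)) ⟩
         Σ< N' (λ s → ι a * when (avoid? ps s) (ζ ^ (k ℕ.* s))) + Σ< N' (λ s → when (avoid? ps s) (ζ ^ (suc k ℕ.* s) * ev (ζ ^ s) p))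
           ≈⟨ +-cong (trans (sym (Σ<-*ˡ N' (ι a) (λ s → when (avoid? ps s) (ζ ^ (k ℕ.* s))))) (*-congˡ (proj₂ r))) (proj₂ (go (suc k) p)) ⟩
         ι a * ι (proj₁ r) + ι (proj₁ (go (suc k) p))       ≈⟨ +-congʳ (ι-* a (proj₁ r)) ⟨
         ι (a ℤ.* proj₁ r) + ι (proj₁ (go (suc k) p))       ≈⟨ ι-+ (a ℤ.* proj₁ r) (proj₁ (go (suc k) p)) ⟨
         ι (a ℤ.* proj₁ r ℤ.+ proj₁ (go (suc k) p))         ∎)
         where
         r : ∃ λ z → Σ< N' (λ s → when (avoid? ps s) (ζ ^ (k ℕ.* s))) ≈ ι z
         r = ramanujan ps prs u M k (ℕ.∣n⇒∣m*n k (≡.subst (m ℕ.∣_) N≡ m∣N))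
         split : ∀ s → when (avoid? ps s) (ζ ^ (k ℕ.* s) * (ι a + ζ ^ s * ev (ζ ^ s) p)) ≈
                       ι a * when (avoid? ps s) (ζ ^ (k ℕ.* s)) + when (avoid? ps s) (ζ ^ (suc k ℕ.* s) * ev (ζ ^ s) p)
         split s with avoid? ps s
         ... | no _  = solve 1 (λ a → con (+ 0) := a :* con (+ 0) :+ con (+ 0)) refl (ι a)
         ... | yes _ = trans (solve 4 (λ z a w e → z :* (a :+ w :* e) := a :* z :+ (w :* z) :* e) refl (ζ ^ (k ℕ.* s)) (ι a) (ζ ^ s) (ev (ζ ^ s) p))
                         (+-congˡ (*-congʳ (sym (^-homo-* ζ s (k ℕ.* s)))))

    τ : Carrier → ℤ
    τ f = proj₁ (Tr-rational m 0<m ℕ.∣-refl f)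

    ι-τ : ∀ f → Tr m f ≈ ι (τ f)
    ι-τ f = proj₂ (Tr-rational m 0<m ℕ.∣-refl f)

    Tr-cong : ∀ N → m ℕ.∣ N → ∀ {f g} → f ≈ g → Tr N f ≈ Tr N g
    Tr-cong N m∣N e = Σ<-cong N (λ s _ → when-cong (cop? s N) (λ h → σ.φ-cong s (coprime-of m∣N h) e))

    τ-cong : ∀ {f g} → f ≈ g → τ f ≡ τ g
    τ-cong {f} {g} e = ι-injective _ _ (trans (sym (ι-τ f)) (trans (Tr-cong m ℕ.∣-refl e) (ι-τ g)))

    τ-+ : ∀ f g → τ (f + g) ≡ τ f ℤ.+ τ g
    τ-+ f g = ι-injective _ _ (begin
      ι (τ (f + g))          ≈⟨ ι-τ (f + g) ⟨
      Tr m (f + g)           ≈⟨ Σ<-cong m (λ s _ → when-+ (cop? s m) (λ h → σ.φ-+ s h f g)) ⟩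
      Σ< m (λ s → when (cop? s m) (σ s f) + when (cop? s m) (σ s g))
                             ≈⟨ Σ<-+ m (λ s → when (cop? s m) (σ s f)) (λ s → when (cop? s m) (σ s g)) ⟩
      Tr m f + Tr m g        ≈⟨ +-cong (ι-τ f) (ι-τ g) ⟩
      ι (τ f) + ι (τ g)      ≈⟨ ι-+ (τ f) (τ g) ⟨
      ι (τ f ℤ.+ τ g)        ∎)

    τ-ι* : ∀ a f → τ (ι a * f) ≡ a ℤ.* τ f
    τ-ι* a f = ι-injective _ _ (begin
      ι (τ (ι a * f))        ≈⟨ ι-τ (ι a * f) ⟨
      Tr m (ι a * f)         ≈⟨ Σ<-cong m (λ s _ → trans (when-cong (cop? s m) (λ h → trans (σ.φ-* s h (ι a) f) (*-congʳ (σ.φ-ι s h a)))) (sym (when-* (cop? s m)))) ⟩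
      Σ< m (λ s → ι a * when (cop? s m) (σ s f))   ≈⟨ Σ<-*ˡ m (ι a) (λ s → when (cop? s m) (σ s f)) ⟨
      ι a * Tr m f           ≈⟨ *-congˡ (ι-τ f) ⟩
      ι a * ι (τ f)          ≈⟨ ι-* a (τ f) ⟨
      ι (a ℤ.* τ f)          ∎)

    τ-0 : τ 0# ≡ 0ℤ
    τ-0 = ≡.trans (τ-cong (sym (zeroˡ 1#))) (≡.trans (τ-ι* 0ℤ 1#) (ℤ.*-zeroˡ (τ 1#)))

    τ-sub : ∀ f g → τ (f - g) ≡ τ f ℤ.- τ g
    τ-sub f g = ≡.trans (τ-+ f (- g)) (≡.cong (ℤ._+_ (τ f)) (≡.trans (τ-cong (solve 1 (λ g → :- g := con -1ℤ :* g) refl g)) (≡.trans (τ-ι* -1ℤ g) (ℤ.-1*i≡-i (τ g)))))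

    -- Multiplication by `r` permutes the reduced residues modulo `m`.
    τ-σ : ∀ r → Coprime r m → ∀ f → τ (σ r f) ≡ τ f
    τ-σ r h f = ι-injective _ _ (begin
      ι (τ (σ r f))                                    ≈⟨ ι-τ (σ r f) ⟨
      Tr m (σ r f)                                     ≈⟨ Σ<-cong m (λ s _ → trans (when-cong (cop? s m) (λ k → σ-σ s r k h f)) (when-⇔ (cop? s m) (cop? (r ℕ.* s) m)
                                                            (λ k → Cop.sym (coprime-*ʳ (Cop.sym h) (Cop.sym k))) (λ k → coprime-∣ˡ (ℕ.n∣m*n r) k))) ⟩
      Σ< m (λ s → G (r ℕ.* s))                         ≈⟨ Σ<-reindex m r G 0<m h per ⟩
      Σ< m G                                           ≈⟨ Σ<-cong m (λ s _ → when-cong (cop? s m) (λ k → sym (σ-rep s k f))) ⟩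
      Tr m f                                           ≈⟨ ι-τ f ⟩
      ι (τ f)                                          ∎)
      where
      G : ℕ → Carrier
      G s = when (cop? s m) (ev (ζ ^ s) (proj₁ (rep-ev f)))
      per : ∀ {i j} → i ≡ j mod m → G i ≈ G j
      per {i} {j} e = trans (when-⇔ (cop? i m) (cop? j m) (coprime-mod e) (coprime-mod (Z.≡-sym e)))
                        (when-cong (cop? j m) (λ _ → ev-congˡ (proj₁ (rep-ev f)) (ζ-mod e)))

    -- Complex conjugation, with `m ∸ 1` as the exponent -1.
    conj : Carrier → Carrier
    conj = σ (m ∸ 1)

    cop-conj : Coprime (m ∸ 1) m
    cop-conj = pred-coprime m 0<m

    module Conj = σ (m ∸ 1) cop-conj

    -1*-mod : ∀ s → s ℕ.+ (m ∸ 1) ℕ.* s ≡ m ℕ.* s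
    -1*-mod s = ≡.cong (ℕ._* s) (ℕ.m+[n∸m]≡n 0<m)

    -- Finite Fourier analysis on ℤ/m: orthogonality leaves the pairs with equal indices, each
    -- counted `m` times. The factor `m ∸ 1` in the second exponent is the sign -1.
    parseval : ∀ (A B : ℕ → Carrier) →
      Σ< m (λ k → Σ< m (λ s → A s * ζ ^ (s ℕ.* k)) * Σ< m (λ s → B s * ζ ^ ((m ∸ 1) ℕ.* s ℕ.* k))) ≈ ι (+ m) * Σ< m (λ s → A s * B s)
    parseval A B = begin
      Σ< m (λ k → Σ< m (λ s → A s * ζ ^ (s ℕ.* k)) * Σ< m (λ t → B t * ζ ^ ((m ∸ 1) ℕ.* t ℕ.* k)))
        ≈⟨ Σ<-cong m (λ k _ → trans (Σ<-*ʳ m _ (λ s → A s * ζ ^ (s ℕ.* k))) (Σ<-cong m (λ s _ → trans (Σ<-*ˡ m _ (λ t → B t * ζ ^ ((m ∸ 1) ℕ.* t ℕ.* k)))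
             (Σ<-cong m (λ t _ → combine k s t))))) ⟩
      Σ< m (λ k → Σ< m (λ s → Σ< m (λ t → (A s * B t) * ζ ^ ((s ℕ.+ (m ∸ 1) ℕ.* t) ℕ.* k))))
        ≈⟨ Σ<-comm m m (λ k s → Σ< m (λ t → (A s * B t) * ζ ^ ((s ℕ.+ (m ∸ 1) ℕ.* t) ℕ.* k))) ⟩
      Σ< m (λ s → Σ< m (λ k → Σ< m (λ t → (A s * B t) * ζ ^ ((s ℕ.+ (m ∸ 1) ℕ.* t) ℕ.* k))))
        ≈⟨ Σ<-cong m (λ s s<m → trans (Σ<-comm m m (λ k t → (A s * B t) * ζ ^ ((s ℕ.+ (m ∸ 1) ℕ.* t) ℕ.* k)))
             (trans (Σ<-cong m (λ t _ → sym (Σ<-*ˡ m (A s * B t) (λ k → ζ ^ ((s ℕ.+ (m ∸ 1) ℕ.* t) ℕ.* k))))) (inner s s<m))) ⟩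
      Σ< m (λ s → ι (+ m) * (A s * B s))          ≈⟨ Σ<-*ˡ m (ι (+ m)) (λ s → A s * B s) ⟨
      ι (+ m) * Σ< m (λ s → A s * B s)            ∎
      where
      combine : ∀ k s t → (A s * ζ ^ (s ℕ.* k)) * (B t * ζ ^ ((m ∸ 1) ℕ.* t ℕ.* k)) ≈ (A s * B t) * ζ ^ ((s ℕ.+ (m ∸ 1) ℕ.* t) ℕ.* k)
      combine k s t = trans (solve 4 (λ a x b y → (a :* x) :* (b :* y) := (a :* b) :* (x :* y)) refl _ _ _ _)
        (*-congˡ (trans (sym (^-homo-* ζ (s ℕ.* k) ((m ∸ 1) ℕ.* t ℕ.* k))) (^-congʳ ζ (≡.sym (ℕ.*-distribʳ-+ k s ((m ∸ 1) ℕ.* t))))))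
      inner : ∀ s → s < m → Σ< m (λ t → (A s * B t) * Σ< m (λ k → ζ ^ ((s ℕ.+ (m ∸ 1) ℕ.* t) ℕ.* k))) ≈ ι (+ m) * (A s * B s)
      inner s s<m = trans (Σ<-single m s (λ t → (A s * B t) * Σ< m (λ k → ζ ^ ((s ℕ.+ (m ∸ 1) ℕ.* t) ℕ.* k))) s<m
        (λ t t<m t≢s → trans (*-congˡ (orthogonal m (s ℕ.+ (m ∸ 1) ℕ.* t) (ℕ.n∣m*n (s ℕ.+ (m ∸ 1) ℕ.* t)) (λ h → t≢s (mod-<⇒≡ t<m s<m (sub h))))) (zeroʳ _)))
        (trans (*-congˡ (diagonal m (s ℕ.+ (m ∸ 1) ℕ.* s) (≡.subst (m ℕ.∣_) (≡.sym (-1*-mod s)) (ℕ.m∣m*n s)))) (*-comm _ _))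
        where
        sub : ∀ {t} → m ℕ.∣ s ℕ.+ (m ∸ 1) ℕ.* t → t ≡ s mod m
        sub {t} h = Z.≡-sym (Z.cg (Z.∣-resp (lem (+ s) (+ t) (+ ((m ∸ 1) ℕ.* t))) (Z.∣-sub (∣⇒Z∣ h) (∣⇒Z∣ (≡.subst (m ℕ.∣_) (≡.sym (-1*-mod t)) (ℕ.m∣m*n t))))))
          where
          lem : ∀ s t r → (s ℤ.+ r) ℤ.- (t ℤ.+ r) ≡ s ℤ.- t
          lem = Z.Solver.solve 3 (λ s t r → (s Z.Solver.:+ r) Z.Solver.:- (t Z.Solver.:+ r) Z.Solver.:= s Z.Solver.:- t) ≡.refl

    -- The Fourier coefficients of s ↦ σ_s(f) on reduced residues. They are integers and determine
    -- `f`, so they serve as its coordinates.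
    d : ℕ → Carrier → ℤ
    d k f = τ (f * ζ ^ k)

    A : Carrier → ℕ → Carrier
    A f s = when (cop? s m) (σ s f)

    ι-d : ∀ k f → ι (d k f) ≈ Σ< m (λ s → A f s * ζ ^ (s ℕ.* k))
    ι-d k f = trans (sym (ι-τ (f * ζ ^ k))) (Σ<-cong m (λ s _ → trans
      (when-cong (cop? s m) (λ h → trans (σ.φ-* s h f (ζ ^ k)) (*-congˡ (σ-ζ^ s h k)))) (sym (when-*ʳ (cop? s m)))))

    d-conj : ∀ k f → ι (d k f) ≈ Σ< m (λ s → A (conj f) s * ζ ^ ((m ∸ 1) ℕ.* s ℕ.* k))
    d-conj k f = trans (reflexive (≡.cong ι (≡.trans (≡.sym (τ-σ (m ∸ 1) cop-conj (f * ζ ^ k)))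
      (τ-cong (trans (Conj.φ-* f (ζ ^ k)) (*-congˡ (σ-ζ^ (m ∸ 1) cop-conj k)))))))
      (trans (ι-d ((m ∸ 1) ℕ.* k) (conj f)) (Σ<-cong m (λ s _ → *-congˡ {A (conj f) s} (^-congʳ ζ (lem s (m ∸ 1) k)))))
      where
      open import Data.Nat.Solver using (module +-*-Solver)
      lem : ∀ s n k → s ℕ.* (n ℕ.* k) ≡ n ℕ.* s ℕ.* k
      lem = +-*-Solver.solve 3 (λ s n k → s +-*-Solver.:* (n +-*-Solver.:* k) +-*-Solver.:= n +-*-Solver.:* s +-*-Solver.:* k) ≡.refl

    ‖_‖ : Carrier → ℤ
    ‖ f ‖ = τ (f * conj f)

    ιΣ : ∀ n (F : ℕ → ℤ) → ι (Z.Σ< n F) ≈ Σ< n (λ i → ι (F i))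
    ιΣ zero    F = refl
    ιΣ (suc n) F = trans (ι-+ (F 0) (Z.Σ< n (λ i → F (suc i)))) (+-congˡ (ιΣ n (λ i → F (suc i))))

    -- Parseval, after one of the two equal factors has been rewritten by conjugation. The sum of
    -- integer squares is what makes the form positive definite.
    Σd² : ∀ f → Z.Σ< m (λ k → d k f ℤ.* d k f) ≡ + m ℤ.* ‖ f ‖
    Σd² f = ι-injective _ _ (begin
      ι (Z.Σ< m (λ k → d k f ℤ.* d k f))                ≈⟨ ιΣ m (λ k → d k f ℤ.* d k f) ⟩
      Σ< m (λ k → ι (d k f ℤ.* d k f))                  ≈⟨ Σ<-cong m (λ k _ → trans (ι-* (d k f) (d k f)) (*-cong (ι-d k f) (d-conj k f))) ⟩
      Σ< m (λ k → Σ< m (λ s → A f s * ζ ^ (s ℕ.* k)) * Σ< m (λ s → A (conj f) s * ζ ^ ((m ∸ 1) ℕ.* s ℕ.* k)))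
                                                        ≈⟨ parseval (A f) (A (conj f)) ⟩
      ι (+ m) * Σ< m (λ s → A f s * A (conj f) s)       ≈⟨ *-congˡ (Σ<-cong m (λ s _ → when-*-when (cop? s m) (λ h → sym (σ.φ-* s h f (conj f))))) ⟩
      ι (+ m) * Tr m (f * conj f)                       ≈⟨ *-congˡ (ι-τ (f * conj f)) ⟩
      ι (+ m) * ι ‖ f ‖                                 ≈⟨ ι-* (+ m) ‖ f ‖ ⟨
      ι (+ m ℤ.* ‖ f ‖)                                 ∎)

    -- Fourier inversion at the residue of 1: pairing the vanishing coefficients with the indicator
    -- of that residue recovers m f.
    d≡0⇒≈0 : ∀ f → (∀ k → k < m → d k f ≡ 0ℤ) → f ≈ 0#
    d≡0⇒≈0 f h = trans (sym Ae) (torsion-free (+ m) (A f e) (λ m≡0 → ℕ.<⇒≢ 0<m (≡.sym (ℤ.+-injective m≡0))) (begin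
      ι (+ m) * A f e                              ≈⟨ *-congˡ (sym (trans (Σ<-single m e (λ s → A f s * B s) e<m (λ s _ s≢e → trans (*-congˡ (when-no (s ℕ.≟ e) s≢e)) (zeroʳ _)))
                                                       (trans (*-congˡ (when-yes (e ℕ.≟ e) ≡.refl)) (*-identityʳ _)))) ⟩
      ι (+ m) * Σ< m (λ s → A f s * B s)           ≈⟨ parseval (A f) B ⟨
      Σ< m (λ k → Σ< m (λ s → A f s * ζ ^ (s ℕ.* k)) * Σ< m (λ s → B s * ζ ^ ((m ∸ 1) ℕ.* s ℕ.* k)))
        ≈⟨ Σ<-0 m (λ k k<m → trans (*-congʳ (trans (sym (ι-d k f)) (reflexive (≡.cong ι (h k k<m))))) (zeroˡ (Σ< m (λ s → B s * ζ ^ ((m ∸ 1) ℕ.* s ℕ.* k))))) ⟩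
      0#                                           ∎))
      where
      instance _ = ℕ.>-nonZero 0<m
      -- Not simply 1, since for m = 1 the residue of 1 is 0.
      e = 1 % m
      e<m : e < m
      e<m = m%n<n 1 m
      B : ℕ → Carrier
      B s = when (s ℕ.≟ e) 1#
      cop1 : Coprime 1 m
      cop1 = Cop.1-coprimeTo m
      cope : Coprime e m
      cope = coprime-mod (Z.≡-sym (mod-% 1 m)) cop1
      Ae : A f e ≈ f
      Ae = trans (when-yes (cop? e m) cope) (trans (σ-mod (mod-% 1 m) cope cop1 f) (σ-1 f cop1))

-- Contractions of the trace form: powers as Galois conjugates, and invariants.

module Contractions where

  open RingTools
  open IntegerPolynomials
  open NumberTheory
  open IndexedSums
  open FrobeniusPowers
  open CyclotomicRings
  open TraceForm
  open import Algebra.Bundles using (CommutativeRing)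
  open import Data.Nat as ℕ using (ℕ; zero; suc; z≤n; s≤s; _<_; _≤_; _∸_; _!)
  import Data.Nat.Properties as ℕ
  import Data.Nat.Divisibility as ℕ
  open import Data.Nat.Coprimality as Cop using (Coprime)
  open import Data.Nat.Primality using (Prime)
  open import Data.Nat.Induction using (<-rec)
  open import Data.Integer as ℤ using (ℤ; +_; -[1+_]; 0ℤ; 1ℤ)
  import Data.Integer.Properties as ℤ
  open import Data.Fin as Fin using (Fin; toℕ)
  import Data.Fin.Properties as Fin
  open import Data.Product using (∃; _×_; proj₁; proj₂) renaming (_,_ to _,,_)
  open import Data.Sum using (_⊎_) renaming (map to ⊎-map)
  open import Data.Empty using (⊥-elim)
  open import Level using (0ℓ)
  open import Relation.Nullary
  open import Relation.Binary.PropositionalEquality as ≡ using (_≡_; _≢_)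

  sum-nonneg : ∀ {n} (f : Fin n → ℤ) → (∀ i → 0ℤ ℤ.≤ f i) → 0ℤ ℤ.≤ Z.sum f
  sum-nonneg {zero}  f h = ℤ.≤-refl
  sum-nonneg {suc n} f h = ℤ.+-mono-≤ (h Fin.zero) (sum-nonneg (λ i → f (Fin.suc i)) (λ i → h (Fin.suc i)))

  term≤sum : ∀ {n} (f : Fin n → ℤ) → (∀ i → 0ℤ ℤ.≤ f i) → ∀ i → f i ℤ.≤ Z.sum f
  term≤sum {suc n} f h Fin.zero    = ≡.subst (ℤ._≤ Z.sum f) (ℤ.+-identityʳ (f Fin.zero)) (ℤ.+-monoʳ-≤ (f Fin.zero) (sum-nonneg (λ i → f (Fin.suc i)) (λ i → h (Fin.suc i))))
  term≤sum {suc n} f h (Fin.suc i) = ≡.subst (ℤ._≤ Z.sum f) (ℤ.+-identityˡ (f (Fin.suc i))) (ℤ.+-mono-≤ (h Fin.zero) (term≤sum (λ i → f (Fin.suc i)) (λ i → h (Fin.suc i)) i))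

  two-terms≤sum : ∀ {n} (f : Fin n → ℤ) → (∀ i → 0ℤ ℤ.≤ f i) → ∀ i j → i ≢ j → f i ℤ.+ f j ℤ.≤ Z.sum f
  two-terms≤sum {suc n} f h Fin.zero    Fin.zero    i≢j = ⊥-elim (i≢j ≡.refl)
  two-terms≤sum {suc n} f h Fin.zero    (Fin.suc j) i≢j = ℤ.+-monoʳ-≤ (f Fin.zero) (term≤sum (λ i → f (Fin.suc i)) (λ i → h (Fin.suc i)) j)
  two-terms≤sum {suc n} f h (Fin.suc i) Fin.zero    i≢j = ≡.subst (ℤ._≤ Z.sum f) (ℤ.+-comm (f Fin.zero) (f (Fin.suc i)))
    (ℤ.+-monoʳ-≤ (f Fin.zero) (term≤sum (λ i → f (Fin.suc i)) (λ i → h (Fin.suc i)) i))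
  two-terms≤sum {suc n} f h (Fin.suc i) (Fin.suc j) i≢j = ≡.subst (ℤ._≤ Z.sum f) (ℤ.+-identityˡ (f (Fin.suc i) ℤ.+ f (Fin.suc j)))
    (ℤ.+-mono-≤ (h Fin.zero) (two-terms≤sum (λ i → f (Fin.suc i)) (λ i → h (Fin.suc i)) i j (λ { ≡.refl → i≢j ≡.refl })))

  square≡ : ∀ a → a ℤ.* a ≡ + (ℤ.∣ a ∣ ℕ.* ℤ.∣ a ∣)
  square≡ (+ n)    = ≡.sym (ℤ.pos-* n n)
  square≡ -[1+ n ] = ≡.refl

  square≥0 : ∀ a → 0ℤ ℤ.≤ a ℤ.* a
  square≥0 a = ≡.subst (0ℤ ℤ.≤_) (≡.sym (square≡ a)) (ℤ.+≤+ z≤n)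

  square≤⇒≤ : ∀ a n → a ℤ.* a ℤ.≤ + n ℤ.* + n → ℤ.∣ a ∣ ≤ n
  square≤⇒≤ a n h = ℕ.≮⇒≥ (λ n<a → ℕ.<⇒≱ (ℕ.*-mono-< n<a n<a) (ℤ.drop‿+≤+ (≡.subst₂ ℤ._≤_ (square≡ a) (≡.sym (ℤ.pos-* n n)) h)))

  square≤0⇒≡0 : ∀ a → a ℤ.* a ℤ.≤ 0ℤ → a ≡ 0ℤ
  square≤0⇒≡0 a h = ℤ.∣i∣≡0⇒i≡0 (ℕ.n≤0⇒n≡0 (square≤⇒≤ a 0 h))

  -- All prime factors of a number prime to (2m)! exceed 2m, the range in which `prime-power`
  -- applies.
  2m! : ℕ → ℕ
  2m! m = (2 ℕ.* m) !

  ∣! : ∀ {d n} → 0 < d → d ≤ n → d ℕ.∣ n !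
  ∣! {suc d} _ d≤n = ℕ.∣-trans (ℕ.m∣m*n (d !)) (ℕ.m≤n⇒m!∣n! d≤n)

  module Units {m : ℕ} {R : CommutativeRing 0ℓ 0ℓ} {ζ σ} (C : IsCyclotomic m R ζ σ) where
    open Props C
    open Ring R
    open Eval R
    open RingSums R
    open Solver
    open Frobenius R using (frobenius-ev)
    open import Relation.Binary.Reasoning.Setoid setoid

    instance
      m≢0 : ℕ.NonZero m
      m≢0 = ℕ.>-nonZero 0<m

    ‖‖-cong : ∀ {f g} → f ≈ g → ‖ f ‖ ≡ ‖ g ‖
    ‖‖-cong e = τ-cong (*-cong e (Conj.φ-cong e))

    ‖‖≥0 : ∀ f → 0ℤ ℤ.≤ ‖ f ‖
    ‖‖≥0 f = ℤ.*-cancelˡ-≤-pos 0ℤ ‖ f ‖ (+ m) {{pos m}} (≡.subst₂ ℤ._≤_ (≡.sym (ℤ.*-zeroʳ (+ m))) (Σd² f) (sum-nonneg {m} (λ k → d (toℕ k) f ℤ.* d (toℕ k) f) (λ k → square≥0 (d (toℕ k) f))))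
      where
      pos : ∀ m .{{_ : ℕ.NonZero m}} → ℤ.Positive (+ m)
      pos (suc m) = _

    d²≤ : ∀ f k → k < m → d k f ℤ.* d k f ℤ.≤ + m ℤ.* ‖ f ‖
    d²≤ f k k<m = ≡.subst₂ ℤ._≤_ (≡.cong (λ k → d k f ℤ.* d k f) (Fin.toℕ-fromℕ< k<m)) (Σd² f)
      (term≤sum {m} (λ k → d (toℕ k) f ℤ.* d (toℕ k) f) (λ k → square≥0 (d (toℕ k) f)) (Fin.fromℕ< k<m))

    ‖‖≡0⇒≈0 : ∀ f → ‖ f ‖ ℤ.≤ 0ℤ → f ≈ 0#
    ‖‖≡0⇒≈0 f h = d≡0⇒≈0 f (λ k k<m → square≤0⇒≡0 (d k f) (ℤ.≤-trans (d²≤ f k k<m)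
      (≡.subst (+ m ℤ.* ‖ f ‖ ℤ.≤_) (ℤ.*-zeroʳ (+ m)) (ℤ.*-monoˡ-≤-nonNeg (+ m) h))))

    -- The trace of 1 counts the reduced residues modulo `m`.
    ‖1‖≤m : ‖ 1# ‖ ℤ.≤ + m
    ‖1‖≤m = ≡.subst (ℤ._≤ + m) (≡.sym eq) (count m)
      where
      module ZS = RingSums ℤ.+-*-commutativeRing
      χ : ℕ → ℤ
      χ s = ZS.when (cop? s m) 1ℤ
      ι-when : ∀ {A : Set} (a : Dec A) → ι (ZS.when a 1ℤ) ≈ when a 1#
      ι-when (yes _) = refl
      ι-when (no _)  = refl
      eq : ‖ 1# ‖ ≡ Z.Σ< m χ
      eq = ι-injective _ _ (begin
        ι ‖ 1# ‖                                  ≈⟨ ι-τ (1# * conj 1#) ⟨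
        Tr m (1# * conj 1#)                       ≈⟨ Tr-cong m ℕ.∣-refl (trans (*-identityˡ _) Conj.φ-1) ⟩
        Tr m 1#                                   ≈⟨ Σ<-cong m (λ s _ → trans (when-cong (cop? s m) (λ h → σ.φ-1 s h)) (sym (ι-when (cop? s m)))) ⟩
        Σ< m (λ s → ι (χ s))                      ≈⟨ ιΣ m χ ⟨
        ι (Z.Σ< m χ)                              ∎)
      χ≤1 : ∀ s → χ s ℤ.≤ 1ℤ
      χ≤1 s with cop? s m
      ... | yes _ = ℤ.≤-refl
      ... | no _  = ℤ.+≤+ z≤n
      sum≤ : ∀ n (f : Fin n → ℤ) → (∀ i → f i ℤ.≤ 1ℤ) → Z.sum f ℤ.≤ + n
      sum≤ zero    f h = ℤ.≤-refl
      sum≤ (suc n) f h = ℤ.+-mono-≤ (h Fin.zero) (sum≤ n (λ i → f (Fin.suc i)) (λ i → h (Fin.suc i)))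
      count : ∀ n → Z.Σ< n χ ℤ.≤ + n
      count n = sum≤ n (λ i → χ (toℕ i)) (λ i → χ≤1 (toℕ i))

    ‖σ‖ : ∀ r → Coprime r m → ∀ f → ‖ σ r f ‖ ≡ ‖ f ‖
    ‖σ‖ r h f = ≡.trans (τ-cong (trans (*-congˡ (σ-comm (m ∸ 1) r cop-conj h f)) (sym (σ.φ-* r h f (conj f))))) (τ-σ r h (f * conj f))

    d-bound : ∀ f → ‖ f ‖ ℤ.≤ + m → ∀ k → k < m → ℤ.∣ d k f ∣ ≤ m
    d-bound f h k k<m = square≤⇒≤ (d k f) m (ℤ.≤-trans (d²≤ f k k<m) (ℤ.*-monoˡ-≤-nonNeg (+ m) h))

    -- An algebraic stand-in for absolute value at most 1 under every complex embedding, visibly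
    -- closed under products.
    Contraction : Carrier → Set
    Contraction α = ∀ x → ‖ α * x ‖ ℤ.≤ ‖ x ‖

    con-1 : Contraction 1#
    con-1 x = ℤ.≤-reflexive (‖‖-cong (*-identityˡ x))

    con-* : ∀ {α β} → Contraction α → Contraction β → Contraction (α * β)
    con-* {α} {β} h k x = ℤ.≤-trans (ℤ.≤-reflexive (‖‖-cong (*-assoc α β x))) (ℤ.≤-trans (h (β * x)) (k x))

    con-^ : ∀ {α} n → Contraction α → Contraction (α ^ n)
    con-^ zero    h = con-1
    con-^ (suc n) h = con-* h (con-^ n h)

    con-neg : ∀ {α} → Contraction α → Contraction (- α)
    con-neg {α} h x = ℤ.≤-trans (ℤ.≤-reflexive (τ-cong (trans (*-congˡ (trans (Conj.φ-cong (sym (-‿distribˡ-* α x))) (Conj.φ-neg (α * x))))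
      (solve 3 (λ a x c → ((:- a) :* x) :* (:- c) := (a :* x) :* c) refl α x (conj (α * x)))))) (h x)

    con-‖‖ : ∀ {α} → Contraction α → ‖ α ‖ ℤ.≤ + m
    con-‖‖ {α} h = ℤ.≤-trans (ℤ.≤-reflexive (‖‖-cong (sym (*-identityʳ α)))) (ℤ.≤-trans (h 1#) ‖1‖≤m)

    -- Write α^ℓ - σ_ℓ(α) = ℓ γ. Both terms have norm at most `m`, hence coordinates `d k` of
    -- absolute value at most `m`. So ℓ times each coordinate of γ is at most 2m, which is less than
    -- ℓ, and all of them vanish.
    prime-power : ∀ ℓ → Prime ℓ → 2 ℕ.* m < ℓ → Coprime ℓ m → ∀ α → Contraction α → α ^ ℓ ≈ σ ℓ α
    prime-power ℓ pℓ 2m<ℓ cop α hα = x∙y⁻¹≈ε⇒x≈y (α ^ ℓ) (σ ℓ α) (trans δ≈ (trans (*-congˡ γ≈0) (zeroʳ _)))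
      where
      p = proj₁ (rep-ev α)
      div : ι (+ ℓ) ∣ α ^ ℓ - σ ℓ α
      div = difference (≡-resp (^-congˡ ℓ (sym (proj₂ (rep-ev α)))) (sym (σ-rep ℓ cop α)) (frobenius-ev pℓ ζ p))
      γ = _∣_.quotient div
      δ≈ : α ^ ℓ - σ ℓ α ≈ ι (+ ℓ) * γ
      δ≈ = _∣_.equality div
      dγ : ∀ k → d k (α ^ ℓ) ℤ.- d k (σ ℓ α) ≡ + ℓ ℤ.* d k γ
      dγ k = ≡.trans (≡.sym (≡.trans (τ-cong (solve 3 (λ a b z → (a :- b) :* z := a :* z :- b :* z) refl (α ^ ℓ) (σ ℓ α) (ζ ^ k))) (τ-sub (α ^ ℓ * ζ ^ k) (σ ℓ α * ζ ^ k))))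
        (≡.trans (τ-cong (trans (*-congʳ δ≈) (*-assoc (ι (+ ℓ)) γ (ζ ^ k)))) (τ-ι* (+ ℓ) (γ * ζ ^ k)))
      small : ∀ k → k < m → ℓ ℕ.* ℤ.∣ d k γ ∣ ≤ 2 ℕ.* m
      small k k<m = ℕ.≤-trans (ℕ.≤-reflexive (≡.trans (≡.sym (ℤ.abs-* (+ ℓ) (d k γ))) (≡.cong ℤ.∣_∣ (≡.sym (dγ k)))))
        (ℕ.≤-trans (ℤ.∣i-j∣≤∣i∣+∣j∣ (d k (α ^ ℓ)) (d k (σ ℓ α))) (ℕ.≤-trans (ℕ.+-mono-≤ (d-bound (α ^ ℓ) (con-‖‖ (con-^ ℓ hα)) k k<m)
          (d-bound (σ ℓ α) (≡.subst (ℤ._≤ + m) (≡.sym (‖σ‖ ℓ cop α)) (con-‖‖ hα)) k k<m)) (ℕ.≤-reflexive (≡.cong (m ℕ.+_) (≡.sym (ℕ.+-identityʳ m))))))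
      zero′ : ∀ n → ℓ ℕ.* n ≤ 2 ℕ.* m → n ≡ 0
      zero′ zero    h = ≡.refl
      zero′ (suc n) h = ⊥-elim (ℕ.<⇒≱ 2m<ℓ (ℕ.≤-trans (ℕ.m≤m*n ℓ (suc n)) h))
      γ≈0 : γ ≈ 0#
      γ≈0 = d≡0⇒≈0 γ (λ k k<m → ℤ.∣i∣≡0⇒i≡0 (zero′ ℤ.∣ d k γ ∣ (small k k<m)))

    N : ℕ
    N = 2m! m

    N>0 : 0 < N
    N>0 = ℕ.1≤n! (2 ℕ.* m)

    m∣N : m ℕ.∣ N
    m∣N = ∣! 0<m (ℕ.m≤n*m m 2)

    2∣N : 2 ℕ.∣ N
    2∣N = ∣! (s≤s z≤n) (ℕ.m≤m*n 2 m)

    -- Peel off one prime factor q of `s` at a time: it exceeds 2m, and α^q is again a contraction.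
    power-σ : ∀ s → 0 < s → Coprime s N → ∀ α → Contraction α → α ^ s ≈ σ s α
    power-σ = <-rec _ go
      where
      Goal : ℕ → Set
      Goal s = 0 < s → Coprime s N → ∀ α → Contraction α → α ^ s ≈ σ s α
      go : ∀ s → (∀ {t} → t < s → Goal t) → Goal s
      go s rec 0<s cop α hα = byCases (1 ℕ.<? s)
        where
        byCases : Dec (1 < s) → α ^ s ≈ σ s α
        byCases (no ¬1<s) = ≡.subst (λ s → α ^ s ≈ σ s α) (ℕ.≤-antisym 0<s (ℕ.≮⇒≥ ¬1<s)) (trans (*-identityʳ α) (sym (σ-1 α (Cop.1-coprimeTo m))))
        byCases (yes 1<s) = split (primeDivisor s 1<s)
          where
          split : (∃ λ q → Prime q × q ℕ.∣ s) → α ^ s ≈ σ s α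
          split (q ,, pq ,, ℕ.divides t s≡) = begin
            α ^ s                ≡⟨ ≡.cong (α ^_) s≡qt ⟩
            α ^ (q ℕ.* t)        ≈⟨ ^-assocʳ α q t ⟨
            (α ^ q) ^ t          ≈⟨ rec t<s 0<t copt (α ^ q) (con-^ q hα) ⟩
            σ t (α ^ q)          ≈⟨ σ.φ-cong t (coprime-of m∣N copt) (prime-power q pq 2m<q (coprime-of m∣N copq) α hα) ⟩
            σ t (σ q α)          ≈⟨ σ-* t q (coprime-of m∣N copt) (coprime-of m∣N copq) (≡.subst (λ s → Coprime s m) s≡qt (coprime-of m∣N cop)) α ⟩
            σ (q ℕ.* t) α        ≡⟨ ≡.cong (λ s → σ s α) s≡qt ⟨
            σ s α                ∎
            where
            s≡qt : s ≡ q ℕ.* t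
            s≡qt = ≡.trans s≡ (ℕ.*-comm t q)
            0<t : 0 < t
            0<t = ℕ.n≢0⇒n>0 (λ t≡0 → ℕ.<⇒≢ 0<s (≡.sym (≡.trans s≡ (≡.cong (ℕ._* q) t≡0))))
            t<s : t < s
            t<s = ≡.subst (t <_) (≡.sym s≡) (ℕ.m<m*n t q {{ℕ.>-nonZero 0<t}} (prime>1 pq))
            copq : Coprime q N
            copq = coprime-∣ˡ (ℕ.divides t s≡) cop
            copt : Coprime t N
            copt = coprime-∣ˡ (ℕ.divides q s≡qt) cop
            2m<q : 2 ℕ.* m < q
            2m<q = ℕ.≰⇒> (λ q≤2m → coprime⇒∤ pq copq (∣! (prime>0 pq) q≤2m))

    -- Galois invariance, tested at the exponents for which `power-σ` is available.
    Invariant : Carrier → Set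
    Invariant f = ∀ s → 0 < s → Coprime s N → σ s f ≈ f

    cop0 : ∀ {n} → 1 < n → ¬ Coprime 0 n
    cop0 1<n h = ℕ.<⇒≢ 1<n (≡.sym (h (_ ℕ.∣0 ,, ℕ.∣-refl)))

    1<N : 1 < N
    1<N = ℕ.∣⇒≤ {{ℕ.>-nonZero N>0}} 2∣N

    -- Euler's φ(N), nonzero because of the residue 1.
    κ : ℤ
    κ = Z.Σ< N (λ s → RingSums.when ℤ.+-*-commutativeRing (cop? s N) 1ℤ)

    κ≢0 : κ ≢ 0ℤ
    κ≢0 κ≡0 = ℤ.<⇒≢ (ℤ.<-≤-trans (ℤ.+<+ (s≤s z≤n)) (ℤ.≤-trans (ℤ.≤-reflexive (≡.sym one))
      (term≤sum {N} (λ i → χ (toℕ i)) (λ i → χ≥0 (toℕ i)) (Fin.fromℕ< 1<N)))) (≡.sym κ≡0)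
      where
      χ : ℕ → ℤ
      χ s = RingSums.when ℤ.+-*-commutativeRing (cop? s N) 1ℤ
      χ≥0 : ∀ s → 0ℤ ℤ.≤ χ s
      χ≥0 s with cop? s N
      ... | yes _ = ℤ.+≤+ z≤n
      ... | no _  = ℤ.≤-refl
      one : χ (toℕ (Fin.fromℕ< 1<N)) ≡ 1ℤ
      one = ≡.trans (≡.cong χ (Fin.toℕ-fromℕ< 1<N)) (RingSums.when-yes ℤ.+-*-commutativeRing (cop? 1 N) (Cop.1-coprimeTo N))

    -- Summing the conjugates of `f` over the reduced residues modulo `N` gives κ f by invariance
    -- and an integer by `Tr-rational`.
    invariant-rational : ∀ f → Invariant f → ∃ λ c → ι κ * f ≈ ι c
    invariant-rational f inv = proj₁ r ,, trans (sym eq) (proj₂ r)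
      where
      r = Tr-rational N N>0 m∣N f
      χ : ℕ → ℤ
      χ s = RingSums.when ℤ.+-*-commutativeRing (cop? s N) 1ℤ
      ι-when : ∀ {A : Set} (a : Dec A) → (A → σ 1 f ≈ σ 1 f) → when a f ≈ ι (RingSums.when ℤ.+-*-commutativeRing a 1ℤ) * f
      ι-when (yes _) _ = sym (*-identityˡ f)
      ι-when (no _)  _ = sym (zeroˡ f)
      pos : ∀ {s} → Coprime s N → 0 < s
      pos {zero}  h = ⊥-elim (cop0 1<N h)
      pos {suc s} h = s≤s z≤n
      eq : Tr N f ≈ ι κ * f
      eq = begin
        Tr N f                         ≈⟨ Σ<-cong N (λ s _ → trans (when-cong (cop? s N) (λ h → inv s (pos h) h)) (ι-when (cop? s N) (λ _ → refl))) ⟩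
        Σ< N (λ s → ι (χ s) * f)       ≈⟨ Σ<-*ʳ N f (λ s → ι (χ s)) ⟨
        Σ< N (λ s → ι (χ s)) * f       ≈⟨ *-congʳ (ιΣ N χ) ⟨
        ι κ * f                        ∎

    -- Since κ y is an integer c, the relation becomes c (c - κ w) = 0 in ℤ, where one factor must
    -- vanish; torsion-freeness carries this back to `y`.
    scaled-idempotent : ∀ w y → Invariant y → y * y ≈ ι w * y → y ≈ 0# ⊎ y ≈ ι w
    scaled-idempotent w y inv e = ⊎-map (λ c≡0 → torsion-free κ y κ≢0 (trans κy (reflexive (≡.cong ι c≡0))))
        (λ c≡κw → x∙y⁻¹≈ε⇒x≈y y (ι w) (torsion-free κ (y - ι w) κ≢0 (begin
          ι κ * (y - ι w)            ≈⟨ solve 3 (λ k y w → k :* (y :- w) := k :* y :- k :* w) refl (ι κ) y (ι w) ⟩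
          ι κ * y - ι κ * ι w        ≈⟨ sub-self (trans κy (trans (reflexive (≡.cong ι c≡κw)) (ι-* κ w))) ⟩
          0#                         ∎)))
        (zero-or cc)
      where
      c = proj₁ (invariant-rational y inv)
      κy : ι κ * y ≈ ι c
      κy = proj₂ (invariant-rational y inv)
      c² : c ℤ.* c ≡ (κ ℤ.* w) ℤ.* c
      c² = ι-injective _ _ (begin
        ι (c ℤ.* c)                    ≈⟨ ι-* c c ⟩
        ι c * ι c                      ≈⟨ *-cong κy κy ⟨
        (ι κ * y) * (ι κ * y)          ≈⟨ solve 2 (λ k y → (k :* y) :* (k :* y) := k :* (k :* (y :* y))) refl (ι κ) y ⟩
        ι κ * (ι κ * (y * y))          ≈⟨ *-congˡ (*-congˡ e) ⟩
        ι κ * (ι κ * (ι w * y))        ≈⟨ solve 3 (λ k w y → k :* (k :* (w :* y)) := (k :* w) :* (k :* y)) refl (ι κ) (ι w) y ⟩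
        (ι κ * ι w) * (ι κ * y)        ≈⟨ *-cong (sym (ι-* κ w)) κy ⟩
        ι (κ ℤ.* w) * ι c              ≈⟨ ι-* (κ ℤ.* w) c ⟨
        ι ((κ ℤ.* w) ℤ.* c)            ∎)
      cc : c ℤ.* (c ℤ.- κ ℤ.* w) ≡ 0ℤ
      cc = ≡.trans (lem c (κ ℤ.* w)) (≡.trans (≡.cong (ℤ._- (κ ℤ.* w) ℤ.* c) c²) (ℤ.+-inverseʳ ((κ ℤ.* w) ℤ.* c)))
        where
        lem : ∀ c k → c ℤ.* (c ℤ.- k) ≡ c ℤ.* c ℤ.- k ℤ.* c
        lem = Z.Solver.solve 2 (λ c k → c Z.Solver.:* (c Z.Solver.:- k) Z.Solver.:= c Z.Solver.:* c Z.Solver.:- k Z.Solver.:* c) ≡.refl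
      zero-or : c ℤ.* (c ℤ.- κ ℤ.* w) ≡ 0ℤ → c ≡ 0ℤ ⊎ c ≡ κ ℤ.* w
      zero-or h = ⊎-map (λ z → z) (λ z → Z.x∙y⁻¹≈ε⇒x≈y c (κ ℤ.* w) z) (ℤ.i*j≡0⇒i≡0∨j≡0 c h)

-- Roots of unity among contractions, and families with Σ E_g Ē_g = 1.

module UnitFamilies where

  open RingTools
  open IntegerPolynomials
  open NumberTheory
  open IndexedSums
  open CyclotomicRings
  open TraceForm
  open Contractions
  open import Algebra.Bundles using (CommutativeRing)
  open import Data.Nat as ℕ using (ℕ; zero; suc; z≤n; s≤s; _<_; _≤_; _∸_)
  import Data.Nat.Properties as ℕ
  import Data.Nat.Divisibility as ℕ
  open import Data.Nat.Coprimality as Cop using (Coprime)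
  open import Data.Nat.Primality using (Prime; euclidsLemma; prime[2])
  open import Data.Integer as ℤ using (ℤ; +_; 0ℤ; 1ℤ)
  import Data.Integer.Properties as ℤ
  open import Data.Fin as Fin using (Fin)
  import Data.Fin.Properties as Fin
  open import Data.Product using (∃; _×_; proj₁; proj₂) renaming (_,_ to _,,_)
  open import Data.Sum using (_⊎_; inj₁; inj₂; [_,_]′)
  open import Data.Empty using (⊥; ⊥-elim)
  open import Level using (0ℓ)
  open import Relation.Nullary
  open import Relation.Binary.PropositionalEquality as ≡ using (_≡_; _≢_)

  -- Let `x` be prime to `h` and contain all prime divisors of `n` outside `h`. With s = x (1 + h) -
  -- h the two numbers are x (1 + h) - h and x (1 + h) + h, and every prime divisor of `n` divides
  -- exactly one of `h` and x (1 + h).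
  coprime-gap : ∀ h n → 0 < h → 0 < n → ∃ λ s → 0 < s × Coprime s n × Coprime (s ℕ.+ 2 ℕ.* h) n
  coprime-gap h n 0<h 0<n = build (coprimePart h 0<h n 0<n)
    where
    build : (∃ λ x → 0 < x × Coprime x h × (∀ q → Prime q → q ℕ.∣ n → q ℕ.∣ h ⊎ q ℕ.∣ x)) →
            ∃ λ s → 0 < s × Coprime s n × Coprime (s ℕ.+ 2 ℕ.* h) n
    build (x ,, 0<x ,, xh ,, parts) = s ,, 0<s ,,
        coprimeByPrimes 0<n (λ q pq q∣s q∣n → bad q pq (parts q pq q∣n) (λ q∣x' → ℕ.∣m+n∣m⇒∣n (≡.subst (q ℕ.∣_) (≡.sym s+h) q∣x') q∣s)
                                                  (λ q∣h → ≡.subst (q ℕ.∣_) s+h (ℕ.∣m∣n⇒∣m+n q∣s q∣h))) ,,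
        coprimeByPrimes 0<n (λ q pq q∣s q∣n → bad q pq (parts q pq q∣n) (λ q∣x' → ℕ.∣m+n∣m⇒∣n (≡.subst (q ℕ.∣_) s+2h q∣s) q∣x')
                                                  (λ q∣h → ℕ.∣m+n∣m⇒∣n (≡.subst (q ℕ.∣_) (≡.trans s+2h (ℕ.+-comm x' h)) q∣s) q∣h))
      where
      x' = x ℕ.* suc h
      s = x' ∸ h
      h<x' : h < x'
      h<x' = ℕ.<-≤-trans (ℕ.n<1+n h) (ℕ.m≤n*m (suc h) x {{ℕ.>-nonZero 0<x}})
      0<s : 0 < s
      0<s = ℕ.m<n⇒0<n∸m h<x'
      s+h : s ℕ.+ h ≡ x'
      s+h = ℕ.m∸n+n≡m (ℕ.<⇒≤ h<x')
      s+2h : s ℕ.+ 2 ℕ.* h ≡ x' ℕ.+ h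
      s+2h = ≡.trans (≡.cong (λ z → s ℕ.+ (h ℕ.+ z)) (ℕ.+-identityʳ h)) (≡.trans (≡.sym (ℕ.+-assoc s h h)) (≡.cong (ℕ._+ h) s+h))
      bad : ∀ q → Prime q → q ℕ.∣ h ⊎ q ℕ.∣ x → (q ℕ.∣ x' → q ℕ.∣ h) → (q ℕ.∣ h → q ℕ.∣ x') → ⊥
      bad q pq (inj₁ q∣h) _ f = [ (λ q∣x → coprime⇒∤ pq (coprime-∣ˡ q∣x xh) q∣h) ,
                                  (λ q∣1+h → prime∤1 pq (ℕ.∣m+n∣m⇒∣n (≡.subst (q ℕ.∣_) (ℕ.+-comm 1 h) q∣1+h) q∣h)) ]′ (euclidsLemma x (suc h) pq (f q∣h))
      bad q pq (inj₂ q∣x) f _ = coprime⇒∤ pq (coprime-∣ˡ q∣x xh) (f (ℕ.∣m⇒∣m*n (suc h) q∣x))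

  parity : ∀ m → (∃ λ h → m ≡ 2 ℕ.* h) ⊎ Coprime 2 m
  parity m with 2 ℕ.∣? m
  ... | yes (ℕ.divides h e) = inj₁ (h ,, ≡.trans e (ℕ.*-comm h 2))
  ... | no 2∤m = inj₂ (∤⇒coprime prime[2] 2∤m)

  +-cancel≤ : ∀ a {b} → a ℤ.+ b ℤ.≤ a → b ℤ.≤ 0ℤ
  +-cancel≤ a {b} h = ℤ.≤-trans (ℤ.≤-reflexive (lem a b)) (ℤ.≤-trans (ℤ.+-monoʳ-≤ (ℤ.- a) h) (ℤ.≤-reflexive (ℤ.+-inverseˡ a)))
    where
    lem : ∀ a b → b ≡ ℤ.- a ℤ.+ (a ℤ.+ b)
    lem = Z.Solver.solve 2 (λ a b → b Z.Solver.:= Z.Solver.:- a Z.Solver.:+ (a Z.Solver.:+ b)) ≡.refl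

  odd⇒≡1 : ∀ s → ¬ 2 ℕ.∣ s → s ≡ 1 mod 2
  odd⇒≡1 zero          h = ⊥-elim (h (2 ℕ.∣0))
  odd⇒≡1 (suc zero)    h = mod-refl ≡.refl
  odd⇒≡1 (suc (suc s)) h = mod-+ {2} {0} {s} {1} (∣⇒mod0 ℕ.∣-refl) (odd⇒≡1 s (λ k → h (ℕ.∣m∣n⇒∣m+n ℕ.∣-refl k)))

  module RootsOfUnity {m : ℕ} {R : CommutativeRing 0ℓ 0ℓ} {ζ σ} (C : IsCyclotomic m R ζ σ) where
    open Props C
    open Units C
    open Ring R
    open RingSums R
    open Solver
    open import Relation.Binary.Reasoning.Setoid setoid

    σ-power : ∀ {β} → Contraction β → ∀ s → 0 < s → Coprime s N → σ s β ≈ β ^ s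
    σ-power h s 0<s c = sym (power-σ s 0<s c _ h)

    odd : ∀ {s} → Coprime s N → s ≡ 1 mod 2
    odd {s} c = odd⇒≡1 s (coprime⇒∤ prime[2] (Cop.sym (coprime-∣ʳ 2∣N c)))

    -- Up to a factor m, `y e` is the projector onto β = ζ^e: a sum of the powers of η = β ζ^(-e).
    -- Invariance makes each `y e` equal to 0 or m, and since the `y e` add up to m, one of them is
    -- m, which forces η = 1.
    module Power (β : Carrier) (β^m : β ^ m ≈ 1#) (rule : ∀ s → 0 < s → Coprime s N → σ s β ≈ β ^ s) where

      η y : ℕ → Carrier
      η e = β * ζ ^ ((m ∸ 1) ℕ.* e)
      y e = Σ< m (η e ^_)

      η^m : ∀ e → η e ^ m ≈ 1#
      η^m e = trans (^-distrib-* β (ζ ^ ((m ∸ 1) ℕ.* e)) m) (trans (*-cong β^m (trans (^-assocʳ ζ ((m ∸ 1) ℕ.* e) m)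
        (ζ-mod {(m ∸ 1) ℕ.* e ℕ.* m} {0} (∣⇒mod0 (ℕ.n∣m*n ((m ∸ 1) ℕ.* e)))))) (*-identityˡ 1#))

      ηy : ∀ e → η e * y e ≈ y e
      ηy e = x∙y⁻¹≈ε⇒x≈y (η e * y e) (y e) (begin
        η e * y e - y e         ≈⟨ solve 2 (λ x y → x :* y :- y := (x :- con (+ 1)) :* y) refl (η e) (y e) ⟩
        (η e - 1#) * y e        ≈⟨ geometric (η e) m ⟩
        η e ^ m - 1#            ≈⟨ sub-self (η^m e) ⟩
        0#                      ∎)

      ηjy : ∀ e j → η e ^ j * y e ≈ y e
      ηjy e zero    = *-identityˡ _
      ηjy e (suc j) = trans (*-assoc (η e) (η e ^ j) (y e)) (trans (*-congˡ (ηjy e j)) (ηy e))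

      yy : ∀ e → y e * y e ≈ ι (+ m) * y e
      yy e = trans (Σ<-*ʳ m (y e) (η e ^_)) (trans (Σ<-cong m (λ j _ → ηjy e j)) (Σ<-const m (y e)))

      ση : ∀ e s → 0 < s → Coprime s N → σ s (η e) ≈ η e ^ s
      ση e s 0<s c = trans (σ.φ-* s cm β (ζ ^ ((m ∸ 1) ℕ.* e))) (trans (*-cong (rule s 0<s c)
        (trans (σ-ζ^ s cm ((m ∸ 1) ℕ.* e)) (trans (^-congʳ ζ (ℕ.*-comm s ((m ∸ 1) ℕ.* e))) (sym (^-assocʳ ζ ((m ∸ 1) ℕ.* e) s))))) (sym (^-distrib-* β _ s)))
        where
        cm : Coprime s m
        cm = coprime-of m∣N c

      y-invariant : ∀ e → Invariant (y e)
      y-invariant e s 0<s c = begin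
        σ s (y e)                          ≈⟨ σ.φ-Σ s cm m (η e ^_) ⟩
        Σ< m (λ j → σ s (η e ^ j))         ≈⟨ Σ<-cong m (λ j _ → trans (σ.φ-^ s cm (η e) j) (trans (^-congˡ j (ση e s 0<s c)) (^-assocʳ (η e) s j))) ⟩
        Σ< m (λ j → η e ^ (s ℕ.* j))       ≈⟨ Σ<-reindex m s (η e ^_) 0<m cm (pow-mod (η^m e)) ⟩
        y e                                ∎
        where
        cm : Coprime s m
        cm = coprime-of m∣N c

      y-dichotomy : ∀ e → y e ≈ 0# ⊎ y e ≈ ι (+ m)
      y-dichotomy e = scaled-idempotent (+ m) (y e) (y-invariant e) (yy e)

      ιm-cancel : ∀ f → ι (+ m) * f ≈ 0# → f ≈ 0#
      ιm-cancel f = torsion-free (+ m) f (λ m≡0 → ℕ.<⇒≢ 0<m (≡.sym (ℤ.+-injective m≡0)))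

      Σy : Σ< m y ≈ ι (+ m)
      Σy = begin
        Σ< m (λ e → Σ< m (λ j → η e ^ j))                       ≈⟨ Σ<-comm m m (λ e j → η e ^ j) ⟩
        Σ< m (λ j → Σ< m (λ e → η e ^ j))                       ≈⟨ Σ<-cong m (λ j _ → trans (Σ<-cong m (λ e _ → term e j)) (sym (Σ<-*ˡ m (β ^ j) (λ e → ζ ^ ((m ∸ 1) ℕ.* j ℕ.* e))))) ⟩
        Σ< m (λ j → β ^ j * Σ< m (λ e → ζ ^ ((m ∸ 1) ℕ.* j ℕ.* e)))
          ≈⟨ Σ<-single m 0 (λ j → β ^ j * Σ< m (λ e → ζ ^ ((m ∸ 1) ℕ.* j ℕ.* e))) 0<m (λ j j<m j≢0 → trans (*-congˡ (orthogonal m ((m ∸ 1) ℕ.* j)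
               (ℕ.n∣m*n ((m ∸ 1) ℕ.* j)) (λ h → j≢0 (small j j<m h)))) (zeroʳ _)) ⟩
        1# * Σ< m (λ e → ζ ^ ((m ∸ 1) ℕ.* 0 ℕ.* e))             ≈⟨ *-identityˡ _ ⟩
        Σ< m (λ e → ζ ^ ((m ∸ 1) ℕ.* 0 ℕ.* e))                  ≈⟨ diagonal m ((m ∸ 1) ℕ.* 0) (≡.subst (m ℕ.∣_) (≡.sym (ℕ.*-zeroʳ (m ∸ 1))) (m ℕ.∣0)) ⟩
        ι (+ m)                                                 ∎
        where
        open import Data.Nat.Solver using (module +-*-Solver)
        term : ∀ e j → η e ^ j ≈ β ^ j * ζ ^ ((m ∸ 1) ℕ.* j ℕ.* e)
        term e j = trans (^-distrib-* β (ζ ^ ((m ∸ 1) ℕ.* e)) j) (*-congˡ (trans (^-assocʳ ζ ((m ∸ 1) ℕ.* e) j)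
          (^-congʳ ζ (+-*-Solver.solve 3 (λ n e j → n +-*-Solver.:* e +-*-Solver.:* j +-*-Solver.:= n +-*-Solver.:* j +-*-Solver.:* e) ≡.refl (m ∸ 1) e j))))
        small : ∀ j → j < m → m ℕ.∣ (m ∸ 1) ℕ.* j → j ≡ 0
        small zero    _   _ = ≡.refl
        small (suc j) j<m h = ⊥-elim (ℕ.<⇒≱ j<m (ℕ.∣⇒≤ (Cop.coprime-divisor {m} {m ∸ 1} (Cop.sym {m ∸ 1} cop-conj) h)))

      isPower : ∃ λ e → β ≈ ζ ^ e
      isPower = search (ℕ.anyUpTo? (λ e → ¬? (≈0? (y e))) m)
        where
        search : Dec (∃ λ e → e < m × ¬ y e ≈ 0#) → ∃ λ e → β ≈ ζ ^ e
        search (no none) = ⊥-elim (1≉0 (ιm-cancel 1# (trans (*-identityʳ _) (trans (sym Σy) (Σ<-0 m (λ e e<m → zero-at e e<m (≈0? (y e))))))))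
          where
          zero-at : ∀ e → e < m → Dec (y e ≈ 0#) → y e ≈ 0#
          zero-at e e<m (yes z) = z
          zero-at e e<m (no n)  = ⊥-elim (none (e ,, e<m ,, n))
        search (yes (e ,, _ ,, ye≉0)) = e ,, [ (λ z → ⊥-elim (ye≉0 z)) , found ]′ (y-dichotomy e)
          where
          found : y e ≈ ι (+ m) → β ≈ ζ ^ e
          found ye≈m = begin
            β                                        ≈⟨ *-identityʳ β ⟨
            β * 1#                                   ≈⟨ *-congˡ (ζ-mod {m ℕ.* e} {0} (∣⇒mod0 (ℕ.m∣m*n e))) ⟨
            β * ζ ^ (m ℕ.* e)                        ≈⟨ *-congˡ (trans (^-congʳ ζ (≡.trans (≡.sym (-1*-mod e)) (ℕ.+-comm e _))) (^-homo-* ζ ((m ∸ 1) ℕ.* e) e)) ⟩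
            β * (ζ ^ ((m ∸ 1) ℕ.* e) * ζ ^ e)        ≈⟨ *-assoc β _ _ ⟨
            η e * ζ ^ e                              ≈⟨ *-congʳ η≈1 ⟩
            1# * ζ ^ e                               ≈⟨ *-identityˡ _ ⟩
            ζ ^ e                                    ∎
            where
            η≈1 : η e ≈ 1#
            η≈1 = x∙y⁻¹≈ε⇒x≈y (η e) 1# (ιm-cancel (η e - 1#) (begin
              ι (+ m) * (η e - 1#)                   ≈⟨ solve 2 (λ m x → m :* (x :- con (+ 1)) := x :* m :- m) refl (ι (+ m)) (η e) ⟩
              η e * ι (+ m) - ι (+ m)                ≈⟨ +-cong (*-congˡ ye≈m) (-‿cong ye≈m) ⟨
              η e * y e - y e                        ≈⟨ sub-self (ηy e) ⟩
              0#                                     ∎))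

    module Torsion (β : Carrier) (hβ : Contraction β) (K : ℕ) (β^K : β ^ suc K ≈ 1#) where

      cancel : ∀ n {x z} → β ^ n * x ≈ β ^ n * z → x ≈ z
      cancel n {x} {z} e = trans (sym (un x)) (trans (*-congˡ e) (un z))
        where
        un : ∀ x → β ^ (K ℕ.* n) * (β ^ n * x) ≈ x
        un x = trans (sym (*-assoc _ _ x)) (trans (*-congʳ (trans (sym (^-homo-* β (K ℕ.* n) n)) (trans (^-congʳ β (ℕ.+-comm (K ℕ.* n) n))
          (trans (sym (^-assocʳ β (suc K) n)) (trans (^-congˡ n β^K) (1^n≈1 n)))))) (*-identityˡ x))

      -- Choose s such that s and s + 2h are both prime to N. They agree modulo m, so β^s and β^(s +
      -- 2h) are the same conjugate of β, and β^s cancels.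
      β^2h : ∀ h → 0 < h → m ℕ.∣ 2 ℕ.* h → β ^ (2 ℕ.* h) ≈ 1#
      β^2h h 0<h m∣2h = use (coprime-gap h N 0<h N>0)
        where
        use : (∃ λ s → 0 < s × Coprime s N × Coprime (s ℕ.+ 2 ℕ.* h) N) → β ^ (2 ℕ.* h) ≈ 1#
        use (s ,, 0<s ,, c ,, c') = cancel s (begin
          β ^ s * β ^ (2 ℕ.* h)       ≈⟨ ^-homo-* β s (2 ℕ.* h) ⟨
          β ^ (s ℕ.+ 2 ℕ.* h)         ≈⟨ power-σ (s ℕ.+ 2 ℕ.* h) (ℕ.≤-trans 0<s (ℕ.m≤m+n s _)) c' β hβ ⟩
          σ (s ℕ.+ 2 ℕ.* h) β         ≈⟨ σ-mod {s ℕ.+ 2 ℕ.* h} {s} same (coprime-of m∣N c') (coprime-of m∣N c) β ⟩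
          σ s β                       ≈⟨ power-σ s 0<s c β hβ ⟨
          β ^ s                       ≈⟨ *-identityʳ _ ⟨
          β ^ s * 1#                  ∎)
          where
          same : s ℕ.+ 2 ℕ.* h ≡ s mod m
          same = Z.≡-trans (mod-+ {s} {s} {2 ℕ.* h} {0} (mod-refl ≡.refl) (∣⇒mod0 m∣2h)) (mod-refl (ℕ.+-identityʳ s))

      -- For even m, taking h = m/2 gives β^m = 1. For odd m only β^(2m) = 1 is at hand; then the
      -- invariant element y = 1 + β^m satisfies y² = 2 y, hence is 0 or 2, and -β or β has m-th
      -- power 1.
      ±ζ^e : ∃ λ e → β ≈ ζ ^ e ⊎ β ≈ - ζ ^ e
      ±ζ^e = byParity (parity m)
        where
        positive : β ^ m ≈ 1# → ∃ λ e → β ≈ ζ ^ e ⊎ β ≈ - ζ ^ e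
        positive h = proj₁ p ,, inj₁ (proj₂ p)
          where
          p : ∃ λ e → β ≈ ζ ^ e
          p = Power.isPower β h (σ-power hβ)
        byParity : (∃ λ h → m ≡ 2 ℕ.* h) ⊎ Coprime 2 m → ∃ λ e → β ≈ ζ ^ e ⊎ β ≈ - ζ ^ e
        byParity (inj₁ (h ,, m≡2h)) = positive (trans (^-congʳ β m≡2h) (β^2h h (ℕ.n≢0⇒n>0 (λ h≡0 → ℕ.<⇒≢ 0<m (≡.sym (≡.trans m≡2h (≡.cong (2 ℕ.*_) h≡0))))) (≡.subst (m ℕ.∣_) m≡2h ℕ.∣-refl)))
        byParity (inj₂ m-odd) = [ negative , (λ y≈2 → positive (+-cancelˡ′ y≈2)) ]′ (scaled-idempotent (+ 2) y inv yy)
          where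
          γ = β ^ m
          y = 1# + γ
          γ² : γ * γ ≈ 1#
          γ² = trans (sym (^-homo-* β m m)) (trans (^-congʳ β (≡.cong (m ℕ.+_) (≡.sym (ℕ.+-identityʳ m)))) (β^2h m 0<m (ℕ.n∣m*n 2)))
          yy : y * y ≈ ι (+ 2) * y
          yy = trans (solve 1 (λ g → (con (+ 1) :+ g) :* (con (+ 1) :+ g) := (con (+ 1) :+ con (+ 2) :* g) :+ g :* g) refl γ)
            (trans (+-congˡ γ²) (solve 1 (λ g → (con (+ 1) :+ con (+ 2) :* g) :+ con (+ 1) := con (+ 2) :* (con (+ 1) :+ g)) refl γ))
          inv : Invariant y
          inv s 0<s c = trans (σ.φ-+ s cm 1# γ) (+-cong (σ.φ-1 s cm) (trans (σ-power (con-^ m hβ) s 0<s c)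
            (trans (pow-mod {γ} {2} (trans (*-congˡ (*-identityʳ γ)) γ²) {s} {1} (odd c)) (*-identityʳ γ))))
            where
            cm : Coprime s m
            cm = coprime-of m∣N c
          +-cancelˡ′ : y ≈ ι (+ 2) → γ ≈ 1#
          +-cancelˡ′ e = trans (solve 1 (λ g → g := (con (+ 1) :+ g) :- con (+ 1)) refl γ) (trans (+-congʳ e) (solve 0 (con (+ 2) :- con (+ 1) := con (+ 1)) refl))
          odd-neg : ∀ n → n ≡ 1 mod 2 → (- 1#) ^ n ≈ - 1#
          odd-neg n h = trans (pow-mod { - 1# } {2} (solve 0 (:- con (+ 1) :* (:- con (+ 1) :* con (+ 1)) := con (+ 1)) refl) {n} {1} h) (*-identityʳ _)
          m≡1 : m ≡ 1 mod 2
          m≡1 = odd⇒≡1 m (coprime⇒∤ prime[2] m-odd)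
          negative : y ≈ 0# → ∃ λ e → β ≈ ζ ^ e ⊎ β ≈ - ζ ^ e
          negative y≈0 = proj₁ p ,, inj₂ (trans (sym (-‿involutive β)) (-‿cong (proj₂ p)))
            where
            γ≈-1 : γ ≈ - 1#
            γ≈-1 = trans (solve 1 (λ g → g := (con (+ 1) :+ g) :- con (+ 1)) refl γ) (trans (+-congʳ y≈0) (+-identityˡ _))
            -β^m : (- β) ^ m ≈ 1#
            -β^m = trans (^-congˡ m (solve 1 (λ b → :- b := (:- con (+ 1)) :* b) refl β)) (trans (^-distrib-* (- 1#) β m)
              (trans (*-cong (odd-neg m m≡1) γ≈-1) (solve 0 ((:- con (+ 1)) :* (:- con (+ 1)) := con (+ 1)) refl)))
            p : ∃ λ e → - β ≈ ζ ^ e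
            p = Power.isPower (- β) -β^m (σ-power (con-neg hβ))

  module UnitFamily {m : ℕ} {R : CommutativeRing 0ℓ 0ℓ} {ζ σ} (C : IsCyclotomic m R ζ σ)
                    {n : ℕ} (E : Fin n → CommutativeRing.Carrier R) where
    open Props C
    open Units C
    open Ring R
    open Solver
    open import Relation.Binary.Reasoning.Setoid setoid

    τ-sum : ∀ {n} (f : Fin n → Carrier) → τ (sum f) ≡ Z.sum (λ g → τ (f g))
    τ-sum {zero}  f = τ-0
    τ-sum {suc n} f = ≡.trans (τ-+ (f Fin.zero) (sum (λ g → f (Fin.suc g)))) (≡.cong (ℤ._+_ (τ (f Fin.zero))) (τ-sum (λ g → f (Fin.suc g))))

    module _ (unit : sum (λ g → E g * conj (E g)) ≈ 1#) where

      -- Multiplying x x̄ by 1 = Σ E_g Ē_g distributes the form over the coefficients, whose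
      -- contributions are nonnegative; each coefficient is therefore a contraction.
      norm-sum : ∀ x → ‖ x ‖ ≡ Z.sum (λ g → ‖ E g * x ‖)
      norm-sum x = ≡.trans (τ-cong eq) (τ-sum (λ g → (E g * x) * conj (E g * x)))
        where
        eq : x * conj x ≈ sum (λ g → (E g * x) * conj (E g * x))
        eq = begin
          x * conj x                                          ≈⟨ *-identityˡ _ ⟨
          1# * (x * conj x)                                   ≈⟨ *-congʳ unit ⟨
          sum (λ g → E g * conj (E g)) * (x * conj x)         ≈⟨ *-distribʳ-sum (x * conj x) (λ g → E g * conj (E g)) ⟩
          sum (λ g → (E g * conj (E g)) * (x * conj x))
            ≈⟨ sum-cong-≋ (λ g → trans (solve 4 (λ e f x y → (e :* f) :* (x :* y) := (e :* x) :* (f :* y)) refl (E g) (conj (E g)) x (conj x)) (*-congˡ (sym (Conj.φ-* (E g) x)))) ⟩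
          sum (λ g → (E g * x) * conj (E g * x))              ∎

      contraction : ∀ g → Contraction (E g)
      contraction g x = ≡.subst (‖ E g * x ‖ ℤ.≤_) (≡.sym (norm-sum x)) (term≤sum (λ g → ‖ E g * x ‖) (λ g → ‖‖≥0 (E g * x)) g)

      K : ℕ
      K = m ℕ.* N ∸ 1

      sK : suc K ≡ m ℕ.* N
      sK = ℕ.m+[n∸m]≡n (ℕ.*-mono-< 0<m N>0)

      -- s = 1 + m N is coprime to N and acts trivially
      power-fixed : ∀ g → E g * E g ^ suc K ≈ E g
      power-fixed g = begin
        E g ^ suc (suc K)     ≈⟨ power-σ (suc (suc K)) (s≤s z≤n) cN (E g) (contraction g) ⟩
        σ (suc (suc K)) (E g) ≈⟨ σ-mod {suc (suc K)} {1} same (coprime-of m∣N cN) (Cop.1-coprimeTo m) (E g) ⟩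
        σ 1 (E g)             ≈⟨ σ-1 (E g) (Cop.1-coprimeTo m) ⟩
        E g                   ∎
        where
        cN : Coprime (suc (suc K)) N
        cN {i} (i∣s ,, i∣N) = ℕ.∣1⇒≡1 (ℕ.∣m+n∣m⇒∣n (≡.subst (i ℕ.∣_) (ℕ.+-comm 1 (suc K)) i∣s) (≡.subst (i ℕ.∣_) (≡.sym sK) (ℕ.∣n⇒∣m*n m i∣N)))
        same : suc (suc K) ≡ 1 mod m
        same = mod-+ {1} {1} {suc K} {0} (mod-refl ≡.refl) (∣⇒mod0 (≡.subst (m ℕ.∣_) (≡.sym sK) (ℕ.m∣m*n N)))

      ε : Fin n → Carrier
      ε g = E g ^ suc K

      ε-idem : ∀ g → ε g * ε g ≈ ε g
      ε-idem g = trans (solve 3 (λ e f x → (e :* f) :* x := f :* (e :* x)) refl (E g) (E g ^ K) (ε g)) (trans (*-congˡ (power-fixed g)) (*-comm _ _))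

      ε-power : ∀ g s → 0 < s → ε g ^ s ≈ ε g
      ε-power g (suc zero)    _ = *-identityʳ _
      ε-power g (suc (suc s)) _ = trans (*-congˡ (ε-power g (suc s) (s≤s z≤n))) (ε-idem g)

      -- An idempotent equals all its positive powers, and for contractions powers are conjugates,
      -- so ε is invariant.
      ε-01 : ∀ g → ε g ≈ 0# ⊎ ε g ≈ 1#
      ε-01 g = scaled-idempotent 1ℤ (ε g) (λ s 0<s c → trans (sym (power-σ s 0<s c (ε g) (con-^ (suc K) (contraction g)))) (ε-power g s 0<s))
        (trans (ε-idem g) (sym (*-identityˡ _)))

      Single : Set
      Single = ∃ λ g → (∃ λ e → E g ≈ ζ ^ e ⊎ E g ≈ - ζ ^ e) × (∀ h → h ≢ g → E h ≈ 0#)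

      -- If every ε_g were 0, all E_g = E_g ε_g would vanish, against Σ E_g Ē_g = 1. An ε_g equal to
      -- 1 makes E_g an element of finite order.
      single : Single
      single = search (Fin.any? (λ g → ¬? (≈0? (ε g))))
        where
        search : Dec (∃ λ g → ¬ ε g ≈ 0#) → Single
        search (no none) = ⊥-elim (1≉0 (trans (sym unit) (trans (sum-cong-≋ (λ g → trans (*-congʳ (E≈0 g (≈0? (ε g)))) (zeroˡ (conj (E g))))) (sum-replicate-zero n))))
          where
          E≈0 : ∀ g → Dec (ε g ≈ 0#) → E g ≈ 0#
          E≈0 g (yes z) = trans (sym (power-fixed g)) (trans (*-congˡ z) (zeroʳ (E g)))
          E≈0 g (no nz) = ⊥-elim (none (g ,, nz))
        search (yes (g ,, εg≉0)) = [ (λ z → ⊥-elim (εg≉0 z)) , found ]′ (ε-01 g)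
          where
          found : ε g ≈ 1# → Single
          found εg≈1 = g ,, RootsOfUnity.Torsion.±ζ^e C (E g) (contraction g) K εg≈1 ,, others
            where
            -- E_g preserves the form, which leaves nothing for the other entries
            full : ‖ 1# ‖ ℤ.≤ ‖ E g * 1# ‖
            full = ≡.subst (ℤ._≤ ‖ E g * 1# ‖) (‖‖-cong (trans (solve 3 (λ e f x → f :* (e :* x) := (e :* f) :* x) refl (E g) (E g ^ K) 1#) (trans (*-congʳ εg≈1) (*-identityˡ 1#))))
              (con-^ K (contraction g) (E g * 1#))
            others : ∀ h → h ≢ g → E h ≈ 0#
            others h h≢g = trans (sym (*-identityʳ (E h))) (‖‖≡0⇒≈0 (E h * 1#) (+-cancel≤ ‖ E g * 1# ‖ (ℤ.≤-trans
              (two-terms≤sum (λ g → ‖ E g * 1# ‖) (λ g → ‖‖≥0 (E g * 1#)) g h (λ g≡h → h≢g (≡.sym g≡h)))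
              (ℤ.≤-trans (ℤ.≤-reflexive (≡.sym (norm-sum 1#))) full))))

-- A prime ideal above p, and its stabiliser through Gauss periods.

module PrimeIdeals where

  open import Defs using (Poly)
  open RingTools
  open IntegerPolynomials
  open NumberTheory
  open IndexedSums
  open FrobeniusPowers
  open CyclotomicTower
  open CyclotomicRings
  open TraceForm
  open import Algebra.Bundles using (CommutativeRing)
  open import Data.Nat as ℕ using (ℕ; zero; suc; z≤n; s≤s; _<_; _≤_; _∸_)
  import Data.Nat.Properties as ℕ
  import Data.Nat.Divisibility as ℕ
  open import Data.Nat.Coprimality as Cop using (Coprime)
  open import Data.Nat.Primality using (Prime)
  open import Data.Integer as ℤ using (ℤ; +_; 0ℤ)
  import Data.Integer.Properties as ℤ
  import Data.Integer.DivMod as ℤ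
  open import Data.List using (List; []; _∷_; length; filter; upTo; concatMap; map)
  import Data.List.Properties as List
  open import Data.List.Relation.Unary.Any as Any using (Any; here; there)
  open import Data.List.Membership.Propositional using (_∈_; find; lose)
  open import Data.List.Membership.Propositional.Properties using (∈-concat⁺′; ∈-map⁺; ∈-upTo⁺)
  open import Data.Product using (∃; ∃₂; _×_; proj₁; proj₂) renaming (_,_ to _,,_)
  open import Data.Sum using (_⊎_; inj₁; inj₂; [_,_]′)
  open import Data.Empty using (⊥-elim)
  open import Level using (0ℓ)
  open import Relation.Nullary
  open import Relation.Nullary.Decidable using (_×-dec_)
  open import Relation.Unary using (Decidable)
  open import Relation.Binary.PropositionalEquality as ≡ using (_≡_; _≢_)

  filter-< : ∀ {A : Set} {P Q : A → Set} (P? : Decidable P) (Q? : Decidable Q) → (∀ {x} → P x → Q x) →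
    ∀ xs → Any (λ x → Q x × ¬ P x) xs → length (filter P? xs) < length (filter Q? xs)
  filter-< P? Q? P⊆Q (x ∷ xs) (here (q ,, ¬p)) with P? x | Q? x
  ... | yes p | _      = ⊥-elim (¬p p)
  ... | no _  | no ¬q  = ⊥-elim (¬q q)
  ... | no _  | yes _  = s≤s (weak xs)
    where
    weak : ∀ xs → length (filter P? xs) ≤ length (filter Q? xs)
    weak [] = z≤n
    weak (x ∷ xs) with P? x | Q? x
    ... | yes p | yes _ = s≤s (weak xs)
    ... | yes p | no ¬q = ⊥-elim (¬q (P⊆Q p))
    ... | no _  | yes _ = ℕ.m≤n⇒m≤1+n (weak xs)
    ... | no _  | no _  = weak xs
  filter-< P? Q? P⊆Q (x ∷ xs) (there h) with P? x | Q? x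
  ... | yes p | yes _ = s≤s (filter-< P? Q? P⊆Q xs h)
  ... | yes p | no ¬q = ⊥-elim (¬q (P⊆Q p))
  ... | no _  | yes _ = ℕ.m≤n⇒m≤1+n (filter-< P? Q? P⊆Q xs h)
  ... | no _  | no _  = filter-< P? Q? P⊆Q xs h

  record IsPrime (R : CommutativeRing 0ℓ 0ℓ) (P : CommutativeRing.Carrier R → Set) : Set where
    open CommutativeRing R
    field
      P-resp   : ∀ {x y} → x ≈ y → P x → P y
      P-0      : P 0#
      P-+      : ∀ {x y} → P x → P y → P (x + y)
      P-*      : ∀ r {x} → P x → P (r * x)
      P-proper : ¬ P 1#
      P-prime  : ∀ x y → P (x * y) → P x ⊎ P y

  -- A prime ideal above p: the annihilator, in R / p, of an element whose annihilator is largest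

  module PrimeAbove {m : ℕ} {R : CommutativeRing 0ℓ 0ℓ} {ζ σ} (C : IsCyclotomic m R ζ σ) (p : ℕ) (pp : Prime p) where
    open Props C
    open Ring R
    open Eval R
    open Solver
    open import Relation.Binary.Reasoning.Setoid setoid

    Null : Carrier → Set
    Null f = ι (+ p) ∣ f

    null? : ∀ f → Dec (Null f)
    null? = ι∣? p

    -- All sums of `k` terms c_i ζ^i with digits 0 ≤ c_i < p. For k = m they represent R / p,
    -- possibly with repetitions, so that R / p can be searched.
    residues : ℕ → List Carrier
    residues zero    = 0# ∷ []
    residues (suc k) = concatMap (λ c → map (λ l → ι (+ c) + ζ * l) (residues k)) (upTo p)

    mod-p : ∀ a → ∃ λ c → c < p × ι a ≡[ ι (+ p) ] ι (+ c)
    mod-p a = a ℤ.%ℕ p ,, ℤ.n%ℕd<d a p ,, cg (∣-resp (ι-- a (+ (a ℤ.%ℕ p))) (ι-∣ {+ p} (a ℤ./ℕ p) (≡.trans (≡.cong (ℤ._- + (a ℤ.%ℕ p)) (ℤ.a≡a%ℕn+[a/ℕn]*n a p))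
        (lem (+ (a ℤ.%ℕ p)) (a ℤ./ℕ p) (+ p)))))
      where
      instance _ = ℕ.>-nonZero (prime>0 pp)
      lem : ∀ r q p → (r ℤ.+ q ℤ.* p) ℤ.- r ≡ p ℤ.* q
      lem = Z.Solver.solve 3 (λ r q p → (r Z.Solver.:+ q Z.Solver.:* p) Z.Solver.:- r Z.Solver.:= p Z.Solver.:* q) ≡.refl

    residue-of : ∀ k (c : ℕ → ℤ) → ∃ λ l → l ∈ residues k × Σ< k (λ i → ι (c i) * ζ ^ i) ≡[ ι (+ p) ] l
    residue-of zero    c = 0# ,, here ≡.refl ,, ≡-refl refl
    residue-of (suc k) c = extend (mod-p (c 0)) (residue-of k (λ i → c (suc i)))
      where
      extend : (∃ λ b → b < p × ι (c 0) ≡[ ι (+ p) ] ι (+ b)) →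
               (∃ λ l → l ∈ residues k × Σ< k (λ i → ι (c (suc i)) * ζ ^ i) ≡[ ι (+ p) ] l) →
               ∃ λ l → l ∈ residues (suc k) × Σ< (suc k) (λ i → ι (c i) * ζ ^ i) ≡[ ι (+ p) ] l
      extend (b ,, b<p ,, e) (l ,, l∈ ,, e') = ι (+ b) + ζ * l ,,
        ∈-concat⁺′ (∈-map⁺ (λ l → ι (+ b) + ζ * l) l∈) (∈-map⁺ (λ c → map (λ l → ι (+ c) + ζ * l) (residues k)) (∈-upTo⁺ b<p)) ,,
        ≡-trans (≡-refl (+-cong (*-identityʳ _) (trans (Σ<-cong k (λ i _ → solve 3 (λ c z w → c :* (z :* w) := z :* (c :* w)) refl (ι (c (suc i))) ζ (ζ ^ i)))
          (sym (Σ<-*ˡ k ζ (λ i → ι (c (suc i)) * ζ ^ i)))))) (≡-+ e (≡-* (≡-refl refl) e'))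

    -- Exponents wrap around through ζ^(n+1) = 1, so n + 1 coefficients are enough.
    coefficients : ∀ n → ζ ^ suc n ≈ 1# → ∀ (q : Poly) → ∃ λ (c : ℕ → ℤ) → ev ζ q ≈ Σ< (suc n) (λ i → ι (c i) * ζ ^ i)
    coefficients n ζ^n []      = (λ _ → 0ℤ) ,, sym (Σ<-0 (suc n) (λ i _ → zeroˡ (ζ ^ i)))
    coefficients n ζ^n (a ∷ q) = step (coefficients n ζ^n q)
      where
      step : (∃ λ (c : ℕ → ℤ) → ev ζ q ≈ Σ< (suc n) (λ i → ι (c i) * ζ ^ i)) → ∃ λ (c : ℕ → ℤ) → ev ζ (a ∷ q) ≈ Σ< (suc n) (λ i → ι (c i) * ζ ^ i)
      step (c ,, e) = c' ,, (begin
        ι a + ζ * ev ζ q                                  ≈⟨ +-congˡ (*-congˡ (trans e (Σ<-last n (λ i → ι (c i) * ζ ^ i)))) ⟩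
        ι a + ζ * (S + ι (c n) * ζ ^ n)
          ≈⟨ solve 5 (λ a z s c w → a :+ z :* (s :+ c :* w) := (a :+ c :* (z :* w)) :+ z :* s) refl (ι a) ζ S (ι (c n)) (ζ ^ n) ⟩
        (ι a + ι (c n) * ζ ^ suc n) + ζ * S               ≈⟨ +-cong constant rest ⟩
        Σ< (suc n) (λ i → ι (c' i) * ζ ^ i)               ∎)
        where
        S = Σ< n (λ i → ι (c i) * ζ ^ i)
        c' : ℕ → ℤ
        c' zero    = a ℤ.+ c n
        c' (suc i) = c i
        constant : ι a + ι (c n) * ζ ^ suc n ≈ ι (a ℤ.+ c n) * 1#
        constant = trans (+-congˡ (trans (*-congˡ ζ^n) (*-identityʳ _))) (trans (sym (ι-+ a (c n))) (sym (*-identityʳ _)))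
        rest : ζ * S ≈ Σ< n (λ i → ι (c i) * ζ ^ suc i)
        rest = trans (Σ<-*ˡ n ζ (λ i → ι (c i) * ζ ^ i)) (Σ<-cong n (λ i _ → solve 3 (λ z c w → z :* (c :* w) := c :* (z :* w)) refl ζ (ι (c i)) (ζ ^ i)))

    L : List Carrier
    L = residues m

    represent : ∀ f → ∃ λ l → l ∈ L × f ≡[ ι (+ p) ] l
    represent f = proj₁ r ,, proj₁ (proj₂ r) ,, ≡-trans (≡-refl (trans (proj₂ (rep-ev f)) expand)) (proj₂ (proj₂ r))
      where
      q = proj₁ (rep-ev f)
      m-1 = ℕ.suc-pred m {{ℕ.>-nonZero 0<m}}
      coeffs : ∃ λ (c : ℕ → ℤ) → ev ζ q ≈ Σ< (suc (ℕ.pred m)) (λ i → ι (c i) * ζ ^ i)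
      coeffs = coefficients (ℕ.pred m) (trans (^-congʳ ζ m-1) ζ^m) q
      expand : ev ζ q ≈ Σ< m (λ i → ι (proj₁ coeffs i) * ζ ^ i)
      expand = trans (proj₂ coeffs) (reflexive (≡.cong (λ n → Σ< n (λ i → ι (proj₁ coeffs i) * ζ ^ i)) m-1))
      r = residue-of m (proj₁ coeffs)

    count : Carrier → ℕ
    count a = length (filter (λ x → null? (x * a)) L)

    Good : Carrier → Set
    Good a = ¬ Null a × (∀ x y → Null ((x * y) * a) → Null (x * a) ⊎ Null (y * a))

    -- A failure of primality of the annihilator of `a`, sought among representatives in order to be
    -- decidable.
    Bad : Carrier → Carrier → Set
    Bad a x = ¬ Null (x * a) × Any (λ y → ¬ Null (y * a) × Null ((x * y) * a)) L

    bad? : ∀ a x → Dec (Bad a x)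
    bad? a x = ¬? (null? (x * a)) ×-dec Any.any? (λ y → ¬? (null? (y * a)) ×-dec null? ((x * y) * a)) L

    null-≡ : ∀ {f g} → f ≡[ ι (+ p) ] g → Null g → Null f
    null-≡ = ≡-∣

    -- If x y kills `a` but neither factor does, pass to x a: its annihilator contains that of `a`
    -- and also y. The number of representatives bounds how often this can happen.
    maximal : ∀ fuel a → ¬ Null a → length L ∸ count a ≤ fuel → ∃ Good
    maximal fuel a ¬a bound = decide (Any.any? (bad? a) L)
      where
      decide : Dec (Any (Bad a) L) → ∃ Good
      decide (no none) = a ,, ¬a ,, λ x y n → pick x y n (null? (x * a)) (null? (y * a))
        where
        pick : ∀ x y → Null ((x * y) * a) → Dec (Null (x * a)) → Dec (Null (y * a)) → Null (x * a) ⊎ Null (y * a)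
        pick x y n (yes h) _       = inj₁ h
        pick x y n (no _)  (yes h) = inj₂ h
        pick x y n (no ¬x) (no ¬y) = ⊥-elim (none (lose (proj₁ (proj₂ rx)) ((λ h → ¬x (null-≡ (≡-* (proj₂ (proj₂ rx)) (≡-refl refl)) h)) ,,
            lose (proj₁ (proj₂ ry)) ((λ h → ¬y (null-≡ (≡-* (proj₂ (proj₂ ry)) (≡-refl refl)) h)) ,,
              null-≡ (≡-sym (≡-* (≡-* (proj₂ (proj₂ rx)) (proj₂ (proj₂ ry))) (≡-refl refl))) n))))
          where
          rx = represent x
          ry = represent y
      decide (yes h) = improve (find h)
        where
        improve : (∃ λ x → x ∈ L × Bad a x) → ∃ Good
        improve (x ,, _ ,, ¬xa ,, bad) = next fuel bound
          where
          larger : count a < count (x * a)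
          larger = filter-< (λ z → null? (z * a)) (λ z → null? (z * (x * a)))
            (λ {z} n → ∣-resp (solve 3 (λ x z a → x :* (z :* a) := z :* (x :* a)) refl x z a) (∣-*ˡ x n)) L
            (Any.map (λ {y} h → ∣-resp (solve 3 (λ x y a → (x :* y) :* a := y :* (x :* a)) refl x y a) (proj₂ h) ,, proj₁ h) bad)
          closer : length L ∸ count (x * a) < length L ∸ count a
          closer = ℕ.∸-monoʳ-< larger (List.length-filter (λ z → null? (z * (x * a))) L)
          next : ∀ fuel → length L ∸ count a ≤ fuel → ∃ Good
          next zero        b = ⊥-elim (ℕ.<⇒≱ (ℕ.<-≤-trans closer b) z≤n)
          next (suc fuel') b = maximal fuel' (x * a) ¬xa (ℕ.≤-pred (ℕ.≤-trans closer b))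

    good : ∃ Good
    good = maximal (length L ∸ count 1#) 1# (proper p (prime>1 pp)) ℕ.≤-refl

    P : Carrier → Set
    P f = Null (f * proj₁ good)

    P-isPrime : IsPrime R P
    P-isPrime = record
      { P-resp = λ e → ∣-resp (*-congʳ e) ; P-0 = ∣-resp (sym (zeroˡ _)) ∣0
      ; P-+ = λ h k → ∣-resp (sym (distribʳ _ _ _)) (∣-+ h k)
      ; P-* = λ r h → ∣-resp (sym (*-assoc r _ _)) (∣-*ˡ r h)
      ; P-proper = λ h → proj₁ (proj₂ good) (∣-resp (*-identityˡ _) h)
      ; P-prime = proj₂ (proj₂ good) }

    P-p : P (ι (+ p))
    P-p = proj₁ good , refl

  module Decomposition {m : ℕ} {R : CommutativeRing 0ℓ 0ℓ} {ζ σ} (C : IsCyclotomic m R ζ σ) (p : ℕ) (pp : Prime p)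
    (P : CommutativeRing.Carrier R → Set) (P-isPrime : IsPrime R P) (P-p : P (Ring.ι R (+ p))) where
    open Props C
    open Ring R
    open Eval R
    open Solver
    open IsPrime P-isPrime
    open Frobenius R
    open import Relation.Binary.Reasoning.Setoid setoid

    P-∣ : ∀ {x y} → x ∣ y → P x → P y
    P-∣ {x} (q , e) h = P-resp (trans (*-comm q x) (sym e)) (P-* q h)

    P-neg : ∀ {x} → P x → P (- x)
    P-neg {x} h = P-resp (solve 1 (λ x → (:- con (+ 1)) :* x := :- x) refl x) (P-* (- 1#) h)

    P-sub : ∀ {x y} → P x → P y → P (x - y)
    P-sub h k = P-+ h (P-neg k)

    P-Σ : ∀ n F → (∀ i → P (F i)) → P (Σ< n F)
    P-Σ zero    F h = P-0
    P-Σ (suc n) F h = P-+ (h 0) (P-Σ n (λ i → F (suc i)) (λ i → h (suc i)))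

    -- Otherwise a Bézout combination of `n` and `p` would put 1 into `P`.
    ¬P-coprime : ∀ {n} → Coprime n p → ¬ P (ι (+ n))
    ¬P-coprime {n} c h = P-proper (P-resp (trans (sym (+-cong (ι-* x (+ n)) (ι-* y (+ p)))) (trans (sym (ι-+ (x ℤ.* + n) (y ℤ.* + p))) (reflexive (≡.cong ι (proj₂ (proj₂ (bézout c)))))))
        (P-+ (P-* (ι x) h) (P-* (ι y) P-p)))
      where
      x = proj₁ (bézout c)
      y = proj₁ (proj₂ (bézout c))

    module EvHom c = HomProps (ev-isHom R c)

    divide-linear : ∀ (j : ℤ) f → ∃₂ λ q r → f ≐ (X P.- P.ι j) P.* q P.+ P.ι r
    divide-linear j [] = [] ,, 0ℤ ,, ≐-sym (≐-trans (P.+-identityʳ _) (mul-zeroʳ (X P.- P.ι j)))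
    divide-linear j (a ∷ f) = step (divide-linear j f)
      where
      step : (∃₂ λ q r → f ≐ (X P.- P.ι j) P.* q P.+ P.ι r) → ∃₂ λ q r → (a ∷ f) ≐ (X P.- P.ι j) P.* q P.+ P.ι r
      step (q ,, r ,, e) = (r ∷ q) ,, a ℤ.+ j ℤ.* r ,, ≐-trans (∷≐ a f) (≐-trans (P.+-congˡ {P.ι a} (mul-congʳ X e))
        (≐-trans (P.Solver.solve 5 (λ a x j q r → a S.:+ x S.:* ((x S.:- j) S.:* q S.:+ r) S.:= (x S.:- j) S.:* (r S.:+ x S.:* q) S.:+ (a S.:+ j S.:* r)) ≐-refl (P.ι a) X (P.ι j) q (P.ι r))
        (≐-sym (P.+-cong (mul-congʳ (X P.- P.ι j) (∷≐ r q)) (≐-trans (P.ι-+ a (j ℤ.* r)) (P.+-congˡ {P.ι a} (P.ι-* j r)))))))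
        where module S = P.Solver

    monic-linear : ∀ j → Monic 1 (X P.- P.ι j)
    monic-linear j = monic-cong (P.+-congˡ {X} (P.-‿cong (≐-sym (ι-const j)))) (monic ≡.refl λ { (suc (suc i)) _ → ≡.refl ; (suc zero) (s≤s ()) })

    -- Split off the linear factor at the root `j`. The following integers remain roots of the
    -- quotient, because their distances to `j` are positive and below `p`, hence outside `P`. In
    -- degree 0 the polynomial is 1 and has no root at all.
    roots : ∀ d f → Monic d f → d ≤ p → ∀ j → (∀ i → i < d → P (ev (ι (+ (j ℕ.+ i))) f)) → ∀ c → P (ev c f) → ∃ λ k → P (c - ι k)
    roots zero    f mf d≤p j h c Pc = ⊥-elim (P-proper (P-resp (trans (ev-cong c (one f mf)) (EvHom.φ-1 c)) Pc))
      where
      one : ∀ f → Monic 0 f → f ≐ P.1#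
      one f (monic l a) = mk λ { zero → l ; (suc i) → a (suc i) (s≤s z≤n) }
    roots (suc d) f mf d≤p j h c Pc = divided (divide-linear (+ j) f)
      where
      divided : (∃₂ λ q r → f ≐ (X P.- P.ι (+ j)) P.* q P.+ P.ι r) → ∃ λ k → P (c - ι k)
      divided (q ,, r ,, e) = [ (λ h → + j ,, h) , (λ h → roots d q mq (ℕ.<⇒≤ d≤p) (suc j) roots-q c h) ]′
          (P-prime (c - ι (+ j)) (ev c q) (P-resp (trans (+-congʳ (ev-f c)) (solve 2 (λ x r → (x :+ r) :- r := x) refl _ (ι r))) (P-sub Pc Pr)))
        where
        ev-f : ∀ c → ev c f ≈ (c - ι (+ j)) * ev c q + ι r
        ev-f c = trans (ev-cong c e) (trans (ev-+ c ((X P.- P.ι (+ j)) P.* q) (P.ι r)) (+-cong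
          (trans (ev-* c (X P.- P.ι (+ j)) q) (*-congʳ (trans (EvHom.φ-sub c X (P.ι (+ j))) (+-cong (ev-X c) (-‿cong (EvHom.φ-ι c (+ j)))))))
          (EvHom.φ-ι c r)))
        Pr : P (ι r)
        Pr = P-resp (trans (reflexive (≡.cong (λ k → ev (ι (+ k)) f) (ℕ.+-identityʳ j))) (trans (ev-f (ι (+ j))) (trans (+-congʳ (trans (*-congʳ (-‿inverseʳ (ι (+ j)))) (zeroˡ (ev (ι (+ j)) q)))) (+-identityˡ _)))) (h 0 (s≤s z≤n))
        mq : Monic d q
        mq = monic-quotient (monic-linear (+ j)) d q (monic-cong f-r≐ (monic-sub-const mf))
          where
          f-r≐ : f P.- P.ι r ≐ q P.* (X P.- P.ι (+ j))
          f-r≐ = ≐-trans (P.+-congʳ {x = P.- P.ι r} e) (P.Solver.solve 3 (λ l q r → (l S.:* q S.:+ r) S.:- r S.:= q S.:* l) ≐-refl (X P.- P.ι (+ j)) q (P.ι r))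
            where module S = P.Solver
          monic-sub-const : Monic (suc d) f → Monic (suc d) (f P.- P.ι r)
          monic-sub-const (monic l a) = monic (≡.trans (co d) l) (λ { (suc i) h → ≡.trans (co i) (a (suc i) h) })
            where
            co : ∀ i → coeff (f P.- P.ι r) (suc i) ≡ coeff f (suc i)
            co i = ≡.trans (coeff-add f (P.- P.ι r) (suc i)) (≡.trans (≡.cong (ℤ._+_ (coeff f (suc i))) (≡.trans (coeff-neg (P.ι r) (suc i)) (≡.cong ℤ.-_ (at (ι-const r) (suc i))))) (ℤ.+-identityʳ _))
        roots-q : ∀ i → i < d → P (ev (ι (+ (suc j ℕ.+ i))) q)
        roots-q i i<d = [ (λ h → ⊥-elim (¬P-coprime (Cop.sym (∤⇒coprime pp (λ p∣ → ℕ.<⇒≱ (ℕ.<-≤-trans (s≤s i<d) d≤p) (ℕ.∣⇒≤ p∣)))) h)) , (λ h → h) ]′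
          (P-prime (ι (+ suc i)) (ev k q) (P-resp (trans (+-congʳ (ev-f k)) (trans (solve 2 (λ x r → (x :+ r) :- r := x) refl _ (ι r)) (*-congʳ diff)))
            (P-sub (≡.subst (λ n → P (ev (ι (+ n)) f)) (ℕ.+-suc j i) (h (suc i) (s≤s i<d))) Pr)))
          where
          k = ι (+ (suc j ℕ.+ i))
          diff : k - ι (+ j) ≈ ι (+ suc i)
          diff = trans (sym (ι-- (+ (suc j ℕ.+ i)) (+ j))) (reflexive (≡.cong ι (≡.trans (≡.cong (λ n → + n ℤ.- + j) (≡.sym (ℕ.+-suc j i))) (lem (+ j) (+ suc i)))))
            where
            lem : ∀ j i → (j ℤ.+ i) ℤ.- j ≡ i
            lem = Z.Solver.solve 2 (λ j i → (j Z.Solver.:+ i) Z.Solver.:- j Z.Solver.:= i) ≡.refl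

    -- Modulo `P` the polynomial x^p - x already has the p roots 0, ..., p - 1, so every root is
    -- congruent to one of them.
    frobenius-fixed : ∀ c → P (c ^ p - c) → ∃ λ k → P (c - ι k)
    frobenius-fixed c h = roots p (X P.^ p P.- X) monic-p ℕ.≤-refl 0 (λ i _ → P-resp (sym (ev-f (ι (+ i)))) (P-∣ (difference (fermat pp (+ i))) P-p)) c (P-resp (sym (ev-f c)) h)
      where
      ev-f : ∀ c → ev c (X P.^ p P.- X) ≈ c ^ p - c
      ev-f c = trans (EvHom.φ-sub c (X P.^ p) X) (+-cong (trans (ev-^ c X p) (^-congˡ p (ev-X c))) (-‿cong (ev-X c)))
      monic-p : Monic p (X P.^ p P.- X)
      monic-p = build (proj₁ (≥2 pp)) (proj₂ (≥2 pp))
        where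
        shift : ∀ {d g} → Monic d g → Monic (suc d) (0ℤ ∷ g)
        shift (monic l a) = monic l (λ { (suc i) (s≤s h) → a i h })
        -- x^p - x is x times the value of y - 1 at y = x^(p-1), a form whose leading coefficient is
        -- visible.
        build : ∀ k → p ≡ suc (suc k) → Monic p (X P.^ p P.- X)
        build k ≡.refl = monic-cong (≐-trans (shift≐X* (X-1 ⟨ suc k ⟩)) (≐-trans (mul-congʳ X (≐-trans (Sub.φ-sub (suc k) X P.1#) (P.+-cong (PE.ev-X (X P.^ suc k)) (P.-‿cong {P.1# ⟨ suc k ⟩} (Sub.φ-1 (suc k))))))
            (P.Solver.solve 2 (λ x y → x S.:* (y S.:- S.con (+ 1)) S.:= x S.:* y S.:- x) ≐-refl X (X P.^ suc k))))
          (shift (≡.subst (λ n → Monic n (X-1 ⟨ suc k ⟩)) (ℕ.*-identityʳ (suc k)) (monic-⟨⟩ (suc k) (s≤s z≤n) monic-X-1)))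
          where module S = P.Solver

    frobenius-Σ : ∀ n F → Σ< n F ^ p ≡[ ι (+ p) ] Σ< n (λ i → F i ^ p)
    frobenius-Σ zero    F = ≡-refl (0^p≈0 pp)
    frobenius-Σ (suc n) F = ≡-trans (frobenius-+ pp (F 0) (Σ< n (λ i → F (suc i)))) (≡-+ (≡-refl refl) (frobenius-Σ n (λ i → F (suc i))))

    module Periods (q v' : ℕ) (m≡ : m ≡ q ℕ.* v') (v'-cop : Coprime v' p) (t : ℕ) (cop : Coprime t m) (stable : ∀ f → P f → P (σ t f))
      (M : ℕ) (p^M≡1 : p ℕ.^ suc M ≡ 1 mod v') (M-least : ∀ i → i < M → ¬ p ℕ.^ suc i ≡ 1 mod v') where

      0<v' : 0 < v'
      0<v' = ℕ.n≢0⇒n>0 (λ v'≡0 → ℕ.<⇒≢ 0<m (≡.sym (≡.trans m≡ (≡.trans (≡.cong (q ℕ.*_) v'≡0) (ℕ.*-zeroʳ q)))))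

      q≢0 : q ≢ 0
      q≢0 q≡0 = ℕ.<⇒≢ 0<m (≡.sym (≡.trans m≡ (≡.cong (ℕ._* v') q≡0)))

      ω : ℕ → Carrier
      ω e = ζ ^ (q ℕ.* e)

      ω-mod : ∀ {a b} → a ≡ b mod v' → ω a ≈ ω b
      ω-mod {a} {b} h = ζ-mod {q ℕ.* a} {q ℕ.* b} (≡.subst (λ n → q ℕ.* a ≡ q ℕ.* b mod n) (≡.sym m≡) (mod-scale q h))

      ω-+ : ∀ a b → ω a * ω b ≈ ω (a ℕ.+ b)
      ω-+ a b = trans (sym (^-homo-* ζ (q ℕ.* a) (q ℕ.* b))) (^-congʳ ζ (≡.sym (ℕ.*-distribˡ-+ q a b)))

      ω-^ : ∀ a n → ω a ^ n ≈ ω (a ℕ.* n)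
      ω-^ a n = trans (^-assocʳ ζ (q ℕ.* a) n) (^-congʳ ζ (ℕ.*-assoc q a n))

      ω-orthogonal : ∀ e → ¬ v' ℕ.∣ e → Σ< v' (λ r → ω (e ℕ.* r)) ≈ 0#
      ω-orthogonal e v'∤e = trans (Σ<-cong v' (λ r _ → ^-congʳ ζ (≡.sym (ℕ.*-assoc q e r)))) (orthogonal v' (q ℕ.* e)
        (≡.subst (ℕ._∣ q ℕ.* e ℕ.* v') (≡.sym m≡) (≡.subst (q ℕ.* v' ℕ.∣_) (≡.sym (ℕ.*-assoc q e v')) (ℕ.*-monoʳ-∣ q (ℕ.n∣m*n e))))
        (λ h → v'∤e (ℕ.*-cancelˡ-∣ q {{ℕ.≢-nonZero q≢0}} (≡.subst (ℕ._∣ q ℕ.* e) m≡ h))))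

      ω-diagonal : ∀ e → v' ℕ.∣ e → Σ< v' (λ r → ω (e ℕ.* r)) ≈ ι (+ v')
      ω-diagonal e v'∣e = trans (Σ<-cong v' (λ r _ → ^-congʳ ζ (≡.sym (ℕ.*-assoc q e r)))) (diagonal v' (q ℕ.* e)
        (≡.subst (ℕ._∣ q ℕ.* e) (≡.sym m≡) (ℕ.*-monoʳ-∣ q v'∣e)))

      -- A Gauss period: the orbit of ω^r under multiplication of the exponent by `p`, summed, hence
      -- fixed by Frobenius modulo `p`.
      period : ℕ → Carrier
      period r = Σ< (suc M) (λ i → ω (r ℕ.* p ℕ.^ i))

      period-frobenius : ∀ r → period r ^ p ≡[ ι (+ p) ] period r
      period-frobenius r = ≡-trans (frobenius-Σ (suc M) (λ i → ω (r ℕ.* p ℕ.^ i))) (≡-refl (begin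
        Σ< (suc M) (λ i → ω (r ℕ.* p ℕ.^ i) ^ p)                    ≈⟨ Σ<-cong (suc M) (λ i _ → trans (ω-^ (r ℕ.* p ℕ.^ i) p) (reflexive (≡.cong ω (≡.trans (ℕ.*-assoc r (p ℕ.^ i) p) (≡.cong (r ℕ.*_) (ℕ.*-comm (p ℕ.^ i) p)))))) ⟩
        Σ< (suc M) (λ i → ω (r ℕ.* p ℕ.^ suc i))                    ≈⟨ Σ<-last M (λ i → ω (r ℕ.* p ℕ.^ suc i)) ⟩
        Σ< M (λ i → ω (r ℕ.* p ℕ.^ suc i)) + ω (r ℕ.* p ℕ.^ suc M)  ≈⟨ +-congˡ (ω-mod {r ℕ.* p ℕ.^ suc M} {r ℕ.* 1} (mod-* {r} {r} {p ℕ.^ suc M} {1} (mod-refl ≡.refl) p^M≡1)) ⟩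
        Σ< M (λ i → ω (r ℕ.* p ℕ.^ suc i)) + ω (r ℕ.* 1)            ≈⟨ +-comm _ _ ⟩
        period r                                                    ∎))

      -- The period is congruent to an integer modulo `P`; σ_t fixes integers and `stable`
      -- transports the congruence.
      period-fixed : ∀ r → P (σ t (period r) - period r)
      period-fixed r = P-resp (solve 3 (λ s x k → (s :- k) :- (x :- k) := s :- x) refl (σ t (period r)) (period r) (ι k))
          (P-sub (P-resp (trans (σ.φ-sub t cop (period r) (ι k)) (+-congˡ (-‿cong (σ.φ-ι t cop k)))) (stable _ (proj₂ k,h))) (proj₂ k,h))
        where
        k,h : ∃ λ k → P (period r - ι k)
        k,h = frobenius-fixed (period r) (P-∣ (difference (period-frobenius r)) P-p)
        k = proj₁ k,h

      σ-period : ∀ r → σ t (period r) ≈ Σ< (suc M) (λ i → ω (r ℕ.* (t ℕ.* p ℕ.^ i)))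
      σ-period r = trans (σ.φ-Σ t cop (suc M) (λ i → ω (r ℕ.* p ℕ.^ i))) (Σ<-cong (suc M) (λ i _ → trans (σ-ζ^ t cop (q ℕ.* (r ℕ.* p ℕ.^ i)))
        (^-congʳ ζ (lem t q r (p ℕ.^ i)))))
        where
        open import Data.Nat.Solver using (module +-*-Solver)
        lem : ∀ t q r x → t ℕ.* (q ℕ.* (r ℕ.* x)) ≡ q ℕ.* (r ℕ.* (t ℕ.* x))
        lem = +-*-Solver.solve 4 (λ t q r x → t +-*-Solver.:* (q +-*-Solver.:* (r +-*-Solver.:* x)) +-*-Solver.:= q +-*-Solver.:* (r +-*-Solver.:* (t +-*-Solver.:* x))) ≡.refl

      -- Fourier inversion on ℤ/v': after the interchange, the i-th inner sum is v' or 0 according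
      -- to whether e i is 1 modulo v'.
      multiplicity : ∀ (e : ℕ → ℕ) → Σ< v' (λ r → ω ((v' ∸ 1) ℕ.* r) * Σ< (suc M) (λ i → ω (r ℕ.* e i))) ≈ Σ< (suc M) (λ i → Σ< v' (λ r → ω ((v' ∸ 1 ℕ.+ e i) ℕ.* r)))
      multiplicity e = trans (Σ<-cong v' (λ r _ → trans (Σ<-*ˡ (suc M) (ω ((v' ∸ 1) ℕ.* r)) (λ i → ω (r ℕ.* e i))) (Σ<-cong (suc M) (λ i _ → trans (ω-+ ((v' ∸ 1) ℕ.* r) (r ℕ.* e i))
          (reflexive (≡.cong ω (≡.trans (≡.cong ((v' ∸ 1) ℕ.* r ℕ.+_) (ℕ.*-comm r (e i))) (≡.sym (ℕ.*-distribʳ-+ r (v' ∸ 1) (e i))))))))))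
        (Σ<-comm v' (suc M) (λ r i → ω ((v' ∸ 1 ℕ.+ e i) ℕ.* r)))

      -1+ : ∀ {e} → v' ℕ.∣ v' ∸ 1 ℕ.+ e → e ≡ 1 mod v'
      -1+ {e} h = Z.cg (Z.∣-resp (≡.trans (≡.cong (λ z → (z ℤ.+ + e) ℤ.- + v') v-1) (lem (+ v') (+ e))) (Z.∣-sub (∣⇒Z∣ h) (∣⇒Z∣ ℕ.∣-refl)))
        where
        v-1 : + (v' ∸ 1) ≡ + v' ℤ.- + 1
        v-1 = ≡.trans (≡.sym (ℤ.⊖-≥ 0<v')) (≡.sym (ℤ.m-n≡m⊖n v' 1))
        lem : ∀ v e → ((v ℤ.- + 1) ℤ.+ e) ℤ.- v ≡ e ℤ.- + 1
        lem = Z.Solver.solve 2 (λ v e → ((v Z.Solver.:- Z.Solver.con (+ 1)) Z.Solver.:+ e) Z.Solver.:- v Z.Solver.:= e Z.Solver.:- Z.Solver.con (+ 1)) ≡.refl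

      -- Minimality of the order of `p` leaves only i = 0.
      period-multiplicity : Σ< v' (λ r → ω ((v' ∸ 1) ℕ.* r) * period r) ≈ ι (+ v')
      period-multiplicity = trans (multiplicity (p ℕ.^_)) (trans (+-cong (ω-diagonal (v' ∸ 1 ℕ.+ 1) (≡.subst (v' ℕ.∣_) (≡.sym (ℕ.m∸n+n≡m 0<v')) ℕ.∣-refl))
          (Σ<-0 M (λ i i<M → ω-orthogonal (v' ∸ 1 ℕ.+ p ℕ.^ suc i) (λ h → M-least i i<M (-1+ h))))) (+-identityʳ _))

      -- If no t p^i were 1 modulo v', pairing the differences σ_t(period) - period with ω^(-r)
      -- would give -v'. These differences lie in `P`, whereas v' is prime to `p` and does not.
      power-of-p : ∃ λ j → t ≡ p ℕ.^ j mod v'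
      power-of-p = search (ℕ.anyUpTo? (λ i → v' ℕ.∣? (v' ∸ 1 ℕ.+ t ℕ.* p ℕ.^ i)) (suc M))
        where
        search : Dec (∃ λ i → i < suc M × v' ℕ.∣ v' ∸ 1 ℕ.+ t ℕ.* p ℕ.^ i) → ∃ λ j → t ≡ p ℕ.^ j mod v'
        search (no none) = ⊥-elim (¬P-coprime v'-cop (P-resp (-‿involutive (ι (+ v'))) (P-neg (P-resp eq (P-Σ v' (λ r → ω ((v' ∸ 1) ℕ.* r) * (σ t (period r) - period r)) (λ r → P-* _ (period-fixed r)))))))
          where
          eq : Σ< v' (λ r → ω ((v' ∸ 1) ℕ.* r) * (σ t (period r) - period r)) ≈ - ι (+ v')
          eq = begin
            Σ< v' (λ r → ω ((v' ∸ 1) ℕ.* r) * (σ t (period r) - period r))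
              ≈⟨ Σ<-cong v' (λ r _ → trans (solve 3 (λ w s x → w :* (s :- x) := w :* s :- w :* x) refl (ω ((v' ∸ 1) ℕ.* r)) (σ t (period r)) (period r)) (+-congʳ (*-congˡ (σ-period r)))) ⟩
            Σ< v' (λ r → ω ((v' ∸ 1) ℕ.* r) * Σ< (suc M) (λ i → ω (r ℕ.* (t ℕ.* p ℕ.^ i))) - ω ((v' ∸ 1) ℕ.* r) * period r)
              ≈⟨ Σ<-sub v' (λ r → ω ((v' ∸ 1) ℕ.* r) * Σ< (suc M) (λ i → ω (r ℕ.* (t ℕ.* p ℕ.^ i)))) (λ r → ω ((v' ∸ 1) ℕ.* r) * period r) ⟩
            Σ< v' (λ r → ω ((v' ∸ 1) ℕ.* r) * Σ< (suc M) (λ i → ω (r ℕ.* (t ℕ.* p ℕ.^ i)))) - Σ< v' (λ r → ω ((v' ∸ 1) ℕ.* r) * period r)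
              ≈⟨ +-cong (trans (multiplicity (λ i → t ℕ.* p ℕ.^ i)) (Σ<-0 (suc M) (λ i i<M → ω-orthogonal (v' ∸ 1 ℕ.+ t ℕ.* p ℕ.^ i) (λ h → none (i ,, i<M ,, h))))) (-‿cong period-multiplicity) ⟩
            0# - ι (+ v')       ≈⟨ +-identityˡ _ ⟩
            - ι (+ v')          ∎
        -- From t p^i = 1 and p^(M+1) = 1 modulo v' follows t = p^(M+1-i), an exponent that is again
        -- natural.
        search (yes (i ,, s≤s i≤M ,, h)) = suc M ∸ i ,,
            Z.≡-trans {b = + (t ℕ.* p ℕ.^ suc M)} (Z.≡-sym (Z.≡-trans (mod-* {t} {t} {p ℕ.^ suc M} {1} (mod-refl ≡.refl) p^M≡1) (mod-refl (ℕ.*-identityʳ t))))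
            (Z.≡-trans (mod-refl e) (Z.≡-trans (mod-* {t ℕ.* p ℕ.^ i} {1} {p ℕ.^ (suc M ∸ i)} {p ℕ.^ (suc M ∸ i)} (-1+ h) (mod-refl ≡.refl)) (mod-refl (ℕ.*-identityˡ _))))
          where
          e : t ℕ.* p ℕ.^ suc M ≡ t ℕ.* p ℕ.^ i ℕ.* p ℕ.^ (suc M ∸ i)
          e = ≡.trans (≡.cong (λ n → t ℕ.* p ℕ.^ n) (≡.sym (ℕ.m+[n∸m]≡n (ℕ.m≤n⇒m≤1+n i≤M)))) (≡.trans (≡.cong (t ℕ.*_) (ℕ.^-distribˡ-+-* p i (suc M ∸ i))) (≡.sym (ℕ.*-assoc t (p ℕ.^ i) (p ℕ.^ (suc M ∸ i)))))

    power-of-p : ∀ q v' → m ≡ q ℕ.* v' → ¬ p ℕ.∣ v' → ∀ t → Coprime t m → (∀ f → P f → P (σ t f)) → ∃ λ j → t ≡ p ℕ.^ j mod v'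
    power-of-p q v' m≡ p∤v' t cop stable = use (order 0<v' v'-cop)
      where
      0<v' : 0 < v'
      0<v' = ℕ.n≢0⇒n>0 (λ v'≡0 → ℕ.<⇒≢ 0<m (≡.sym (≡.trans m≡ (≡.trans (≡.cong (q ℕ.*_) v'≡0) (ℕ.*-zeroʳ q)))))
      v'-cop : Coprime v' p
      v'-cop = Cop.sym (∤⇒coprime pp p∤v')
      use : (∃ λ M → p ℕ.^ suc M ≡ 1 mod v' × (∀ i → i < M → ¬ p ℕ.^ suc i ≡ 1 mod v')) → ∃ λ j → t ≡ p ℕ.^ j mod v'
      use (M ,, one ,, least) = Periods.power-of-p q v' m≡ v'-cop t cop stable M one least

-- Transport of p-power divisibility along a lift of Frobenius, with ramification.

module LiftingDivisibility where

  open import Defs using (Poly)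
  open RingTools
  open IntegerPolynomials
  open NumberTheory
  open IndexedSums
  open FrobeniusPowers
  open CyclotomicRings
  open TraceForm
  open import Algebra.Bundles using (CommutativeRing)
  open import Data.Nat as ℕ using (ℕ; zero; suc; z≤n; s≤s; _<_; _∸_)
  import Data.Nat.Properties as ℕ
  import Data.Nat.Divisibility as ℕ
  open import Data.Nat.Coprimality as Cop using (Coprime)
  open import Data.Nat.Primality using (Prime)
  open import Data.Nat.Induction using (<-rec)
  open import Data.Integer as ℤ using (ℤ; +_)
  import Data.Integer.Properties as ℤ
  open import Data.Fin as Fin using (Fin)
  open import Data.Product using (∃; ∃₂; _×_; proj₁; proj₂) renaming (_,_ to _,,_)
  open import Data.Sum using (_⊎_; inj₁; inj₂)
  open import Data.Empty using (⊥-elim)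
  open import Level using (0ℓ)
  open import Relation.Nullary
  open import Relation.Binary.PropositionalEquality as ≡ using (_≡_)

  pos-^ : ∀ p a → + (p ℕ.^ a) ≡ (+ p) ℤ.^ a
  pos-^ p zero    = ≡.refl
  pos-^ p (suc a) = ≡.trans (ℤ.pos-* p (p ℕ.^ a)) (≡.cong (ℤ._*_ (+ p)) (pos-^ p a))

  module Congruences (A : CommutativeRing 0ℓ 0ℓ) where
    open Ring A
    open Solver

    pow-≡ : ∀ {π x L} → x ^ L ≡[ π ] 1# → ∀ {a b} → a ≡ b mod L → x ^ a ≡[ π ] x ^ b
    pow-≡ {π} {x} {L} h {a} {b} c = byCases (mod-cases {a} {b} {L} c)
      where
      step : ∀ a k → x ^ (a ℕ.+ L ℕ.* k) ≡[ π ] x ^ a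
      step a k = ≡-trans (≡-refl (trans (^-homo-* x a (L ℕ.* k)) (*-congˡ (sym (^-assocʳ x L k)))))
        (≡-trans (≡-* (≡-refl refl) (≡-trans (≡-^ k h) (≡-refl (1^n≈1 k)))) (≡-refl (*-identityʳ _)))
      byCases : ∃ (λ k → a ≡ b ℕ.+ L ℕ.* k) ⊎ ∃ (λ k → b ≡ a ℕ.+ L ℕ.* k) → x ^ a ≡[ π ] x ^ b
      byCases (inj₁ (k ,, e)) = ≡-trans (≡-refl (^-congʳ x e)) (step b k)
      byCases (inj₂ (k ,, e)) = ≡-sym (≡-trans (≡-refl (^-congʳ x e)) (step a k))

    coprime-∣ : ∀ {a b w} → Coprime a b → ι (+ a) ∣ w → ι (+ b) ∣ w → ι (+ (a ℕ.* b)) ∣ w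
    coprime-∣ {a} {b} {w} c (q , e) (r , f) = ι x * r + ι y * q , (begin
      w                                                     ≈⟨ *-identityˡ w ⟨
      1# * w                                                ≈⟨ *-congʳ one ⟨
      (ι x * ι (+ a) + ι y * ι (+ b)) * w                   ≈⟨ distribʳ w _ _ ⟩
      (ι x * ι (+ a)) * w + (ι y * ι (+ b)) * w             ≈⟨ +-cong (*-congˡ f) (*-congˡ e) ⟩
      (ι x * ι (+ a)) * (ι (+ b) * r) + (ι y * ι (+ b)) * (ι (+ a) * q)
        ≈⟨ solve 6 (λ x y a b q r → (x :* a) :* (b :* r) :+ (y :* b) :* (a :* q) := (a :* b) :* (x :* r :+ y :* q)) refl (ι x) (ι y) (ι (+ a)) (ι (+ b)) q r ⟩
      (ι (+ a) * ι (+ b)) * (ι x * r + ι y * q)             ≈⟨ *-congʳ (trans (reflexive (≡.cong ι (ℤ.pos-* a b))) (ι-* (+ a) (+ b))) ⟨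
      ι (+ (a ℕ.* b)) * (ι x * r + ι y * q)                 ∎)
      where
      open import Relation.Binary.Reasoning.Setoid setoid
      x = proj₁ (bézout c)
      y = proj₁ (proj₂ (bézout c))
      one : ι x * ι (+ a) + ι y * ι (+ b) ≈ 1#
      one = trans (sym (+-cong (ι-* x (+ a)) (ι-* y (+ b)))) (trans (sym (ι-+ (x ℤ.* + a) (y ℤ.* + b))) (reflexive (≡.cong ι (proj₂ (proj₂ (bézout c))))))

    ι^ : ∀ p a → ι (+ (p ℕ.^ a)) ≈ ι (+ p) ^ a
    ι^ p a = trans (reflexive (≡.cong ι (pos-^ p a))) (ι-^ (+ p) a)

    -- Full prime powers are peeled off `n` one by one and recombined through Bézout identities in
    -- ℤ.
    prime-powers-∣ : ∀ n → 0 < n → ∀ w → (∀ p b → Prime p → p ℕ.^ b ℕ.∣ n → 0 < b → ι (+ p) ^ b ∣ w) → ι (+ n) ∣ w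
    prime-powers-∣ n 0<n w h = <-rec Goal go n 0<n ℕ.∣-refl
      where
      Goal : ℕ → Set
      Goal d = 0 < d → d ℕ.∣ n → ι (+ d) ∣ w
      go : ∀ d → (∀ {e} → e < d → Goal e) → Goal d
      go d rec 0<d d∣n = byCases (1 ℕ.<? d)
        where
        byCases : Dec (1 < d) → ι (+ d) ∣ w
        byCases (no ¬1<d) = ≡.subst (λ d → ι (+ d) ∣ w) (ℕ.≤-antisym 0<d (ℕ.≮⇒≥ ¬1<d)) 1∣
        byCases (yes 1<d) = peel (primeDivisor d 1<d)
          where
          peel : (∃ λ p → Prime p × p ℕ.∣ d) → ι (+ d) ∣ w
          peel (p ,, pp ,, p∣d) = split (primePart p (prime>1 pp) d 0<d)
            where
            split : (∃₂ λ a d' → d ≡ p ℕ.^ a ℕ.* d' × ¬ p ℕ.∣ d') → ι (+ d) ∣ w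
            split (zero ,, d' ,, e ,, p∤d') = ⊥-elim (p∤d' (≡.subst (p ℕ.∣_) (≡.trans e (ℕ.+-identityʳ d')) p∣d))
            split (suc a ,, d' ,, e ,, p∤d') = ≡.subst (λ d → ι (+ d) ∣ w) (≡.sym e) (coprime-∣ {p ℕ.^ suc a} {d'}
                (Cop.sym (coprime-^ʳ (suc a) (Cop.sym (∤⇒coprime pp p∤d')))) (∣-respˡ (sym (ι^ p (suc a))) (h p (suc a) pp (ℕ.∣-trans (≡.subst (p ℕ.^ suc a ℕ.∣_) (≡.sym e) (ℕ.m∣m*n d')) d∣n) (s≤s z≤n)))
                (rec d'<d 0<d' (ℕ.∣-trans (≡.subst (d' ℕ.∣_) (≡.sym e) (ℕ.n∣m*n (p ℕ.^ suc a))) d∣n)))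
              where
              0<d' : 0 < d'
              0<d' = ℕ.n≢0⇒n>0 (λ d'≡0 → p∤d' (≡.subst (p ℕ.∣_) (≡.sym d'≡0) (p ℕ.∣0)))
              1<pa : 1 < p ℕ.^ suc a
              1<pa = ℕ.<-≤-trans (prime>1 pp) (ℕ.m≤m*n p (p ℕ.^ a) {{ℕ.m^n≢0 p a {{ℕ.>-nonZero (prime>0 pp)}}}})
              d'<d : d' < d
              d'<d = ≡.subst (d' <_) (≡.trans (ℕ.*-comm d' (p ℕ.^ suc a)) (≡.sym e)) (ℕ.m<m*n d' (p ℕ.^ suc a) {{ℕ.>-nonZero 0<d'}} 1<pa)

  module GeneratedRing (A : CommutativeRing 0ℓ 0ℓ) where
    open Ring A
    open Eval A

    -- `z` and the `b g` stand for ζ_u and the group elements. The last two hypotheses differ on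
    -- purpose: b^v' is exactly 1, whereas z^v' is only asked to be 1 modulo `π`, which covers the
    -- case that p divides u.
    module Descent
      (z : CommutativeRing.Carrier A) {N : ℕ} (b : Fin N → CommutativeRing.Carrier A)
      (generated : ∀ Y → ∃ λ (F : Fin N → Poly) → Y ≈ sum (λ g → ev z (F g) * b g))
      (σ : CommutativeRing.Carrier A → CommutativeRing.Carrier A) (σ-hom : IsHom A A σ)
      (τ : ℕ) (σ-z : σ z ≈ z ^ τ) (σ-b : ∀ g → σ (b g) ≈ b g ^ τ)
      (p : ℕ) (pp : Prime p) (v' : ℕ) (0<v' : 0 < v') (v'-cop : Coprime v' p) (j : ℕ) (τ≡p^j : τ ≡ p ℕ.^ j mod v')
      (π : CommutativeRing.Carrier A) (π∣p : π ∣ ι (+ p)) (π-regular : ∀ x → π * x ≈ 0# → x ≈ 0#)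
      (π∣σπ : π ∣ σ π) (z^v' : z ^ v' ≡[ π ] 1#) (b^v' : ∀ g → b g ^ v' ≈ 1#) where

      open Solver
      open Frobenius A
      open Congruences A
      module σ = HomProps σ-hom
      open import Relation.Binary.Reasoning.Setoid setoid

      sum-≡ : ∀ {n d} {F G : Fin n → Carrier} → (∀ g → F g ≡[ d ] G g) → sum F ≡[ d ] sum G
      sum-≡ {zero}  h = ≡-refl refl
      sum-≡ {suc n} h = ≡-+ (h Fin.zero) (sum-≡ (λ g → h (Fin.suc g)))

      σ-sum : ∀ {n} (F : Fin n → Carrier) → σ (sum F) ≈ sum (λ g → σ (F g))
      σ-sum {zero}  F = σ.φ-0
      σ-sum {suc n} F = trans (σ.φ-+ (F Fin.zero) (sum (λ g → F (Fin.suc g)))) (+-congˡ (σ-sum (λ g → F (Fin.suc g))))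

      frobenius-sum : ∀ {n} (F : Fin n → Carrier) → sum F ^ p ≡[ ι (+ p) ] sum (λ g → F g ^ p)
      frobenius-sum {zero}  F = ≡-refl (0^p≈0 pp)
      frobenius-sum {suc n} F = ≡-trans (frobenius-+ pp (F Fin.zero) (sum (λ g → F (Fin.suc g)))) (≡-+ (≡-refl refl) (frobenius-sum (λ g → F (Fin.suc g))))

      frobenius-sum-^ : ∀ i {n} (F : Fin n → Carrier) → sum F ^ (p ℕ.^ i) ≡[ ι (+ p) ] sum (λ g → F g ^ (p ℕ.^ i))
      frobenius-sum-^ zero    F = ≡-refl (trans (*-identityʳ _) (sum-cong-≋ (λ g → sym (*-identityʳ (F g)))))
      frobenius-sum-^ (suc i) F = ≡-trans (≡-refl (sym (^-assocʳ (sum F) p (p ℕ.^ i)))) (≡-trans (≡-^ (p ℕ.^ i) (frobenius-sum F))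
        (≡-trans (frobenius-sum-^ i (λ g → F g ^ p)) (≡-refl (sum-cong-≋ (λ g → ^-assocʳ (F g) p (p ℕ.^ i))))))

      -- Modulo `p`, a p^i-th power only raises the generators; modulo `π`, their exponents count
      -- only modulo v'.
      frobenius-generated : ∀ i s → s ≡ p ℕ.^ i mod v' → ∀ (F : Fin N → Poly) →
        sum (λ g → ev z (F g) * b g) ^ (p ℕ.^ i) ≡[ π ] sum (λ g → ev (z ^ s) (F g) * b g ^ s)
      frobenius-generated i s s≡ F = ≡-trans (≡-weaken π∣p (frobenius-sum-^ i (λ g → ev z (F g) * b g))) (sum-≡ (λ g →
        ≡-trans (≡-refl (^-distrib-* (ev z (F g)) (b g) (p ℕ.^ i))) (≡-*
          (≡-trans (≡-weaken π∣p (frobenius-ev-^ pp i z (F g))) (ev-≡ (F g) (pow-≡ {π} {z} {v'} z^v' {p ℕ.^ i} {s} (Z.≡-sym s≡))))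
          (pow-≡ {π} {b g} {v'} (≡-refl (b^v' g)) {p ℕ.^ i} {s} (Z.≡-sym s≡)))))

      σ≡frobenius : ∀ Y → σ Y ≡[ π ] Y ^ (p ℕ.^ j)
      σ≡frobenius Y = ≡-sym (≡-trans (≡-refl (^-congˡ (p ℕ.^ j) (proj₂ (generated Y)))) (≡-trans (frobenius-generated j τ τ≡p^j F) (≡-refl (begin
        sum (λ g → ev (z ^ τ) (F g) * b g ^ τ)        ≈⟨ sum-cong-≋ (λ g → trans (σ.φ-* (ev z (F g)) (b g)) (*-cong (trans (σ.φ-ev z (F g)) (ev-congˡ (F g) σ-z)) (σ-b g))) ⟨
        sum (λ g → σ (ev z (F g) * b g))              ≈⟨ σ-sum (λ g → ev z (F g) * b g) ⟨
        σ (sum (λ g → ev z (F g) * b g))              ≈⟨ σ.φ-cong (proj₂ (generated Y)) ⟨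
        σ Y                                           ∎))))
        where
        F = proj₁ (generated Y)

      module _ (M : ℕ) (p^M≡1 : p ℕ.^ suc M ≡ 1 mod v') where

        q-1 : ℕ
        q-1 = p ℕ.^ suc M ∸ 1

        q≡ : suc q-1 ≡ p ℕ.^ suc M
        q≡ = ℕ.m+[n∸m]≡n (ℕ.>-nonZero⁻¹ _ {{ℕ.m^n≢0 p (suc M) {{ℕ.>-nonZero (prime>0 pp)}}}})

        q-1>0 : 0 < q-1
        q-1>0 = ℕ.≤-pred (≡.subst (1 <_) (≡.sym q≡) (ℕ.<-≤-trans (prime>1 pp) (ℕ.m≤m*n p (p ℕ.^ M) {{ℕ.m^n≢0 p M {{ℕ.>-nonZero (prime>0 pp)}}}})))

        -- As p^(M+1) is 1 modulo v', raising to that power is the identity modulo `π`.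
        fixed-q : ∀ Y → Y * Y ^ q-1 ≡[ π ] Y
        fixed-q Y = ≡-trans (≡-refl (^-congʳ Y q≡)) (≡-trans (≡-refl (^-congˡ (p ℕ.^ suc M) (proj₂ (generated Y))))
          (≡-trans (frobenius-generated (suc M) 1 (Z.≡-sym p^M≡1) F) (≡-refl (trans (sum-cong-≋ (λ g → *-cong (ev-congˡ (F g) (*-identityʳ z)) (*-identityʳ (b g)))) (sym (proj₂ (generated Y)))))))
          where
          F = proj₁ (generated Y)

        fixed : ∀ r Y → Y * (Y ^ q-1) ^ r ≡[ π ] Y
        fixed zero    Y = ≡-refl (*-identityʳ Y)
        fixed (suc r) Y = ≡-trans (≡-refl (sym (*-assoc Y _ _))) (≡-trans (≡-* (fixed-q Y) (≡-refl refl)) (fixed r Y))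

        -- e = Y^{(q-1) p^c} is an approximate idempotent: it kills Z and leaves Y (1 - e) divisible by π
        σ-∣ : ∀ c Y Z → π ^ c ∣ Y * Z → π ^ c ∣ σ Y * Z
        σ-∣ zero    Y Z h = 1∣
        σ-∣ (suc c) Y Z h = ∣-resp (sym expand) (∣-+ (∣-*ˡ (σ Y) eZ-σ) rest)
          where
          e = (Y ^ q-1) ^ (p ℕ.^ c)
          multiple : ∀ n → 0 < n → π ^ suc c ∣ Y ^ n * Z
          multiple (suc n) _ = ∣-resp (solve 3 (λ y x z → x :* (y :* z) := (y :* x) :* z) refl Y (Y ^ n) Z) (∣-*ˡ (Y ^ n) h)
          pos : ∀ n → 0 < p ℕ.^ n
          pos n = ℕ.>-nonZero⁻¹ _ {{ℕ.m^n≢0 p n {{ℕ.>-nonZero (prime>0 pp)}}}}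
          eZ : π ^ suc c ∣ e * Z
          eZ = ∣-resp (*-congʳ (sym (^-assocʳ Y q-1 (p ℕ.^ c)))) (multiple (q-1 ℕ.* p ℕ.^ c) (ℕ.*-mono-< q-1>0 (pos c)))
          -- σ agrees with a power of Frobenius modulo π, and p^c-th powers lift this to π^(c+1). So
          -- σ e is again congruent to a positive power of `Y` and kills `Z` as well.
          σe : σ e ≡[ π ^ suc c ] ((Y ^ (p ℕ.^ j)) ^ q-1) ^ (p ℕ.^ c)
          σe = ≡-trans (≡-refl (trans (σ.φ-^ (Y ^ q-1) (p ℕ.^ c)) (^-congˡ (p ℕ.^ c) (σ.φ-^ Y q-1)))) (≡-lift pp π∣p c (≡-^ q-1 (σ≡frobenius Y)))
          eZ-σ : π ^ suc c ∣ σ e * Z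
          eZ-σ = ≡-∣ (≡-* σe (≡-refl refl)) (∣-resp (*-congʳ (sym (trans (^-congˡ (p ℕ.^ c) (^-assocʳ Y (p ℕ.^ j) q-1)) (^-assocʳ Y (p ℕ.^ j ℕ.* q-1) (p ℕ.^ c)))))
            (multiple (p ℕ.^ j ℕ.* q-1 ℕ.* p ℕ.^ c) (ℕ.*-mono-< (ℕ.*-mono-< (pos j) q-1>0) (pos c))))
          diff : π ∣ Y - Y * e
          diff = difference (≡-sym (fixed (p ℕ.^ c) Y))
          Y₁ = _∣_.quotient diff
          Y₁-eq : Y - Y * e ≈ π * Y₁
          Y₁-eq = _∣_.equality diff
          -- Cancelling one factor π lowers the exponent to `c`, where the induction applies to Y₁;
          -- the factor is regained from `π∣σπ`.
          Y₁Z : π ^ c ∣ Y₁ * Z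
          Y₁Z = _∣_.quotient d , x∙y⁻¹≈ε⇒x≈y (Y₁ * Z) (π ^ c * _∣_.quotient d) (π-regular _ (begin
              π * (Y₁ * Z - π ^ c * k)          ≈⟨ solve 4 (λ π y z w → π :* (y :* z :- w) := (π :* y) :* z :- π :* w) refl π Y₁ Z (π ^ c * k) ⟩
              (π * Y₁) * Z - π * (π ^ c * k)    ≈⟨ +-cong (trans (*-congʳ (sym Y₁-eq)) (_∣_.equality d)) (-‿cong (sym (*-assoc π (π ^ c) k))) ⟩
              π ^ suc c * k - π ^ suc c * k     ≈⟨ -‿inverseʳ _ ⟩
              0#                                ∎))
            where
            d : π ^ suc c ∣ (Y - Y * e) * Z
            d = ∣-resp (solve 3 (λ y e z → y :* z :- y :* (e :* z) := (y :- y :* e) :* z) refl Y e Z) (∣-sub h (∣-*ˡ Y eZ))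
            k = _∣_.quotient d
          rest : π ^ suc c ∣ σ (π * Y₁) * Z
          rest = ∣-resp (trans (sym (*-assoc (σ π) (σ Y₁) Z)) (*-congʳ (sym (σ.φ-* π Y₁)))) (*-∣ π∣σπ (σ-∣ c Y₁ Z Y₁Z))
          expand : σ Y * Z ≈ σ Y * (σ e * Z) + σ (π * Y₁) * Z
          expand = begin
            σ Y * Z                                       ≈⟨ *-congʳ (σ.φ-cong (trans (solve 2 (λ y w → y := w :+ (y :- w)) refl Y (Y * e)) (+-congˡ Y₁-eq))) ⟩
            σ (Y * e + π * Y₁) * Z                        ≈⟨ *-congʳ (trans (σ.φ-+ (Y * e) (π * Y₁)) (+-congʳ (σ.φ-* Y e))) ⟩
            (σ Y * σ e + σ (π * Y₁)) * Z                  ≈⟨ solve 4 (λ a b c z → (a :* b :+ c) :* z := a :* (b :* z) :+ c :* z) refl (σ Y) (σ e) (σ (π * Y₁)) Z ⟩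
            σ Y * (σ e * Z) + σ (π * Y₁) * Z              ∎

      -- Because π^E = p η, divisibility of Y Z by p^n turns into divisibility of Y Z η^n by π^(E
      -- n), where `σ-∣` applies. An inverse of η modulo p^n then removes the extra factor.
      σ-p^∣ : ∀ E η w → π ^ E ≈ ι (+ p) * η → η * w ≡[ π ] 1# → ∀ n Y Z → ι (+ p) ^ n ∣ Y * Z → ι (+ p) ^ n ∣ σ Y * Z
      σ-p^∣ E η w π^E ηw n Y Z h = ∣-resp (*-identityʳ _) (≡-∣ (≡-* (≡-refl {a = σ Y * Z} refl) (≡-sym inverse)) (∣-resp (solve 4 (λ s z e u → (s :* (z :* e)) :* u := (s :* z) :* (e :* u)) refl (σ Y) Z (η ^ n) (w' ^ n))
          (∣-*ʳ (w' ^ n) (∣-trans (η ^ n , πE^n) (use (order 0<v' v'-cop))))))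
        where
        P = ι (+ p) ^ n
        c = E ℕ.* n
        πE^n : π ^ c ≈ P * η ^ n
        πE^n = trans (sym (^-assocʳ π E n)) (trans (^-congˡ n π^E) (^-distrib-* (ι (+ p)) η n))
        use : (∃ λ M → p ℕ.^ suc M ≡ 1 mod v' × (∀ i → i < M → ¬ p ℕ.^ suc i ≡ 1 mod v')) → π ^ c ∣ σ Y * (Z * η ^ n)
        use (M ,, one ,, _) = σ-∣ M one c Y (Z * η ^ n) (∣-respˡ (sym πE^n) (∣-resp (*-assoc Y Z (η ^ n)) (*-∣ h ∣-refl)))
        s = 1# - η * w
        -- The truncated geometric series for 1 / (1 - s), where η w = 1 - s; the error s^c is
        -- divisible by π^c and hence by p^n.
        w' = w * Σ< c (s ^_)
        ηw' : η * w' ≡[ P ] 1#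
        ηw' = cg (∣-resp eq (∣-neg (∣-trans (η ^ n , πE^n) s^c)))
          where
          s^c : π ^ c ∣ s ^ c
          s^c = pow c (difference (≡-sym ηw))
            where
            pow : ∀ c {x} → π ∣ x → π ^ c ∣ x ^ c
            pow zero    d = ∣-refl
            pow (suc c) d = *-∣ d (pow c d)
          eq : - (s ^ c) ≈ η * w' - 1#
          eq = begin
            - (s ^ c)                           ≈⟨ solve 1 (λ x → :- x := :- (x :- con (+ 1)) :- con (+ 1)) refl (s ^ c) ⟩
            - (s ^ c - 1#) - 1#                 ≈⟨ +-congʳ (-‿cong (geometric s c)) ⟨
            - ((s - 1#) * Σ< c (s ^_)) - 1#     ≈⟨ solve 3 (λ e w g → :- (((con (+ 1) :- e :* w) :- con (+ 1)) :* g) :- con (+ 1) := e :* (w :* g) :- con (+ 1)) refl η w (Σ< c (s ^_)) ⟩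
            η * w' - 1#                         ∎
        inverse : η ^ n * w' ^ n ≡[ P ] 1#
        inverse = ≡-trans (≡-refl (sym (^-distrib-* η w' n))) (≡-trans (≡-^ n ηw') (≡-refl (1^n≈1 n)))

  -- `ξ` is a root of unity of order p^(a+1), ϖ = ξ - 1 the usual uniformiser with ramification
  -- index E = p^a (p - 1). The p-th root of unity `ω` = ξ^(p^a) links ϖ to p.
  module Uniformiser {m : ℕ} {R : CommutativeRing 0ℓ 0ℓ} {ζ σ} (C : IsCyclotomic m R ζ σ) (p : ℕ) (pp : Prime p)
    (a u' : ℕ) (m≡ : m ≡ p ℕ.^ suc a ℕ.* u') where
    open Props C
    open Ring R
    open Solver
    open Frobenius R
    open import Relation.Binary.Reasoning.Setoid setoid

    q₀ : ℕ
    q₀ = p ℕ.^ a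

    ξ ω ϖ x : Carrier
    ξ = ζ ^ u'
    ω = ζ ^ (u' ℕ.* q₀)
    ϖ = ξ - 1#
    x = ω - 1#

    e*p : u' ℕ.* q₀ ℕ.* p ≡ m
    e*p = ≡.trans (lem u' q₀ p) (≡.sym m≡)
      where
      open import Data.Nat.Solver using (module +-*-Solver)
      lem : ∀ u q p → u ℕ.* q ℕ.* p ≡ p ℕ.* q ℕ.* u
      lem = +-*-Solver.solve 3 (λ u q p → u +-*-Solver.:* q +-*-Solver.:* p +-*-Solver.:= p +-*-Solver.:* q +-*-Solver.:* u) ≡.refl

    0<e : 0 < u' ℕ.* q₀
    0<e = ℕ.n≢0⇒n>0 (λ e≡0 → ℕ.<⇒≢ 0<m (≡.sym (≡.trans (≡.sym e*p) (≡.cong (ℕ._* p) e≡0))))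

    e<m : u' ℕ.* q₀ < m
    e<m = ≡.subst (u' ℕ.* q₀ <_) e*p (ℕ.m<m*n (u' ℕ.* q₀) p {{ℕ.>-nonZero 0<e}} (prime>1 pp))

    small : ∀ k → 0 < k → k < m → ¬ m ℕ.∣ k
    small k 0<k k<m h = ℕ.<⇒≱ k<m (ℕ.∣⇒≤ {{ℕ.>-nonZero 0<k}} h)

    0<u' : 0 < u'
    0<u' = ℕ.n≢0⇒n>0 (λ u'≡0 → ℕ.<⇒≢ 0<e (≡.sym (≡.cong (ℕ._* q₀) u'≡0)))

    x-regular : ∀ f → x * f ≈ 0# → f ≈ 0#
    x-regular = ζ^k-1-regular (u' ℕ.* q₀) (small (u' ℕ.* q₀) 0<e e<m)

    ϖ-regular : ∀ f → ϖ * f ≈ 0# → f ≈ 0#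
    ϖ-regular = ζ^k-1-regular u' (small u' 0<u' (ℕ.≤-<-trans (ℕ.m≤m*n u' q₀ {{ℕ.m^n≢0 p a {{ℕ.>-nonZero (prime>0 pp)}}}}) e<m))

    ϖ∣x : ϖ ∣ x
    ϖ∣x = ∣-resp (+-congʳ (^-assocʳ ζ u' q₀)) (x-1∣x^n-1 ξ q₀)

    ϖ∣p : ϖ ∣ ι (+ p)
    ϖ∣p = ∣-trans ϖ∣x (ζ^e-1∣p p pp (u' ℕ.* q₀) e*p)

    ϖ∣ξ^-1 : ∀ t → ϖ ∣ ξ ^ t - 1#
    ϖ∣ξ^-1 = x-1∣x^n-1 ξ

    p' : ℕ
    p' = proj₁ (≥2 pp)

    p≡ : p ≡ suc (suc p')
    p≡ = proj₂ (≥2 pp)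

    -- The modulus p ϖ is sharper than p: the mixed binomial terms contain ϖ besides p. Modulo p
    -- alone the term -p in the expansion of ϖ^E would be invisible.
    power-ϖ : ∀ n → (ϖ + 1#) ^ (p ℕ.^ n) ≡[ ι (+ p) * ϖ ] ϖ ^ (p ℕ.^ n) + 1#
    power-ϖ zero    = ≡-refl (trans (*-identityʳ _) (+-congʳ (sym (*-identityʳ ϖ))))
    power-ϖ (suc n) = ≡-trans (≡-refl (trans (^-congʳ (ϖ + 1#) (ℕ.*-comm p (p ℕ.^ n))) (sym (^-assocʳ (ϖ + 1#) (p ℕ.^ n) p))))
      (≡-trans (≡-^ p (power-ϖ n)) (≡-trans (≡-refl (proj₂ bin)) (cg (∣-resp eq (*-∣ (∣-refl {ι (+ p)}) ϖ∣y)))))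
      where
      z = ϖ ^ (p ℕ.^ n)
      bin = binomial-prime pp z 1#
      y = z * 1# ^ (p ∸ 1) + z * z * proj₁ bin
      ϖ∣z : ϖ ∣ z
      ϖ∣z = pos (p ℕ.^ n) (ℕ.>-nonZero⁻¹ _ {{ℕ.m^n≢0 p n {{ℕ.>-nonZero (prime>0 pp)}}}})
        where
        pos : ∀ k → 0 < k → ϖ ∣ ϖ ^ k
        pos (suc k) _ = ϖ ^ k , refl
      ϖ∣y : ϖ ∣ y
      ϖ∣y = ∣-+ (∣-*ʳ _ ϖ∣z) (∣-*ʳ (proj₁ bin) (∣-*ʳ z ϖ∣z))
      eq : ι (+ p) * y ≈ ((z ^ p + 1# ^ p) + ι (+ p) * y) - (ϖ ^ (p ℕ.^ suc n) + 1#)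
      eq = trans (solve 3 (λ a b c → c := ((a :+ b) :+ c) :- (a :+ b)) refl (z ^ p) (1# ^ p) (ι (+ p) * y))
        (+-congˡ (-‿cong (+-cong (trans (^-assocʳ ϖ (p ℕ.^ n) p) (^-congʳ ϖ (ℕ.*-comm (p ℕ.^ n) p))) (1^n≈1 p))))

    x≡ϖ^q₀ : x ≡[ ι (+ p) * ϖ ] ϖ ^ q₀
    x≡ϖ^q₀ = ≡-resp (+-congʳ (trans (^-congˡ q₀ (solve 1 (λ y → (y :- con (+ 1)) :+ con (+ 1) := y) refl ξ)) (^-assocʳ ζ u' q₀)))
      (solve 1 (λ y → (y :+ con (+ 1)) :- con (+ 1) := y) refl (ϖ ^ q₀)) (≡-+ (power-ϖ a) (≡-refl {b = - 1#} refl))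

    -- from ω^p = 1: x^(p-1) = - p (1 + x r)
    r : Carrier
    r = proj₁ (binomial-prime pp x 1#)

    x^p-1 : x ^ suc p' ≈ - (ι (+ p) * (1# + x * r))
    x^p-1 = x∙y⁻¹≈ε⇒x≈y _ _ (x-regular _ (begin
      x * (x ^ suc p' - - (ι (+ p) * (1# + x * r)))     ≈⟨ solve 4 (λ x y p r → x :* (y :- :- (p :* (con (+ 1) :+ x :* r))) := x :* y :+ p :* (x :+ x :* x :* r)) refl x (x ^ suc p') (ι (+ p)) r ⟩
      x ^ suc (suc p') + ι (+ p) * (x + x * x * r)      ≈⟨ +-cong (^-congʳ x (≡.sym p≡)) (*-congˡ (+-congʳ (sym (trans (*-congˡ (1^n≈1 (p ∸ 1))) (*-identityʳ x))))) ⟩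
      x ^ p + ι (+ p) * (x * 1# ^ (p ∸ 1) + x * x * r)
        ≈⟨ solve 3 (λ a b c → a :+ c := ((a :+ b) :+ c) :- b) refl (x ^ p) (1# ^ p) (ι (+ p) * (x * 1# ^ (p ∸ 1) + x * x * r)) ⟩
      ((x ^ p + 1# ^ p) + ι (+ p) * (x * 1# ^ (p ∸ 1) + x * x * r)) - 1# ^ p     ≈⟨ +-congʳ (proj₂ (binomial-prime pp x 1#)) ⟨
      (x + 1#) ^ p - 1# ^ p                             ≈⟨ sub-self (trans (trans (^-congˡ p (solve 1 (λ y → (y :- con (+ 1)) :+ con (+ 1) := y) refl ω)) ω^p) (sym (1^n≈1 p))) ⟩
      0#                                                ∎))
      where
      ω^p : ω ^ p ≈ 1#
      ω^p = trans (^-assocʳ ζ (u' ℕ.* q₀) p) (trans (^-congʳ ζ e*p) ζ^m)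

    E : ℕ
    E = q₀ ℕ.* suc p'

    ϖ^E≡ : ϖ ^ E ≡[ ι (+ p) * ϖ ] - (ι (+ p) * (1# + x * r))
    ϖ^E≡ = ≡-trans (≡-refl (sym (^-assocʳ ϖ q₀ (suc p')))) (≡-trans (≡-^ (suc p') (≡-sym x≡ϖ^q₀)) (≡-refl x^p-1))

    k : Carrier
    k = _∣_.quotient (difference ϖ^E≡)

    η : Carrier
    η = ϖ * k - (1# + x * r)

    ϖ^E : ϖ ^ E ≈ ι (+ p) * η
    ϖ^E = begin
      ϖ ^ E                                                          ≈⟨ solve 2 (λ a b → a := (a :- b) :+ b) refl (ϖ ^ E) (- (ι (+ p) * (1# + x * r))) ⟩
      (ϖ ^ E - - (ι (+ p) * (1# + x * r))) + - (ι (+ p) * (1# + x * r))   ≈⟨ +-congʳ (_∣_.equality (difference ϖ^E≡)) ⟩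
      (ι (+ p) * ϖ) * k + - (ι (+ p) * (1# + x * r))                 ≈⟨ solve 4 (λ p w k y → (p :* w) :* k :+ :- (p :* y) := p :* (w :* k :- y)) refl (ι (+ p)) ϖ k (1# + x * r) ⟩
      ι (+ p) * η                                                    ∎

    -- ϖ divides x, so η = ϖ k - (1 + x r) is -1 modulo ϖ, its own inverse.
    η-unit : η * - 1# ≡[ ϖ ] 1#
    η-unit = cg (∣-resp (solve 3 (λ w xr c → xr :- w :* c := (w :* c :- (con (+ 1) :+ xr)) :* (:- con (+ 1)) :- con (+ 1)) refl ϖ (x * r) k)
      (∣-sub (∣-*ʳ r ϖ∣x) (∣-*ʳ k ∣-refl)))

-- Group rings of finite abelian groups over a commutative ring, and their twists.

module GroupRings where

  open RingTools
  open IntegerPolynomials using (IsHom; module HomProps)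
  open IndexedSums
  open import Algebra.Bundles using (CommutativeRing)
  open import Data.Nat using (ℕ; zero; suc)
  open import Data.Fin as Fin using (Fin; _≟_)
  open import Data.Fin.Permutation using (permutation)
  open import Data.Product using () renaming (_,_ to _,,_)
  open import Level using (0ℓ)
  open import Relation.Nullary
  open import Relation.Binary.PropositionalEquality as ≡ using (_≡_; _≢_)

  -- Left division as a primitive matches the index i⁻¹ j in `mulGR`; working on indices turns the
  -- setoid equality of the given group into propositional equality.
  record FinGroup (N : ℕ) : Set where
    infixl 7 _∙_ _\\_
    field
      _∙_ _\\_   : Fin N → Fin N → Fin N
      e          : Fin N
      assoc      : ∀ i j k → (i ∙ j) ∙ k ≡ i ∙ (j ∙ k)
      comm       : ∀ i j → i ∙ j ≡ j ∙ i
      identityˡ  : ∀ i → e ∙ i ≡ i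
      ∙-\\       : ∀ i j → i ∙ (i \\ j) ≡ j
      \\-∙       : ∀ i j → i \\ (i ∙ j) ≡ j

    cancelˡ : ∀ i {j k} → i ∙ j ≡ i ∙ k → j ≡ k
    cancelˡ i {j} {k} h = ≡.trans (≡.sym (\\-∙ i j)) (≡.trans (≡.cong (i \\_) h) (\\-∙ i k))

    \\-invol : ∀ i j → (i \\ j) \\ j ≡ i
    \\-invol i j = cancelˡ (i \\ j) (≡.trans (∙-\\ (i \\ j) j) (≡.sym (≡.trans (comm (i \\ j) i) (∙-\\ i j))))

    e-\\ : ∀ j → e \\ j ≡ j
    e-\\ j = cancelˡ e (≡.trans (∙-\\ e j) (≡.sym (identityˡ j)))

    ∙-\\-assoc : ∀ k l j → (k ∙ l) \\ j ≡ l \\ (k \\ j)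
    ∙-\\-assoc k l j = cancelˡ (k ∙ l) (≡.trans (∙-\\ (k ∙ l) j) (≡.sym (≡.trans (assoc k l _) (≡.trans (≡.cong (k ∙_) (∙-\\ l _)) (∙-\\ k j)))))

    pw : ℕ → Fin N → Fin N
    pw zero    i = e
    pw (suc s) i = i ∙ pw s i

    pw-e : ∀ s → pw s e ≡ e
    pw-e zero    = ≡.refl
    pw-e (suc s) = ≡.trans (identityˡ _) (pw-e s)

    pw-∙ : ∀ s i j → pw s (i ∙ j) ≡ pw s i ∙ pw s j
    pw-∙ zero    i j = ≡.sym (identityˡ e)
    pw-∙ (suc s) i j = ≡.trans (≡.cong ((i ∙ j) ∙_) (pw-∙ s i j)) (≡.trans (assoc i j _) (≡.trans (≡.cong (i ∙_) (≡.trans (≡.sym (assoc j _ _))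
      (≡.trans (≡.cong (_∙ pw s j) (comm j (pw s i))) (assoc _ j _)))) (≡.sym (assoc i _ _))))

  module FinSums (R : CommutativeRing 0ℓ 0ℓ) where
    open Ring R
    open RingSums R
    open import Relation.Binary.Reasoning.Setoid setoid

    sum-0 : ∀ {n} {f : Fin n → Carrier} → (∀ i → f i ≈ 0#) → sum f ≈ 0#
    sum-0 {n} h = trans (sum-cong-≋ h) (sum-replicate-zero n)

    sum-single : ∀ {n} (k : Fin n) (f : Fin n → Carrier) → (∀ i → i ≢ k → f i ≈ 0#) → sum f ≈ f k
    sum-single Fin.zero    f h = trans (+-congˡ (sum-0 (λ i → h (Fin.suc i) (λ ())))) (+-identityʳ _)
    sum-single (Fin.suc k) f h = trans (+-cong (h Fin.zero (λ ())) (sum-single k (λ i → f (Fin.suc i)) (λ i i≢k → h (Fin.suc i) (λ { ≡.refl → i≢k ≡.refl })))) (+-identityˡ _)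

    sum-when : ∀ {n} (k : Fin n) (f : Fin n → Carrier) → sum (λ i → when (k ≟ i) (f i)) ≈ f k
    sum-when k f = trans (sum-single k (λ i → when (k ≟ i) (f i)) (λ i i≢k → when-no (k ≟ i) (λ k≡i → i≢k (≡.sym k≡i)))) (when-yes (k ≟ k) ≡.refl)

    sum-when′ : ∀ {n} (k : Fin n) (f : Fin n → Carrier) {P : Fin n → Set} (d : ∀ i → Dec (P i)) → P k → (∀ i → P i → i ≡ k) → sum (λ i → when (d i) (f i)) ≈ f k
    sum-when′ k f d Pk uniq = trans (sum-single k (λ i → when (d i) (f i)) (λ i i≢k → when-no (d i) (λ p → i≢k (uniq i p)))) (when-yes (d k) Pk)

  module GroupRing (R : CommutativeRing 0ℓ 0ℓ) {N : ℕ} (G : FinGroup N) where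
    open Ring R
    open RingSums R
    open FinSums R
    open FinGroup G renaming (assoc to ∙-assoc; comm to ∙-comm; identityˡ to ∙-identityˡ)
    open Solver
    open import Relation.Binary.Reasoning.Setoid setoid

    Elt : Set
    Elt = Fin N → Carrier

    _⋆_ : Elt → Elt → Elt
    (X ⋆ Y) j = sum (λ i → X i * Y (i \\ j))

    one : Elt
    one j = when (e ≟ j) 1#

    ⋆-cong : ∀ {X X' Y Y' : Elt} → (∀ j → X j ≈ X' j) → (∀ j → Y j ≈ Y' j) → ∀ j → (X ⋆ Y) j ≈ (X' ⋆ Y') j
    ⋆-cong h k j = sum-cong-≋ (λ i → *-cong (h i) (k (i \\ j)))

    -- For fixed `j`, the map i ↦ i⁻¹ j is an involution that exchanges the two factors.
    ⋆-comm : ∀ X Y j → (X ⋆ Y) j ≈ (Y ⋆ X) j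
    ⋆-comm X Y j = trans (sum-permute (λ i → X i * Y (i \\ j)) (permutation (_\\ j) (_\\ j) (λ i → \\-invol i j) (λ i → \\-invol i j)))
      (sum-cong-≋ (λ i → trans (*-congˡ (reflexive (≡.cong Y (\\-invol i j)))) (*-comm _ _)))

    translate : ∀ k (f : Fin N → Carrier) → sum f ≈ sum (λ l → f (k ∙ l))
    translate k f = sum-permute f (permutation (k ∙_) (k \\_) (∙-\\ k) (\\-∙ k))

    ⋆-assoc : ∀ X Y Z j → ((X ⋆ Y) ⋆ Z) j ≈ (X ⋆ (Y ⋆ Z)) j
    ⋆-assoc X Y Z j = begin
      sum (λ i → sum (λ k → X k * Y (k \\ i)) * Z (i \\ j))             ≈⟨ sum-cong-≋ (λ i → *-distribʳ-sum (Z (i \\ j)) (λ k → X k * Y (k \\ i))) ⟩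
      sum (λ i → sum (λ k → (X k * Y (k \\ i)) * Z (i \\ j)))           ≈⟨ ∑-comm (λ i k → (X k * Y (k \\ i)) * Z (i \\ j)) ⟩
      sum (λ k → sum (λ i → (X k * Y (k \\ i)) * Z (i \\ j)))           ≈⟨ sum-cong-≋ (λ k → translate k (λ i → (X k * Y (k \\ i)) * Z (i \\ j))) ⟩
      sum (λ k → sum (λ l → (X k * Y (k \\ (k ∙ l))) * Z ((k ∙ l) \\ j)))
        ≈⟨ sum-cong-≋ (λ k → sum-cong-≋ (λ l → trans (*-cong (*-congˡ (reflexive (≡.cong Y (\\-∙ k l)))) (reflexive (≡.cong Z (∙-\\-assoc k l j)))) (*-assoc _ _ _))) ⟩
      sum (λ k → sum (λ l → X k * (Y l * Z (l \\ (k \\ j)))))           ≈⟨ sum-cong-≋ (λ k → *-distribˡ-sum (X k) (λ l → Y l * Z (l \\ (k \\ j)))) ⟨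
      sum (λ k → X k * sum (λ l → Y l * Z (l \\ (k \\ j))))             ∎

    ⋆-identityˡ : ∀ Y j → (one ⋆ Y) j ≈ Y j
    ⋆-identityˡ Y j = trans (sum-cong-≋ (λ i → trans (when-*ʳ (e ≟ i)) (when-cong (e ≟ i) (λ _ → *-identityˡ _))))
      (trans (sum-when e (λ i → Y (i \\ j))) (reflexive (≡.cong Y (e-\\ j))))

    ⋆-distribˡ : ∀ X Y Z j → (X ⋆ (λ i → Y i + Z i)) j ≈ (X ⋆ Y) j + (X ⋆ Z) j
    ⋆-distribˡ X Y Z j = trans (sum-cong-≋ (λ i → distribˡ (X i) _ _)) (∑-distrib-+ (λ i → X i * Y (i \\ j)) (λ i → X i * Z (i \\ j)))

    A : CommutativeRing 0ℓ 0ℓ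
    A .CommutativeRing.Carrier = Elt
    A .CommutativeRing._≈_ X Y = ∀ j → X j ≈ Y j
    A .CommutativeRing._+_ X Y j = X j + Y j
    A .CommutativeRing._*_ = _⋆_
    A .CommutativeRing.-_ X j = - X j
    A .CommutativeRing.0# _ = 0#
    A .CommutativeRing.1# = one
    A .CommutativeRing.isCommutativeRing = record
      { isRing = record
        { +-isAbelianGroup = record
          { isGroup = record
            { isMonoid = record
              { isSemigroup = record
                { isMagma = record
                  { isEquivalence = record { refl = λ j → refl ; sym = λ h j → sym (h j) ; trans = λ h k j → trans (h j) (k j) }
                  ; ∙-cong = λ h k j → +-cong (h j) (k j) }
                ; assoc = λ X Y Z j → +-assoc _ _ _ }
              ; identity = (λ X j → +-identityˡ _) ,, (λ X j → +-identityʳ _) }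
            ; inverse = (λ X j → -‿inverseˡ _) ,, (λ X j → -‿inverseʳ _)
            ; ⁻¹-cong = λ h j → -‿cong (h j) }
          ; comm = λ X Y j → +-comm _ _ }
        ; *-cong = λ {X} {X'} {Y} {Y'} h k → ⋆-cong {X} {X'} {Y} {Y'} h k
        ; *-assoc = ⋆-assoc
        ; *-identity = ⋆-identityˡ ,, (λ X j → trans (⋆-comm X one j) (⋆-identityˡ X j))
        ; distrib = ⋆-distribˡ ,, (λ X Y Z j → trans (⋆-comm (λ i → Y i + Z i) X j) (trans (⋆-distribˡ X Y Z j) (+-cong (⋆-comm X Y j) (⋆-comm X Z j))))
        }
      ; *-comm = ⋆-comm
      }

    module A = Ring A

    sum-at : ∀ {n} (F : Fin n → Elt) j → A.sum F j ≈ sum (λ i → F i j)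
    sum-at {zero}  F j = refl
    sum-at {suc n} F j = +-congˡ (sum-at (λ i → F (Fin.suc i)) j)

    cst : Carrier → Elt
    cst r j = when (e ≟ j) r

    basis : Fin N → Elt
    basis g j = when (g ≟ j) 1#

    cst-⋆ : ∀ r Y j → (cst r ⋆ Y) j ≈ r * Y j
    cst-⋆ r Y j = trans (sum-cong-≋ (λ i → when-*ʳ (e ≟ i))) (trans (sum-when e (λ i → r * Y (i \\ j))) (*-congˡ (reflexive (≡.cong Y (e-\\ j)))))

    basis-⋆ : ∀ g Y j → (basis g ⋆ Y) j ≈ Y (g \\ j)
    basis-⋆ g Y j = trans (sum-cong-≋ (λ i → trans (when-*ʳ (g ≟ i)) (when-cong (g ≟ i) (λ _ → *-identityˡ _)))) (sum-when g (λ i → Y (i \\ j)))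

    cst-isHom : IsHom R A cst
    cst-isHom = record
      { φ-cong = λ h j → when-cong (e ≟ j) (λ _ → h)
      ; φ-+ = λ x y j → when-+ (e ≟ j) (λ _ → refl)
      ; φ-* = λ x y j → sym (trans (cst-⋆ x (cst y) j) (when-* (e ≟ j)))
      ; φ-1 = λ j → refl }

    module Cst = HomProps cst-isHom

    cst-regular : ∀ r → (∀ x → r * x ≈ 0# → x ≈ 0#) → ∀ Y → cst r A.* Y A.≈ A.0# → Y A.≈ A.0#
    cst-regular r reg Y h j = reg (Y j) (trans (sym (cst-⋆ r Y j)) (h j))

    basis-∙ : ∀ g h → basis g A.* basis h A.≈ basis (g ∙ h)
    basis-∙ g h j = trans (basis-⋆ g (basis h) j) (when-⇔ (h ≟ g \\ j) ((g ∙ h) ≟ j) (λ { ≡.refl → ∙-\\ g j }) (λ { ≡.refl → ≡.sym (\\-∙ g h) }))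

    basis-^ : ∀ g s → basis g A.^ s A.≈ basis (pw s g)
    basis-^ g zero    = A.refl
    basis-^ g (suc s) = A.trans (A.*-congˡ {basis g} (basis-^ g s)) (basis-∙ g (pw s g))

    expand : ∀ Y → Y A.≈ A.sum (λ g → cst (Y g) A.* basis g)
    expand Y j = sym (trans (sum-at (λ g → cst (Y g) ⋆ basis g) j) (trans (sum-cong-≋ (λ g → trans (cst-⋆ (Y g) (basis g) j) (trans (when-* (g ≟ j)) (when-cong (g ≟ j) (λ _ → *-identityʳ _)))))
      (sum-when′ j Y (λ g → g ≟ j) ≡.refl (λ i h → h))))

    -- Sends Σ X_i i to Σ φ(X_i) ψ(i). With φ = σ_t and ψ the t-th power map this is X^(t).
    push : (Carrier → Carrier) → (Fin N → Fin N) → Elt → Elt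
    push φ ψ X j = sum (λ i → when (ψ i ≟ j) (φ (X i)))

    module Push {φ : Carrier → Carrier} (φ-hom : IsHom R R φ) (ψ : Fin N → Fin N) (ψ-∙ : ∀ i j → ψ (i ∙ j) ≡ ψ i ∙ ψ j) (ψ-e : ψ e ≡ e) where
      private module φ = HomProps φ-hom

      φ-sum : ∀ {n} (f : Fin n → Carrier) → φ (sum f) ≈ sum (λ i → φ (f i))
      φ-sum {zero}  f = φ.φ-0
      φ-sum {suc n} f = trans (φ.φ-+ (f Fin.zero) _) (+-congˡ (φ-sum (λ i → f (Fin.suc i))))

      φ-when : ∀ {P : Set} (d : Dec P) x → φ (when d x) ≈ when d (φ x)
      φ-when (yes _) x = refl
      φ-when (no _)  x = φ.φ-0

      push-cst : ∀ r → push φ ψ (cst r) A.≈ cst (φ r)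
      push-cst r j = trans (sum-cong-≋ (λ i → trans (when-cong (ψ i ≟ j) (λ _ → φ-when (e ≟ i) r)) (swap (ψ i ≟ j) (e ≟ i))))
        (trans (sum-when e (λ i → when (ψ i ≟ j) (φ r))) (when-⇔ (ψ e ≟ j) (e ≟ j) (λ h → ≡.trans (≡.sym ψ-e) h) (λ h → ≡.trans ψ-e h)))
        where
        swap : ∀ {P Q : Set} (d : Dec P) (d' : Dec Q) {x} → when d (when d' x) ≈ when d' (when d x)
        swap (yes _) d'      = refl
        swap (no _)  (yes _) = refl
        swap (no _)  (no _)  = refl

      push-basis : ∀ g → push φ ψ (basis g) A.≈ basis (ψ g)
      push-basis g j = trans (sum-cong-≋ (λ i → trans (when-cong (ψ i ≟ j) (λ _ → trans (φ-when (g ≟ i) 1#) (when-cong (g ≟ i) (λ _ → φ.φ-1)))) (swap (ψ i ≟ j) (g ≟ i))))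
        (sum-when g (λ i → when (ψ i ≟ j) 1#))
        where
        swap : ∀ {P Q : Set} (d : Dec P) (d' : Dec Q) {x} → when d (when d' x) ≈ when d' (when d x)
        swap (yes _) d'      = refl
        swap (no _)  (yes _) = refl
        swap (no _)  (no _)  = refl

      -- Several indices may have the same image under ψ, so both sides are expanded into a sum over
      -- pairs (k, l) under the condition ψ(k l) = j, which is rewritten as ψ(l) = ψ(k)⁻¹ j.
      push-* : ∀ X Y → push φ ψ (X ⋆ Y) A.≈ push φ ψ X ⋆ push φ ψ Y
      push-* X Y j = begin
        sum (λ i → when (ψ i ≟ j) (φ (sum (λ k → X k * Y (k \\ i)))))
          ≈⟨ sum-cong-≋ (λ i → trans (when-cong (ψ i ≟ j) (λ _ → trans (φ-sum (λ k → X k * Y (k \\ i))) (sum-cong-≋ (λ k → φ.φ-* (X k) (Y (k \\ i)))))) (when-sum (ψ i ≟ j) (λ k → φ (X k) * φ (Y (k \\ i))))) ⟩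
        sum (λ i → sum (λ k → when (ψ i ≟ j) (φ (X k) * φ (Y (k \\ i)))))
          ≈⟨ ∑-comm (λ i k → when (ψ i ≟ j) (φ (X k) * φ (Y (k \\ i)))) ⟩
        sum (λ k → sum (λ i → when (ψ i ≟ j) (φ (X k) * φ (Y (k \\ i)))))
          ≈⟨ sum-cong-≋ (λ k → translate k (λ i → when (ψ i ≟ j) (φ (X k) * φ (Y (k \\ i))))) ⟩
        sum (λ k → sum (λ l → when (ψ (k ∙ l) ≟ j) (φ (X k) * φ (Y (k \\ (k ∙ l))))))
          ≈⟨ sum-cong-≋ (λ k → sum-cong-≋ (λ l → trans (when-cong (ψ (k ∙ l) ≟ j) (λ _ → *-congˡ (reflexive (≡.cong (λ i → φ (Y i)) (\\-∙ k l)))))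
               (trans (when-⇔ (ψ (k ∙ l) ≟ j) (ψ l ≟ ψ k \\ j) (λ h → ≡.sym (≡.trans (≡.cong (ψ k \\_) (≡.trans (≡.sym h) (ψ-∙ k l))) (\\-∙ (ψ k) (ψ l)))) (λ h → ≡.trans (ψ-∙ k l) (≡.trans (≡.cong (ψ k ∙_) h) (∙-\\ (ψ k) j))))
                 (sym (when-* (ψ l ≟ ψ k \\ j)))))) ⟩
        sum (λ k → sum (λ l → φ (X k) * when (ψ l ≟ ψ k \\ j) (φ (Y l))))
          ≈⟨ sum-cong-≋ (λ k → *-distribˡ-sum (φ (X k)) (λ l → when (ψ l ≟ ψ k \\ j) (φ (Y l)))) ⟨
        sum (λ k → φ (X k) * push φ ψ Y (ψ k \\ j))
          ≈⟨ sum-cong-≋ (λ k → sym (trans (sum-cong-≋ (λ i → when-*ʳ (ψ k ≟ i))) (sum-when (ψ k) (λ i → φ (X k) * push φ ψ Y (i \\ j))))) ⟩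
        sum (λ k → sum (λ i → when (ψ k ≟ i) (φ (X k)) * push φ ψ Y (i \\ j)))
          ≈⟨ ∑-comm (λ k i → when (ψ k ≟ i) (φ (X k)) * push φ ψ Y (i \\ j)) ⟩
        sum (λ i → sum (λ k → when (ψ k ≟ i) (φ (X k)) * push φ ψ Y (i \\ j)))
          ≈⟨ sum-cong-≋ (λ i → *-distribʳ-sum (push φ ψ Y (i \\ j)) (λ k → when (ψ k ≟ i) (φ (X k)))) ⟨
        sum (λ i → push φ ψ X i * push φ ψ Y (i \\ j))  ∎
        where
        when-sum : ∀ {n} {P : Set} (d : Dec P) (f : Fin n → Carrier) → when d (sum f) ≈ sum (λ k → when d (f k))
        when-sum (yes _) f = refl
        when-sum {n} (no _) f = sym (sum-0 {n} {λ _ → 0#} (λ _ → refl))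

      push-isHom : IsHom A A (push φ ψ)
      push-isHom = record
        { φ-cong = λ h j → sum-cong-≋ (λ i → when-cong (ψ i ≟ j) (λ _ → φ.φ-cong (h i)))
        ; φ-+ = λ X Y j → trans (sum-cong-≋ (λ i → when-+ (ψ i ≟ j) (λ _ → φ.φ-+ (X i) (Y i)))) (∑-distrib-+ (λ i → when (ψ i ≟ j) (φ (X i))) (λ i → when (ψ i ≟ j) (φ (Y i))))
        ; φ-* = push-*
        ; φ-1 = λ j → trans (push-cst 1# j) (when-cong (e ≟ j) (λ _ → φ.φ-1)) }

-- The multiplier argument over an abstract cyclotomic ring.

module AbstractMultiplier where

  open import Defs using (Poly)
  open RingTools
  open IntegerPolynomials
  open NumberTheory
  open IndexedSums
  open CyclotomicRings
  open TraceForm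
  open UnitFamilies
  open LiftingDivisibility
  open GroupRings
  open import Algebra.Bundles using (CommutativeRing)
  open import Data.Nat as ℕ using (ℕ; zero; suc; _<_; _∸_)
  import Data.Nat.Properties as ℕ
  import Data.Nat.Divisibility as ℕ
  open import Data.Nat.Coprimality as Cop using (Coprime)
  open import Data.Nat.Primality using (Prime)
  open import Data.Integer as ℤ using (ℤ; +_)
  import Data.Integer.Properties as ℤ
  open import Data.Fin as Fin using (Fin; _≟_)
  open import Data.Product using (∃; ∃₂; _×_; proj₁; proj₂) renaming (_,_ to _,,_)
  open import Data.Sum using (_⊎_; inj₁; inj₂) renaming (map to ⊎-map)
  open import Level using (0ℓ)
  open import Relation.Nullary
  open import Relation.Binary.PropositionalEquality as ≡ using (_≡_; _≢_)

  module HomExt (A : CommutativeRing 0ℓ 0ℓ) where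
    open Ring A
    open Eval A

    -- Reduces identities between endomorphisms to arithmetic with exponents of the generators; that
    -- twists commute and that `inv` is an involution are instances.
    hom-ext : ∀ {N} (z : Carrier) (b : Fin N → Carrier) → (∀ Y → ∃ λ (F : Fin N → Poly) → Y ≈ sum (λ g → ev z (F g) * b g)) →
      ∀ {φ ψ} → IsHom A A φ → IsHom A A ψ → φ z ≈ ψ z → (∀ g → φ (b g) ≈ ψ (b g)) → ∀ Y → φ Y ≈ ψ Y
    hom-ext z b gen {φ} {ψ} hφ hψ hz hb Y = trans (φ.φ-cong (proj₂ (gen Y))) (trans (φ-sum hφ (λ g → ev z (F g) * b g)) (trans
        (sum-cong-≋ (λ g → trans (φ.φ-* _ _) (trans (*-cong (trans (φ.φ-ev z (F g)) (trans (ev-congˡ (F g) hz) (sym (ψ.φ-ev z (F g))))) (hb g)) (sym (ψ.φ-* _ _)))))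
        (trans (sym (φ-sum hψ (λ g → ev z (F g) * b g))) (sym (ψ.φ-cong (proj₂ (gen Y)))))))
      where
      F = proj₁ (gen Y)
      module φ = HomProps hφ
      module ψ = HomProps hψ
      φ-sum : ∀ {χ} → IsHom A A χ → ∀ {n} (f : Fin n → Carrier) → χ (sum f) ≈ sum (λ i → χ (f i))
      φ-sum h {zero}  f = HomProps.φ-0 h
      φ-sum h {suc n} f = trans (HomProps.φ-+ h _ _) (+-congˡ (φ-sum h (λ i → f (Fin.suc i))))

    ∘-isHom : ∀ {φ ψ} → IsHom A A φ → IsHom A A ψ → IsHom A A (λ x → φ (ψ x))
    ∘-isHom hφ hψ = record
      { φ-cong = λ e → φ.φ-cong (ψ.φ-cong e) ; φ-+ = λ x y → trans (φ.φ-cong (ψ.φ-+ x y)) (φ.φ-+ _ _)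
      ; φ-* = λ x y → trans (φ.φ-cong (ψ.φ-* x y)) (φ.φ-* _ _) ; φ-1 = trans (φ.φ-cong ψ.φ-1) φ.φ-1 }
      where
      module φ = HomProps hφ
      module ψ = HomProps hψ

    id-isHom : IsHom A A (λ x → x)
    id-isHom = record { φ-cong = λ e → e ; φ-+ = λ _ _ → refl ; φ-* = λ _ _ → refl ; φ-1 = refl }

  module Multiplier {u : ℕ} {R : CommutativeRing 0ℓ 0ℓ} {ζ σ} (C : IsCyclotomic u R ζ σ)
    {N : ℕ} (G : FinGroup N) (v : ℕ) (0<v : 0 < v) (u∣v : u ℕ.∣ v) (pw-v : ∀ g → FinGroup.pw G v g ≡ FinGroup.e G) where

    open Props C hiding (A)
    open Ring R
    open Eval R
    open RingSums R
    open FinSums R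
    open FinGroup G using (e; pw; pw-e; pw-∙; cancelˡ; \\-∙; ∙-\\; _\\_; _∙_; comm)
    open GroupRings.GroupRing R G
    open Eval A using () renaming (ev to evA)
    open HomExt A

    T : ℕ → Elt → Elt
    T s = push (σ s) (pw s)

    module T s (h : Coprime s u) = Push (σ-hom s h) (pw s) (pw-∙ s) (pw-e s)

    T-isHom : ∀ s → Coprime s u → IsHom A A (T s)
    T-isHom s h = T.push-isHom s h

    z : Elt
    z = cst ζ

    generated : ∀ Y → ∃ λ (F : Fin N → Poly) → Y A.≈ A.sum (λ g → evA z (F g) A.* basis g)
    generated Y = (λ g → proj₁ (rep-ev (Y g))) ,, A.trans (expand Y) (A.sum-cong-≋ (λ g → A.*-congʳ {basis g} (A.trans (Cst.φ-cong (proj₂ (rep-ev (Y g)))) (Cst.φ-ev ζ (proj₁ (rep-ev (Y g)))))))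

    T-z : ∀ s → (h : Coprime s u) → T s z A.≈ z A.^ s
    T-z s h = A.trans (T.push-cst s h ζ) (A.trans (Cst.φ-cong (σ-ζ s h)) (Cst.φ-^ ζ s))

    T-basis : ∀ s → (h : Coprime s u) → ∀ g → T s (basis g) A.≈ basis g A.^ s
    T-basis s h g = A.trans (T.push-basis s h g) (A.sym (basis-^ g s))

    T-z^ : ∀ s → (h : Coprime s u) → ∀ k → T s (z A.^ k) A.≈ z A.^ (s ℕ.* k)
    T-z^ s h k = A.trans (HomProps.φ-^ (T-isHom s h) z k) (A.trans (A.^-congˡ k (T-z s h)) (A.^-assocʳ z s k))

    T-basis^ : ∀ s → (h : Coprime s u) → ∀ g k → T s (basis g A.^ k) A.≈ basis g A.^ (s ℕ.* k)
    T-basis^ s h g k = A.trans (HomProps.φ-^ (T-isHom s h) (basis g) k) (A.trans (A.^-congˡ k (T-basis s h g)) (A.^-assocʳ (basis g) s k))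

    T-T : ∀ s t → (h : Coprime s u) (k : Coprime t u) → ∀ Y → T s (T t Y) A.≈ T t (T s Y)
    T-T s t h k = hom-ext z basis generated (∘-isHom (T-isHom s h) (T-isHom t k)) (∘-isHom (T-isHom t k) (T-isHom s h))
      (A.trans (HomProps.φ-cong (T-isHom s h) (T-z t k)) (A.trans (T-z^ s h t) (A.trans (A.^-congʳ z (ℕ.*-comm s t)) (A.sym (A.trans (HomProps.φ-cong (T-isHom t k) (T-z s h)) (T-z^ t k s))))))
      (λ g → A.trans (HomProps.φ-cong (T-isHom s h) (T-basis t k g)) (A.trans (T-basis^ s h g t) (A.trans (A.^-congʳ (basis g) (ℕ.*-comm s t)) (A.sym (A.trans (HomProps.φ-cong (T-isHom t k) (T-basis s h g)) (T-basis^ t k g s))))))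

    powA-mod : ∀ (x : Elt) L → x A.^ L A.≈ A.1# → ∀ {a b} → a ≡ b mod L → x A.^ a A.≈ x A.^ b
    powA-mod x L h {a} {b} c = byCases (mod-cases {a} {b} {L} c)
      where
      step : ∀ a k → x A.^ (a ℕ.+ L ℕ.* k) A.≈ x A.^ a
      step a k = A.trans (A.^-homo-* x a (L ℕ.* k)) (A.trans (A.*-congˡ {x A.^ a} (A.trans (A.sym (A.^-assocʳ x L k)) (A.trans (A.^-congˡ k h) (A.1^n≈1 k)))) (A.*-identityʳ _))
      byCases : ∃ (λ k → a ≡ b ℕ.+ L ℕ.* k) ⊎ ∃ (λ k → b ≡ a ℕ.+ L ℕ.* k) → x A.^ a A.≈ x A.^ b
      byCases (inj₁ (k ,, ≡.refl)) = step b k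
      byCases (inj₂ (k ,, ≡.refl)) = A.sym (step a k)

    z^v : z A.^ v A.≈ A.1#
    z^v = A.trans (A.sym (Cst.φ-^ ζ v)) (A.trans (Cst.φ-cong (ζ-mod {v} {0} (∣⇒mod0 u∣v))) Cst.φ-1)

    basis^v : ∀ g → basis g A.^ v A.≈ A.1#
    basis^v g = A.trans (basis-^ g v) (A.reflexive (≡.cong basis (pw-v g)))

    cop₋₁ : Coprime (v ∸ 1) u
    cop₋₁ = coprime-∣ʳ u∣v (pred-coprime v 0<v)

    -- `v ∸ 1` acts as -1 on ζ and on every group element, since v is a multiple of u and kills the
    -- group; so this is X ↦ X^(-1).
    inv : Elt → Elt
    inv = T (v ∸ 1)

    module Inv = HomProps (T-isHom (v ∸ 1) cop₋₁)

    [v-1]² : (v ∸ 1) ℕ.* (v ∸ 1) ≡ 1 mod v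
    [v-1]² = Z.cg ((+ v ℤ.- + 2) Z., ≡.trans (≡.cong (ℤ._- + 1) (≡.trans (ℤ.pos-* (v ∸ 1) (v ∸ 1)) (≡.cong₂ ℤ._*_ v-1 v-1))) (lem (+ v)))
      where
      v-1 : + (v ∸ 1) ≡ + v ℤ.- + 1
      v-1 = ≡.trans (≡.sym (ℤ.⊖-≥ 0<v)) (≡.sym (ℤ.m-n≡m⊖n v 1))
      lem : ∀ m → (m ℤ.- + 1) ℤ.* (m ℤ.- + 1) ℤ.- + 1 ≡ m ℤ.* (m ℤ.- + 2)
      lem = Z.Solver.solve 1 (λ m → (m Z.Solver.:- Z.Solver.con (+ 1)) Z.Solver.:* (m Z.Solver.:- Z.Solver.con (+ 1)) Z.Solver.:- Z.Solver.con (+ 1) Z.Solver.:= m Z.Solver.:* (m Z.Solver.:- Z.Solver.con (+ 2))) ≡.refl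

    inv-inv : ∀ Y → inv (inv Y) A.≈ Y
    inv-inv = hom-ext z basis generated (∘-isHom (T-isHom (v ∸ 1) cop₋₁) (T-isHom (v ∸ 1) cop₋₁)) id-isHom
      (A.trans (Inv.φ-cong (T-z (v ∸ 1) cop₋₁)) (A.trans (T-z^ (v ∸ 1) cop₋₁ (v ∸ 1)) (A.trans (powA-mod z v z^v {(v ∸ 1) ℕ.* (v ∸ 1)} {1} [v-1]²) (A.*-identityʳ z))))
      (λ g → A.trans (Inv.φ-cong (T-basis (v ∸ 1) cop₋₁ g)) (A.trans (T-basis^ (v ∸ 1) cop₋₁ g (v ∸ 1)) (A.trans (powA-mod (basis g) v (basis^v g) {(v ∸ 1) ℕ.* (v ∸ 1)} {1} [v-1]²) (A.*-identityʳ (basis g)))))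

    -- What the hypothesis on prime ideals contributes at one prime `p` of n: modulo the prime-to-p
    -- part v' the exponent is a power of `p`, and v' still kills the group.
    record Local (τ p : ℕ) : Set where
      field
        a v' j : ℕ
        v≡     : v ≡ p ℕ.^ a ℕ.* v'
        p∤v'   : ¬ p ℕ.∣ v'
        pw-v'  : ∀ g → pw v' g ≡ e
        τ≡p^j  : τ ≡ p ℕ.^ j mod v'

    module AtPrime (τ : ℕ) (τ-cop : Coprime τ u) (p : ℕ) (pp : Prime p) (loc : Local τ p) where
      open Local loc

      0<v' : 0 < v'
      0<v' = ℕ.n≢0⇒n>0 (λ v'≡0 → p∤v' (≡.subst (p ℕ.∣_) (≡.sym v'≡0) (p ℕ.∣0)))

      v'-cop : Coprime v' p
      v'-cop = Cop.sym (∤⇒coprime pp p∤v')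

      basis^v' : ∀ g → basis g A.^ v' A.≈ A.1#
      basis^v' g = A.trans (basis-^ g v') (A.reflexive (≡.cong basis (pw-v' g)))

      p-powers : ∀ (ρ : Carrier) → ρ ∣ ι (+ p) → (∀ f → ρ * f ≈ 0# → f ≈ 0#) → ρ ∣ σ τ ρ → ρ ∣ ζ ^ v' - 1# →
        ∀ E η w → ρ ^ E ≈ ι (+ p) * η → η * w ≡[ ρ ] 1# → ∀ n Y Z → A.ι (+ p) A.^ n A.∣ Y A.* Z → A.ι (+ p) A.^ n A.∣ T τ Y A.* Z
      p-powers ρ ρ∣p ρ-reg ρ∣σρ ρ∣ζ E η w ρ^E ηw = GeneratedRing.Descent.σ-p^∣ A z basis generated (T τ) (T-isHom τ τ-cop) τ (T-z τ τ-cop) (T-basis τ τ-cop) p pp v' 0<v' v'-cop j τ≡p^j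
        (cst ρ) (A.∣-resp (Cst.φ-ι (+ p)) (Cst.φ-∣ ρ∣p)) (cst-regular ρ ρ-reg) (A.∣-resp (A.sym (T.push-cst τ τ-cop ρ)) (Cst.φ-∣ ρ∣σρ))
        (A.cg (A.∣-resp (A.trans (Cst.φ-sub (ζ ^ v') 1#) (A.+-cong {cst (ζ ^ v')} {z A.^ v'} {A.- cst 1#} {A.- A.1#} (Cst.φ-^ ζ v') (A.-‿cong {cst 1#} {A.1#} Cst.φ-1))) (Cst.φ-∣ ρ∣ζ)))
        basis^v' E (cst η) (cst w) (A.trans (A.sym (Cst.φ-^ ρ E)) (A.trans (Cst.φ-cong ρ^E) (A.trans (Cst.φ-* (ι (+ p)) η) (A.*-congʳ {cst η} (Cst.φ-ι (+ p))))))
        (A.cg (A.∣-resp (A.trans (Cst.φ-sub (η * w) 1#) (A.+-cong {cst (η * w)} {cst η A.* cst w} {A.- cst 1#} {A.- A.1#} (Cst.φ-* η w) (A.-‿cong {cst 1#} {A.1#} Cst.φ-1))) (Cst.φ-∣ (difference ηw))))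

      divides : ∀ n Y Z → A.ι (+ p) A.^ n A.∣ Y A.* Z → A.ι (+ p) A.^ n A.∣ T τ Y A.* Z
      divides = byPart (primePart p (prime>1 pp) u 0<m)
        where
        u'∣v' : ∀ {a u'} → u ≡ p ℕ.^ a ℕ.* u' → ¬ p ℕ.∣ u' → u' ℕ.∣ v'
        u'∣v' {a₁} {u'} u≡ p∤u' = Cop.coprime-divisor {u'} {p ℕ.^ a} {v'} (coprime-^ʳ a (Cop.sym (∤⇒coprime pp p∤u')))
          (≡.subst (u' ℕ.∣_) v≡ (ℕ.∣-trans (≡.subst (u' ℕ.∣_) (≡.sym u≡) (ℕ.n∣m*n (p ℕ.^ a₁))) u∣v))
        byPart : (∃₂ λ a u' → u ≡ p ℕ.^ a ℕ.* u' × ¬ p ℕ.∣ u') → ∀ n Y Z → A.ι (+ p) A.^ n A.∣ Y A.* Z → A.ι (+ p) A.^ n A.∣ T τ Y A.* Z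
        -- The unramified case: `p` itself is the uniformiser, with E = 1 and η = w = 1.
        byPart (zero ,, u' ,, u≡ ,, p∤u') = p-powers (ι (+ p)) ∣-refl
          (λ f → torsion-free (+ p) f (λ p≡0 → ℕ.<⇒≢ (prime>0 pp) (≡.sym (ℤ.+-injective p≡0))))
          (∣-resp (sym (σ.φ-ι τ τ-cop (+ p))) ∣-refl)
          (∣-resp (sym (sub-self (ζ-mod {v'} {0} (∣⇒mod0 (≡.subst (ℕ._∣ v') (≡.sym (≡.trans u≡ (ℕ.*-identityˡ u'))) (u'∣v' {0} {u'} u≡ p∤u')))))) ∣0)
          1 1# 1# (trans (*-identityʳ _) (sym (*-identityʳ _))) (≡-refl (*-identityˡ 1#))
        -- The ramified case. As u' divides v', ζ^v' is a power of ξ and hence 1 modulo ϖ; σ_τ sends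
        -- ϖ to ξ^τ - 1, a multiple of ϖ.
        byPart (suc a ,, u' ,, u≡ ,, p∤u') = p-powers U.ϖ U.ϖ∣p U.ϖ-regular
          (∣-resp (sym (trans (σ.φ-sub τ τ-cop U.ξ 1#) (+-cong (trans (σ-ζ^ τ τ-cop u') (trans (^-congʳ ζ (ℕ.*-comm τ u')) (sym (^-assocʳ ζ u' τ)))) (-‿cong (σ.φ-1 τ τ-cop))))) (U.ϖ∣ξ^-1 τ))
          (ϖ∣ζ^v' (u'∣v' {suc a} {u'} u≡ p∤u'))
          U.E U.η (- 1#) U.ϖ^E U.η-unit
          where
          module U = Uniformiser C p pp a u' u≡
          ϖ∣ζ^v' : u' ℕ.∣ v' → U.ϖ ∣ ζ ^ v' - 1#
          ϖ∣ζ^v' (ℕ.divides k v'≡) = ∣-resp (+-congʳ (trans (^-assocʳ ζ u' k) (^-congʳ ζ (≡.trans (ℕ.*-comm u' k) (≡.sym v'≡))))) (U.ϖ∣ξ^-1 k)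

    module _ (n : ℕ) (0<n : 0 < n) (τ : ℕ) (τ-cop : Coprime τ u) (loc : ∀ p → Prime p → p ℕ.∣ n → Local τ p)
             (X : Elt) (XX : X A.* inv X A.≈ A.ι (+ n)) where
      open import Relation.Binary.Reasoning.Setoid A.setoid
      open A.Solver
      module Tτ = HomProps (T-isHom τ τ-cop)

      ιn-regular : ∀ Y → A.ι (+ n) A.* Y A.≈ A.0# → Y A.≈ A.0#
      ιn-regular Y h = cst-regular (ι (+ n)) (λ f → torsion-free (+ n) f (λ n≡0 → ℕ.<⇒≢ 0<n (≡.sym (ℤ.+-injective n≡0)))) Y
        (A.trans (A.*-congʳ {Y} (Cst.φ-ι (+ n))) h)

      ιn-cancel : ∀ Y Z → A.ι (+ n) A.* Y A.≈ A.ι (+ n) A.* Z → Y A.≈ Z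
      ιn-cancel Y Z h = A.x∙y⁻¹≈ε⇒x≈y Y Z (ιn-regular (Y A.- Z) (A.trans (solve 3 (λ n y z → n :* (y :- z) := n :* y :- n :* z) A.refl (A.ι (+ n)) Y Z) (A.sub-self h)))

      -- Each prime power p^b dividing n = X X^(-1) still divides the product after the left factor
      -- has been twisted, and these prime powers recombine to n.
      n∣ : A.ι (+ n) A.∣ T τ X A.* inv X
      n∣ = prime-powers-∣ n 0<n (T τ X A.* inv X) (λ p b pp p^b∣n 0<b → AtPrime.divides τ τ-cop p pp (loc p pp (ℕ.∣-trans (p∣p^ p b 0<b) p^b∣n)) b X (inv X)
          (A.∣-resp (A.sym XX) (A.∣-respˡ (ι^ p b) (A.ι-∣ {+ (p ℕ.^ b)} (+ ℕ.quotient p^b∣n) (≡.trans (≡.cong +_ (ℕ.m∣n⇒n≡m*quotient p^b∣n)) (ℤ.pos-* (p ℕ.^ b) (ℕ.quotient p^b∣n)))))))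
        where
        open Congruences A using (prime-powers-∣; ι^)
        p∣p^ : ∀ p b → 0 < b → p ℕ.∣ p ℕ.^ b
        p∣p^ p (suc b) _ = ℕ.m∣m*n (p ℕ.^ b)

      E : Elt
      E = A._∣_.quotient n∣

      E-eq : T τ X A.* inv X A.≈ A.ι (+ n) A.* E
      E-eq = A._∣_.equality n∣

      -- n² E E^(-1) regroups as (X X^(-1))^(t) times X X^(-1), because twists commute and `inv` is
      -- an involution; both factors are n.
      E-unit : E A.* inv E A.≈ A.1#
      E-unit = ιn-cancel (E A.* inv E) A.1# (ιn-cancel (A.ι (+ n) A.* (E A.* inv E)) (A.ι (+ n) A.* A.1#) (begin
        A.ι (+ n) A.* (A.ι (+ n) A.* (E A.* inv E))
          ≈⟨ solve 3 (λ n e f → n :* (n :* (e :* f)) := (n :* e) :* (n :* f)) A.refl (A.ι (+ n)) E (inv E) ⟩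
        (A.ι (+ n) A.* E) A.* (A.ι (+ n) A.* inv E)          ≈⟨ A.*-cong {A.ι (+ n) A.* E} {T τ X A.* inv X} {A.ι (+ n) A.* inv E} {inv (T τ X A.* inv X)} (A.sym E-eq)
                                                                  (A.sym (A.trans (Inv.φ-cong E-eq) (A.trans (Inv.φ-* (A.ι (+ n)) E) (A.*-congʳ {inv E} (Inv.φ-ι (+ n)))))) ⟩
        (T τ X A.* inv X) A.* inv (T τ X A.* inv X)          ≈⟨ A.*-congˡ {T τ X A.* inv X} (A.trans (Inv.φ-* (T τ X) (inv X)) (A.*-cong {inv (T τ X)} {T τ (inv X)} {inv (inv X)} {X}
                                                                  (T-T (v ∸ 1) τ cop₋₁ τ-cop X) (inv-inv X))) ⟩
        (T τ X A.* inv X) A.* (T τ (inv X) A.* X)            ≈⟨ solve 4 (λ a b c d → (a :* b) :* (c :* d) := (a :* c) :* (d :* b)) A.refl (T τ X) (inv X) (T τ (inv X)) X ⟩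
        (T τ X A.* T τ (inv X)) A.* (X A.* inv X)            ≈⟨ A.*-cong {T τ X A.* T τ (inv X)} {A.ι (+ n)} {X A.* inv X} {A.ι (+ n)} (A.trans (A.sym (Tτ.φ-* X (inv X))) (A.trans (Tτ.φ-cong XX) (Tτ.φ-ι (+ n)))) XX ⟩
        A.ι (+ n) A.* A.ι (+ n)                              ≈⟨ A.*-congˡ {A.ι (+ n)} (A.sym (A.*-identityʳ (A.ι (+ n)))) ⟩
        A.ι (+ n) A.* (A.ι (+ n) A.* A.1#)                   ∎))

      T≈EX : T τ X A.≈ E A.* X
      T≈EX = ιn-cancel (T τ X) (E A.* X) (begin
        A.ι (+ n) A.* T τ X               ≈⟨ A.*-congʳ {T τ X} (A.sym XX) ⟩
        (X A.* inv X) A.* T τ X           ≈⟨ solve 3 (λ x y t → (x :* y) :* t := (t :* y) :* x) A.refl X (inv X) (T τ X) ⟩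
        (T τ X A.* inv X) A.* X           ≈⟨ A.*-congʳ {X} E-eq ⟩
        (A.ι (+ n) A.* E) A.* X           ≈⟨ A.*-assoc (A.ι (+ n)) E X ⟩
        A.ι (+ n) A.* (E A.* X)           ∎)

      -- The coefficient of the identity in E E^(-1) = 1. The exponents v - 1 and u - 1, both used
      -- for conjugation, agree modulo u.
      family : sum (λ g → E g * conj (E g)) ≈ 1#
      family = trans (sum-cong-≋ (λ g → *-congˡ (sym (inv-E g)))) (trans (E-unit e) (when-yes (e ≟ e) ≡.refl))
        where
        u-1≡v-1 : v ∸ 1 ≡ u ∸ 1 mod u
        u-1≡v-1 = cancel (≡.subst₂ (λ x y → x ≡ y mod u) (≡.sym (ℕ.m∸n+n≡m 0<v)) (≡.sym (ℕ.m∸n+n≡m 0<m)) (Z.≡-trans (∣⇒mod0 u∣v) (Z.≡-sym (∣⇒mod0 (ℕ.∣-refl {u})))))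
          where
          cancel : ∀ {a b} → a ℕ.+ 1 ≡ b ℕ.+ 1 mod u → a ≡ b mod u
          cancel {a} {b} (Z.cg d) = Z.cg (Z.∣-resp (lem (+ a) (+ b)) d)
            where
            lem : ∀ a b → (a ℤ.+ + 1) ℤ.- (b ℤ.+ + 1) ≡ a ℤ.- b
            lem = Z.Solver.solve 2 (λ a b → (a Z.Solver.:+ Z.Solver.con (+ 1)) Z.Solver.:- (b Z.Solver.:+ Z.Solver.con (+ 1)) Z.Solver.:= a Z.Solver.:- b) ≡.refl
        pw-inv : ∀ g → g ∙ pw (v ∸ 1) g ≡ e
        pw-inv g = ≡.trans (≡.cong (λ s → pw s g) (ℕ.m+[n∸m]≡n 0<v)) (pw-v g)
        inv-E : ∀ g → inv E (g \\ e) ≈ conj (E g)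
        inv-E g = trans (sum-when′ g (λ i → σ (v ∸ 1) (E i)) (λ i → pw (v ∸ 1) i ≟ g \\ e) (cancelˡ g (≡.trans (pw-inv g) (≡.sym (∙-\\ g e))))
            (λ i h → cancelˡ (pw (v ∸ 1) i) (≡.trans (comm _ i) (≡.trans (pw-inv i) (≡.sym (≡.trans (≡.cong (_∙ g) h) (≡.trans (comm _ g) (∙-\\ g e))))))))
          (σ-mod {v ∸ 1} {u ∸ 1} u-1≡v-1 cop₋₁ cop-conj (E g))

      multiplier : ∃₂ λ g k → (∀ j → T τ X j ≈ ζ ^ k * X (g \\ j)) ⊎ (∀ j → T τ X j ≈ - (ζ ^ k * X (g \\ j)))
      multiplier = conclude (UnitFamily.single C E family)
        where
        conclude : (∃ λ g → (∃ λ k → E g ≈ ζ ^ k ⊎ E g ≈ - ζ ^ k) × (∀ h → h ≢ g → E h ≈ 0#)) →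
          ∃₂ λ g k → (∀ j → T τ X j ≈ ζ ^ k * X (g \\ j)) ⊎ (∀ j → T τ X j ≈ - (ζ ^ k * X (g \\ j)))
        conclude (g ,, (k ,, s) ,, others) = g ,, k ,, ⊎-map (λ h j → trans (at-j j) (*-congʳ h)) (λ h j → trans (at-j j) (trans (*-congʳ h) (sym (-‿distribˡ-* _ _)))) s
          where
          at-j : ∀ j → T τ X j ≈ E g * X (g \\ j)
          at-j j = trans (T≈EX j) (sum-single g (λ i → E i * X (i \\ j)) (λ i i≢g → trans (*-congʳ (others i i≢g)) (zeroˡ _)))

-- The given finite abelian group on indices, its exponent, and encoded exponents.

module FiniteGroups where

  open import Defs
  open NumberTheory hiding (order; least)
  open GroupRings
  open import Algebra.Bundles using (CommutativeMonoid)
  open import Data.Nat as ℕ using (ℕ; zero; suc; z≤n; s≤s; _<_)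
  import Data.Nat.Properties as ℕ
  import Data.Nat.Divisibility as ℕ
  open import Data.Nat.DivMod using (_%_; m%n<n; m≡m%n+[m/n]*n; _/_)
  open import Data.Nat.LCM using (lcm; lcm-least)
  open import Data.Nat.Coprimality as Cop using (Coprime)
  open import Data.Nat.Primality using (Prime; euclidsLemma)
  open import Data.Integer as ℤ using (ℤ; +_; -[1+_])
  import Data.Integer.Properties as ℤ
  open import Data.Fin as Fin using (Fin; _≟_)
  open import Data.Fin.Permutation using (permutation)
  open import Data.List using ([])
  open import Data.Product using (_,_)
  open import Data.Sum using (_⊎_)
  open import Data.Bool using (if_then_else_)
  open import Data.Empty using (⊥-elim)
  open import Function.Bundles using (Inverse)
  open import Level using (0ℓ)
  open import Relation.Nullary
  open import Relation.Binary.PropositionalEquality as ≡ using (_≡_)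

  module Lagrange {N : ℕ} (G : FinGroup N) where
    open FinGroup G

    monoid : CommutativeMonoid 0ℓ 0ℓ
    monoid = record { Carrier = Fin N ; _≈_ = _≡_ ; _∙_ = _∙_ ; ε = e
      ; isCommutativeMonoid = record
        { isMonoid = record
          { isSemigroup = record { isMagma = record { isEquivalence = ≡.isEquivalence ; ∙-cong = ≡.cong₂ _∙_ } ; assoc = assoc }
          ; identity = identityˡ , λ i → ≡.trans (comm i e) (identityˡ i) }
        ; comm = comm } }

    open import Algebra.Properties.CommutativeMonoid.Sum monoid using (sum; ∑-distrib-+; sum-permute)

    sum-const : ∀ n g → sum {n} (λ _ → g) ≡ pw n g
    sum-const zero    g = ≡.refl
    sum-const (suc n) g = ≡.cong (g ∙_) (sum-const n g)

    -- Translation by `g` permutes the factors of the product of all elements, so this product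
    -- absorbs g^N.
    pw-N : ∀ g → pw N g ≡ e
    pw-N g = cancelˡ s (≡.trans (comm s _) (≡.trans (≡.sym eq) (≡.sym (≡.trans (comm s e) (identityˡ s)))))
      where
      s = sum {N} (λ i → i)
      eq : s ≡ pw N g ∙ s
      eq = ≡.trans (sum-permute {N} {N} (λ i → i) (permutation (g ∙_) (g \\_) (∙-\\ g) (\\-∙ g)))
        (≡.trans (∑-distrib-+ {N} (λ _ → g) (λ i → i)) (≡.cong (_∙ s) (sum-const N g)))

    pw-+ : ∀ a b g → pw (a ℕ.+ b) g ≡ pw a g ∙ pw b g
    pw-+ zero    b g = ≡.sym (identityˡ _)
    pw-+ (suc a) b g = ≡.trans (≡.cong (g ∙_) (pw-+ a b g)) (≡.sym (assoc g _ _))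

    pw-* : ∀ a b g → pw b g ≡ e → pw (a ℕ.* b) g ≡ e
    pw-* zero    b g h = ≡.refl
    pw-* (suc a) b g h = ≡.trans (pw-+ b (a ℕ.* b) g) (≡.trans (≡.cong₂ _∙_ h (pw-* a b g h)) (identityˡ e))

    pw-∣ : ∀ {a b} g → a ℕ.∣ b → pw a g ≡ e → pw b g ≡ e
    pw-∣ {a} g (ℕ.divides q ≡.refl) h = pw-* q a g h

  module Transport {c ℓ} (𝔾 : FinAbGroup c ℓ) where
    open FinAbGroup 𝔾
    module 𝔾 = FinAbGroup 𝔾
    private
      el = elt 𝔾
      ix = idx 𝔾

    el-ix : ∀ g → el (ix g) ≈ g
    el-ix = Inverse.strictlyInverseˡ enum

    ix-el : ∀ i → ix (el i) ≡ i
    ix-el = Inverse.strictlyInverseʳ enum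

    ix-cong : ∀ {g h} → g ≈ h → ix g ≡ ix h
    ix-cong = Inverse.from-cong enum

    finGroup : FinGroup order
    finGroup = record
      { _∙_ = λ i j → ix (el i ∙ el j) ; _\\_ = λ i j → ix (el i ⁻¹ ∙ el j) ; e = ix ε
      ; assoc = λ i j k → ix-cong (𝔾.trans (∙-cong (el-ix _) 𝔾.refl) (𝔾.trans (𝔾.assoc _ _ _) (∙-cong 𝔾.refl (𝔾.sym (el-ix _)))))
      ; comm = λ i j → ix-cong (𝔾.comm _ _)
      ; identityˡ = λ i → ≡.trans (ix-cong (𝔾.trans (∙-cong (el-ix ε) 𝔾.refl) (𝔾.identityˡ _))) (ix-el i)
      ; ∙-\\ = λ i j → ≡.trans (ix-cong (𝔾.trans (∙-cong 𝔾.refl (el-ix _)) (𝔾.trans (𝔾.sym (𝔾.assoc _ _ _)) (𝔾.trans (∙-cong (𝔾.inverseʳ _) 𝔾.refl) (𝔾.identityˡ _))))) (ix-el j)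
      ; \\-∙ = λ i j → ≡.trans (ix-cong (𝔾.trans (∙-cong 𝔾.refl (el-ix _)) (𝔾.trans (𝔾.sym (𝔾.assoc _ _ _)) (𝔾.trans (∙-cong (𝔾.inverseˡ _) 𝔾.refl) (𝔾.identityˡ _))))) (ix-el j)
      }

    open FinGroup finGroup using (pw; e; _\\_; cancelˡ; comm) renaming (_∙_ to _⊙_)
    open Lagrange finGroup

    ix-gpowℕ : ∀ i s → ix (gpowℕ 𝔾 (el i) s) ≡ pw s i
    ix-gpowℕ i zero    = ≡.refl
    ix-gpowℕ i (suc s) = ix-cong (∙-cong 𝔾.refl (𝔾.trans (𝔾.sym (el-ix _)) (Inverse.to-cong enum (ix-gpowℕ i s))))

    ix-⁻¹ : ∀ g j → ix g ⊙ j ≡ e → ix (g ⁻¹) ≡ j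
    ix-⁻¹ g j h = cancelˡ (ix g) (≡.trans (ix-cong (𝔾.trans (∙-cong (el-ix g) (el-ix (g ⁻¹))) (𝔾.inverseʳ g))) (≡.sym h))

    module Exponent {m : ℕ} (isExp : IsExponent 𝔾 m) where
      open IsExponent isExp

      pw-exp : ∀ i → pw m i ≡ e
      pw-exp i = ≡.trans (≡.sym (ix-gpowℕ i m)) (ix-cong (kills (el i)))

      -- The remainder of the order modulo the exponent kills the whole group, so minimality of the
      -- exponent forces it to be 0.
      exp∣order : m ℕ.∣ order
      exp∣order = zero? (order % m) ≡.refl
        where
        instance _ = ℕ.>-nonZero pos
        rem : ∀ g → pw (order % m) g ≡ e
        rem g = cancelˡ (pw (order / m ℕ.* m) g) (≡.trans (≡.sym (pw-+ (order / m ℕ.* m) (order % m) g))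
          (≡.trans (≡.cong (λ k → pw k g) (≡.trans (ℕ.+-comm (order / m ℕ.* m) (order % m)) (≡.sym (m≡m%n+[m/n]*n order m)))) (≡.trans (pw-N g)
            (≡.sym (≡.trans (FinGroup.comm finGroup (pw (order / m ℕ.* m) g) e) (≡.trans (FinGroup.identityˡ finGroup (pw (order / m ℕ.* m) g)) (pw-* (order / m) m g (pw-exp g))))))))
        gpow-rem : ∀ r → order % m ≡ r → ∀ g → gpowℕ 𝔾 g r ≈ ε
        gpow-rem r ≡.refl g = 𝔾.trans (gpow-cong (𝔾.sym (el-ix g)) r) (𝔾.trans (𝔾.sym (el-ix _)) (𝔾.trans (Inverse.to-cong enum (≡.trans (ix-gpowℕ (ix g) r) (rem (ix g)))) (el-ix ε)))
          where
          gpow-cong : ∀ {g h} → g ≈ h → ∀ s → gpowℕ 𝔾 g s ≈ gpowℕ 𝔾 h s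
          gpow-cong e zero    = 𝔾.refl
          gpow-cong e (suc s) = ∙-cong e (gpow-cong e s)
        zero? : ∀ r → order % m ≡ r → m ℕ.∣ order
        zero? zero    h = ℕ.m%n≡0⇒n∣m order m h
        zero? (suc r) h = ⊥-elim (ℕ.<⇒≱ (≡.subst (_< m) h (m%n<n order m)) (least (suc r) (s≤s z≤n) (gpow-rem (suc r) h)))

    expo-+ : ∀ w k → 0 < w → expo w -[1+ k ] ℕ.+ suc k ≡ suc k ℕ.* w
    expo-+ (suc w) k _ = ≡.trans (ℕ.+-comm _ (suc k)) (≡.sym (ℕ.*-suc (suc k) w))

    -- `expo v` encodes the exponent -k as k (v - 1), and adding k gives k v, which kills the group.
    ix-gpow : ∀ v → 0 < v → (∀ i → pw v i ≡ e) → ∀ t i → ix (gpow 𝔾 (el i) t) ≡ pw (expo v t) i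
    ix-gpow v 0<v pw-v (+ n)    i = ix-gpowℕ i n
    ix-gpow v 0<v pw-v -[1+ k ] i = ix-⁻¹ (gpowℕ 𝔾 (el i) (suc k)) (pw (expo v -[1+ k ]) i) (≡.trans (≡.cong (_⊙ pw (expo v -[1+ k ]) i) (ix-gpowℕ i (suc k)))
      (≡.trans (FinGroup.comm finGroup (pw (suc k) i) (pw (expo v -[1+ k ]) i)) (≡.trans (≡.sym (pw-+ (expo v -[1+ k ]) (suc k) i)) (≡.trans (≡.cong (λ s → pw s i) (expo-+ v k 0<v)) (pw-* (suc k) v i (pw-v i))))))

  expo-coprime : ∀ w → 0 < w → ∀ t → Coprime ℤ.∣ t ∣ w → Coprime (expo w t) w
  expo-coprime w 0<w (+ n)    h = h
  expo-coprime (suc w) 0<w -[1+ k ] h = Cop.sym (coprime-*ʳ {suc w} {suc k} {w} (Cop.sym h) (λ {d} → suc-coprime {d}))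
    where
    suc-coprime : Coprime (suc w) w
    suc-coprime {d} (d∣1+w , d∣w) = ℕ.∣1⇒≡1 (ℕ.∣m+n∣m⇒∣n (≡.subst (d ℕ.∣_) (ℕ.+-comm 1 w) d∣1+w) d∣w)

  -- Negative exponents carry the factor u - 1 in one ring and v - 1 in the other; both are -1
  -- modulo u.
  expo-mod : ∀ u v → 0 < u → 0 < v → u ℕ.∣ v → ∀ t → expo u t ≡ expo v t mod u
  expo-mod u v 0<u 0<v u∣v (+ n)    = mod-refl ≡.refl
  expo-mod (suc u) (suc v) 0<u 0<v u∣v -[1+ k ] = mod-* {suc k} {suc k} {u} {v} (mod-refl ≡.refl) (shift (Z.≡-trans (∣⇒mod0 (ℕ.∣-refl {suc u})) (Z.≡-sym (∣⇒mod0 u∣v))))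
    where
    shift : suc u ≡ suc v mod suc u → u ≡ v mod suc u
    shift (Z.cg d) = Z.cg (Z.∣-resp (lem (+ u) (+ v)) d)
      where
      lem : ∀ a b → (+ 1 ℤ.+ a) ℤ.- (+ 1 ℤ.+ b) ≡ a ℤ.- b
      lem = Z.Solver.solve 2 (λ a b → (Z.Solver.con (+ 1) Z.Solver.:+ a) Z.Solver.:- (Z.Solver.con (+ 1) Z.Solver.:+ b) Z.Solver.:= a Z.Solver.:- b) ≡.refl

  lcm-primes : ∀ {q} u w → Prime q → q ℕ.∣ lcm u w → q ℕ.∣ u ⊎ q ℕ.∣ w
  lcm-primes {q} u w pq h = euclidsLemma u w pq (ℕ.∣-trans h (lcm-least {u} {w} (ℕ.m∣m*n w) (ℕ.n∣m*n u)))

  sumPoly : ∀ {k} → (Fin k → Poly) → Poly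
  sumPoly {zero}  f = []
  sumPoly {suc k} f = addP (f Fin.zero) (sumPoly (λ i → f (Fin.suc i)))

  -- The summation inside `mulGR` and `twist` is private; the metavariable, solved by the unfolding
  -- in `mulGR-sum`, gives it a name.
  mutual
    private
      sumF : ∀ {c ℓ} (G : FinAbGroup c ℓ) k → (Fin k → Poly) → Poly
      sumF = _

      sumF≡ : ∀ {c ℓ} (G : FinAbGroup c ℓ) k (f : Fin k → Poly) → sumF G k f ≡ sumPoly f
      sumF≡ G zero    f = ≡.refl
      sumF≡ G (suc k) f = ≡.cong (addP (f Fin.zero)) (sumF≡ G k (λ i → f (Fin.suc i)))

    mulGR-sum : ∀ {c ℓ} (G : FinAbGroup c ℓ) (X Y : GR G) j →
      mulGR G X Y j ≡ sumPoly (λ i → mulP (X i) (Y (idx G (FinAbGroup._∙_ G (FinAbGroup._⁻¹ G (elt G i)) (elt G j)))))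
    mulGR-sum G X Y j with FinAbGroup.order G | (λ i → mulP (X i) (Y (idx G (FinAbGroup._∙_ G (FinAbGroup._⁻¹ G (elt G i)) (elt G j)))))
    ... | k | f = sumF≡ G k f

  twist-sum : ∀ {c ℓ} (G : FinAbGroup c ℓ) m t (X : GR G) j →
    twist G m t X j ≡ sumPoly (λ i → if does (idx G (gpow G (elt G i) t) ≟ j) then σ m t (X i) else [])
  twist-sum G m t X j = sumF≡ G (FinAbGroup.order G) (λ i → if does (idx G (gpow G (elt G i) t) ≟ j) then σ m t (X i) else [])

-- From the polynomial formulation of the statement to the abstract setting and back.

module Transfer where

  open import Defs
  open RingTools
  open IntegerPolynomials
  open NumberTheory hiding (order; least)
  open IndexedSums
  open CyclotomicRings
  open TraceForm
  open PrimeIdeals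
  open GroupRings
  open AbstractMultiplier
  open FiniteGroups
  open import Level using (Level)
  open import Data.Nat as ℕ using (ℕ; zero; suc; _<_; _∸_; _*_)
  import Data.Nat.Properties as ℕ
  import Data.Nat.Divisibility as ℕ
  open import Data.Nat.LCM using (lcm; m∣lcm[m,n]; n∣lcm[m,n]; lcm-least)
  open import Data.Nat.Coprimality as Cop using (Coprime)
  open import Data.Nat.Primality using (Prime)
  open import Data.Integer as ℤ using (ℤ; +_; 1ℤ; -1ℤ; ∣_∣)
  import Data.Integer.Properties as ℤ
  open import Data.Fin as Fin using (Fin; _≟_)
  open import Data.List using ([])
  open import Data.Product using (Σ; ∃; ∃₂; _×_; proj₁; proj₂) renaming (_,_ to _,,_)
  open import Data.Sum using (_⊎_; [_,_]′) renaming (map to ⊎-map)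
  open import Data.Bool using (if_then_else_)
  open import Relation.Nullary
  open import Relation.Binary.PropositionalEquality as ≡ using (_≡_)

  -- The instance at which the hypothesis on prime ideals of ℤ[ζ_v] is applied: the annihilator
  -- construction, read on polynomial representatives.
  module PrimeIdeal {v : ℕ} (Cv : CyclotomicPoly v) (p : ℕ) (pp : Prime p) where
    open CyclotomicPoly Cv using (Φ)
    open Cyclotomic Cv using (isCyclotomic; ≈⇒≡; module R; module Quot)
    open PrimeAbove isCyclotomic p pp using (P; P-isPrime; P-p)
    open IsPrime P-isPrime
    open Decomposition isCyclotomic p pp P P-isPrime P-p using (P-∣; power-of-p)

    isPrimeIdeal : IsPrimeIdeal v P
    isPrimeIdeal = record
      { isIdeal = record { resp = λ a b h → P-resp {a} {b} (≈⇒≡ h) ; zero∈ = P-0 ; add∈ = λ a b → P-+ {a} {b} ; mul∈ = λ r a → P-* r {a} }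
      ; proper = P-proper ; prime = P-prime }

    const≈ι : ∀ c → constP c R.≈ R.ι c
    const≈ι c = P.≡-trans (P.≡-refl (≐-sym (ι-const c))) (Quot.φ-ι c)

    contains : ∀ n → p ℕ.∣ n → P (constP (+ n))
    contains n (ℕ.divides k n≡kp) = P-resp {R.ι (+ n)} {constP (+ n)} (R.sym {constP (+ n)} {R.ι (+ n)} (const≈ι (+ n)))
      (P-∣ {R.ι (+ p)} {R.ι (+ n)} (R.ι-∣ {+ p} {+ n} (+ k) (≡.trans (≡.cong +_ (≡.trans n≡kp (ℕ.*-comm k p))) (ℤ.pos-* p k))) P-p)

  module Translate {c ℓ} (G : FinAbGroup c ℓ) {u : ℕ} (Cu : CyclotomicPoly u) (v : ℕ) (0<v : 0 < v) (u∣v : u ℕ.∣ v)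
                   (pw-v : ∀ g → FinGroup.pw (Transport.finGroup G) v g ≡ FinGroup.e (Transport.finGroup G)) where
    open CyclotomicPoly Cu using (Φ; 0<m)
    open Cyclotomic Cu using (isCyclotomic; ≈⇒≡; ≡⇒≈; module R; module Quot)
    open Transport G using (finGroup; ix-gpow)
    open FinGroup finGroup using (pw; e; _\\_)
    open Multiplier isCyclotomic finGroup v 0<v u∣v pw-v
    open Props isCyclotomic using (σ-mod)
    open RingSums (ℤ[x] /⟨ Φ ⟩) using (when; when-cong)
    open GroupRings.GroupRing (ℤ[x] /⟨ Φ ⟩) finGroup using (Elt; _⋆_; module A; cst; module Cst)

    sumPoly≡sum : ∀ {k} (f : Fin k → Poly) → sumPoly f ≡ R.sum f
    sumPoly≡sum {zero}  f = ≡.refl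
    sumPoly≡sum {suc k} f = ≡.cong (addP (f Fin.zero)) (sumPoly≡sum (λ i → f (Fin.suc i)))

    ≡⇒R : ∀ {f g : Poly} → f ≡ g → f R.≈ g
    ≡⇒R ≡.refl = P.≡-refl ≐-refl

    -- In the statement coefficients are twisted by `expo u t` and group elements by the integer
    -- `t`; the abstract argument uses one natural exponent `s` for both.
    twist≈T : ∀ t s → expo u t ≡ s mod u → Coprime (expo u t) u → Coprime s u → (∀ i → idx G (gpow G (elt G i) t) ≡ pw s i) →
      ∀ (X : Elt) j → twist G u t X j R.≈ T s X j
    twist≈T t s e≡s copt cops gp X j = P.≡-trans (≡⇒R (≡.trans (twist-sum G u t X j) (sumPoly≡sum F))) (R.sum-cong-≋ {_} {F} {F'} term)
      where
      F F' : Fin _ → Poly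
      F i = if does (idx G (gpow G (elt G i) t) ≟ j) then substP (expo u t) (X i) else []
      F' i = when (pw s i ≟ j) (substP s (X i))
      term : ∀ i → F i R.≈ F' i
      term i = P.≡-trans (≡⇒R (≡.cong (λ k → if does (k ≟ j) then substP (expo u t) (X i) else []) (gp i)))
        (when-cong (pw s i ≟ j) {substP (expo u t) (X i)} {substP s (X i)} (λ _ → σ-mod {expo u t} {s} e≡s copt cops (X i)))

    mulGR≈⋆ : ∀ (X Y : Elt) j → mulGR G X Y j R.≈ (X ⋆ Y) j
    mulGR≈⋆ X Y j = ≡⇒R (≡.trans (mulGR-sum G X Y j) (sumPoly≡sum (λ i → mulP (X i) (Y (i \\ j)))))

    const≈ι : ∀ c → constP c R.≈ R.ι c
    const≈ι c = P.≡-trans (P.≡-refl (≐-sym (ι-const c))) (Quot.φ-ι c)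

    scalar≈ι : ∀ n j → scalarGR G (+ n) j R.≈ A.ι (+ n) j
    scalar≈ι n j = P.≡-trans (when-cong (e ≟ j) {constP (+ n)} {R.ι (+ n)} (λ _ → const≈ι (+ n))) (Cst.φ-ι (+ n) j)

    ζ^≈monomial : ∀ k → monomial k 1ℤ R.≈ X R.^ k
    ζ^≈monomial k = P.≡-trans (P.≡-refl (monomial≐ k)) (Quot.φ-^ X k)

    shift-+ : ∀ k g (Y : Elt) j f → f R.≈ (X R.^ k) R.* Y (g \\ j) → f ≈[ u ] shiftGR G u 1ℤ (+ k) (elt G g) Y j
    shift-+ k g Y j f h = ≡⇒≈ (P.≡-trans h (P.≡-trans (P.≡-* {a = X R.^ k} {monomial k 1ℤ} {Y (g \\ j)} {Y (g \\ j)} (P.≡-sym (ζ^≈monomial k)) (P.≡-refl ≐-refl))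
      (P.≡-refl (≐-sym (scale-1 _)))))

    shift-- : ∀ k g (Y : Elt) j f → f R.≈ R.- ((X R.^ k) R.* Y (g \\ j)) → f ≈[ u ] shiftGR G u -1ℤ (+ k) (elt G g) Y j
    shift-- k g Y j f h = ≡⇒≈ (P.≡-trans h (P.≡-neg (P.≡-* {a = X R.^ k} {monomial k 1ℤ} {Y (g \\ j)} {Y (g \\ j)} (P.≡-sym (ζ^≈monomial k)) (P.≡-refl ≐-refl))))

    conclusion : ∀ (Y : Elt) n → 0 < n → _≈GR[_]_ G (mulGR G Y (twist G u -1ℤ Y)) u (scalarGR G (+ n)) →
      ∀ t → Coprime ∣ t ∣ u → (∀ p → Prime p → p ℕ.∣ n → Local (expo v t) p) →
      Σ (FinAbGroup.Carrier G) (λ g → ∃ λ (k : ℤ) →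
        _≈GR[_]_ G (twist G u t Y) u (shiftGR G u 1ℤ k g Y) ⊎ _≈GR[_]_ G (twist G u t Y) u (shiftGR G u -1ℤ k g Y))
    conclusion Y n 0<n YY t cop-t loc = finish (multiplier n 0<n τ cop-τ loc Y unit)
      where
      τ : ℕ
      τ = expo v t
      τ≡ : expo u t ≡ τ mod u
      τ≡ = expo-mod u v 0<m 0<v u∣v t
      cop-ut : Coprime (expo u t) u
      cop-ut = expo-coprime u 0<m t cop-t
      cop-τ : Coprime τ u
      cop-τ = coprime-mod {expo u t} {τ} τ≡ cop-ut
      expo₋₁ : expo v -1ℤ ≡ v ∸ 1
      expo₋₁ = ℕ.+-identityʳ (v ∸ 1)
      inv≈ : ∀ j → twist G u -1ℤ Y j R.≈ inv Y j
      inv≈ = twist≈T -1ℤ (v ∸ 1) (≡.subst (λ s → expo u -1ℤ ≡ s mod u) expo₋₁ (expo-mod u v 0<m 0<v u∣v -1ℤ))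
        (expo-coprime u 0<m -1ℤ (Cop.1-coprimeTo u)) cop₋₁ (λ i → ≡.trans (ix-gpow v 0<v pw-v -1ℤ i) (≡.cong (λ s → pw s i) expo₋₁)) Y
      unit : Y A.* inv Y A.≈ A.ι (+ n)
      unit j = P.≡-trans (P.≡-sym (P.≡-trans (mulGR≈⋆ Y (twist G u -1ℤ Y) j) (A.*-congˡ {Y} {twist G u -1ℤ Y} {inv Y} inv≈ j))) (P.≡-trans (≈⇒≡ (YY j)) (scalar≈ι n j))
      twist≈ : ∀ j → twist G u t Y j R.≈ T τ Y j
      twist≈ = twist≈T t τ τ≡ cop-ut cop-τ (ix-gpow v 0<v pw-v t) Y
      finish : (∃₂ λ g k → (∀ j → T τ Y j R.≈ (X R.^ k) R.* Y (g \\ j)) ⊎ (∀ j → T τ Y j R.≈ R.- ((X R.^ k) R.* Y (g \\ j)))) → _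
      finish (g ,, k ,, s) = elt G g ,, + k ,, ⊎-map (λ h j → shift-+ k g Y j (twist G u t Y j) (P.≡-trans (twist≈ j) (h j)))
                                                     (λ h j → shift-- k g Y j (twist G u t Y j) (P.≡-trans (twist≈ j) (h j))) s

  module Hypotheses {c ℓ : Level} (G : FinAbGroup c ℓ) (u : ℕ) (0<u : 0 < u) (expG : ℕ) (isExp : IsExponent G expG) (v : ℕ) (v≡lcm : v ≡ lcm u expG)
           (n : ℕ) (cop-n : Coprime n (FinAbGroup.order G)) (t : ℤ) (cop-t : Coprime ∣ t ∣ (u * FinAbGroup.order G)) where
    open Transport G
    open Exponent isExp
    open FinGroup finGroup using (pw; e)
    open Lagrange finGroup using (pw-∣)
    private
      N = FinAbGroup.order G

    u∣v : u ℕ.∣ v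
    u∣v = ≡.subst (u ℕ.∣_) (≡.sym v≡lcm) (m∣lcm[m,n] u expG)

    exp∣v : expG ℕ.∣ v
    exp∣v = ≡.subst (expG ℕ.∣_) (≡.sym v≡lcm) (n∣lcm[m,n] u expG)

    0<v : 0 < v
    0<v = ℕ.n≢0⇒n>0 (λ v≡0 → [ (λ u≡0 → ℕ.<⇒≢ 0<u (≡.sym u≡0)) , (λ e≡0 → ℕ.<⇒≢ (IsExponent.pos isExp) (≡.sym e≡0)) ]′
      (ℕ.m*n≡0⇒m≡0∨n≡0 u (ℕ.0∣⇒≡0 (≡.subst (ℕ._∣ u * expG) (≡.trans (≡.sym v≡lcm) v≡0) (lcm-least {u} {expG} (ℕ.m∣m*n expG) (ℕ.n∣m*n u))))))

    pw-v : ∀ g → pw v g ≡ e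
    pw-v g = pw-∣ g exp∣v (pw-exp g)

    cop-u : Coprime ∣ t ∣ u
    cop-u = coprime-∣ʳ (ℕ.m∣m*n N) cop-t

    -- A prime dividing the lcm divides u or the exponent, and the exponent divides |G|.
    cop-v : Coprime ∣ t ∣ v
    cop-v = coprimeByPrimes 0<v (λ q pq q∣t q∣v → coprime⇒∤ pq (coprime-∣ˡ q∣t cop-t)
      ([ ℕ.∣m⇒∣m*n N , (λ q∣e → ℕ.∣n⇒∣m*n u (ℕ.∣-trans q∣e exp∣order)) ]′ (lcm-primes u expG pq (≡.subst (q ℕ.∣_) v≡lcm q∣v))))

    -- The Gauss period argument runs in ℤ[ζ_v], while the result is used over ℤ[ζ_u]. That v' kills
    -- the group comes from gcd(n, |G|) = 1: `p` does not divide the exponent, so the exponent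
    -- divides v'.
    local : (Cu : CyclotomicPoly u) (Cv : CyclotomicPoly v) → ((P : Poly → Set) → IsPrimeIdeal v P → P (constP (+ n)) → FixedBy v t P) →
      ∀ p → Prime p → p ℕ.∣ n → Multiplier.Local (Cyclotomic.isCyclotomic Cu) finGroup v 0<v u∣v pw-v (expo v t) p
    local Cu Cv fixed p pp p∣n = split (primePart p (prime>1 pp) v 0<v)
      where
      open PrimeIdeal Cv p pp
      split : (∃₂ λ a v' → v ≡ p ℕ.^ a * v' × ¬ p ℕ.∣ v') → Multiplier.Local (Cyclotomic.isCyclotomic Cu) finGroup v 0<v u∣v pw-v (expo v t) p
      split (a ,, v' ,, v≡ ,, p∤v') = record { a = a ; v' = v' ; j = proj₁ power ; v≡ = v≡ ; p∤v' = p∤v'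
        ; pw-v' = λ g → pw-∣ g exp∣v' (pw-exp g) ; τ≡p^j = proj₂ power }
        where
        open PrimeAbove (Cyclotomic.isCyclotomic Cv) p pp using (P)
        power : ∃ λ j → expo v t ≡ p ℕ.^ j mod v'
        power = Decomposition.power-of-p (Cyclotomic.isCyclotomic Cv) p pp P
          (PrimeAbove.P-isPrime (Cyclotomic.isCyclotomic Cv) p pp) (PrimeAbove.P-p (Cyclotomic.isCyclotomic Cv) p pp)
          (p ℕ.^ a) v' v≡ p∤v' (expo v t) (expo-coprime v 0<v t cop-v) (λ f → proj₁ (fixed P isPrimeIdeal (contains n p∣n) f))
        p∤exp : ¬ p ℕ.∣ expG
        p∤exp p∣e = coprime⇒∤ pp (coprime-∣ˡ p∣n cop-n) (ℕ.∣-trans p∣e exp∣order)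
        exp∣v' : expG ℕ.∣ v'
        exp∣v' = Cop.coprime-divisor {expG} {p ℕ.^ a} {v'} (coprime-^ʳ a (Cop.sym (∤⇒coprime pp p∤exp))) (≡.subst (expG ℕ.∣_) v≡ exp∣v)

-- Assembly over the two rings ℤ[ζ_u] and ℤ[ζ_v].

open import Defs
open import Level using (Level)
open import Data.Nat using (ℕ; _<_; _*_)
open import Data.Nat.LCM using (lcm)
open import Data.Nat.Coprimality using (Coprime)
open import Data.Integer using (ℤ; +_; -1ℤ; 1ℤ; ∣_∣)
open import Data.Product using (Σ; ∃; _×_)
open import Data.Sum using (_⊎_)
open import Relation.Binary.PropositionalEquality using (_≡_)

open CyclotomicRings using (cyclotomicPoly)
open Transfer using (module Translate; module Hypotheses)

mainTheorem2 : ∀ {c ℓ : Level} (G : FinAbGroup c ℓ) (u : ℕ) → 0 < u →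
    (X : GR G) →
    (expG : ℕ) → IsExponent G expG →
    (v : ℕ) → v ≡ lcm u expG →
    (n : ℕ) → 0 < n → Coprime n (FinAbGroup.order G) →
    _≈GR[_]_ G (mulGR G X (twist G u -1ℤ X)) u (scalarGR G (+ n)) →
    (t : ℤ) → Coprime ∣ t ∣ (u * FinAbGroup.order G) →
    ((P : Poly → Set) → IsPrimeIdeal v P → P (constP (+ n)) → FixedBy v t P) →
    Σ (FinAbGroup.Carrier G) (λ g → ∃ λ (e : ℤ) →
    _≈GR[_]_ G (twist G u t X) u (shiftGR G u 1ℤ e g X)
    ⊎ _≈GR[_]_ G (twist G u t X) u (shiftGR G u -1ℤ e g X))
mainTheorem2 G u 0<u X expG isExp v v≡lcm n 0<n cop-n unit t cop-t fixed =
  Translate.conclusion G (cyclotomicPoly u 0<u) v H.0<v H.u∣v H.pw-v X n 0<n unit t H.cop-u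
    (H.local (cyclotomicPoly u 0<u) (cyclotomicPoly v H.0<v) fixed)
  where
  module H = Hypotheses G u 0<u expG isExp v v≡lcm n cop-n t cop-t
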